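{- Let $\mathcal{L}\in \mathrm{Mat}_d(\mathbb{Z})$ have no non-trivial invariant subspace over $\mathbb{Q}$ and let $k=|\det \mathcal{L}|$. Then there are constants $D_2,\sigma_2>0$ depending only on $d$ and $k$ such that $$|A+\mathcal{L} A| \geq (1+k^{1/d})^d|A|-D_2|A|^{1-\sigma_2}$$ for all finite $A\subset \mathbb{Z}^d$.
   Context: A non-trivial invariant subspace of $\mathcal{L}$ over $\mathbb{Q}$ is a subspace $W\subseteq\mathbb{Q}^d$ with $W\ne\{0\},\mathbb{Q}^d$ and $\mathcal{L}W\subseteq W$. -}

module Defs where

open import Algebra.Bundles.Raw using (RawRing)
open import Data.Fin.Base using (Fin)
open import Data.Integer.Base as ℤ using (ℤ; +_; -[1+_])
import Data.Integer.Properties as ℤ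
open import Data.Integer.Solver using () renaming (module +-*-Solver to ℤSolver)
open import Data.List.Base as List using (List)
open import Data.Nat.Base as ℕ using (ℕ; zero; suc)
import Data.Nat.Properties as ℕ
open import Data.Nat.Solver using (module +-*-Solver)
open import Data.Product.Base using (∃-syntax; _×_; _,_)
open import Data.Rational.Base as ℚ using (ℚ; mkℚ; 0ℚ; 1ℚ; ½; ↥_; ↧ₙ_)
import Data.Rational.Properties as ℚ
import Data.Rational.Solver as ℚ
open import Data.Rational.Unnormalised.Base as ℚᵘ using (mkℚᵘ; *≡*; *≤*)
import Data.Rational.Unnormalised.Properties as ℚᵘ
open import Data.Sum.Base using (inj₁; inj₂)
open import Data.Vec.Base as Vec using (Vec; []; _∷_)
open import Data.Vec.Properties using (≡-dec)
open import Level using (0ℓ)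
open import Relation.Binary.PropositionalEquality
open import Relation.Nullary using (¬_; yes; no; contradiction)
open import Relation.Unary using (Pred; Decidable; _∈_; _≐_; U; ｛_｝)

module CauchySequence where

  Cauchy : (ℕ → ℚ) → Set
  Cauchy x = ∀ {ε} → 0ℚ ℚ.< ε → ∃[ N ] (∀ {i j} → N ℕ.≤ i → N ℕ.≤ j → ℚ.∣ x i ℚ.- x j ∣ ℚ.≤ ε)

  -- the largest r ≤ B satisfying P, or 0 if there is none
  largest : ∀ {P : ℕ → Set} → Decidable P → ℕ → ℕ
  largest P? zero    = 0
  largest P? (suc B) with P? (suc B)
  ... | yes _ = suc B
  ... | no  _ = largest P? B

  largest-holds : ∀ {P : ℕ → Set} (P? : Decidable P) B → P 0 → P (largest P? B)
  largest-holds P? zero    p0 = p0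
  largest-holds P? (suc B) p0 with P? (suc B)
  ... | yes p = p
  ... | no  _ = largest-holds P? B p0

  largest-max : ∀ {P : ℕ → Set} (P? : Decidable P) B {r} → r ℕ.≤ B → P r → r ℕ.≤ largest P? B
  largest-max P? zero    r≤B pr = r≤B
  largest-max P? (suc B) r≤B pr with P? (suc B)
  ... | yes _ = r≤B
  ... | no ¬p with ℕ.m≤n⇒m<n∨m≡n r≤B
  ...   | inj₁ (ℕ.s≤s r≤B′) = largest-max P? B r≤B′ pr
  ...   | inj₂ refl         = contradiction pr ¬p

  pos neg : ℤ → ℕ
  pos (+ a)    = a
  pos -[1+ _ ] = 0
  neg (+ _)    = 0
  neg -[1+ a ] = suc a

  -- r ≤ N · nᵉ, cleared of the denominator and of the sign of e
  Below : ℕ → ℚ → ℕ → ℕ → Set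
  Below n e N r = r ℕ.^ ↧ₙ e ℕ.* n ℕ.^ neg (↥ e) ℕ.≤ n ℕ.^ pos (↥ e) ℕ.* N ℕ.^ ↧ₙ e

  below? : ∀ n e N → Decidable (Below n e N)
  below? n e N r =
    r ℕ.^ ↧ₙ e ℕ.* n ℕ.^ neg (↥ e) ℕ.≤? n ℕ.^ pos (↥ e) ℕ.* N ℕ.^ ↧ₙ e

  -- ⌊ N · nᵉ ⌋ for n ≥ 1
  floorPow : ℕ → ℚ → ℕ → ℕ
  floorPow n e N = largest (below? n e N) (n ℕ.^ pos (↥ e) ℕ.* N ℕ.^ ↧ₙ e)

  -- the i-th term approximates n ^ x i from below with error less than 1 / (i + 1)
  powSeq : ℕ → (ℕ → ℚ) → ℕ → ℚ
  powSeq n x i = + floorPow n (x i) (suc i) ℚ./ suc i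

  floorPow-lower : ∀ n e N → Below n e N (floorPow n e N)
  floorPow-lower n e@record{} N = largest-holds (below? n e N) (n ℕ.^ pos (↥ e) ℕ.* N ℕ.^ ↧ₙ e) ℕ.z≤n

  floorPow-upper : ∀ n .{{_ : ℕ.NonZero n}} e N →
    n ℕ.^ pos (↥ e) ℕ.* N ℕ.^ ↧ₙ e ℕ.≤ suc (floorPow n e N) ℕ.^ ↧ₙ e ℕ.* n ℕ.^ neg (↥ e)
  floorPow-upper n e@record{} N with ℕ.≤-total (n ℕ.^ pos (↥ e) ℕ.* N ℕ.^ ↧ₙ e) (suc (floorPow n e N) ℕ.^ ↧ₙ e ℕ.* n ℕ.^ neg (↥ e))
  ... | inj₁ h = h
  ... | inj₂ h = contradiction (largest-max (below? n e N) _ bound h) (ℕ.<⇒≱ ℕ.≤-refl)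
    where
    s = suc (floorPow n e N)
    bound : s ℕ.≤ n ℕ.^ pos (↥ e) ℕ.* N ℕ.^ ↧ₙ e
    bound = begin
      s                                       ≤⟨ ℕ.m≤m*n s (s ℕ.^ ℚ.ℚ.denominator-1 e) {{ℕ.m^n≢0 s (ℚ.ℚ.denominator-1 e)}} ⟩
      s ℕ.^ ↧ₙ e                              ≤⟨ ℕ.m≤m*n (s ℕ.^ ↧ₙ e) (n ℕ.^ neg (↥ e)) {{ℕ.m^n≢0 n (neg (↥ e))}} ⟩
      s ℕ.^ ↧ₙ e ℕ.* n ℕ.^ neg (↥ e)          ≤⟨ h ⟩
      n ℕ.^ pos (↥ e) ℕ.* N ℕ.^ ↧ₙ e          ∎
      where open ℕ.≤-Reasoning

  ^-cancelʳ-≤ : ∀ K .{{_ : ℕ.NonZero K}} {a b} → a ℕ.^ K ℕ.≤ b ℕ.^ K → a ℕ.≤ b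
  ^-cancelʳ-≤ K {a} {b} h with ℕ.≤-total a b
  ... | inj₁ a≤b = a≤b
  ... | inj₂ b≤a with ℕ.m≤n⇒m<n∨m≡n b≤a
  ...   | inj₁ b<a  = contradiction (ℕ.^-monoˡ-< K b<a) (ℕ.≤⇒≯ h)
  ...   | inj₂ refl = ℕ.≤-refl

  ^-distribʳ-* : ∀ a b n → (a ℕ.* b) ℕ.^ n ≡ a ℕ.^ n ℕ.* b ℕ.^ n
  ^-distribʳ-* a b zero    = refl
  ^-distribʳ-* a b (suc n) = trans (cong (a ℕ.* b ℕ.*_) (^-distribʳ-* a b n)) (ℕ.[m*n]*[o*p]≡[m*o]*[n*p] a b (a ℕ.^ n) (b ℕ.^ n))

  bernoulli : ∀ M n k → M ℕ.^ k ℕ.* M ℕ.+ k ℕ.* n ℕ.* M ℕ.^ k ℕ.≤ (M ℕ.+ n) ℕ.^ k ℕ.* M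
  bernoulli M n zero    = ℕ.≤-reflexive (ℕ.+-identityʳ _)
  bernoulli M n (suc k) = begin
    M ℕ.* m ℕ.* M ℕ.+ suc k ℕ.* n ℕ.* (M ℕ.* m)
      ≤⟨ ℕ.m≤m+n _ (n ℕ.* (k ℕ.* n ℕ.* m)) ⟩
    M ℕ.* m ℕ.* M ℕ.+ suc k ℕ.* n ℕ.* (M ℕ.* m) ℕ.+ n ℕ.* (k ℕ.* n ℕ.* m)
      ≡⟨ solve 4 (λ M m n k → M :* m :* M :+ (con 1 :+ k) :* n :* (M :* m) :+ n :* (k :* n :* m) := (M :+ n) :* (m :* M :+ k :* n :* m)) refl M m n k ⟩
    (M ℕ.+ n) ℕ.* (m ℕ.* M ℕ.+ k ℕ.* n ℕ.* m)
      ≤⟨ ℕ.*-monoʳ-≤ (M ℕ.+ n) (bernoulli M n k) ⟩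
    (M ℕ.+ n) ℕ.* ((M ℕ.+ n) ℕ.^ k ℕ.* M)
      ≡⟨ ℕ.*-assoc (M ℕ.+ n) _ M ⟨
    (M ℕ.+ n) ℕ.^ suc k ℕ.* M ∎
    where
    open ℕ.≤-Reasoning
    open +-*-Solver
    m = M ℕ.^ k

  M^M*n≤ : ∀ M .{{_ : ℕ.NonZero M}} n → M ℕ.^ M ℕ.* n ℕ.≤ (M ℕ.+ n) ℕ.^ M
  M^M*n≤ M n = ℕ.*-cancelʳ-≤ _ _ M (begin
    M ℕ.^ M ℕ.* n ℕ.* M                            ≡⟨ solve 3 (λ M n m → m :* n :* M := M :* n :* m) refl M n (M ℕ.^ M) ⟩
    M ℕ.* n ℕ.* M ℕ.^ M                            ≤⟨ ℕ.m≤n+m _ _ ⟩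
    M ℕ.^ M ℕ.* M ℕ.+ M ℕ.* n ℕ.* M ℕ.^ M          ≤⟨ bernoulli M n M ⟩
    (M ℕ.+ n) ℕ.^ M ℕ.* M                          ∎)
    where
    open ℕ.≤-Reasoning
    open +-*-Solver

  module _ (n : ℕ) .{{_ : ℕ.NonZero n}} (e e′ : ℚ) (m : ℕ) (N N′ : ℕ) where
    private
      b = ↧ₙ e ; b′ = ↧ₙ e′
      M = suc m
      p = pos (↥ e) ; q = neg (↥ e) ; p′ = pos (↥ e′) ; q′ = neg (↥ e′)
      r = floorPow n e N ; r′ = floorPow n e′ N′
      c = b′ ℕ.* M ; c′ = b ℕ.* M ; K = b ℕ.* c

    floorPow-compare : p ℕ.* c ℕ.+ q′ ℕ.* c′ ℕ.≤ q ℕ.* c ℕ.+ p′ ℕ.* c′ ℕ.+ b ℕ.* b′ →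
      r ℕ.* N′ ℕ.* M ℕ.≤ suc r′ ℕ.* N ℕ.* (M ℕ.+ n)
    floorPow-compare h = ^-cancelʳ-≤ K {{K≢0}} (ℕ.*-cancelʳ-≤ _ _ Z {{Z≢0}} (begin
        (r ℕ.* N′ ℕ.* M) ℕ.^ K ℕ.* Z
          ≡⟨ cong (ℕ._* Z) (trans (^-distribʳ-* (r ℕ.* N′) M K) (cong (ℕ._* M ℕ.^ K) (^-distribʳ-* r N′ K))) ⟩
        r ℕ.^ K ℕ.* N′ ℕ.^ K ℕ.* M ℕ.^ K ℕ.* (n ℕ.^ (q ℕ.* c) ℕ.* n ℕ.^ (p′ ℕ.* c′) ℕ.* n ℕ.^ (b ℕ.* b′))
          ≡⟨ solve 6 (λ r N M q p b → r :* N :* M :* (q :* p :* b) := (r :* q) :* (p :* N) :* (M :* b)) refl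
               (r ℕ.^ K) (N′ ℕ.^ K) (M ℕ.^ K) (n ℕ.^ (q ℕ.* c)) (n ℕ.^ (p′ ℕ.* c′)) (n ℕ.^ (b ℕ.* b′)) ⟩
        (r ℕ.^ K ℕ.* n ℕ.^ (q ℕ.* c)) ℕ.* (n ℕ.^ (p′ ℕ.* c′) ℕ.* N′ ℕ.^ K) ℕ.* (M ℕ.^ K ℕ.* n ℕ.^ (b ℕ.* b′))
          ≤⟨ ℕ.*-mono-≤ (ℕ.*-mono-≤ lower upper) bern ⟩
        (n ℕ.^ (p ℕ.* c) ℕ.* N ℕ.^ K) ℕ.* (suc r′ ℕ.^ K ℕ.* n ℕ.^ (q′ ℕ.* c′)) ℕ.* (M ℕ.+ n) ℕ.^ K
          ≡⟨ solve 5 (λ p N s q t → (p :* N) :* (s :* q) :* t := s :* N :* t :* (p :* q)) refl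
               (n ℕ.^ (p ℕ.* c)) (N ℕ.^ K) (suc r′ ℕ.^ K) (n ℕ.^ (q′ ℕ.* c′)) ((M ℕ.+ n) ℕ.^ K) ⟩
        suc r′ ℕ.^ K ℕ.* N ℕ.^ K ℕ.* (M ℕ.+ n) ℕ.^ K ℕ.* (n ℕ.^ (p ℕ.* c) ℕ.* n ℕ.^ (q′ ℕ.* c′))
          ≤⟨ ℕ.*-monoʳ-≤ (suc r′ ℕ.^ K ℕ.* N ℕ.^ K ℕ.* (M ℕ.+ n) ℕ.^ K) exps ⟩
        suc r′ ℕ.^ K ℕ.* N ℕ.^ K ℕ.* (M ℕ.+ n) ℕ.^ K ℕ.* Z
          ≡⟨ cong (ℕ._* Z) (trans (^-distribʳ-* (suc r′ ℕ.* N) (M ℕ.+ n) K) (cong (ℕ._* (M ℕ.+ n) ℕ.^ K) (^-distribʳ-* (suc r′) N K))) ⟨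
        (suc r′ ℕ.* N ℕ.* (M ℕ.+ n)) ℕ.^ K ℕ.* Z ∎))
      where
      open ℕ.≤-Reasoning
      open +-*-Solver
      Z = n ℕ.^ (q ℕ.* c) ℕ.* n ℕ.^ (p′ ℕ.* c′) ℕ.* n ℕ.^ (b ℕ.* b′)
      Z≢0 : ℕ.NonZero Z
      Z≢0 = ℕ.m*n≢0 (n ℕ.^ (q ℕ.* c) ℕ.* n ℕ.^ (p′ ℕ.* c′)) (n ℕ.^ (b ℕ.* b′)) {{ℕ.m*n≢0 (n ℕ.^ (q ℕ.* c)) (n ℕ.^ (p′ ℕ.* c′)) {{ℕ.m^n≢0 n (q ℕ.* c)}} {{ℕ.m^n≢0 n (p′ ℕ.* c′)}}}} {{ℕ.m^n≢0 n (b ℕ.* b′)}}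
      K≢0 : ℕ.NonZero K
      K≢0 = ℕ.m*n≢0 b c {{_}} {{ℕ.m*n≢0 b′ M}}
      K≡ : b′ ℕ.* c′ ≡ K
      K≡ = solve 3 (λ b b′ M → b′ :* (b :* M) := b :* (b′ :* M)) refl b b′ M

      raise : ∀ x a y a′ t → (x ℕ.^ a ℕ.* y ℕ.^ a′) ℕ.^ t ≡ x ℕ.^ (a ℕ.* t) ℕ.* y ℕ.^ (a′ ℕ.* t)
      raise x a y a′ t = trans (^-distribʳ-* (x ℕ.^ a) (y ℕ.^ a′) t) (cong₂ ℕ._*_ (ℕ.^-*-assoc x a t) (ℕ.^-*-assoc y a′ t))

      lower : r ℕ.^ K ℕ.* n ℕ.^ (q ℕ.* c) ℕ.≤ n ℕ.^ (p ℕ.* c) ℕ.* N ℕ.^ K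
      lower = subst₂ ℕ._≤_ (raise r b n q c) (raise n p N b c) (ℕ.^-monoˡ-≤ c (floorPow-lower n e N))

      upper : n ℕ.^ (p′ ℕ.* c′) ℕ.* N′ ℕ.^ K ℕ.≤ suc r′ ℕ.^ K ℕ.* n ℕ.^ (q′ ℕ.* c′)
      upper = subst (λ k → n ℕ.^ (p′ ℕ.* c′) ℕ.* N′ ℕ.^ k ℕ.≤ suc r′ ℕ.^ k ℕ.* n ℕ.^ (q′ ℕ.* c′)) K≡
        (subst₂ ℕ._≤_ (raise n p′ N′ b′ c′) (raise (suc r′) b′ n q′ c′) (ℕ.^-monoˡ-≤ c′ (floorPow-upper n e′ N′)))

      MK : M ℕ.* (b ℕ.* b′) ≡ K
      MK = solve 3 (λ b b′ M → M :* (b :* b′) := b :* (b′ :* M)) refl b b′ M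

      bern : M ℕ.^ K ℕ.* n ℕ.^ (b ℕ.* b′) ℕ.≤ (M ℕ.+ n) ℕ.^ K
      bern = subst (λ k → M ℕ.^ k ℕ.* n ℕ.^ (b ℕ.* b′) ℕ.≤ (M ℕ.+ n) ℕ.^ k) MK
        (subst₂ ℕ._≤_ (trans (^-distribʳ-* (M ℕ.^ M) n (b ℕ.* b′)) (cong (ℕ._* n ℕ.^ (b ℕ.* b′)) (ℕ.^-*-assoc M M (b ℕ.* b′))))
                      (ℕ.^-*-assoc (M ℕ.+ n) M (b ℕ.* b′))
                      (ℕ.^-monoˡ-≤ (b ℕ.* b′) (M^M*n≤ M n)))

      exps : n ℕ.^ (p ℕ.* c) ℕ.* n ℕ.^ (q′ ℕ.* c′) ℕ.≤ Z
      exps = subst₂ ℕ._≤_ (ℕ.^-distribˡ-+-* n (p ℕ.* c) (q′ ℕ.* c′))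
        (trans (ℕ.^-distribˡ-+-* n (q ℕ.* c ℕ.+ p′ ℕ.* c′) (b ℕ.* b′)) (cong (ℕ._* n ℕ.^ (b ℕ.* b′)) (ℕ.^-distribˡ-+-* n (q ℕ.* c) (p′ ℕ.* c′))))
        (ℕ.^-monoʳ-≤ n h)

  frac : ℕ → ℕ → ℚ
  frac a i = + a ℚ./ suc i

  frac-+ : ∀ a b i → frac (a ℕ.+ b) i ≡ frac a i ℚ.+ frac b i
  frac-+ a b i = ℚ.toℚᵘ-injective (begin-equality
    ℚ.toℚᵘ (frac (a ℕ.+ b) i)                    ≃⟨ ℚ.toℚᵘ-fromℚᵘ _ ⟩
    mkℚᵘ (+ (a ℕ.+ b)) i                         ≃⟨ *≡* (trans (cong (ℤ._* (+ suc i ℤ.* + suc i)) (ℤ.pos-+ a b)) (ident (+ a) (+ b) (+ suc i))) ⟩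
    mkℚᵘ (+ a) i ℚᵘ.+ mkℚᵘ (+ b) i               ≃⟨ ℚᵘ.+-cong (ℚ.toℚᵘ-fromℚᵘ (mkℚᵘ (+ a) i)) (ℚ.toℚᵘ-fromℚᵘ (mkℚᵘ (+ b) i)) ⟨
    ℚ.toℚᵘ (frac a i) ℚᵘ.+ ℚ.toℚᵘ (frac b i)     ≃⟨ ℚ.toℚᵘ-homo-+ (frac a i) (frac b i) ⟨
    ℚ.toℚᵘ (frac a i ℚ.+ frac b i)               ∎)
    where
    open ℚᵘ.≤-Reasoning
    open ℤSolver
    ident : ∀ a b s → (a ℤ.+ b) ℤ.* (s ℤ.* s) ≡ (a ℤ.* s ℤ.+ b ℤ.* s) ℤ.* s
    ident = solve 3 (λ a b s → (a :+ b) :* (s :* s) := (a :* s :+ b :* s) :* s) refl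

  frac-one : ∀ m → frac (suc m) m ≡ 1ℚ
  frac-one m = ℚ.toℚᵘ-injective (ℚᵘ.≃-trans (ℚ.toℚᵘ-fromℚᵘ (mkℚᵘ (+ suc m) m)) (*≡* (ℤ.*-comm (+ suc m) (+ 1))))

  frac-* : ∀ n m → frac n m ≡ frac n 0 ℚ.* frac 1 m
  frac-* n m = ℚ.toℚᵘ-injective (begin-equality
    ℚ.toℚᵘ (frac n m)                            ≃⟨ ℚ.toℚᵘ-fromℚᵘ _ ⟩
    mkℚᵘ (+ n) m                                 ≃⟨ *≡* (ident (+ n) (+ suc m)) ⟩
    mkℚᵘ (+ n) 0 ℚᵘ.* mkℚᵘ (+ 1) m               ≃⟨ ℚᵘ.*-cong (ℚ.toℚᵘ-fromℚᵘ (mkℚᵘ (+ n) 0)) (ℚ.toℚᵘ-fromℚᵘ (mkℚᵘ (+ 1) m)) ⟨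
    ℚ.toℚᵘ (frac n 0) ℚᵘ.* ℚ.toℚᵘ (frac 1 m)     ≃⟨ ℚ.toℚᵘ-homo-* (frac n 0) (frac 1 m) ⟨
    ℚ.toℚᵘ (frac n 0 ℚ.* frac 1 m)               ∎)
    where
    open ℚᵘ.≤-Reasoning
    open ℤSolver
    ident : ∀ n s → n ℤ.* (+ 1 ℤ.* s) ≡ n ℤ.* + 1 ℤ.* s
    ident = solve 2 (λ n s → n :* (con (+ 1) :* s) := n :* con (+ 1) :* s) refl

  frac-≤-* : ∀ {a i b j c m} → a ℕ.* suc j ℕ.* suc m ℕ.≤ b ℕ.* suc i ℕ.* c → frac a i ℚ.≤ frac b j ℚ.* frac c m
  frac-≤-* {a} {i} {b} {j} {c} {m} h = ℚ.toℚᵘ-cancel-≤ (begin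
    ℚ.toℚᵘ (frac a i)                            ≃⟨ ℚ.toℚᵘ-fromℚᵘ _ ⟩
    mkℚᵘ (+ a) i                                 ≤⟨ *≤* h′ ⟩
    mkℚᵘ (+ b) j ℚᵘ.* mkℚᵘ (+ c) m               ≃⟨ ℚᵘ.*-cong (ℚ.toℚᵘ-fromℚᵘ (mkℚᵘ (+ b) j)) (ℚ.toℚᵘ-fromℚᵘ (mkℚᵘ (+ c) m)) ⟨
    ℚ.toℚᵘ (frac b j) ℚᵘ.* ℚ.toℚᵘ (frac c m)     ≃⟨ ℚ.toℚᵘ-homo-* (frac b j) (frac c m) ⟨
    ℚ.toℚᵘ (frac b j ℚ.* frac c m)               ∎)
    where
    open ℚᵘ.≤-Reasoning
    open +-*-Solver
    h′ : + a ℤ.* (+ suc j ℤ.* + suc m) ℤ.≤ (+ b ℤ.* + c) ℤ.* + suc i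
    h′ = subst₂ ℤ._≤_ (trans (cong +_ (ℕ.*-assoc a (suc j) (suc m))) (ℤ.pos-* a _))
           (trans (cong +_ (solve 3 (λ b i c → b :* i :* c := b :* c :* i) refl b (suc i) c))
                  (trans (ℤ.pos-* (b ℕ.* c) (suc i)) (cong (ℤ._* + suc i) (ℤ.pos-* b c))))
           (ℤ.+≤+ h)

  0≤frac : ∀ a i → 0ℚ ℚ.≤ frac a i
  0≤frac a i = ℚ.nonNegative⁻¹ (frac a i) {{ℚ.normalize-nonNeg a (suc i)}}

  archimedean : ∀ {ε} → 0ℚ ℚ.< ε → ∃[ m ] (∀ {i} → m ℕ.≤ i → frac 1 i ℚ.≤ ε)
  archimedean {mkℚ (+ zero) m _}   (ℚ.*<* (ℤ.+<+ ()))
  archimedean {mkℚ -[1+ _ ] m _}   (ℚ.*<* ())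
  archimedean {mkℚ (+ suc p) m cp} 0<ε = m , λ {i} m≤i → ℚ.toℚᵘ-cancel-≤ (begin
    ℚ.toℚᵘ (frac 1 i)  ≃⟨ ℚ.toℚᵘ-fromℚᵘ _ ⟩
    mkℚᵘ (+ 1) i       ≤⟨ *≤* (ℤ.+≤+ (ℕ.*-mono-≤ {1} {suc p} (ℕ.s≤s ℕ.z≤n) (ℕ.s≤s m≤i))) ⟩
    mkℚᵘ (+ suc p) m   ∎)
    where open ℚᵘ.≤-Reasoning

  ∣∣≤-intro : ∀ {p q ε} → p ℚ.≤ q ℚ.+ ε → q ℚ.≤ p ℚ.+ ε → ℚ.∣ p ℚ.- q ∣ ℚ.≤ ε
  ∣∣≤-intro {p} {q} {ε} h h′ with ℚ.∣p∣≡p∨∣p∣≡-p (p ℚ.- q)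
  ... | inj₁ eq = subst₂ ℚ._≤_ (sym eq) (ident q ε) (ℚ.+-monoˡ-≤ (ℚ.- q) h)
    where
    open ℚ.+-*-Solver
    ident : ∀ q ε → q ℚ.+ ε ℚ.+ ℚ.- q ≡ ε
    ident = solve 2 (λ q ε → q :+ ε :+ :- q := ε) refl
  ... | inj₂ eq = subst₂ ℚ._≤_ (trans (ident′ p q) (sym eq)) (ident p ε) (ℚ.+-monoˡ-≤ (ℚ.- p) h′)
    where
    open ℚ.+-*-Solver
    ident : ∀ q ε → q ℚ.+ ε ℚ.+ ℚ.- q ≡ ε
    ident = solve 2 (λ q ε → q :+ ε :+ :- q := ε) refl
    ident′ : ∀ p q → q ℚ.+ ℚ.- p ≡ ℚ.- (p ℚ.- q)
    ident′ = solve 2 (λ p q → q :+ :- p := :- (p :- q)) refl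

  p≤∣p∣ : ∀ p → p ℚ.≤ ℚ.∣ p ∣
  p≤∣p∣ p with ℚ.∣p∣≡p∨∣p∣≡-p p | ℚ.≤-total 0ℚ p
  ... | _       | inj₁ 0≤p = ℚ.≤-reflexive (sym (ℚ.0≤p⇒∣p∣≡p 0≤p))
  ... | _       | inj₂ p≤0 = ℚ.≤-trans p≤0 (ℚ.0≤∣p∣ p)

  ∣∣≤-elim : ∀ {p q ε} → ℚ.∣ p ℚ.- q ∣ ℚ.≤ ε → p ℚ.≤ q ℚ.+ ε
  ∣∣≤-elim {p} {q} {ε} h = subst (ℚ._≤ q ℚ.+ ε) (ident p q) (ℚ.+-monoʳ-≤ q (ℚ.≤-trans (p≤∣p∣ (p ℚ.- q)) h))
    where
    open ℚ.+-*-Solver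
    ident : ∀ p q → q ℚ.+ (p ℚ.- q) ≡ p
    ident = solve 2 (λ p q → q :+ (p :- q) := p) refl

  split : ∀ {ε C} → 0ℚ ℚ.< ε → 0ℚ ℚ.< C → ∃[ η ] 0ℚ ℚ.< η × C ℚ.* η ≡ ε
  split {ε} {C} 0<ε 0<C = C⁻¹ ℚ.* ε , ℚ.positive⁻¹ (C⁻¹ ℚ.* ε) {{ℚ.pos*pos⇒pos C⁻¹ {{ℚ.1/pos⇒pos C {{ℚ.positive 0<C}}}} ε {{ℚ.positive 0<ε}}}} ,
    trans (sym (ℚ.*-assoc C C⁻¹ ε)) (trans (cong (ℚ._* ε) (ℚ.*-inverseʳ C {{C≢0}})) (ℚ.*-identityˡ ε))
    where
    C≢0 = ℚ.pos⇒nonZero C {{ℚ.positive 0<C}}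
    C⁻¹ = (ℚ.1/ C) {{C≢0}}

  half-sum : ∀ ε → ½ ℚ.* ε ℚ.+ ½ ℚ.* ε ≡ ε
  half-sum ε = trans (sym (ℚ.*-distribʳ-+ ε ½ ½)) (ℚ.*-identityˡ ε)

  0<half : ∀ {ε} → 0ℚ ℚ.< ε → 0ℚ ℚ.< ½ ℚ.* ε
  0<half {ε} 0<ε = ℚ.positive⁻¹ (½ ℚ.* ε) {{ℚ.pos*pos⇒pos ½ ε {{ℚ.positive 0<ε}}}}

  0<1 : 0ℚ ℚ.< 1ℚ
  0<1 = ℚ.positive⁻¹ 1ℚ

  Cauchy-const : ∀ q → Cauchy (λ _ → q)
  Cauchy-const q 0<ε = 0 , λ _ _ → subst (ℚ._≤ _) (sym (cong ℚ.∣_∣ (ℚ.+-inverseʳ q))) (ℚ.<⇒≤ 0<ε)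

  Cauchy-+ : ∀ {x y} → Cauchy x → Cauchy y → Cauchy (λ i → x i ℚ.+ y i)
  Cauchy-+ {x} {y} cx cy {ε} 0<ε with cx (0<half 0<ε) | cy (0<half 0<ε)
  ... | N , hx | N′ , hy = N ℕ.⊔ N′ , λ {i} {j} ≤i ≤j → begin
    ℚ.∣ x i ℚ.+ y i ℚ.- (x j ℚ.+ y j) ∣            ≡⟨ cong ℚ.∣_∣ (ident (x i) (y i) (x j) (y j)) ⟩
    ℚ.∣ (x i ℚ.- x j) ℚ.+ (y i ℚ.- y j) ∣          ≤⟨ ℚ.∣p+q∣≤∣p∣+∣q∣ (x i ℚ.- x j) (y i ℚ.- y j) ⟩
    ℚ.∣ x i ℚ.- x j ∣ ℚ.+ ℚ.∣ y i ℚ.- y j ∣        ≤⟨ ℚ.+-mono-≤ (hx (ℕ.m⊔n≤o⇒m≤o N N′ ≤i) (ℕ.m⊔n≤o⇒m≤o N N′ ≤j)) (hy (ℕ.m⊔n≤o⇒n≤o N N′ ≤i) (ℕ.m⊔n≤o⇒n≤o N N′ ≤j)) ⟩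
    ½ ℚ.* ε ℚ.+ ½ ℚ.* ε                            ≡⟨ half-sum ε ⟩
    ε                                              ∎
    where
    open ℚ.≤-Reasoning
    ident : ∀ a b c d → a ℚ.+ b ℚ.- (c ℚ.+ d) ≡ (a ℚ.- c) ℚ.+ (b ℚ.- d)
    ident = let open ℚ.+-*-Solver in solve 4 (λ a b c d → a :+ b :- (c :+ d) := (a :- c) :+ (b :- d)) refl

  Cauchy-neg : ∀ {x} → Cauchy x → Cauchy (λ i → ℚ.- x i)
  Cauchy-neg {x} cx 0<ε with cx 0<ε
  ... | N , hx = N , λ {i} {j} ≤i ≤j →
    subst (ℚ._≤ _) (trans (sym (ℚ.∣-p∣≡∣p∣ (x i ℚ.- x j))) (cong ℚ.∣_∣ (ident (x i) (x j)))) (hx ≤i ≤j)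
    where
    ident : ∀ a b → ℚ.- (a ℚ.- b) ≡ ℚ.- a ℚ.- ℚ.- b
    ident = let open ℚ.+-*-Solver in solve 2 (λ a b → :- (a :- b) := :- a :- :- b) refl

  Bounded : (ℕ → ℚ) → Set
  Bounded x = ∃[ B ] 0ℚ ℚ.< B × ∃[ N ] (∀ {i} → N ℕ.≤ i → ℚ.∣ x i ∣ ℚ.≤ B)

  Cauchy-bounded : ∀ {x} → Cauchy x → Bounded x
  Cauchy-bounded {x} cx with cx 0<1
  ... | N , hx = ℚ.∣ x N ∣ ℚ.+ 1ℚ , ℚ.+-mono-≤-< (ℚ.0≤∣p∣ (x N)) 0<1 , N , λ {i} ≤i → begin
    ℚ.∣ x i ∣                             ≡⟨ cong ℚ.∣_∣ (ident (x i) (x N)) ⟩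
    ℚ.∣ x N ℚ.+ (x i ℚ.- x N) ∣           ≤⟨ ℚ.∣p+q∣≤∣p∣+∣q∣ (x N) (x i ℚ.- x N) ⟩
    ℚ.∣ x N ∣ ℚ.+ ℚ.∣ x i ℚ.- x N ∣       ≤⟨ ℚ.+-monoʳ-≤ ℚ.∣ x N ∣ (hx ≤i ℕ.≤-refl) ⟩
    ℚ.∣ x N ∣ ℚ.+ 1ℚ                      ∎
    where
    open ℚ.≤-Reasoning
    ident : ∀ a b → a ≡ b ℚ.+ (a ℚ.- b)
    ident = let open ℚ.+-*-Solver in solve 2 (λ a b → a := b :+ (a :- b)) refl

  *-mono-≤-nonNeg : ∀ {p q r s} → 0ℚ ℚ.≤ r → 0ℚ ℚ.≤ q → p ℚ.≤ q → r ℚ.≤ s → p ℚ.* r ℚ.≤ q ℚ.* s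
  *-mono-≤-nonNeg {p} {q} {r} {s} 0≤r 0≤q p≤q r≤s = ℚ.≤-trans {p ℚ.* r} {q ℚ.* r} {q ℚ.* s}
    (ℚ.*-monoʳ-≤-nonNeg r {{ℚ.nonNegative 0≤r}} {p} {q} p≤q)
    (ℚ.*-monoˡ-≤-nonNeg q {{ℚ.nonNegative 0≤q}} {r} {s} r≤s)

  *-close : ∀ {a b c d A D η} → 0ℚ ℚ.≤ A → 0ℚ ℚ.≤ D → ℚ.∣ a ∣ ℚ.≤ A → ℚ.∣ d ∣ ℚ.≤ D →
    ℚ.∣ b ℚ.- d ∣ ℚ.≤ η → ℚ.∣ a ℚ.- c ∣ ℚ.≤ η → ℚ.∣ a ℚ.* b ℚ.- c ℚ.* d ∣ ℚ.≤ (A ℚ.+ D) ℚ.* η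
  *-close {a} {b} {c} {d} {A} {D} {η} 0≤A 0≤D a≤ d≤ bd≤ ac≤ = begin
    ℚ.∣ a ℚ.* b ℚ.- c ℚ.* d ∣
      ≡⟨ cong ℚ.∣_∣ (ident a b c d) ⟩
    ℚ.∣ a ℚ.* (b ℚ.- d) ℚ.+ d ℚ.* (a ℚ.- c) ∣
      ≤⟨ ℚ.∣p+q∣≤∣p∣+∣q∣ (a ℚ.* (b ℚ.- d)) (d ℚ.* (a ℚ.- c)) ⟩
    ℚ.∣ a ℚ.* (b ℚ.- d) ∣ ℚ.+ ℚ.∣ d ℚ.* (a ℚ.- c) ∣
      ≡⟨ cong₂ ℚ._+_ (ℚ.∣p*q∣≡∣p∣*∣q∣ a (b ℚ.- d)) (ℚ.∣p*q∣≡∣p∣*∣q∣ d (a ℚ.- c)) ⟩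
    ℚ.∣ a ∣ ℚ.* ℚ.∣ b ℚ.- d ∣ ℚ.+ ℚ.∣ d ∣ ℚ.* ℚ.∣ a ℚ.- c ∣
      ≤⟨ ℚ.+-mono-≤
           (*-mono-≤-nonNeg {ℚ.∣ a ∣} {A} {ℚ.∣ b ℚ.- d ∣} {η} (ℚ.0≤∣p∣ (b ℚ.- d)) 0≤A a≤ bd≤)
           (*-mono-≤-nonNeg {ℚ.∣ d ∣} {D} {ℚ.∣ a ℚ.- c ∣} {η} (ℚ.0≤∣p∣ (a ℚ.- c)) 0≤D d≤ ac≤) ⟩
    A ℚ.* η ℚ.+ D ℚ.* η
      ≡⟨ ℚ.*-distribʳ-+ η A D ⟨
    (A ℚ.+ D) ℚ.* η ∎
    where
    open ℚ.≤-Reasoning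
    ident : ∀ a b c d → a ℚ.* b ℚ.- c ℚ.* d ≡ a ℚ.* (b ℚ.- d) ℚ.+ d ℚ.* (a ℚ.- c)
    ident = let open ℚ.+-*-Solver in solve 4 (λ a b c d → a :* b :- c :* d := a :* (b :- d) :+ d :* (a :- c)) refl

  bounded-* : ∀ {x y} → Cauchy x → Cauchy y → Bounded x → Bounded y → Cauchy (λ i → x i ℚ.* y i)
  bounded-* {x} {y} cx cy (Bx , 0<Bx , N₁ , bx) (By , 0<By , N₂ , by) {ε} 0<ε = close (split {ε} {Bx ℚ.+ By} 0<ε 0<C)
    where
    0<C : 0ℚ ℚ.< Bx ℚ.+ By
    0<C = ℚ.<-trans 0<Bx (subst (ℚ._< Bx ℚ.+ By) (ℚ.+-identityʳ Bx) (ℚ.+-monoʳ-< Bx 0<By))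

    close : ∃[ η ] 0ℚ ℚ.< η × (Bx ℚ.+ By) ℚ.* η ≡ ε →
      ∃[ N ] (∀ {i j} → N ℕ.≤ i → N ℕ.≤ j → ℚ.∣ x i ℚ.* y i ℚ.- x j ℚ.* y j ∣ ℚ.≤ ε)
    close (η , 0<η , Cη≡ε) with cx 0<η | cy 0<η
    ... | N₃ , hx | N₄ , hy = N₁ ℕ.⊔ N₂ ℕ.⊔ (N₃ ℕ.⊔ N₄) , λ {i} {j} ≤i ≤j →
      let ≤i₃₄ = ℕ.m⊔n≤o⇒n≤o (N₁ ℕ.⊔ N₂) (N₃ ℕ.⊔ N₄) ≤i
          ≤j₃₄ = ℕ.m⊔n≤o⇒n≤o (N₁ ℕ.⊔ N₂) (N₃ ℕ.⊔ N₄) ≤j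
      in subst (ℚ.∣ x i ℚ.* y i ℚ.- x j ℚ.* y j ∣ ℚ.≤_) Cη≡ε
           (*-close {x i} {y i} {x j} {y j} {Bx} {By} {η} (ℚ.<⇒≤ 0<Bx) (ℚ.<⇒≤ 0<By)
             (bx {i} (ℕ.m⊔n≤o⇒m≤o N₁ N₂ (ℕ.m⊔n≤o⇒m≤o (N₁ ℕ.⊔ N₂) (N₃ ℕ.⊔ N₄) ≤i)))
             (by {j} (ℕ.m⊔n≤o⇒n≤o N₁ N₂ (ℕ.m⊔n≤o⇒m≤o (N₁ ℕ.⊔ N₂) (N₃ ℕ.⊔ N₄) ≤j)))
             (hy {i} {j} (ℕ.m⊔n≤o⇒n≤o N₃ N₄ ≤i₃₄) (ℕ.m⊔n≤o⇒n≤o N₃ N₄ ≤j₃₄))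
             (hx {i} {j} (ℕ.m⊔n≤o⇒m≤o N₃ N₄ ≤i₃₄) (ℕ.m⊔n≤o⇒m≤o N₃ N₄ ≤j₃₄)))

  Cauchy-* : ∀ {x y} → Cauchy x → Cauchy y → Cauchy (λ i → x i ℚ.* y i)
  Cauchy-* {x} {y} cx cy = bounded-* {x} {y} cx cy (Cauchy-bounded {x} cx) (Cauchy-bounded {y} cy)

  z+neg≡pos : ∀ z → z ℤ.+ + neg z ≡ + pos z
  z+neg≡pos (+ a)    = cong +_ (ℕ.+-identityʳ a)
  z+neg≡pos -[1+ a ] = ℤ.n⊖n≡0 (suc a)

  exponents : ∀ e e′ m → e ℚ.≤ e′ ℚ.+ frac 1 m →
    pos (↥ e) ℕ.* (↧ₙ e′ ℕ.* suc m) ℕ.+ neg (↥ e′) ℕ.* (↧ₙ e ℕ.* suc m) ℕ.≤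
    neg (↥ e) ℕ.* (↧ₙ e′ ℕ.* suc m) ℕ.+ pos (↥ e′) ℕ.* (↧ₙ e ℕ.* suc m) ℕ.+ ↧ₙ e ℕ.* ↧ₙ e′
  exponents e@record{} e′@record{} m h = ℤ.drop‿+≤+ (subst₂ ℤ._≤_ lhs rhs (ℤ.+-monoˡ-≤ (q ℤ.* (b′ ℤ.* M) ℤ.+ q′ ℤ.* (b ℤ.* M)) (ℚᵘ.drop-*≤* hᵘ)))
    where
    b = + ↧ₙ e ; b′ = + ↧ₙ e′ ; M = + suc m
    z = ↥ e ; z′ = ↥ e′ ; q = + neg z ; q′ = + neg z′
    hᵘ : ℚ.toℚᵘ e ℚᵘ.≤ ℚ.toℚᵘ e′ ℚᵘ.+ mkℚᵘ (+ 1) m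
    hᵘ = begin
      ℚ.toℚᵘ e                                ≤⟨ ℚ.toℚᵘ-mono-≤ h ⟩
      ℚ.toℚᵘ (e′ ℚ.+ frac 1 m)                ≃⟨ ℚ.toℚᵘ-homo-+ e′ (frac 1 m) ⟩
      ℚ.toℚᵘ e′ ℚᵘ.+ ℚ.toℚᵘ (frac 1 m)        ≃⟨ ℚᵘ.+-congʳ (ℚ.toℚᵘ e′) (ℚ.toℚᵘ-fromℚᵘ (mkℚᵘ (+ 1) m)) ⟩
      ℚ.toℚᵘ e′ ℚᵘ.+ mkℚᵘ (+ 1) m             ∎
      where open ℚᵘ.≤-Reasoning

    pos-*³ : ∀ a b c → + (a ℕ.* (b ℕ.* c)) ≡ + a ℤ.* (+ b ℤ.* + c)
    pos-*³ a b c = trans (ℤ.pos-* a (b ℕ.* c)) (cong (+ a ℤ.*_) (ℤ.pos-* b c))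

    lhs : z ℤ.* (b′ ℤ.* M) ℤ.+ (q ℤ.* (b′ ℤ.* M) ℤ.+ q′ ℤ.* (b ℤ.* M)) ≡ + (pos z ℕ.* (↧ₙ e′ ℕ.* suc m) ℕ.+ neg z′ ℕ.* (↧ₙ e ℕ.* suc m))
    lhs = trans (let open ℤSolver in solve 5 (λ z q q′ c c′ → z :* c :+ (q :* c :+ q′ :* c′) := (z :+ q) :* c :+ q′ :* c′) refl z q q′ (b′ ℤ.* M) (b ℤ.* M))
      (trans (cong (λ p → p ℤ.* (b′ ℤ.* M) ℤ.+ q′ ℤ.* (b ℤ.* M)) (z+neg≡pos z))
        (trans (sym (cong₂ ℤ._+_ (pos-*³ (pos z) (↧ₙ e′) (suc m)) (pos-*³ (neg z′) (↧ₙ e) (suc m)))) (sym (ℤ.pos-+ (pos z ℕ.* (↧ₙ e′ ℕ.* suc m)) (neg z′ ℕ.* (↧ₙ e ℕ.* suc m))))))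

    rhs : (z′ ℤ.* M ℤ.+ + 1 ℤ.* b′) ℤ.* b ℤ.+ (q ℤ.* (b′ ℤ.* M) ℤ.+ q′ ℤ.* (b ℤ.* M)) ≡ + (neg z ℕ.* (↧ₙ e′ ℕ.* suc m) ℕ.+ pos z′ ℕ.* (↧ₙ e ℕ.* suc m) ℕ.+ ↧ₙ e ℕ.* ↧ₙ e′)
    rhs = trans (let open ℤSolver in solve 6 (λ z′ q q′ b b′ M → (z′ :* M :+ con (+ 1) :* b′) :* b :+ (q :* (b′ :* M) :+ q′ :* (b :* M)) := q :* (b′ :* M) :+ (z′ :+ q′) :* (b :* M) :+ b :* b′) refl z′ q q′ b b′ M)
      (trans (cong (λ p → q ℤ.* (b′ ℤ.* M) ℤ.+ p ℤ.* (b ℤ.* M) ℤ.+ b ℤ.* b′) (z+neg≡pos z′))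
        (trans (cong₂ ℤ._+_ (trans (sym (cong₂ ℤ._+_ (pos-*³ (neg z) (↧ₙ e′) (suc m)) (pos-*³ (pos z′) (↧ₙ e) (suc m)))) (sym (ℤ.pos-+ (neg z ℕ.* (↧ₙ e′ ℕ.* suc m)) (pos z′ ℕ.* (↧ₙ e ℕ.* suc m))))) (sym (ℤ.pos-* (↧ₙ e) (↧ₙ e′))))
          (sym (ℤ.pos-+ (neg z ℕ.* (↧ₙ e′ ℕ.* suc m) ℕ.+ pos z′ ℕ.* (↧ₙ e ℕ.* suc m)) (↧ₙ e ℕ.* ↧ₙ e′)))))

  powSeq-compare : ∀ n .{{_ : ℕ.NonZero n}} (x : ℕ → ℚ) i j m → ℚ.∣ x i ℚ.- x j ∣ ℚ.≤ frac 1 m →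
    powSeq n x i ℚ.≤ (powSeq n x j ℚ.+ frac 1 j) ℚ.* (1ℚ ℚ.+ frac n 0 ℚ.* frac 1 m)
  powSeq-compare n x i j m h = subst (powSeq n x i ℚ.≤_)
    (cong₂ ℚ._*_
      (trans (cong (λ r → frac r j) (ℕ.+-comm 1 (floorPow n (x j) (suc j)))) (frac-+ (floorPow n (x j) (suc j)) 1 j))
      (trans (frac-+ (suc m) n m) (cong₂ ℚ._+_ (frac-one m) (frac-* n m))))
    (frac-≤-* {floorPow n (x i) (suc i)} {i} {suc (floorPow n (x j) (suc j))} {j} {suc m ℕ.+ n} {m}
      (floorPow-compare n (x i) (x j) m (suc i) (suc j) (exponents (x i) (x j) m (∣∣≤-elim h))))

  0≤powSeq : ∀ n x i → 0ℚ ℚ.≤ powSeq n x i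
  0≤powSeq n x i = 0≤frac (floorPow n (x i) (suc i)) i

  0<frac1 : ∀ i → 0ℚ ℚ.< frac 1 i
  0<frac1 i = ℚ.positive⁻¹ (frac 1 i) {{ℚ.normalize-pos 1 (suc i)}}

  frac1≤1 : ∀ i → frac 1 i ℚ.≤ 1ℚ
  frac1≤1 i = ℚ.≤-trans (ℚ.≤-trans (ℚ.≤-reflexive (sym (ℚ.+-identityʳ (frac 1 i)))) (ℚ.+-monoʳ-≤ (frac 1 i) (0≤frac i i)))
    (ℚ.≤-reflexive (trans (sym (frac-+ 1 i i)) (frac-one i)))

  powSeq-bounded : ∀ n .{{_ : ℕ.NonZero n}} {x} → Cauchy x → Bounded (powSeq n x)
  powSeq-bounded n {x} cx = bound (cx 0<1)
    where
    bound : ∃[ N ] (∀ {i j} → N ℕ.≤ i → N ℕ.≤ j → ℚ.∣ x i ℚ.- x j ∣ ℚ.≤ 1ℚ) → Bounded (powSeq n x)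
    bound (N , h) = B ℚ.+ 1ℚ , ℚ.+-mono-≤-< 0≤B 0<1 , N , λ {i} ≤i →
        subst (ℚ._≤ B ℚ.+ 1ℚ) (sym (ℚ.0≤p⇒∣p∣≡p (0≤powSeq n x i))) (ℚ.≤-trans (≤B ≤i) B≤B+1)
      where
      B = (powSeq n x N ℚ.+ frac 1 N) ℚ.* (1ℚ ℚ.+ frac n 0 ℚ.* 1ℚ)

      ≤B : ∀ {i} → N ℕ.≤ i → powSeq n x i ℚ.≤ B
      ≤B {i} ≤i = powSeq-compare n x i N 0 (h ≤i ℕ.≤-refl)

      0≤B : 0ℚ ℚ.≤ B
      0≤B = ℚ.≤-trans (0≤powSeq n x N) (≤B ℕ.≤-refl)

      B≤B+1 : B ℚ.≤ B ℚ.+ 1ℚ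
      B≤B+1 = subst (ℚ._≤ B ℚ.+ 1ℚ) (ℚ.+-identityʳ B) (ℚ.+-monoʳ-≤ B (ℚ.<⇒≤ 0<1))

  powSeq-close : ∀ {s f ν g B η ε} → 0ℚ ℚ.≤ ν → 0ℚ ℚ.≤ g → 0ℚ ℚ.≤ B → s ℚ.≤ B → f ℚ.≤ 1ℚ → f ℚ.≤ ½ ℚ.* ε →
    g ℚ.≤ η → (B ℚ.+ 1ℚ) ℚ.* ν ℚ.* η ≡ ½ ℚ.* ε → (s ℚ.+ f) ℚ.* (1ℚ ℚ.+ ν ℚ.* g) ℚ.≤ s ℚ.+ ε
  powSeq-close {s} {f} {ν} {g} {B} {η} {ε} 0≤ν 0≤g 0≤B s≤B f≤1 f≤½ε g≤η Cη≡ = begin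
    (s ℚ.+ f) ℚ.* (1ℚ ℚ.+ ν ℚ.* g)                ≡⟨ ident s f ν g ⟩
    s ℚ.+ (f ℚ.+ (s ℚ.+ f) ℚ.* ν ℚ.* g)           ≤⟨ ℚ.+-monoʳ-≤ s (ℚ.+-mono-≤ f≤½ε tail) ⟩
    s ℚ.+ (½ ℚ.* ε ℚ.+ ½ ℚ.* ε)                   ≡⟨ cong (s ℚ.+_) (half-sum ε) ⟩
    s ℚ.+ ε                                       ∎
    where
    open ℚ.≤-Reasoning
    ident : ∀ s f ν g → (s ℚ.+ f) ℚ.* (1ℚ ℚ.+ ν ℚ.* g) ≡ s ℚ.+ (f ℚ.+ (s ℚ.+ f) ℚ.* ν ℚ.* g)
    ident = let open ℚ.+-*-Solver in solve 4 (λ s f ν g → (s :+ f) :* (con 1ℚ :+ ν :* g) := s :+ (f :+ (s :+ f) :* ν :* g)) refl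

    0≤C : 0ℚ ℚ.≤ (B ℚ.+ 1ℚ) ℚ.* ν
    0≤C = subst (ℚ._≤ (B ℚ.+ 1ℚ) ℚ.* ν) (ℚ.*-zeroˡ ν) (ℚ.*-monoʳ-≤-nonNeg ν {{ℚ.nonNegative 0≤ν}} {0ℚ} {B ℚ.+ 1ℚ} (ℚ.+-mono-≤ 0≤B (ℚ.<⇒≤ 0<1)))

    tail : (s ℚ.+ f) ℚ.* ν ℚ.* g ℚ.≤ ½ ℚ.* ε
    tail = subst ((s ℚ.+ f) ℚ.* ν ℚ.* g ℚ.≤_) Cη≡
      (*-mono-≤-nonNeg {(s ℚ.+ f) ℚ.* ν} {(B ℚ.+ 1ℚ) ℚ.* ν} {g} {η} 0≤g 0≤C
        (ℚ.*-monoʳ-≤-nonNeg ν {{ℚ.nonNegative 0≤ν}} {s ℚ.+ f} {B ℚ.+ 1ℚ} (ℚ.+-mono-≤ s≤B f≤1)) g≤η)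

  bounded-pow : ∀ n .{{_ : ℕ.NonZero n}} {x} → Cauchy x → Bounded (powSeq n x) → Cauchy (powSeq n x)
  bounded-pow n {x} cx (B , 0<B , N₀ , s≤) {ε} 0<ε = step₁ (split {½ ℚ.* ε} {C} (0<half 0<ε) 0<C) (archimedean (0<half 0<ε))
    where
    s = powSeq n x
    ν = frac n 0
    C = (B ℚ.+ 1ℚ) ℚ.* ν

    Goal : Set
    Goal = ∃[ N ] (∀ {i j} → N ℕ.≤ i → N ℕ.≤ j → ℚ.∣ s i ℚ.- s j ∣ ℚ.≤ ε)

    0<ν : 0ℚ ℚ.< ν
    0<ν = ℚ.positive⁻¹ ν {{ℚ.normalize-pos n 1}}

    0<C : 0ℚ ℚ.< C
    0<C = ℚ.positive⁻¹ C {{ℚ.pos*pos⇒pos (B ℚ.+ 1ℚ) {{ℚ.positive (ℚ.+-mono-< 0<B 0<1)}} ν {{ℚ.positive 0<ν}}}}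

    step₁ : ∃[ η ] 0ℚ ℚ.< η × C ℚ.* η ≡ ½ ℚ.* ε → ∃[ m ] (∀ {i} → m ℕ.≤ i → frac 1 i ℚ.≤ ½ ℚ.* ε) → Goal
    step₁ (η , 0<η , Cη≡) (m₂ , 1/≤½ε) = step₂ (archimedean 0<η)
      where
      step₂ : ∃[ m ] (∀ {i} → m ℕ.≤ i → frac 1 i ℚ.≤ η) → Goal
      step₂ (m , 1/≤η) = step₃ (cx (0<frac1 m))
        where
        step₃ : ∃[ N ] (∀ {i j} → N ℕ.≤ i → N ℕ.≤ j → ℚ.∣ x i ℚ.- x j ∣ ℚ.≤ frac 1 m) → Goal
        step₃ (N₁ , h) = N₀ ℕ.⊔ N₁ ℕ.⊔ m₂ , λ {i} {j} ≤i ≤j → ∣∣≤-intro {s i} {s j} {ε} (close {i} {j} ≤i ≤j) (close {j} {i} ≤j ≤i)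
          where
          close : ∀ {i j} → N₀ ℕ.⊔ N₁ ℕ.⊔ m₂ ℕ.≤ i → N₀ ℕ.⊔ N₁ ℕ.⊔ m₂ ℕ.≤ j → s i ℚ.≤ s j ℚ.+ ε
          close {i} {j} ≤i ≤j = ℚ.≤-trans {s i} {(s j ℚ.+ frac 1 j) ℚ.* (1ℚ ℚ.+ ν ℚ.* frac 1 m)} {s j ℚ.+ ε}
            (powSeq-compare n x i j m (h (ℕ.m⊔n≤o⇒n≤o N₀ N₁ ≤i₀₁) (ℕ.m⊔n≤o⇒n≤o N₀ N₁ ≤j₀₁)))
            (powSeq-close {s j} {frac 1 j} {ν} {frac 1 m} {B} {η} {ε} (0≤frac n 0) (0≤frac 1 m) (ℚ.<⇒≤ 0<B)
              (ℚ.≤-trans (p≤∣p∣ (s j)) (s≤ (ℕ.m⊔n≤o⇒m≤o N₀ N₁ ≤j₀₁))) (frac1≤1 j)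
              (1/≤½ε (ℕ.m⊔n≤o⇒n≤o (N₀ ℕ.⊔ N₁) m₂ ≤j)) (1/≤η ℕ.≤-refl) Cη≡)
            where
            ≤i₀₁ = ℕ.m⊔n≤o⇒m≤o (N₀ ℕ.⊔ N₁) m₂ ≤i
            ≤j₀₁ = ℕ.m⊔n≤o⇒m≤o (N₀ ℕ.⊔ N₁) m₂ ≤j

  Cauchy-pow : ∀ n .{{_ : ℕ.NonZero n}} {x} → Cauchy x → Cauchy (powSeq n x)
  Cauchy-pow n {x} cx = bounded-pow n {x} cx (powSeq-bounded n {x} cx)

open CauchySequence using (Cauchy; Cauchy-const; Cauchy-+; Cauchy-neg; Cauchy-*; Cauchy-pow; powSeq)

-- A Cauchy sequence stands for its limit; no quotient is taken, and _≤_ and _<_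
-- below compare the limits.
record ℝ : Set where
  constructor mkℝ
  field
    seq    : ℕ → ℚ
    cauchy : Cauchy seq

open ℝ public

infixr 9 _^_ _^ᴿ_
infixl 7 _*_
infixl 6 _+_ _-_
infix  8 -_
infix  4 _≤_ _<_ _≥_

fromℚ : ℚ → ℝ
fromℚ q = mkℝ (λ _ → q) (Cauchy-const q)

fromℕ : ℕ → ℝ
fromℕ n = fromℚ (+ n ℚ./ 1)

0ℝ 1ℝ : ℝ
0ℝ = fromℚ 0ℚ
1ℝ = fromℚ 1ℚ

_+_ _*_ : ℝ → ℝ → ℝ
x + y = mkℝ (λ i → seq x i ℚ.+ seq y i) (Cauchy-+ {seq x} {seq y} (cauchy x) (cauchy y))
x * y = mkℝ (λ i → seq x i ℚ.* seq y i) (Cauchy-* {seq x} {seq y} (cauchy x) (cauchy y))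

-_ : ℝ → ℝ
- x = mkℝ (λ i → ℚ.- seq x i) (Cauchy-neg {seq x} (cauchy x))

_-_ : ℝ → ℝ → ℝ
x - y = x + (- y)

_^_ : ℝ → ℕ → ℝ
x ^ zero  = 1ℝ
x ^ suc n = x * x ^ n

-- Real powers of a natural number.  The convention 0 ^ᴿ x = 0 is the usual value
-- for x > 0; whether x > 0 is not decidable.
_^ᴿ_ : ℕ → ℝ → ℝ
zero      ^ᴿ x = 0ℝ
n@(suc _) ^ᴿ x = mkℝ (powSeq n (seq x)) (Cauchy-pow n {seq x} (cauchy x))

_≤_ _<_ _≥_ : ℝ → ℝ → Set
x ≤ y = ∀ {ε} → 0ℚ ℚ.< ε → ∃[ N ] (∀ {i} → N ℕ.≤ i → seq x i ℚ.≤ seq y i ℚ.+ ε)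
x < y = ∃[ ε ] 0ℚ ℚ.< ε × ∃[ N ] (∀ {i} → N ℕ.≤ i → seq x i ℚ.+ ε ℚ.≤ seq y i)
x ≥ y = y ≤ x

Matrix : ∀ {a} → Set a → ℕ → Set a
Matrix A d = Vec (Vec A d) d

module Linear {c ℓ} (R : RawRing c ℓ) where
  open RawRing R using (Carrier; 0#)
    renaming (_+_ to _⊕_; _*_ to _⊗_; -_ to ⊖_; 1# to 1R)

  0ᵥ : ∀ {d} → Vec Carrier d
  0ᵥ {d} = Vec.replicate d 0#

  _+ᵥ_ : ∀ {d} → Vec Carrier d → Vec Carrier d → Vec Carrier d
  _+ᵥ_ = Vec.zipWith _⊕_

  _*ₛ_ : ∀ {d} → Carrier → Vec Carrier d → Vec Carrier d
  a *ₛ v = Vec.map (a ⊗_) v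

  dot : ∀ {d} → Vec Carrier d → Vec Carrier d → Carrier
  dot u v = Vec.foldr′ _⊕_ 0# (Vec.zipWith _⊗_ u v)

  _*ᵥ_ : ∀ {d} → Matrix Carrier d → Vec Carrier d → Vec Carrier d
  M *ᵥ v = Vec.map (λ row → dot row v) M

  alternatingSum : ∀ {n} → Vec Carrier n → Carrier
  alternatingSum []       = 0#
  alternatingSum (x ∷ xs) = x ⊕ ⊖ alternatingSum xs

  -- Laplace expansion along the first row
  det : ∀ {d} → Matrix Carrier d → Carrier
  det []           = 1R
  det (row ∷ rows) = alternatingSum (Vec.zipWith _⊗_ row (Vec.tabulate minor))
    where
    minor : Fin _ → Carrier
    minor j = det (Vec.map (λ r → Vec.removeAt r j) rows)

module ℤLinear = Linear ℤ.+-*-rawRing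
module ℚLinear = Linear ℚ.+-*-rawRing

open ℤLinear public using (det)

toℚ : ∀ {d} → Matrix ℤ d → Matrix ℚ d
toℚ = Vec.map (Vec.map (λ a → a ℚ./ 1))

record IsSubspace {d} (W : Pred (Vec ℚ d) 0ℓ) : Set where
  open ℚLinear
  field
    0-closed : 0ᵥ ∈ W
    +-closed : ∀ {u v} → u ∈ W → v ∈ W → (u +ᵥ v) ∈ W
    *-closed : ∀ a {v} → v ∈ W → (a *ₛ v) ∈ W

record IsNontrivialInvariantSubspace {d} (L : Matrix ℤ d) (W : Pred (Vec ℚ d) 0ℓ) : Set where
  open ℚLinear
  field
    isSubspace : IsSubspace W
    nonzero    : ¬ (W ≐ ｛ 0ᵥ ｝)
    proper     : ¬ (W ≐ U)
    invariant  : ∀ {v} → v ∈ W → (toℚ L *ᵥ v) ∈ W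

NoNontrivialInvariantSubspace : ∀ {d} → Matrix ℤ d → Set₁
NoNontrivialInvariantSubspace {d} L = ∀ (W : Pred (Vec ℚ d) 0ℓ) → ¬ IsNontrivialInvariantSubspace L W

-- A finite subset of ℤᵈ is given by a list enumerating its elements, possibly
-- with repetitions, which the cardinality does not count.
FiniteSet : ℕ → Set
FiniteSet d = List (Vec ℤ d)

card : ∀ {d} → FiniteSet d → ℕ
card A = List.length (List.deduplicate (≡-dec ℤ._≟_) A)

_⊞_ : ∀ {d} → FiniteSet d → FiniteSet d → FiniteSet d
_⊞_ = List.cartesianProductWith ℤLinear._+ᵥ_

_·_ : ∀ {d} → Matrix ℤ d → FiniteSet d → FiniteSet d
L · A = List.map (L ℤLinear.*ᵥ_) A

infixl 6 _⊞_
infixl 7 _·_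

{-# OPTIONS --safe #-}
-- Suppose |A + LA| ≤ C |A|.  By Plünnecke's inequality and Ruzsa's covering lemma the sets P = A - A and
-- LP are covered by boundedly many translates of P, so by pigeonhole there is a vector v ≠ 0 such that
-- 2ⁱ v (i ≤ t) and Lʲ v (j ≤ J) all lie in P - P, where t is of order log |A|.  As L is irreducible,
-- v, L v, …, Lᵈ⁻¹ v span a lattice Λ, and Lʲ⁺¹ Λ has index k = |det L| in Lʲ Λ, with digits 0, v, …, (k-1) v
-- (scaled by Lʲ) as coset representatives.
--
-- Let bⱼ be the largest size of the part of A in a coset of Lʲ Λ.  Adding L times such a part to the parts
-- of A in the cosets of Lʲ⁺¹ Λ gives disjoint sets, each bounded from below by a discrete
-- Brunn–Minkowski inequality in ℤᵈ, whose error counts the lines in the coordinate directions that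
-- meet the sumset; it is small because A + LA + Lʲ⁺ⁱ {0, v, …, (2ᵗ - 1) v} is still small.
-- By Huygens' inequality the sum of the main terms is at least (1 + κ)ᵈ |A| for all rational κ with κᵈ ≤ k
-- as soon as k ∑ |part|² ≤ bⱼ |A|, the sum being over the parts in the cosets of Lʲ⁺¹ Λ.
--
-- If this failed at all levels j < J, the relative growth xⱼ / bⱼ, where xⱼ = k bⱼ₊₁ - bⱼ, would be
-- squared (up to a constant) from one level to the preceding one whenever it is small, hence be bounded
-- from below at some level of each run of about log log |A| levels, and kʲ bⱼ / b₀ would grow exponentially in
-- j / log log |A|.  But it is bounded by a power of j, as the class of size bⱼ has disjoint translates in a small sumset.
module Submission where

-- The obstacle is unequal parts: the lower bound for a part of size a is quadratic in a, so a level
-- with too large a sum of squares does not give the main term, and the failures of different levels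
-- have to be played off against each other. Each level costs a bounded factor in the error term,
-- while the progression of length 2ᵗ saves a power of |A|; hence J may be a small multiple of log
-- |A|. The contradiction needs only order (log log |A|)² levels: about log log |A| doublings of kʲ
-- bⱼ, each paid for by boundedly many runs. The rational κ = p/q serve the reals directly: the
-- approximants of k^(1/d) are floor quotients with pᵈ ≤ k qᵈ, so the estimate is proved in natural
-- numbers and holds for every term of the sequences. Inequalities between naturals are decidable,
-- so minimising subsets, coset classes and the existence of a good level are needed only under
-- double negation. The constant C is 2ᶜ with c = (k + 1)ᵈ: as κ ≤ k, a sumset larger than C |A|
-- needs no argument, and powers of two turn the choice of parameters into a comparison of
-- exponents. The case k = 0 is separate and reduces to |A| ≤ |A + LA|.

open import Data.Empty using (⊥; ⊥-elim)
open import Data.Integer.Base as ℤ using (ℤ)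
import Data.Integer.Properties as ℤ
open import Data.List.Membership.Propositional using (_∈_; _∉_; find; lose)
open import Data.List.Relation.Binary.Subset.Propositional using (_⊆_)
open import Data.List.Relation.Unary.All as All using (All; []; _∷_)
import Data.List.Relation.Unary.All.Properties as All
open import Data.List.Relation.Unary.AllPairs as AllPairs using (AllPairs; []; _∷_)
import Data.List.Relation.Unary.AllPairs.Properties as AllPairs
open import Data.List.Relation.Unary.Any as Any using (Any; here; there)
open import Data.List.Relation.Unary.Unique.Propositional using (Unique)
import Data.List.Relation.Unary.Unique.Propositional.Properties as Unique
open import Data.Nat.ListAction using (sum)
open import Data.Product.Base using (∃; ∃-syntax; _×_; _,_; proj₁; proj₂)
open import Data.Sum.Base using (_⊎_; inj₁; inj₂)
open import Relation.Binary.PropositionalEquality hiding (J)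
open import Relation.Nullary using (¬_; Dec; yes; no; contradiction)
open import Relation.Nullary.Decidable using (¬?; decidable-stable)

-- Counting in lists up to repetition.

module Cardinality where

  open import Data.List.Base hiding (sum)
  open import Data.List.Properties using (length-map; length-++)
  open import Data.List.Membership.Propositional.Properties
  open import Data.List.Relation.Unary.Unique.DecPropositional.Properties using (deduplicate-!)
  open import Data.Nat.Base using (ℕ; suc; _+_; _*_; _≤_; z≤n; s≤s)
  open import Data.Nat.Properties
  open import Function.Base using (id)
  open import Relation.Binary.Definitions using (DecidableEquality)

  indicator : ∀ {P : Set} → Dec P → ℕ
  indicator (yes _) = 1
  indicator (no _)  = 0

  length-cartesianProductWith : ∀ {A B C : Set} (f : A → B → C) xs ys →
    length (cartesianProductWith f xs ys) ≡ length xs * length ys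
  length-cartesianProductWith f []       ys = refl
  length-cartesianProductWith f (x ∷ xs) ys =
    trans (length-++ (map (f x) ys)) (cong₂ _+_ (length-map (f x) ys) (length-cartesianProductWith f xs ys))

  module _ {A : Set} where

    -- The position to delete is read off the membership proof, so no equality test on `A` is
    -- needed. Further copies of `x` may survive in `zs`, which only helps the upper bounds drawn
    -- from it.
    remove-∈ : ∀ {x : A} {ys} → x ∈ ys →
      ∃[ zs ] length ys ≡ suc (length zs) × (∀ {y} → y ∈ ys → y ≢ x → y ∈ zs)
    remove-∈ {ys = _ ∷ ys} (here refl) = ys , refl , λ
      { (here refl) y≢x → contradiction refl y≢x
      ; (there y∈) _ → y∈ }
    remove-∈ {ys = y ∷ ys} (there x∈) with remove-∈ x∈
    ... | zs , eq , sub = y ∷ zs , cong suc eq , λ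
      { (here refl) _ → here refl
      ; (there y∈) y≢x → there (sub y∈ y≢x) }

    length-mono-⊆ : ∀ {xs ys : List A} → Unique xs → xs ⊆ ys → length xs ≤ length ys
    length-mono-⊆ [] _ = z≤n
    length-mono-⊆ {x ∷ xs} (x∉ ∷ u) sub with remove-∈ (sub (here refl))
    ... | zs , eq , sub′ = subst (suc (length xs) ≤_) (sym eq)
      (s≤s (length-mono-⊆ u λ y∈ → sub′ (sub (there y∈)) λ y≡x → All.lookup x∉ y∈ (sym y≡x)))

    sum-remove-∈ : ∀ (f : A → ℕ) {x ys} → x ∈ ys →
      ∃[ zs ] sum (map f ys) ≡ f x + sum (map f zs) × (∀ {y} → y ∈ ys → y ≢ x → y ∈ zs)
    sum-remove-∈ f {ys = _ ∷ ys} (here refl) = ys , refl , λ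
      { (here refl) y≢x → contradiction refl y≢x
      ; (there y∈) _ → y∈ }
    sum-remove-∈ f {x} {y ∷ ys} (there x∈) with sum-remove-∈ f x∈
    ... | zs , eq , sub = y ∷ zs ,
      trans (cong (f y +_) eq) (trans (sym (+-assoc (f y) (f x) _)) (trans (cong (_+ sum (map f zs)) (+-comm (f y) (f x))) (+-assoc (f x) (f y) _))) , λ
      { (here refl) _ → here refl
      ; (there y∈) y≢x → there (sub y∈ y≢x) }

    sum-mono-⊆ : ∀ (f g : A → ℕ) {xs ys} → Unique xs → xs ⊆ ys → (∀ {x} → x ∈ xs → f x ≤ g x) →
      sum (map f xs) ≤ sum (map g ys)
    sum-mono-⊆ f g [] _ _ = z≤n
    sum-mono-⊆ f g {x ∷ xs} (x∉ ∷ u) sub f≤g with sum-remove-∈ g (sub (here refl))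
    ... | zs , eq , sub′ = subst (f x + sum (map f xs) ≤_) (sym eq)
      (+-mono-≤ (f≤g (here refl)) (sum-mono-⊆ f g u
        (λ y∈ → sub′ (sub (there y∈)) λ y≡x → All.lookup x∉ y∈ (sym y≡x)) (λ y∈ → f≤g (there y∈))))

    sum-mono : ∀ (f g : A → ℕ) xs → (∀ {x} → x ∈ xs → f x ≤ g x) → sum (map f xs) ≤ sum (map g xs)
    sum-mono f g [] _ = z≤n
    sum-mono f g (x ∷ xs) f≤g = +-mono-≤ (f≤g (here refl)) (sum-mono f g xs (λ p → f≤g (there p)))

    sum-+ : ∀ (f g : A → ℕ) xs → sum (map (λ x → f x + g x) xs) ≡ sum (map f xs) + sum (map g xs)
    sum-+ f g [] = refl
    sum-+ f g (x ∷ xs) = trans (cong (f x + g x +_) (sum-+ f g xs)) (+-+-swap (f x) (g x) _ _)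
      where
      +-+-swap : ∀ a b c d → a + b + (c + d) ≡ a + c + (b + d)
      +-+-swap a b c d = trans (+-assoc a b (c + d)) (trans (cong (a +_)
        (trans (sym (+-assoc b c d)) (trans (cong (_+ d) (+-comm b c)) (+-assoc c b d)))) (sym (+-assoc a c (b + d))))

    sum-* : ∀ c (f : A → ℕ) xs → sum (map (λ x → c * f x) xs) ≡ c * sum (map f xs)
    sum-* c f [] = sym (*-zeroʳ c)
    sum-* c f (x ∷ xs) = trans (cong (c * f x +_) (sum-* c f xs)) (sym (*-distribˡ-+ c (f x) _))

    ∈⇒≤sum : ∀ (f : A → ℕ) {x xs} → x ∈ xs → f x ≤ sum (map f xs)
    ∈⇒≤sum f {xs = _ ∷ xs} (here refl) = m≤m+n _ _
    ∈⇒≤sum f {xs = y ∷ xs} (there p) = ≤-trans (∈⇒≤sum f p) (m≤n+m _ (f y))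

    -- Stated for any total preorder so that least and greatest integers, largest slices and largest
    -- classes are all instances. The membership proof only witnesses that `xs` is not empty.
    extremum : ∀ {_≼_ : A → A → Set} → (∀ x y → x ≼ y ⊎ y ≼ x) → (∀ {x y z} → x ≼ y → y ≼ z → x ≼ z) →
      ∀ {x xs} → x ∈ xs → ∃[ m ] m ∈ xs × (∀ {y} → y ∈ xs → m ≼ y)
    extremum {_≼_} total ≼-trans {xs = x ∷ xs} _ = go x xs
      where
      ≼-refl : ∀ {x} → x ≼ x
      ≼-refl {x} with total x x
      ... | inj₁ p = p
      ... | inj₂ p = p
      go : ∀ x xs → ∃[ m ] m ∈ x ∷ xs × (∀ {y} → y ∈ x ∷ xs → m ≼ y)
      go x [] = x , here refl , λ { (here refl) → ≼-refl }
      go x (y ∷ xs) with go y xs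
      ... | m , m∈ , least with total x m
      ...   | inj₁ x≼m = x , here refl , λ { (here refl) → ≼-refl ; (there p) → ≼-trans x≼m (least p) }
      ...   | inj₂ m≼x = m , there m∈ , λ { (here refl) → m≼x ; (there p) → least p }

    length-filter-sum : ∀ {P : A → Set} (P? : ∀ x → Dec (P x)) xs → length (filter P? xs) ≡ sum (map (λ x → indicator (P? x)) xs)
    length-filter-sum P? [] = refl
    length-filter-sum P? (x ∷ xs) with P? x
    ... | yes _ = cong suc (length-filter-sum P? xs)
    ... | no _  = length-filter-sum P? xs

    Unique-map : ∀ {B : Set} (f : A → B) {xs} → (∀ {x y} → x ∈ xs → y ∈ xs → f x ≡ f y → x ≡ y) →
      Unique xs → Unique (map f xs)
    Unique-map f inj [] = []
    Unique-map f inj (x∉ ∷ u) =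
      All.map⁺ (All.tabulate λ y∈ fx≡fy → All.lookup x∉ y∈ (inj (here refl) (there y∈) fx≡fy))
      ∷ Unique-map f (λ p q → inj (there p) (there q)) u

    module Card (_≟_ : DecidableEquality A) where

      card : List A → ℕ
      card xs = length (deduplicate _≟_ xs)

      dedup-! : ∀ xs → Unique (deduplicate _≟_ xs)
      dedup-! = deduplicate-! _≟_

      dedup⁺ : ∀ {xs z} → z ∈ xs → z ∈ deduplicate _≟_ xs
      dedup⁺ = ∈-deduplicate⁺ _≟_

      dedup⁻ : ∀ xs {z} → z ∈ deduplicate _≟_ xs → z ∈ xs
      dedup⁻ = ∈-deduplicate⁻ _≟_

      card≤length : ∀ {xs ys} → xs ⊆ ys → card xs ≤ length ys
      card≤length {xs} sub = length-mono-⊆ (dedup-! xs) (λ z∈ → sub (dedup⁻ xs z∈))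

      length≤card : ∀ {xs ys} → Unique xs → xs ⊆ ys → length xs ≤ card ys
      length≤card u sub = length-mono-⊆ u (λ z∈ → dedup⁺ (sub z∈))

      card-mono : ∀ {xs ys} → xs ⊆ ys → card xs ≤ card ys
      card-mono {xs} sub = length≤card (dedup-! xs) (λ z∈ → sub (dedup⁻ xs z∈))

      card-Unique : ∀ {xs} → Unique xs → card xs ≡ length xs
      card-Unique {xs} u = ≤-antisym (card≤length {xs} id) (length≤card u id)

      card>0 : ∀ {xs x} → x ∈ xs → 1 ≤ card xs
      card>0 {x = x} x∈ = length≤card {xs = x ∷ []} ([] ∷ []) λ { (here refl) → x∈ }

      card-++ : ∀ xs ys → card (xs ++ ys) ≤ card xs + card ys
      card-++ xs ys = subst (card (xs ++ ys) ≤_) (length-++ (deduplicate _≟_ xs))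
        (card≤length {xs ++ ys} λ z∈ → case (∈-++⁻ xs z∈))
        where
        case : ∀ {z} → z ∈ xs ⊎ z ∈ ys → z ∈ deduplicate _≟_ xs ++ deduplicate _≟_ ys
        case (inj₁ p) = ∈-++⁺ˡ (dedup⁺ p)
        case (inj₂ p) = ∈-++⁺ʳ (deduplicate _≟_ xs) (dedup⁺ p)

  module _ {A B : Set} (_≟ᴮ_ : DecidableEquality B) (f : A → B) where

    -- A section of `f` over its image, with `a` as default elsewhere. It supplies the
    -- representatives in the injections that count a set through a map.
    pick : List A → A → B → A
    pick []       a y = a
    pick (x ∷ xs) a y with f x ≟ᴮ y
    ... | yes _ = x
    ... | no _  = pick xs a y

    pick-∈ : ∀ {xs a y} → y ∈ map f xs → pick xs a y ∈ xs × f (pick xs a y) ≡ y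
    pick-∈ {x ∷ xs} {a} {y} y∈ with f x ≟ᴮ y
    ... | yes eq = here refl , eq
    ... | no ≢ with y∈
    ...   | here eq = contradiction (sym eq) ≢
    ...   | there p = let q = pick-∈ {xs} {a} p in there (proj₁ q) , proj₂ q

  module _ {A B : Set} where

    sum-concatMap : ∀ (f : B → ℕ) (g : A → List B) xs → sum (map f (concatMap g xs)) ≡ sum (map (λ x → sum (map f (g x))) xs)
    sum-concatMap f g [] = refl
    sum-concatMap f g (x ∷ xs) = trans (sum-map-++ (g x)) (cong (sum (map f (g x)) +_) (sum-concatMap f g xs))
      where
      sum-map-++ : ∀ ys {zs} → sum (map f (ys ++ zs)) ≡ sum (map f ys) + sum (map f zs)
      sum-map-++ [] = refl
      sum-map-++ (y ∷ ys) = trans (cong (f y +_) (sum-map-++ ys)) (sym (+-assoc (f y) _ _))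

  module _ {A B : Set} (_≟ᴬ_ : DecidableEquality A) (_≟ᴮ_ : DecidableEquality B) where
    private
      module A = Card _≟ᴬ_
      module B = Card _≟ᴮ_

    card-inj : ∀ (f : A → B) {xs ys} → (∀ {x} → x ∈ xs → f x ∈ ys) →
      (∀ {x y} → x ∈ xs → y ∈ xs → f x ≡ f y → x ≡ y) → A.card xs ≤ B.card ys
    card-inj f {xs} {ys} into inj = subst (_≤ B.card ys) (length-map f (deduplicate _≟ᴬ_ xs))
      (B.length≤card {map f (deduplicate _≟ᴬ_ xs)}
        (Unique-map f (λ p q → inj (A.dedup⁻ xs p) (A.dedup⁻ xs q)) (A.dedup-! xs))
        λ z∈ → sub (∈-map⁻ f z∈))
      where
      sub : ∀ {z} → ∃[ x ] x ∈ deduplicate _≟ᴬ_ xs × z ≡ f x → z ∈ ys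
      sub (x , x∈ , refl) = into (A.dedup⁻ xs x∈)

    card-map : ∀ (f : A → B) {xs} → (∀ {x y} → x ∈ xs → y ∈ xs → f x ≡ f y → x ≡ y) →
      B.card (map f xs) ≡ A.card xs
    card-map f {xs} inj = ≤-antisym
      (subst (B.card (map f xs) ≤_) (length-map f (deduplicate _≟ᴬ_ xs)) (B.card≤length {map f xs} λ z∈ → case (∈-map⁻ f z∈)))
      (card-inj f (∈-map⁺ f) inj)
      where
      case : ∀ {z} → ∃[ x ] x ∈ xs × z ≡ f x → z ∈ map f (deduplicate _≟ᴬ_ xs)
      case (x , x∈ , refl) = ∈-map⁺ f (A.dedup⁺ x∈)

  module _ {A B C : Set} (_≟ᴬ_ : DecidableEquality A) (_≟ᴮ_ : DecidableEquality B) (_≟ᶜ_ : DecidableEquality C) where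
    private
      module A = Card _≟ᴬ_
      module B = Card _≟ᴮ_
      module C = Card _≟ᶜ_

    card-productWith : ∀ (f : A → B → C) xs ys → C.card (cartesianProductWith f xs ys) ≤ A.card xs * B.card ys
    card-productWith f xs ys = subst (C.card (cartesianProductWith f xs ys) ≤_)
      (length-cartesianProductWith f (deduplicate _≟ᴬ_ xs) (deduplicate _≟ᴮ_ ys))
      (C.card≤length λ z∈ → case (∈-cartesianProductWith⁻ f xs ys z∈))
      where
      case : ∀ {z} → ∃[ a ] ∃[ b ] a ∈ xs × b ∈ ys × z ≡ f a b →
        z ∈ cartesianProductWith f (deduplicate _≟ᴬ_ xs) (deduplicate _≟ᴮ_ ys)
      case (a , b , a∈ , b∈ , refl) = ∈-cartesianProductWith⁺ f (A.dedup⁺ a∈) (B.dedup⁺ b∈)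

    card-productWith-inj : ∀ (f : A → B → C) {xs ys zs} →
      (∀ {a b} → a ∈ xs → b ∈ ys → f a b ∈ zs) →
      (∀ {a b a′ b′} → a ∈ xs → b ∈ ys → a′ ∈ xs → b′ ∈ ys → f a b ≡ f a′ b′ → a ≡ a′ × b ≡ b′) →
      A.card xs * B.card ys ≤ C.card zs
    card-productWith-inj f {xs} {ys} {zs} into inj = subst (_≤ C.card zs)
      (trans (length-map _ (cartesianProduct (deduplicate _≟ᴬ_ xs) (deduplicate _≟ᴮ_ ys)))
        (length-cartesianProductWith _,_ (deduplicate _≟ᴬ_ xs) (deduplicate _≟ᴮ_ ys)))
      (C.length≤card
        (Unique-map (λ p → f (proj₁ p) (proj₂ p)) inj′
          (Unique.cartesianProduct⁺ (A.dedup-! xs) (B.dedup-! ys)))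
        λ z∈ → into′ (∈-map⁻ _ z∈))
      where
      split : ∀ {p} → p ∈ cartesianProduct (deduplicate _≟ᴬ_ xs) (deduplicate _≟ᴮ_ ys) → proj₁ p ∈ xs × proj₂ p ∈ ys
      split p∈ = let q = ∈-cartesianProduct⁻ (deduplicate _≟ᴬ_ xs) (deduplicate _≟ᴮ_ ys) p∈
                 in A.dedup⁻ xs (proj₁ q) , B.dedup⁻ ys (proj₂ q)
      inj′ : ∀ {p q} → p ∈ cartesianProduct (deduplicate _≟ᴬ_ xs) (deduplicate _≟ᴮ_ ys) →
        q ∈ cartesianProduct (deduplicate _≟ᴬ_ xs) (deduplicate _≟ᴮ_ ys) →
        f (proj₁ p) (proj₂ p) ≡ f (proj₁ q) (proj₂ q) → p ≡ q
      inj′ p∈ q∈ eq with split p∈ | split q∈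
      ... | a , b | a′ , b′ with inj a b a′ b′ eq
      ...   | refl , refl = refl
      into′ : ∀ {z} → ∃[ p ] p ∈ cartesianProduct (deduplicate _≟ᴬ_ xs) (deduplicate _≟ᴮ_ ys) × z ≡ f (proj₁ p) (proj₂ p) → z ∈ zs
      into′ (p , p∈ , refl) = into (proj₁ (split p∈)) (proj₂ (split p∈))

  module _ {I A B : Set} (_≟ᴬ_ : DecidableEquality A) (_≟ᴮ_ : DecidableEquality B) where
    private
      module A = Card _≟ᴬ_
      module B = Card _≟ᴮ_

    -- Common source of the lower bounds for sumsets: every piece has its own injection `h i` into
    -- the target, and images for different indices never meet. Slices, coset classes and their
    -- translates enter in this way.
    sum-card-disjoint : ∀ (Z : I → List A) (h : I → A → B) {is ys} →
      (∀ {i a} → i ∈ is → a ∈ Z i → h i a ∈ ys) →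
      (∀ {i a a′} → i ∈ is → h i a ≡ h i a′ → a ≡ a′) →
      AllPairs (λ i j → ∀ a a′ → h i a ≢ h j a′) is →
      sum (map (λ i → A.card (Z i)) is) ≤ B.card ys
    sum-card-disjoint Z h {is} {ys} into inj pairs =
      subst (_≤ B.card ys) (len is) (B.length≤card (uniq is inj pairs) (sub is into))
      where
      D : I → List B
      D i = map (h i) (deduplicate _≟ᴬ_ (Z i))
      len : ∀ is → length (concatMap D is) ≡ sum (map (λ i → A.card (Z i)) is)
      len [] = refl
      len (i ∷ is) = trans (length-++ (D i)) (cong₂ _+_ (length-map (h i) (deduplicate _≟ᴬ_ (Z i))) (len is))
      sub : ∀ is → (∀ {i a} → i ∈ is → a ∈ Z i → h i a ∈ ys) → concatMap D is ⊆ ys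
      sub (i ∷ is) into z∈ with ∈-++⁻ (D i) z∈
      ... | inj₂ q = sub is (λ p → into (there p)) q
      ... | inj₁ q with ∈-map⁻ (h i) q
      ...   | a , a∈ , refl = into (here refl) (A.dedup⁻ (Z i) a∈)
      apart : ∀ i is {z} → All (λ j → ∀ a a′ → h i a ≢ h j a′) is → z ∈ D i → z ∉ concatMap D is
      apart i (j ∷ is) (p ∷ ps) z∈ z∈′ with ∈-++⁻ (D j) z∈′
      ... | inj₂ q = apart i is ps z∈ q
      ... | inj₁ q with ∈-map⁻ (h i) z∈ | ∈-map⁻ (h j) q
      ...   | a , _ , eq | a′ , _ , eq′ = p a a′ (trans (sym eq) eq′)
      uniq : ∀ is → (∀ {i a a′} → i ∈ is → h i a ≡ h i a′ → a ≡ a′) →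
        AllPairs (λ i j → ∀ a a′ → h i a ≢ h j a′) is → Unique (concatMap D is)
      uniq [] inj [] = []
      uniq (i ∷ is) inj (p ∷ ps) = Unique.++⁺ (Unique-map (h i) (λ _ _ → inj (here refl)) (A.dedup-! (Z i)))
        (uniq is (λ q → inj (there q)) ps) λ (a , b) → apart i is p a b

-- A discrete Brunn-Minkowski inequality with an error term.

module BrunnMinkowski where

  open import Defs using (card; _⊞_; module ℤLinear)
  open import Data.Fin.Base using (zero; suc)
  open import Data.List.Base using (List; []; _∷_; map; filter; length; deduplicate; cartesianProductWith; concatMap; _++_)
  open import Data.List.Properties using (length-map; length-++; map-cong)
  open import Data.List.Membership.Propositional.Properties
  open import Data.Nat.Base using (ℕ; zero; suc; _+_; _*_; _^_; _≤_; z≤n; s≤s; >-nonZero)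
  open import Data.Nat.Properties
  open import Data.Nat.Tactic.RingSolver using (solve-∀)
  open import Data.Vec.Base as Vec using (Vec; []; _∷_; head; tail)
  open import Data.Vec.Properties using (≡-dec)
  open import Algebra.Properties.AbelianGroup ℤ.+-0-abelianGroup public using () renaming (∙-cancelˡ to ℤ-cancelˡ; ∙-cancelʳ to ℤ-cancelʳ)
  open import Function.Base using (_∘_)
  open import Relation.Binary.Definitions using (DecidableEquality)
  open Cardinality

  open ℤLinear using (_+ᵥ_)

  _≟ᵥ_ : ∀ {d} → DecidableEquality (Vec ℤ d)
  _≟ᵥ_ = ≡-dec ℤ._≟_

  module ℤCard = Card ℤ._≟_
  module VCard {d} = Card (_≟ᵥ_ {d})

  ∈-⊞⁺ : ∀ {d} {X Y : List (Vec ℤ d)} {x y} → x ∈ X → y ∈ Y → (x +ᵥ y) ∈ (X ⊞ Y)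
  ∈-⊞⁺ = ∈-cartesianProductWith⁺ _+ᵥ_

  ∈-⊞⁻ : ∀ {d} (X Y : List (Vec ℤ d)) {z} → z ∈ (X ⊞ Y) → ∃[ x ] ∃[ y ] x ∈ X × y ∈ Y × z ≡ (x +ᵥ y)
  ∈-⊞⁻ = ∈-cartesianProductWith⁻ _+ᵥ_

  -- With `u₀` least in `U` and `v₁` greatest in `V`, every sum `u + v₁` with `u ≠ u₀` exceeds every
  -- sum `u₀ + v`, so these two families are disjoint. Together they have all but one of the
  -- required elements.
  length-sumset-ℤ : ∀ {U V : List ℤ} {u v} → Unique U → Unique V → u ∈ U → v ∈ V →
    length U + length V ≤ suc (ℤCard.card (cartesianProductWith ℤ._+_ U V))
  length-sumset-ℤ {U} {V} !U !V u∈ v∈ with extremum {_≼_ = ℤ._≤_} ℤ.≤-total ℤ.≤-trans u∈ | extremum {_≼_ = ℤ._≥_} (λ x y → ℤ.≤-total y x) (λ p q → ℤ.≤-trans q p) v∈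
  ... | u₀ , u₀∈ , u₀≤ | v₁ , v₁∈ , ≤v₁ = begin
      length U + length V                           ≤⟨ +-monoˡ-≤ (length V) (length-mono-⊆ !U U⊆) ⟩
      suc (length U′ + length V)                    ≡⟨ cong suc (+-comm (length U′) (length V)) ⟩
      suc (length V + length U′)                    ≡⟨ cong suc (cong₂ _+_ (length-map (ℤ._+_ u₀) V) (length-map (ℤ._+ v₁) U′)) ⟨
      suc (length L₁ + length L₂)                   ≡⟨ cong suc (length-++ L₁) ⟨
      suc (length (L₁ ++ L₂))                       ≤⟨ s≤s (ℤCard.length≤card uniq sub) ⟩
      suc (ℤCard.card (cartesianProductWith ℤ._+_ U V)) ∎
    where
    open ≤-Reasoning
    U′ = filter (λ u → ¬? (u ℤ.≟ u₀)) U
    L₁ = map (ℤ._+_ u₀) V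
    L₂ = map (ℤ._+ v₁) U′
    U⊆ : U ⊆ u₀ ∷ U′
    U⊆ {u} p with u ℤ.≟ u₀
    ... | yes refl = here refl
    ... | no u≢    = there (∈-filter⁺ _ p u≢)
    sub : (L₁ ++ L₂) ⊆ cartesianProductWith ℤ._+_ U V
    sub z∈ with ∈-++⁻ L₁ z∈
    ... | inj₁ p with ∈-map⁻ (ℤ._+_ u₀) p
    ...   | v , q , refl = ∈-cartesianProductWith⁺ ℤ._+_ u₀∈ q
    sub z∈ | inj₂ p with ∈-map⁻ (ℤ._+ v₁) p
    ...   | u , q , refl = ∈-cartesianProductWith⁺ ℤ._+_ (proj₁ (∈-filter⁻ _ {xs = U} q)) v₁∈
    apart : ∀ {z} → z ∈ L₁ → ¬ z ∈ L₂
    apart p q with ∈-map⁻ (ℤ._+_ u₀) p | ∈-map⁻ (ℤ._+ v₁) q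
    ... | v , v∈ , refl | u , u∈′ , eq with ∈-filter⁻ _ {xs = U} u∈′
    ...   | u∈ , u≢ = ℤ.<-irrefl eq (ℤ.+-mono-<-≤ (ℤ.≤∧≢⇒< (u₀≤ u∈) (u≢ ∘ sym)) (≤v₁ v∈))
    uniq : Unique (L₁ ++ L₂)
    uniq = Unique.++⁺ (Unique.map⁺ (λ {x} {y} → ℤ-cancelˡ u₀ x y) !V)
      (Unique.map⁺ (λ {x} {y} → ℤ-cancelʳ v₁ x y) (Unique.filter⁺ _ !U)) (λ (p , q) → apart p q)

  module _ {d : ℕ} where

    heads : List (Vec ℤ (suc d)) → List ℤ
    heads S = deduplicate ℤ._≟_ (map head S)

    slice : List (Vec ℤ (suc d)) → ℤ → List (Vec ℤ d)
    slice S t = map tail (filter (λ x → head x ℤ.≟ t) S)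

    heads-! : ∀ S → Unique (heads S)
    heads-! S = ℤCard.dedup-! (map head S)

    ∈-heads⁺ : ∀ {S t x} → (t ∷ x) ∈ S → t ∈ heads S
    ∈-heads⁺ p = ℤCard.dedup⁺ (∈-map⁺ head p)

    ∈-slice⁺ : ∀ {S t x} → (t ∷ x) ∈ S → x ∈ slice S t
    ∈-slice⁺ {S} {t} p = ∈-map⁺ tail (∈-filter⁺ (λ x → head x ℤ.≟ t) p refl)

    ∈-slice⁻ : ∀ S {t x} → x ∈ slice S t → (t ∷ x) ∈ S
    ∈-slice⁻ S {t} p with ∈-map⁻ tail p
    ... | y ∷ _ , q , refl with ∈-filter⁻ (λ x → head x ℤ.≟ t) {xs = S} q
    ...   | r , refl = r

    ∈-heads⁻ : ∀ {S t} → t ∈ heads S → ∃[ x ] x ∈ slice S t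
    ∈-heads⁻ {S} t∈ with ∈-map⁻ head (ℤCard.dedup⁻ (map head S) t∈)
    ... | _ ∷ x , p , refl = x , ∈-slice⁺ p

    slice-mono : ∀ {S S′ t} → S ⊆ S′ → slice S t ⊆ slice S′ t
    slice-mono {S} S⊆ p = ∈-slice⁺ (S⊆ (∈-slice⁻ S p))

    heads-mono : ∀ {S S′} → S ⊆ S′ → heads S ⊆ heads S′
    heads-mono {S} S⊆ t∈ with ∈-heads⁻ {S} t∈
    ... | x , p = ∈-heads⁺ (S⊆ (∈-slice⁻ S p))

    heads-apart : ∀ S → AllPairs (λ i j → ∀ (a a′ : Vec ℤ d) → Vec._∷_ i a ≢ j ∷ a′) (heads S)
    heads-apart S = AllPairs.map (λ i≢j a a′ eq → i≢j (cong head eq)) (heads-! S)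

    sum-card-slices≤ : ∀ S → sum (map (λ t → card (slice S t)) (heads S)) ≤ card S
    sum-card-slices≤ S = sum-card-disjoint _≟ᵥ_ _≟ᵥ_ (slice S) (λ t x → t ∷ x) (λ _ p → ∈-slice⁻ S p) (λ _ → cong tail) (heads-apart S)

    card≤sum-card-slices : ∀ S → card S ≤ sum (map (λ t → card (slice S t)) (heads S))
    card≤sum-card-slices S = subst (card S ≤_) (len (heads S)) (VCard.card≤length {xs = S} sub)
      where
      D : ℤ → List (Vec ℤ (suc d))
      D t = map (t ∷_) (deduplicate _≟ᵥ_ (slice S t))
      len : ∀ ts → length (concatMap D ts) ≡ sum (map (λ t → card (slice S t)) ts)
      len [] = refl
      len (t ∷ ts) = trans (length-++ (D t)) (cong₂ _+_ (length-map (t ∷_) (deduplicate _≟ᵥ_ (slice S t))) (len ts))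
      mem : ∀ {t x} ts → t ∈ ts → x ∈ slice S t → (t ∷ x) ∈ concatMap D ts
      mem (t ∷ ts) (here refl) q = ∈-++⁺ˡ (∈-map⁺ (t ∷_) (VCard.dedup⁺ q))
      mem (t ∷ ts) (there p)   q = ∈-++⁺ʳ (D t) (mem ts p q)
      sub : S ⊆ concatMap D (heads S)
      sub {t ∷ x} p = mem (heads S) (∈-heads⁺ p) (∈-slice⁺ p)

    slice-⊞ : ∀ X Y {u v} → (slice X u ⊞ slice Y v) ⊆ slice (X ⊞ Y) (u ℤ.+ v)
    slice-⊞ X Y {u} {v} p with ∈-⊞⁻ (slice X u) (slice Y v) p
    ... | x , y , x∈ , y∈ , refl = ∈-slice⁺ {X ⊞ Y} (∈-⊞⁺ (∈-slice⁻ X x∈) (∈-slice⁻ Y y∈))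

  -- Bounds the loss in the discrete Brunn–Minkowski inequality: the number of lines
  -- in the coordinate directions that meet S, up to a factor at most 2 ^ d.
  lines : ∀ {d} → List (Vec ℤ d) → ℕ
  lines {zero}  S = 0
  lines {suc d} S = card (map tail S) + 2 * sum (map (λ t → lines (slice S t)) (heads S))

  lines-mono : ∀ {d} {S S′ : List (Vec ℤ d)} → S ⊆ S′ → lines S ≤ lines S′
  lines-mono {zero}  S⊆ = z≤n
  lines-mono {suc d} {S} {S′} S⊆ = +-mono-≤ (VCard.card-mono (tails S⊆))
    (*-monoʳ-≤ 2 (sum-mono-⊆ (λ t → lines (slice S t)) (λ t → lines (slice S′ t)) (heads-! S) (heads-mono S⊆)
      λ {t} _ → lines-mono (slice-mono {S = S} {S′} {t} S⊆)))
    where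
    tails : S ⊆ S′ → map tail S ⊆ map tail S′
    tails S⊆ p with ∈-map⁻ tail p
    ... | x , q , refl = ∈-map⁺ tail (S⊆ q)

  ∏ : ∀ {d} → Vec ℕ d → ℕ
  ∏ = Vec.foldr′ _*_ 1

  _+ⁿ_ : ∀ {d} → Vec ℕ d → Vec ℕ d → Vec ℕ d
  _+ⁿ_ = Vec.zipWith _+_

  -- w₁ / w₂ is at most the volume of the sum of any two boxes of volumes at least a and b;
  -- the side lengths are rational, and D is their common denominator.
  BoxBound : ℕ → ℕ → ℕ → ℕ → ℕ → Set
  BoxBound d a b w₁ w₂ = ∀ D (xs ys : Vec ℕ d) → D * a ≤ ∏ xs → D * b ≤ ∏ ys → D * w₁ ≤ w₂ * ∏ (xs +ⁿ ys)

  -- Sums over the levels `1 ≤ l ≤ M`. With indicators they give the layer-cake formula: a number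
  -- `c ≤ M` is the number of levels `l ≤ c`.
  Σ≤ : ℕ → (ℕ → ℕ) → ℕ
  Σ≤ zero    g = 0
  Σ≤ (suc M) g = g (suc M) + Σ≤ M g

  Σ≤-mono : ∀ M {g h : ℕ → ℕ} → (∀ l → 1 ≤ l → l ≤ M → g l ≤ h l) → Σ≤ M g ≤ Σ≤ M h
  Σ≤-mono zero    g≤h = z≤n
  Σ≤-mono (suc M) g≤h = +-mono-≤ (g≤h (suc M) (s≤s z≤n) ≤-refl) (Σ≤-mono M λ l p q → g≤h l p (m≤n⇒m≤1+n q))

  Σ≤-+ : ∀ M (g h : ℕ → ℕ) → Σ≤ M (λ l → g l + h l) ≡ Σ≤ M g + Σ≤ M h
  Σ≤-+ zero    g h = refl
  Σ≤-+ (suc M) g h = trans (cong (g (suc M) + h (suc M) +_) (Σ≤-+ M g h)) (lem (g (suc M)) (h (suc M)) _ _)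
    where
    lem : ∀ a b c d → a + b + (c + d) ≡ a + c + (b + d)
    lem = solve-∀

  Σ≤-suc : ∀ M (g : ℕ → ℕ) → Σ≤ M (λ l → suc (g l)) ≡ M + Σ≤ M g
  Σ≤-suc zero    g = refl
  Σ≤-suc (suc M) g = cong suc (trans (cong (g (suc M) +_) (Σ≤-suc M g)) (lem (g (suc M)) M _))
    where
    lem : ∀ a b c → a + (b + c) ≡ b + (a + c)
    lem = solve-∀

  Σ≤-sum : ∀ {A : Set} M (g : ℕ → A → ℕ) xs → Σ≤ M (λ l → sum (map (g l) xs)) ≡ sum (map (λ x → Σ≤ M (λ l → g l x)) xs)
  Σ≤-sum zero    g []       = refl
  Σ≤-sum zero    g (x ∷ xs) = Σ≤-sum zero g xs
  Σ≤-sum (suc M) g xs = trans (cong (sum (map (g (suc M)) xs) +_) (Σ≤-sum M g xs)) (sym (sum-+ (g (suc M)) (λ x → Σ≤ M (λ l → g l x)) xs))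

  Σ≤-indicator≤ : ∀ M {P : ℕ → Set} (P? : ∀ l → Dec (P l)) → Σ≤ M (λ l → indicator (P? l)) ≤ M
  Σ≤-indicator≤ zero    P? = z≤n
  Σ≤-indicator≤ (suc M) P? with P? (suc M)
  ... | yes _ = s≤s (Σ≤-indicator≤ M P?)
  ... | no _  = m≤n⇒m≤1+n (Σ≤-indicator≤ M P?)

  Σ≤-indicator-≤? : ∀ M c → c ≤ M → c ≤ Σ≤ M (λ l → indicator (l ≤? c))
  Σ≤-indicator-≤? zero    c c≤ = c≤
  Σ≤-indicator-≤? (suc M) c c≤ with suc M ≤? c
  ... | yes M<c = ≤-trans c≤ (s≤s (full M (≤-trans (n≤1+n M) M<c)))
    where
    full : ∀ M → M ≤ c → M ≤ Σ≤ M (λ l → indicator (l ≤? c))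
    full zero    _ = z≤n
    full (suc M) M<c with suc M ≤? c
    ... | yes _ = s≤s (full M (≤-trans (n≤1+n M) M<c))
    ... | no ¬p = contradiction M<c ¬p
  ... | no ¬p = Σ≤-indicator-≤? M c (≤-pred (≰⇒> ¬p))

  *-Σ≤-indicator : ∀ M w z → w * Σ≤ M (λ l → indicator (w * l ≤? z)) ≤ z
  *-Σ≤-indicator zero    w z = subst (_≤ z) (sym (*-zeroʳ w)) z≤n
  *-Σ≤-indicator (suc M) w z with w * suc M ≤? z
  ... | yes p = ≤-trans (*-monoʳ-≤ w (s≤s (Σ≤-indicator≤ M (λ l → w * l ≤? z)))) p
  ... | no _  = *-Σ≤-indicator M w z

  largest-slice : ∀ {d} (X : List (Vec ℤ (suc d))) {x} → x ∈ X →
    ∃[ u ] u ∈ heads X × 1 ≤ card (slice X u) × (∀ {t} → t ∈ heads X → card (slice X t) ≤ card (slice X u))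
  largest-slice X {t ∷ x} p with extremum {_≼_ = λ i j → card (slice X j) ≤ card (slice X i)} (λ i j → ≤-total (card (slice X j)) (card (slice X i))) (λ p q → ≤-trans q p) (∈-heads⁺ {S = X} p)
  ... | u , u∈ , max = u , u∈ , VCard.card>0 (proj₂ (∈-heads⁻ {S = X} u∈)) , max

  -- Induction on the dimension by slices along the first coordinate. Slice sizes are scaled so that
  -- both largest slices have height `M = α * β`. At each level `l ≤ M` the first coordinates of the
  -- slices of height at least `l` form `U l` and `V l`; the one-dimensional bound counts their
  -- sums, and over each sum the induction hypothesis applies. The bound loses 1 per level, `M` in
  -- total, and this is paid for by using the slice at `t₀ = u₀ + v₀` once more.
  brunn-minkowski : ∀ d (X Y : List (Vec ℤ d)) {x y} → x ∈ X → y ∈ Y → ∀ w₁ w₂ →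
    BoxBound d (card X) (card Y) w₁ w₂ → w₁ ≤ w₂ * (card (X ⊞ Y) + lines (X ⊞ Y))
  brunn-minkowski zero X Y {[]} {[]} x∈ y∈ w₁ w₂ hyp = begin
    w₁                                       ≡⟨ *-identityˡ w₁ ⟨
    1 * w₁                                   ≤⟨ hyp 1 [] [] (one X) (one Y) ⟩
    w₂ * 1                                   ≤⟨ *-monoʳ-≤ w₂ (≤-trans (VCard.card>0 (∈-⊞⁺ x∈ y∈)) (m≤m+n _ 0)) ⟩
    w₂ * (card (X ⊞ Y) + 0)                  ∎
    where
    open ≤-Reasoning
    one : ∀ (Z : List (Vec ℤ 0)) → 1 * card Z ≤ 1
    one Z = subst (_≤ 1) (sym (*-identityˡ (card Z))) (VCard.card≤length {xs = Z} {[] ∷ []} λ { {[]} _ → here refl })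
  brunn-minkowski (suc d) X Y x∈ y∈ w₁ w₂ hyp with largest-slice X x∈ | largest-slice Y y∈
  ... | u₀ , u₀∈ , α>0 , ≤α | v₀ , v₀∈ , β>0 , ≤β = *-cancelʳ-≤ w₁ _ Z {{>-nonZero Z>0}} (begin
      w₁ * Z                                              ≤⟨ *-monoʳ-≤ w₁ Z≤ ⟩
      w₁ * (M + sum (map N Hs))                           ≡⟨ *-distribˡ-+ w₁ M (sum (map N Hs)) ⟩
      w₁ * M + w₁ * sum (map N Hs)                        ≤⟨ +-mono-≤ (level M u₀∈ v₀∈ (≤-refl) (≤-reflexive (*-comm α β))) Σ-bound ⟩
      w₂ * Z * h t₀ + w₂ * Z * sum (map h Hs)             ≡⟨ lem w₂ Z (h t₀) (sum (map h Hs)) ⟩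
      w₂ * (h t₀ + sum (map h Hs)) * Z                    ≤⟨ *-monoˡ-≤ Z (*-monoʳ-≤ w₂ final) ⟩
      w₂ * (card S + lines S) * Z                         ∎)
    where
    open ≤-Reasoning
    S  = X ⊞ Y
    us = heads X
    vs = heads Y
    Hs = heads S
    a : ℤ → ℕ
    a u = card (slice X u)
    b : ℤ → ℕ
    b v = card (slice Y v)
    h : ℤ → ℕ
    h t = card (slice S t) + lines (slice S t)
    α = a u₀
    β = b v₀
    M = α * β
    Z = card X * β + card Y * α
    t₀ = u₀ ℤ.+ v₀
    N : ℤ → ℕ
    N t = Σ≤ M (λ l → indicator (w₁ * l ≤? w₂ * Z * h t))

    Z>0 : 1 ≤ Z
    Z>0 = ≤-trans (*-mono-≤ (VCard.card>0 x∈) β>0) (m≤m+n _ _)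

    lem : ∀ w z h s → w * z * h + w * z * s ≡ w * (h + s) * z
    lem = solve-∀

    sum-∈ : ∀ {u v} → u ∈ us → v ∈ vs → (u ℤ.+ v) ∈ Hs
    sum-∈ u∈ v∈ = ∈-heads⁺ (∈-⊞⁺ (∈-slice⁻ X (proj₂ (∈-heads⁻ {S = X} u∈))) (∈-slice⁻ Y (proj₂ (∈-heads⁻ {S = Y} v∈))))

    level : ∀ l {u v} → u ∈ us → v ∈ vs → l ≤ a u * β → l ≤ b v * α → w₁ * l ≤ w₂ * Z * h (u ℤ.+ v)
    level l {u} {v} u∈ v∈ l≤ l≤′ = ≤-trans
      (brunn-minkowski d (slice X u) (slice Y v) (proj₂ (∈-heads⁻ {S = X} u∈)) (proj₂ (∈-heads⁻ {S = Y} v∈)) (w₁ * l) (w₂ * Z) bound)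
      (*-monoʳ-≤ (w₂ * Z) (+-mono-≤ (VCard.card-mono (slice-⊞ X Y)) (lines-mono (slice-⊞ X Y))))
      where
      -- A box for a slice becomes one for `X` or `Y`, with denominator `D * l`, by a first side
      -- `card X * β` or `card Y * α`. The conditions on `l` keep the volumes large enough, and the
      -- two new sides add up to `Z`.
      bound : BoxBound d (a u) (b v) (w₁ * l) (w₂ * Z)
      bound D xs ys p q = begin
        D * (w₁ * l)                                                ≡⟨ (λ D w l → solve-∀-1 D w l) D w₁ l ⟩
        D * l * w₁                                                  ≤⟨ hyp (D * l) (card X * β ∷ xs) (card Y * α ∷ ys) (side (card X) β (a u) l D p l≤) (side (card Y) α (b v) l D q l≤′) ⟩
        w₂ * (Z * ∏ (xs +ⁿ ys))                                     ≡⟨ *-assoc w₂ Z _ ⟨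
        w₂ * Z * ∏ (xs +ⁿ ys)                                       ∎
        where
        solve-∀-1 : ∀ D w l → D * (w * l) ≡ D * l * w
        solve-∀-1 = solve-∀
        side : ∀ A β a l D {Π} → D * a ≤ Π → l ≤ a * β → D * l * A ≤ A * β * Π
        side A β a l D {Π} p q = begin
          D * l * A          ≤⟨ *-monoˡ-≤ A (*-monoʳ-≤ D q) ⟩
          D * (a * β) * A    ≡⟨ eq D a β A ⟩
          A * β * (D * a)    ≤⟨ *-monoʳ-≤ (A * β) p ⟩
          A * β * Π          ∎
          where
          eq : ∀ D a β A → D * (a * β) * A ≡ A * β * (D * a)
          eq = solve-∀

    U : ℕ → List ℤ
    U l = filter (λ u → l ≤? a u * β) us
    V : ℕ → List ℤ
    V l = filter (λ v → l ≤? b v * α) vs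

    count : ∀ l → 1 ≤ l → l ≤ M → length (U l) + length (V l) ≤ suc (length (filter (λ t → w₁ * l ≤? w₂ * Z * h t) Hs))
    count l _ l≤M = ≤-trans
      (length-sumset-ℤ (Unique.filter⁺ _ (heads-! X)) (Unique.filter⁺ _ (heads-! Y))
        (∈-filter⁺ (λ u → l ≤? a u * β) u₀∈ l≤M) (∈-filter⁺ (λ v → l ≤? b v * α) v₀∈ (subst (l ≤_) (*-comm α β) l≤M)))
      (s≤s (ℤCard.card≤length sub))
      where
      sub : cartesianProductWith ℤ._+_ (U l) (V l) ⊆ filter (λ t → w₁ * l ≤? w₂ * Z * h t) Hs
      sub z∈ with ∈-cartesianProductWith⁻ ℤ._+_ (U l) (V l) z∈
      ... | u , v , u∈U , v∈V , refl with ∈-filter⁻ (λ u → l ≤? a u * β) {xs = us} u∈U | ∈-filter⁻ (λ v → l ≤? b v * α) {xs = vs} v∈V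
      ...   | u∈ , p | v∈ , q = ∈-filter⁺ (λ t → w₁ * l ≤? w₂ * Z * h t) (sum-∈ u∈ v∈) (level l u∈ v∈ p q)

    mass : ∀ (c : ℤ → ℕ) ts → (∀ {t} → t ∈ ts → c t ≤ M) → sum (map c ts) ≤ Σ≤ M (λ l → length (filter (λ t → l ≤? c t) ts))
    mass c ts c≤ = begin
      sum (map c ts)                                                  ≤⟨ sum-mono c (λ t → Σ≤ M (λ l → indicator (l ≤? c t))) ts (λ p → Σ≤-indicator-≤? M _ (c≤ p)) ⟩
      sum (map (λ t → Σ≤ M (λ l → indicator (l ≤? c t))) ts)  ≡⟨ Σ≤-sum M (λ l t → indicator (l ≤? c t)) ts ⟨
      Σ≤ M (λ l → sum (map (λ t → indicator (l ≤? c t)) ts))  ≤⟨ Σ≤-mono M (λ l _ _ → ≤-reflexive (sym (length-filter-sum (λ t → l ≤? c t) ts))) ⟩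
      Σ≤ M (λ l → length (filter (λ t → l ≤? c t) ts))                ∎

    mass-slices : ∀ (W : List (Vec ℤ (suc d))) c → sum (map (λ t → card (slice W t) * c) (heads W)) ≡ c * sum (map (λ t → card (slice W t)) (heads W))
    mass-slices W c = trans (cong sum (map-cong (λ t → *-comm (card (slice W t)) c) (heads W))) (sum-* c (λ t → card (slice W t)) (heads W))

    Z≤ : Z ≤ M + sum (map N Hs)
    Z≤ = begin
      card X * β + card Y * α                                          ≡⟨ cong₂ _+_ (*-comm (card X) β) (*-comm (card Y) α) ⟩
      β * card X + α * card Y                                          ≤⟨ +-mono-≤ (*-monoʳ-≤ β (card≤sum-card-slices X)) (*-monoʳ-≤ α (card≤sum-card-slices Y)) ⟩
      β * sum (map a us) + α * sum (map b vs)                          ≡⟨ cong₂ _+_ (mass-slices X β) (mass-slices Y α) ⟨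
      sum (map (λ u → a u * β) us) + sum (map (λ v → b v * α) vs)      ≤⟨ +-mono-≤ (mass (λ u → a u * β) us (λ p → *-monoˡ-≤ β (≤α p))) (mass (λ v → b v * α) vs (λ {v} p → subst (b v * α ≤_) (*-comm β α) (*-monoˡ-≤ α (≤β p)))) ⟩
      Σ≤ M (λ l → length (U l)) + Σ≤ M (λ l → length (V l))            ≡⟨ Σ≤-+ M (λ l → length (U l)) (λ l → length (V l)) ⟨
      Σ≤ M (λ l → length (U l) + length (V l))                         ≤⟨ Σ≤-mono M count ⟩
      Σ≤ M (λ l → suc (length (filter (λ t → w₁ * l ≤? w₂ * Z * h t) Hs))) ≡⟨ Σ≤-suc M _ ⟩
      M + Σ≤ M (λ l → length (filter (λ t → w₁ * l ≤? w₂ * Z * h t) Hs))   ≤⟨ +-monoʳ-≤ M (Σ≤-mono M (λ l _ _ → ≤-reflexive (length-filter-sum (λ t → w₁ * l ≤? w₂ * Z * h t) Hs))) ⟩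
      M + Σ≤ M (λ l → sum (map (λ t → indicator (w₁ * l ≤? w₂ * Z * h t)) Hs)) ≡⟨ cong (M +_) (Σ≤-sum M (λ l t → indicator (w₁ * l ≤? w₂ * Z * h t)) Hs) ⟩
      M + sum (map N Hs)                                               ∎

    Σ-bound : w₁ * sum (map N Hs) ≤ w₂ * Z * sum (map h Hs)
    Σ-bound = begin
      w₁ * sum (map N Hs)                   ≡⟨ sum-* w₁ N Hs ⟨
      sum (map (λ t → w₁ * N t) Hs)         ≤⟨ sum-mono (λ t → w₁ * N t) (λ t → w₂ * Z * h t) Hs (λ {t} _ → *-Σ≤-indicator M w₁ (w₂ * Z * h t)) ⟩
      sum (map (λ t → w₂ * Z * h t) Hs)     ≡⟨ sum-* (w₂ * Z) h Hs ⟩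
      w₂ * Z * sum (map h Hs)               ∎

    slice⊆tails : ∀ t → slice S t ⊆ map tail S
    slice⊆tails t p = ∈-map⁺ tail (∈-slice⁻ S p)

    -- The second use of the slice at `t₀` is an error term: its points inject into the lines of the
    -- first direction, and its own `lines` are at most `ℓ`. This is the origin of the factor 2 in
    -- `lines`.
    final : h t₀ + sum (map h Hs) ≤ card S + lines S
    final = begin
      card (slice S t₀) + lines (slice S t₀) + sum (map h Hs)
        ≤⟨ +-mono-≤ (+-mono-≤ (VCard.card-mono (slice⊆tails t₀)) (∈⇒≤sum (λ t → lines (slice S t)) (sum-∈ u₀∈ v₀∈)))
             (≤-reflexive (sum-+ (λ t → card (slice S t)) (λ t → lines (slice S t)) Hs)) ⟩
      T + ℓ + (sum (map (λ t → card (slice S t)) Hs) + ℓ)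
        ≤⟨ +-monoʳ-≤ (T + ℓ) (+-monoˡ-≤ ℓ (sum-card-slices≤ S)) ⟩
      T + ℓ + (card S + ℓ)      ≡⟨ eq T ℓ (card S) ⟩
      card S + (T + 2 * ℓ)      ∎
      where
      T = card (map tail S)
      ℓ = sum (map (λ t → lines (slice S t)) Hs)
      eq : ∀ T ℓ S → T + ℓ + (S + ℓ) ≡ S + (T + 2 * ℓ)
      eq = solve-∀

-- Line counts, and lower bounds for volumes of sums of boxes.

module BoxVolumes where

  open import Defs using (card; _⊞_; module ℤLinear)
  open import Data.Fin.Base using (Fin; zero; suc)
  open import Data.List.Base using (List; []; _∷_; map; upTo; length; concatMap)
  open import Data.List.Properties using (map-∘; map-cong; length-upTo)
  open import Data.List.Membership.Propositional.Properties
  open import Data.Nat.Base using (ℕ; zero; suc; _+_; _*_; _^_; _∸_; _≤_; _<_; z≤n; s≤s; NonZero; >-nonZero; >-nonZero⁻¹)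
  open import Data.Nat.Properties
  open import Data.Nat.Tactic.RingSolver using (solve-∀)
  open import Data.Vec.Base as Vec using (Vec; []; _∷_; head; tail)
  open Cardinality
  open BrunnMinkowski

  open ℤLinear using (_+ᵥ_; 0ᵥ)

  0+ᵥ : ∀ {d} (x : Vec ℤ d) → 0ᵥ +ᵥ x ≡ x
  0+ᵥ []      = refl
  0+ᵥ (a ∷ x) = cong₂ _∷_ (ℤ.+-identityˡ a) (0+ᵥ x)

  +ᵥ0 : ∀ {d} (x : Vec ℤ d) → x +ᵥ 0ᵥ ≡ x
  +ᵥ0 []      = refl
  +ᵥ0 (a ∷ x) = cong₂ _∷_ (ℤ.+-identityʳ a) (+ᵥ0 x)

  axis : ∀ {d} → Fin d → ℕ → Vec ℤ d
  axis zero    l = ℤ.+ l ∷ 0ᵥ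
  axis (suc i) l = ℤ.0ℤ ∷ axis i l

  ray : ∀ {d} → ℕ → Fin d → List (Vec ℤ d)
  ray m i = map (axis i) (upTo m)

  -- Each line parallel to the first axis that meets `S` gets one representative, whose `m`
  -- translates along the ray stay on that line. The tail recovers the line, and then the head
  -- recovers the translate.
  tails-ray : ∀ {d} (S : List (Vec ℤ (suc d))) m → m * card (map tail S) ≤ card (S ⊞ ray m zero)
  tails-ray {d} S m = begin
    m * card (map tail S)                                   ≡⟨ *-comm m _ ⟩
    card (map tail S) * m                                   ≡⟨ cong (card (map tail S) *_) (trans (ℕCard.card-Unique (Unique.upTo⁺ m)) (length-upTo m)) ⟨
    card (map tail S) * ℕCard.card (upTo m)                 ≤⟨ card-productWith-inj _≟ᵥ_ _≟_ _≟ᵥ_ f into inj ⟩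
    card (S ⊞ ray m zero)                                   ∎
    where
    open ≤-Reasoning
    module ℕCard = Card _≟_
    rep : Vec ℤ d → Vec ℤ (suc d)
    rep = pick _≟ᵥ_ tail S 0ᵥ
    f : Vec ℤ d → ℕ → Vec ℤ (suc d)
    f x l = rep x +ᵥ axis zero l
    tail-f : ∀ {x} l → x ∈ map tail S → tail (f x l) ≡ x
    tail-f {x} l p with rep x | proj₂ (pick-∈ _≟ᵥ_ tail {S} {0ᵥ} p)
    ... | t ∷ .x | refl = +ᵥ0 x
    head-f : ∀ x l → head (f x l) ≡ head (rep x) ℤ.+ ℤ.+ l
    head-f x l with rep x
    ... | t ∷ _ = refl
    into : ∀ {x l} → x ∈ map tail S → l ∈ upTo m → f x l ∈ (S ⊞ ray m zero)
    into p q = ∈-⊞⁺ (proj₁ (pick-∈ _≟ᵥ_ tail {S} p)) (∈-map⁺ (axis zero) q)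
    inj : ∀ {x l x′ l′} → x ∈ map tail S → l ∈ upTo m → x′ ∈ map tail S → l′ ∈ upTo m → f x l ≡ f x′ l′ → x ≡ x′ × l ≡ l′
    inj {x} {l} {x′} {l′} p _ p′ _ eq with trans (sym (tail-f l p)) (trans (cong tail eq) (tail-f l′ p′))
    ... | refl = refl , ℤ.+-injective (ℤ-cancelˡ (head (rep x)) (ℤ.+ l) (ℤ.+ l′) (trans (sym (head-f x l)) (trans (cong head eq) (head-f x l′))))

  slices-ray : ∀ {d} (S : List (Vec ℤ (suc d))) m i →
    sum (map (λ t → card (slice S t ⊞ ray m i)) (heads S)) ≤ card (S ⊞ ray m (suc i))
  slices-ray S m i = sum-card-disjoint _≟ᵥ_ _≟ᵥ_ (λ t → slice S t ⊞ ray m i) (λ t x → t ∷ x) into (λ _ → cong tail) (heads-apart S)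
    where
    into : ∀ {t a} → t ∈ heads S → a ∈ (slice S t ⊞ ray m i) → (t ∷ a) ∈ (S ⊞ ray m (suc i))
    into {t} _ p with ∈-⊞⁻ (slice S t) (ray m i) p
    ... | x , y , x∈ , y∈ , refl with ∈-map⁻ (axis i) y∈
    ...   | l , l∈ , refl = subst (_∈ (S ⊞ ray m (suc i))) (cong (_∷ (x +ᵥ axis i l)) (ℤ.+-identityʳ t))
      (∈-⊞⁺ (∈-slice⁻ S x∈) (∈-map⁺ (axis (suc i)) l∈))

  -- Stated for a family, so that the induction can pass to all slices of all members at once, with
  -- the same `N` serving the remaining directions. The summand `N` on the left turns the recursion
  -- into a plain doubling.
  lines-rays : ∀ d (Ss : List (List (Vec ℤ d))) m N →
    (∀ i → sum (map (λ S → card (S ⊞ ray m i)) Ss) ≤ N) → m * sum (map lines Ss) + N ≤ 2 ^ d * N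
  lines-rays zero Ss m N _ = ≤-reflexive (trans (cong (λ s → m * s + N) (zeros Ss)) (trans (cong (_+ N) (*-zeroʳ m)) (sym (+-identityʳ N))))
    where
    zeros : ∀ (Ss : List (List (Vec ℤ 0))) → sum (map lines Ss) ≡ 0
    zeros [] = refl
    zeros (_ ∷ Ss) = zeros Ss
  lines-rays (suc d) Ss m N hyp = begin
    m * sum (map lines Ss) + N                        ≡⟨ cong (λ s → m * s + N) split ⟩
    m * (T + 2 * Λ) + N                               ≡⟨ eq₁ m T Λ N ⟩
    m * T + (2 * (m * Λ) + N)                         ≤⟨ +-monoˡ-≤ (2 * (m * Λ) + N) T≤ ⟩
    N + (2 * (m * Λ) + N)                             ≡⟨ eq₂ N (m * Λ) ⟩
    2 * (m * Λ + N)                                   ≤⟨ *-monoʳ-≤ 2 (subst (λ s → m * s + N ≤ 2 ^ d * N) (sum-concatMap lines _ Ss) (lines-rays d Ss′ m N hyp′)) ⟩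
    2 * (2 ^ d * N)                                   ≡⟨ *-assoc 2 (2 ^ d) N ⟨
    2 * 2 ^ d * N                                     ∎
    where
    open ≤-Reasoning
    Ss′ = concatMap (λ S → map (slice S) (heads S)) Ss
    T = sum (map (λ S → card (map tail S)) Ss)
    Λ = sum (map (λ S → sum (map lines (map (slice S) (heads S)))) Ss)
    eq₁ : ∀ m T Λ N → m * (T + 2 * Λ) + N ≡ m * T + (2 * (m * Λ) + N)
    eq₁ = solve-∀
    eq₂ : ∀ N L → N + (2 * L + N) ≡ 2 * (L + N)
    eq₂ = solve-∀
    split : sum (map lines Ss) ≡ T + 2 * Λ
    split = trans (cong sum (map-cong (λ S → cong (λ s → card (map tail S) + 2 * sum s) (map-∘ (heads S))) Ss))
      (trans (sum-+ (λ S → card (map tail S)) (λ S → 2 * sum (map lines (map (slice S) (heads S)))) Ss)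
        (cong (T +_) (sum-* 2 (λ S → sum (map lines (map (slice S) (heads S)))) Ss)))
    T≤ : m * T ≤ N
    T≤ = ≤-trans (≤-reflexive (sym (sum-* m (λ S → card (map tail S)) Ss)))
      (≤-trans (sum-mono (λ S → m * card (map tail S)) (λ S → card (S ⊞ ray m zero)) Ss (λ {S} _ → tails-ray S m)) (hyp zero))
    hyp′ : ∀ i → sum (map (λ S → card (S ⊞ ray m i)) Ss′) ≤ N
    hyp′ i = ≤-trans (≤-reflexive (sum-concatMap (λ S → card (S ⊞ ray m i)) _ Ss))
      (≤-trans (sum-mono _ (λ S → card (S ⊞ ray m (suc i))) Ss
        (λ {S} _ → ≤-trans (≤-reflexive (cong sum (sym (map-∘ (heads S))))) (slices-ray S m i))) (hyp (suc i)))

  -- Huygens' inequality ∏ (1 + yᵢ/xᵢ) ≥ (1 + p/q)ⁿ when ∏ yᵢ/xᵢ ≥ (p/q)ⁿ.  A factor below p/q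
  -- and one above it are replaced by p/q and the quotient of their product by p/q.
  module Huygens (p q : ℕ) where

    Pairs : Set
    Pairs = List (ℕ × ℕ)

    Π₁ Π₂ Π₊ : Pairs → ℕ
    Π₁ []             = 1
    Π₁ ((x , y) ∷ L)  = x * Π₁ L
    Π₂ []             = 1
    Π₂ ((x , y) ∷ L)  = y * Π₂ L
    Π₊ []             = 1
    Π₊ ((x , y) ∷ L)  = (x + y) * Π₊ L

    Low High : ℕ × ℕ → Set
    Low  (x , y) = q * y ≤ p * x
    High (x , y) = p * x ≤ q * y

    Extract : (ℕ × ℕ → Set) → Pairs → Set
    Extract R L = ∃[ x ] ∃[ y ] ∃[ L′ ] R (x , y) × length L ≡ suc (length L′) ×
      Π₁ L ≡ x * Π₁ L′ × Π₂ L ≡ y * Π₂ L′ × Π₊ L ≡ (x + y) * Π₊ L′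

    swap : ∀ a b c → a * (b * c) ≡ b * (a * c)
    swap = solve-∀

    extract : ∀ {R : ℕ × ℕ → Set} → (∀ z → Dec (R z)) → ∀ L → Extract R L ⊎ All (λ z → ¬ R z) L
    extract R? [] = inj₂ []
    extract R? ((x , y) ∷ L) with R? (x , y)
    ... | yes r = inj₁ (x , y , L , r , refl , refl , refl , refl)
    ... | no ¬r with extract R? L
    ...   | inj₂ none = inj₂ (¬r ∷ none)
    ...   | inj₁ (x′ , y′ , L′ , r , l , e₁ , e₂ , e₃) = inj₁ (x′ , y′ , (x , y) ∷ L′ , r , cong suc l ,
        trans (cong (x *_) e₁) (swap x x′ _) , trans (cong (y *_) e₂) (swap y y′ _) , trans (cong ((x + y) *_) e₃) (swap (x + y) (x′ + y′) _))

    -- The difference of the two sides is `(p x - q y) (q y′ - p x′)`, the product `s * t` of two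
    -- nonnegative gaps. The terms added on both sides in `lemma` only avoid subtraction.
    cross : ∀ {x y x′ y′} → q * y ≤ p * x → p * x′ ≤ q * y′ → (p + q) * (p * (x * x′) + q * (y * y′)) ≤ p * (q * ((x + y) * (x′ + y′)))
    cross {x} {y} {x′} {y′} low high with m≤n⇒∃[o]m+o≡n low | m≤n⇒∃[o]m+o≡n high
    ... | s , eqs | t , eqt = begin
      (p + q) * (p * (x * x′) + q * (y * y′))                                   ≤⟨ m≤m+n _ (s * t) ⟩
      (p + q) * (p * (x * x′) + q * (y * y′)) + s * t                           ≡⟨ +-cancelʳ-≡ (p * x * (q * y) + q * y * (p * x′)) _ _ lemma ⟩
      p * (q * ((x + y) * (x′ + y′)))                                           ∎
      where
      open ≤-Reasoning
      e₁ : ∀ p q x y x′ y′ s t → (p + q) * (p * (x * x′) + q * (y * y′)) + s * t + (p * x * (q * y) + q * y * (p * x′)) ≡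
        p * q * (x * x′ + y * y′) + (p * x) * (p * x′) + (q * y) * (q * y′) + s * t + (p * x * (q * y) + q * y * (p * x′))
      e₁ = solve-∀
      e₂ : ∀ p q x y x′ y′ → p * (q * ((x + y) * (x′ + y′))) + (p * x * (q * y) + q * y * (p * x′)) ≡
        p * q * (x * x′ + y * y′) + (p * x) * (q * y′) + (q * y) * (p * x′) + (p * x * (q * y) + q * y * (p * x′))
      e₂ = solve-∀
      e₃ : ∀ a u v s t → a + (u + s) * v + u * (v + t) + s * t + ((u + s) * u + u * v) ≡
        a + (u + s) * (v + t) + u * v + ((u + s) * u + u * v)
      e₃ = solve-∀
      lemma : (p + q) * (p * (x * x′) + q * (y * y′)) + s * t + (p * x * (q * y) + q * y * (p * x′)) ≡
        p * (q * ((x + y) * (x′ + y′))) + (p * x * (q * y) + q * y * (p * x′))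
      lemma = trans (e₁ p q x y x′ y′ s t) (trans
        (subst₂ (λ a b → p * q * (x * x′ + y * y′) + a * (p * x′) + (q * y) * b + s * t + (a * (q * y) + q * y * (p * x′)) ≡
                         p * q * (x * x′ + y * y′) + a * b + (q * y) * (p * x′) + (a * (q * y) + q * y * (p * x′)))
          eqs eqt (e₃ (p * q * (x * x′ + y * y′)) (q * y) (p * x′) s t))
        (sym (e₂ p q x y x′ y′)))

    all-high : ∀ L → All High L → (p + q) ^ length L * Π₁ L ≤ q ^ length L * Π₊ L
    all-high [] [] = ≤-refl
    all-high ((x , y) ∷ L) (h ∷ hs) = begin
      (p + q) * (p + q) ^ length L * (x * Π₁ L)       ≡⟨ eq (p + q) _ x _ ⟩
      (p + q) * x * ((p + q) ^ length L * Π₁ L)       ≤⟨ *-mono-≤ step (all-high L hs) ⟩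
      q * (x + y) * (q ^ length L * Π₊ L)             ≡⟨ eq q _ (x + y) _ ⟨
      q * q ^ length L * ((x + y) * Π₊ L)             ∎
      where
      open ≤-Reasoning
      eq : ∀ a b c d → a * b * (c * d) ≡ a * c * (b * d)
      eq = solve-∀
      step : (p + q) * x ≤ q * (x + y)
      step = begin
        (p + q) * x       ≡⟨ *-distribʳ-+ x p q ⟩
        p * x + q * x     ≤⟨ +-monoˡ-≤ (q * x) h ⟩
        q * y + q * x     ≡⟨ +-comm (q * y) (q * x) ⟩
        q * x + q * y     ≡⟨ *-distribˡ-+ q x y ⟨
        q * (x + y)       ∎

    all-low : ∀ z L → All (λ z → ¬ High z) (z ∷ L) → q ^ length (z ∷ L) * Π₂ (z ∷ L) < p ^ length (z ∷ L) * Π₁ (z ∷ L)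
    all-low (x , y) L (¬h ∷ hs) = subst₂ _<_ (sym (eq q _ y _)) (sym (eq p _ x _)) (rest L hs)
      where
      eq : ∀ a b c d → a * b * (c * d) ≡ a * c * (b * d)
      eq = solve-∀
      rest : ∀ L → All (λ z → ¬ High z) L → q * y * (q ^ length L * Π₂ L) < p * x * (p ^ length L * Π₁ L)
      rest [] [] = subst₂ _<_ (sym (*-identityʳ (q * y))) (sym (*-identityʳ (p * x))) (≰⇒> ¬h)
      rest (z ∷ L) hs = *-mono-< (≰⇒> ¬h) (all-low z L hs)

    -- The last hypothesis is the inequality for the list in which the two pairs are merged into
    -- `(p * (x * x′) , q * (y * y′))`, whose ratio is the product of theirs divided by `p / q`. The
    -- merger is paid for by `cross`.
    combine : ∀ N {x y x′ y′} X F → .{{_ : NonZero p}} → q * y ≤ p * x → p * x′ ≤ q * y′ →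
      (p + q) ^ N * (p * (x * x′) * X) ≤ q ^ N * ((p * (x * x′) + q * (y * y′)) * F) →
      (p + q) ^ suc N * (x * (x′ * X)) ≤ q ^ suc N * ((x + y) * ((x′ + y′) * F))
    combine N {x} {y} {x′} {y′} X F low high ih = *-cancelˡ-≤ p (begin
      p * ((p + q) * (p + q) ^ N * (x * (x′ * X)))                      ≡⟨ eq₂ p (p + q) ((p + q) ^ N) x x′ X ⟩
      (p + q) * ((p + q) ^ N * (p * (x * x′) * X))                      ≤⟨ *-monoʳ-≤ (p + q) ih ⟩
      (p + q) * (q ^ N * ((p * (x * x′) + q * (y * y′)) * F))           ≡⟨ eq₃ (p + q) (q ^ N) (p * (x * x′) + q * (y * y′)) F ⟩
      q ^ N * ((p + q) * (p * (x * x′) + q * (y * y′)) * F)             ≤⟨ *-monoʳ-≤ (q ^ N) (*-monoˡ-≤ F (cross {x} {y} {x′} {y′} low high)) ⟩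
      q ^ N * (p * (q * ((x + y) * (x′ + y′))) * F)                     ≡⟨ eq₄ p q (q ^ N) (x + y) (x′ + y′) F ⟩
      p * (q * q ^ N * ((x + y) * ((x′ + y′) * F)))                     ∎)
      where
      open ≤-Reasoning
      eq₂ : ∀ p s S x x′ X → p * (s * S * (x * (x′ * X))) ≡ s * (S * (p * (x * x′) * X))
      eq₂ = solve-∀
      eq₃ : ∀ s Q Z F → s * (Q * (Z * F)) ≡ Q * (s * Z * F)
      eq₃ = solve-∀
      eq₄ : ∀ p q Q u v F → Q * (p * (q * (u * v)) * F) ≡ p * (q * Q * (u * (v * F)))
      eq₄ = solve-∀

    huygens : ∀ n x y L → length L ≡ n → .{{_ : NonZero p}} → p ^ suc n * (x * Π₁ L) ≤ q ^ suc n * (y * Π₂ L) →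
      (p + q) ^ suc n * (x * Π₁ L) ≤ q ^ suc n * ((x + y) * Π₊ L)
    huygens zero x y [] refl hyp = all-high ((x , y) ∷ []) (subst₂ _≤_ (e p x) (e q y) hyp ∷ [])
      where
      e : ∀ p x → p * 1 * (x * 1) ≡ p * x
      e = solve-∀
    huygens (suc n) x y L len hyp with ≤-total (q * y) (p * x)
    ... | inj₁ low with extract (λ z → p * proj₁ z ≤? q * proj₂ z) L
    ...   | inj₁ (x′ , y′ , L′ , high , l , e₁ , e₂ , e₃) = subst₂ (λ X F → (p + q) ^ suc (suc n) * (x * X) ≤ q ^ suc (suc n) * ((x + y) * F)) (sym e₁) (sym e₃)
      (combine (suc n) {x} {y} {x′} {y′} (Π₁ L′) (Π₊ L′) low high
        (huygens n (p * (x * x′)) (q * (y * y′)) L′ (suc-injective (trans (sym l) len))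
          (subst₂ _≤_ (trans (cong (λ X → p ^ suc (suc n) * (x * X)) e₁) (eq p (p ^ suc n) x x′ (Π₁ L′)))
                      (trans (cong (λ Y → q ^ suc (suc n) * (y * Y)) e₂) (eq q (q ^ suc n) y y′ (Π₂ L′))) hyp)))
      where
      eq : ∀ p P x x′ X → p * P * (x * (x′ * X)) ≡ P * (p * (x * x′) * X)
      eq = solve-∀
    huygens (suc n) zero y L len hyp | inj₁ low | inj₂ none = ≤-trans (≤-reflexive (*-zeroʳ ((p + q) ^ suc (suc n)))) z≤n
    huygens (suc n) (suc x) y (z ∷ L) refl hyp | inj₁ low | inj₂ none = contradiction hyp (<⇒≱ strict)
      where
      eq : ∀ a b c d → a * b * (c * d) ≡ a * c * (b * d)
      eq = solve-∀
      strict : q ^ suc (suc (length L)) * (y * Π₂ (z ∷ L)) < p ^ suc (suc (length L)) * (suc x * Π₁ (z ∷ L))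
      strict = subst₂ _<_ (sym (eq q _ y _)) (sym (eq p _ (suc x) _))
        (≤-<-trans (*-monoˡ-≤ (q ^ suc (length L) * Π₂ (z ∷ L)) low)
          (*-monoʳ-< (p * suc x) {{m*n≢0 p (suc x)}} (all-low z L none)))
    huygens (suc n) x y L len hyp | inj₂ high with extract (λ z → q * proj₂ z ≤? p * proj₁ z) L
    ... | inj₂ none = subst (λ m → (p + q) ^ suc m * (x * Π₁ L) ≤ q ^ suc m * ((x + y) * Π₊ L)) len
      (all-high ((x , y) ∷ L) (high ∷ All.map (λ ¬low → <⇒≤ (≰⇒> ¬low)) none))
    ... | inj₁ (x′ , y′ , L′ , low , l , e₁ , e₂ , e₃) = subst₂ (λ X F → (p + q) ^ suc (suc n) * X ≤ q ^ suc (suc n) * F)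
      (trans (swap x′ x (Π₁ L′)) (cong (x *_) (sym e₁))) (trans (swap (x′ + y′) (x + y) (Π₊ L′)) (cong ((x + y) *_) (sym e₃)))
      (combine (suc n) {x′} {y′} {x} {y} (Π₁ L′) (Π₊ L′) low high
        (huygens n (p * (x′ * x)) (q * (y′ * y)) L′ (suc-injective (trans (sym l) len))
          (subst₂ _≤_ (trans (cong (λ X → p ^ suc (suc n) * (x * X)) e₁) (eq p (p ^ suc n) x x′ (Π₁ L′)))
                      (trans (cong (λ Y → q ^ suc (suc n) * (y * Y)) e₂) (eq q (q ^ suc n) y y′ (Π₂ L′))) hyp)))
      where
      eq : ∀ p P x x′ X → p * P * (x * (x′ * X)) ≡ P * (p * (x′ * x) * X)
      eq = solve-∀

  pairs : ∀ {d} → Vec ℕ d → Vec ℕ d → List (ℕ × ℕ)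
  pairs []       []       = []
  pairs (x ∷ xs) (y ∷ ys) = (x , y) ∷ pairs xs ys

  product≤square : ∀ {x y m} → x + y ≡ m + m → x * y ≤ m * m
  product≤square {x} {y} {m} eq = *-cancelˡ-≤ 4 (begin
    4 * (x * y)             ≤⟨ four x y ⟩
    (x + y) * (x + y)       ≡⟨ cong₂ _*_ eq eq ⟩
    (m + m) * (m + m)       ≡⟨ e m ⟩
    4 * (m * m)             ∎)
    where
    open ≤-Reasoning
    e : ∀ m → (m + m) * (m + m) ≡ 4 * (m * m)
    e = solve-∀
    e₁ : ∀ x t → (x + (x + t)) * (x + (x + t)) ≡ 4 * (x * (x + t)) + t * t
    e₁ = solve-∀
    e₂ : ∀ y t → (y + t + y) * (y + t + y) ≡ 4 * ((y + t) * y) + t * t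
    e₂ = solve-∀
    four : ∀ x y → 4 * (x * y) ≤ (x + y) * (x + y)
    four x y with ≤-total x y
    ... | inj₁ x≤y with m≤n⇒∃[o]m+o≡n x≤y
    ...   | t , refl = ≤-trans (m≤m+n _ (t * t)) (≤-reflexive (sym (e₁ x t)))
    four x y | inj₂ y≤x with m≤n⇒∃[o]m+o≡n y≤x
    ...   | t , refl = ≤-trans (m≤m+n _ (t * t)) (≤-reflexive (sym (e₂ y t)))

  module _ (p q : ℕ) .{{_ : NonZero p}} .{{_ : NonZero q}} where
    open Huygens p q

    length-pairs : ∀ {d} (xs ys : Vec ℕ d) → length (pairs xs ys) ≡ d
    length-pairs []       []       = refl
    length-pairs (x ∷ xs) (y ∷ ys) = cong suc (length-pairs xs ys)

    Π₁-pairs : ∀ {d} (xs ys : Vec ℕ d) → Π₁ (pairs xs ys) ≡ ∏ xs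
    Π₁-pairs []       []       = refl
    Π₁-pairs (x ∷ xs) (y ∷ ys) = cong (x *_) (Π₁-pairs xs ys)

    Π₂-pairs : ∀ {d} (xs ys : Vec ℕ d) → Π₂ (pairs xs ys) ≡ ∏ ys
    Π₂-pairs []       []       = refl
    Π₂-pairs (x ∷ xs) (y ∷ ys) = cong (y *_) (Π₂-pairs xs ys)

    Π₊-pairs : ∀ {d} (xs ys : Vec ℕ d) → Π₊ (pairs xs ys) ≡ ∏ (xs +ⁿ ys)
    Π₊-pairs []       []       = refl
    Π₊-pairs (x ∷ xs) (y ∷ ys) = cong ((x + y) *_) (Π₊-pairs xs ys)

    -- Huygens' inequality with `d + 1` factors: the extra pair
    -- `(q ^ suc d * ∏ ys , p ^ suc d * ∏ xs)` is chosen to make the product of all ratios equal to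
    -- `(p / q) ^ suc d`, whatever the boxes are.
    box-huygens : ∀ {d} (xs ys : Vec ℕ d) →
      (p + q) ^ suc d * (∏ xs * ∏ ys) ≤ ∏ (xs +ⁿ ys) * (q ^ suc d * ∏ ys + p ^ suc d * ∏ xs)
    box-huygens {d} xs ys = *-cancelˡ-≤ (q ^ suc d) {{m^n≢0 q (suc d)}} (subst₂ _≤_
      (trans (cong (λ X → (p + q) ^ suc d * (q ^ suc d * ∏ ys * X)) (Π₁-pairs xs ys)) (e₁ ((p + q) ^ suc d) (q ^ suc d) (∏ ys) (∏ xs)))
      (trans (cong (λ F → q ^ suc d * ((q ^ suc d * ∏ ys + p ^ suc d * ∏ xs) * F)) (Π₊-pairs xs ys))
        (cong (q ^ suc d *_) (*-comm (q ^ suc d * ∏ ys + p ^ suc d * ∏ xs) (∏ (xs +ⁿ ys)))))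
      (huygens d (q ^ suc d * ∏ ys) (p ^ suc d * ∏ xs) (pairs xs ys) (length-pairs xs ys)
        (≤-reflexive (trans (cong (λ X → p ^ suc d * (q ^ suc d * ∏ ys * X)) (Π₁-pairs xs ys))
          (trans (e₂ (p ^ suc d) (q ^ suc d) (∏ ys) (∏ xs)) (cong (λ Y → q ^ suc d * (p ^ suc d * ∏ xs * Y)) (sym (Π₂-pairs xs ys))))))))
      where
      e₁ : ∀ s Q Y X → s * (Q * Y * X) ≡ Q * (s * (X * Y))
      e₁ = solve-∀
      e₂ : ∀ P Q Y X → P * (Q * Y * X) ≡ Q * (P * X * Y)
      e₂ = solve-∀

    -- With κ = p/q and z = k a/b, the bound is (1 + κ)ᵈ a (1 + (1 - z) κ / (1 + κ)).
    boxBound : ∀ d k a b → 1 ≤ a → 1 ≤ b → p ^ d ≤ k * q ^ d →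
      BoxBound d a b ((p + q) ^ d * (a * ((p + (p + q)) * b ∸ p * (k * a)))) (q ^ d * ((p + q) * b))
    boxBound d k a b 1≤a 1≤b p≤ zero xs ys _ _ = z≤n
    boxBound d k a b 1≤a 1≤b p≤ D@(suc _) xs ys Da≤ Db≤ with ≤-total ((p + (p + q)) * b) (p * (k * a))
    -- Here the bound to be shown is not positive, and truncated subtraction makes the left side 0.
    ... | inj₁ ≤P = ≤-trans (≤-reflexive (trans (cong (λ z → D * ((p + q) ^ d * (a * z))) (m≤n⇒m∸n≡0 ≤P)) (e D ((p + q) ^ d) a))) z≤n
      where
      e : ∀ D s a → D * (s * (a * 0)) ≡ 0
      e = solve-∀
    -- `box-huygens` bounds the volume below by a fraction with denominator `Y + P`. As `M` and
    -- `Y + P` add up to twice `(p + q) * b`, the inequality of the means replaces the reciprocal by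
    -- its tangent line `M`, so that a sum over parts involves only their sizes and the squares of
    -- these.
    ... | inj₂ P≤ = *-cancelʳ-≤ _ _ (Y + P) {{>-nonZero Y+P>0}} (begin
      D * (s * (a * M)) * (Y + P)                                   ≡⟨ e₁ D s a M (Y + P) ⟩
      D * s * a * (M * (Y + P))                                     ≤⟨ *-monoʳ-≤ (D * s * a) (product≤square {M} {Y + P} {(p + q) * b} sum-eq) ⟩
      D * s * a * ((p + q) * b * ((p + q) * b))                     ≡⟨ e₂ D s a (p + q) b ⟩
      (p + q) * b * ((p + q) * s * (D * (a * b)))                   ≤⟨ *-monoʳ-≤ ((p + q) * b) reduced ⟩
      (p + q) * b * (S * (q ^ suc d * b + p ^ suc d * a))           ≤⟨ *-monoʳ-≤ ((p + q) * b) (*-monoʳ-≤ S (+-monoʳ-≤ (q ^ suc d * b) p≤′)) ⟩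
      (p + q) * b * (S * (q ^ suc d * b + q ^ d * P))               ≡⟨ e₃ ((p + q) * b) S q (q ^ d) b P ⟩
      q ^ d * ((p + q) * b) * S * (Y + P)                           ∎)
      where
      open ≤-Reasoning
      s = (p + q) ^ d
      S = ∏ (xs +ⁿ ys)
      P = p * (k * a)
      Y = q * b
      M = (p + (p + q)) * b ∸ P
      e₁ : ∀ D s a M Z → D * (s * (a * M)) * Z ≡ D * s * a * (M * Z)
      e₁ = solve-∀
      e₂ : ∀ D s a r b → D * s * a * (r * b * (r * b)) ≡ r * b * (r * s * (D * (a * b)))
      e₂ = solve-∀
      e₃ : ∀ R S q Q b P → R * (S * (q * Q * b + Q * P)) ≡ Q * R * S * (q * b + P)
      e₃ = solve-∀
      Y+P>0 : 1 ≤ Y + P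
      Y+P>0 = ≤-trans (*-mono-≤ (>-nonZero⁻¹ q) 1≤b) (m≤m+n Y P)
      sum-eq : M + (Y + P) ≡ (p + q) * b + (p + q) * b
      sum-eq = trans (f M Y P) (trans (cong (_+ Y) (m∸n+n≡m P≤)) (f′ p q b))
        where
        f : ∀ M Y P → M + (Y + P) ≡ M + P + Y
        f = solve-∀
        f′ : ∀ p q b → (p + (p + q)) * b + q * b ≡ (p + q) * b + (p + q) * b
        f′ = solve-∀
      p≤′ : p ^ suc d * a ≤ q ^ d * P
      p≤′ = begin
        p * p ^ d * a            ≤⟨ *-monoˡ-≤ a (*-monoʳ-≤ p p≤) ⟩
        p * (k * q ^ d) * a      ≡⟨ f p k (q ^ d) a ⟩
        q ^ d * (p * (k * a))    ∎
        where
        f : ∀ p k Q a → p * (k * Q) * a ≡ Q * (p * (k * a))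
        f = solve-∀
      X₀ = ∏ xs
      Y₀ = ∏ ys
      XY>0 : 1 ≤ X₀ * Y₀
      XY>0 = *-mono-≤ (≤-trans (*-mono-≤ {1} {D} (s≤s z≤n) 1≤a) Da≤) (≤-trans (*-mono-≤ {1} {D} (s≤s z≤n) 1≤b) Db≤)
      reduced : (p + q) * s * (D * (a * b)) ≤ S * (q ^ suc d * b + p ^ suc d * a)
      reduced = *-cancelˡ-≤ (X₀ * Y₀) {{>-nonZero XY>0}} (begin
        X₀ * Y₀ * ((p + q) * s * (D * (a * b)))                      ≡⟨ g₁ (X₀ * Y₀) ((p + q) * s) D a b ⟩
        D * (a * b) * ((p + q) * s * (X₀ * Y₀))                      ≤⟨ *-monoʳ-≤ (D * (a * b)) (box-huygens xs ys) ⟩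
        D * (a * b) * (S * (q ^ suc d * Y₀ + p ^ suc d * X₀))        ≡⟨ g₂ D a b S (q ^ suc d) Y₀ (p ^ suc d) X₀ ⟩
        S * (q ^ suc d * b * Y₀ * (D * a) + p ^ suc d * a * X₀ * (D * b)) ≤⟨ *-monoʳ-≤ S (+-mono-≤ (*-monoʳ-≤ (q ^ suc d * b * Y₀) Da≤) (*-monoʳ-≤ (p ^ suc d * a * X₀) Db≤)) ⟩
        S * (q ^ suc d * b * Y₀ * X₀ + p ^ suc d * a * X₀ * Y₀)      ≡⟨ g₃ S (q ^ suc d) b Y₀ X₀ (p ^ suc d) a ⟩
        X₀ * Y₀ * (S * (q ^ suc d * b + p ^ suc d * a))              ∎)
        where
        g₁ : ∀ XY r D a b → XY * (r * (D * (a * b))) ≡ D * (a * b) * (r * XY)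
        g₁ = solve-∀
        g₂ : ∀ D a b S Q Y P X → D * (a * b) * (S * (Q * Y + P * X)) ≡ S * (Q * b * Y * (D * a) + P * a * X * (D * b))
        g₂ = solve-∀
        g₃ : ∀ S Q b Y X P a → S * (Q * b * Y * X + P * a * X * Y) ≡ X * Y * (S * (Q * b + P * a))
        g₃ = solve-∀

-- Growth of the largest class from level to level.

module ClassSizes where

  open import Data.List.Base using (List; []; _∷_; map; concat; length)
  open import Data.List.Properties using (map-∘; map-cong; map-id)
  open import Data.List.Membership.Propositional.Properties using (∈-map⁻; ∈-map⁺; ∈-concat⁺′)
  open import Data.Nat.Base using (ℕ; zero; suc; _+_; _*_; _^_; _∸_; _≤_; _<_; z≤n; s≤s; >-nonZero)
  open import Data.Nat.Properties
  open import Data.Nat.Tactic.RingSolver using (solve-∀)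
  open Cardinality

  sq : ℕ → ℕ
  sq x = x * x

  sq-sum≥ : ∀ zs → sum (map sq zs) ≤ sq (sum zs)
  sq-sum≥ [] = z≤n
  sq-sum≥ (z ∷ zs) = begin
    sq z + sum (map sq zs)                    ≤⟨ +-monoʳ-≤ (sq z) (sq-sum≥ zs) ⟩
    sq z + sq (sum zs)                        ≤⟨ m≤m+n _ (2 * (z * sum zs)) ⟩
    sq z + sq (sum zs) + 2 * (z * sum zs)     ≡⟨ eq z (sum zs) ⟩
    sq (z + sum zs)                           ∎
    where
    open ≤-Reasoning
    eq : ∀ z s → z * z + s * s + 2 * (z * s) ≡ (z + s) * (z + s)
    eq = solve-∀

  -- A class of size R ≤ b split into k classes of sizes at most b′; z = b′ - x are the defects of the parts.
  record Splitting (k b b′ x : ℕ) : Set where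
    field
      kb′ : k * b′ ≡ b + x
      xs  : List ℕ
      len : length xs ≡ k
      xs≤ : All (_≤ b′) xs
      δ   : ℕ
      R+δ : sum xs + δ ≡ b

  module Block (k b b′ x : ℕ) (splitting : Splitting k b b′ x) where

    open Splitting splitting

    R S T Z : ℕ
    R = sum xs
    S = sum (map sq xs)
    T = sum (map (λ a → a * (b′ ∸ a)) xs)
    Z = sum (map (λ a → b′ ∸ a) xs)

    sum-z : ∀ xs → All (_≤ b′) xs → sum xs + sum (map (λ a → b′ ∸ a) xs) ≡ length xs * b′
    sum-z [] [] = refl
    sum-z (a ∷ xs) (a≤ ∷ xs≤) = trans (eq a (sum xs) (b′ ∸ a) _) (cong₂ _+_ (m+[n∸m]≡n a≤) (sum-z xs xs≤))
      where
      eq : ∀ a s z t → a + s + (z + t) ≡ a + z + (s + t)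
      eq = solve-∀

    Z≡ : Z ≡ x + δ
    Z≡ = +-cancelˡ-≡ R Z (x + δ) (begin
      R + Z               ≡⟨ sum-z xs xs≤ ⟩
      length xs * b′      ≡⟨ cong (_* b′) len ⟩
      k * b′              ≡⟨ kb′ ⟩
      b + x               ≡⟨ cong (_+ x) R+δ ⟨
      R + δ + x           ≡⟨ eq R δ x ⟩
      R + (x + δ)         ∎)
      where
      open ≡-Reasoning
      eq : ∀ R δ x → R + δ + x ≡ R + (x + δ)
      eq = solve-∀

    S+T : S + T ≡ b′ * R
    S+T = go xs xs≤
      where
      eq : ∀ a z s t → a * a + s + (a * z + t) ≡ (a + z) * a + (s + t)
      eq = solve-∀
      go : ∀ xs → All (_≤ b′) xs → sum (map sq xs) + sum (map (λ a → a * (b′ ∸ a)) xs) ≡ b′ * sum xs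
      go [] [] = sym (*-zeroʳ b′)
      go (a ∷ xs) (a≤ ∷ xs≤) = trans (eq a (b′ ∸ a) (sum (map sq xs)) _) (trans
        (cong₂ _+_ (cong (_* a) (m+[n∸m]≡n a≤)) (go xs xs≤)) (sym (*-distribˡ-+ b′ a (sum xs))))

    b′Z≤ : b′ * Z ≤ T + sq Z
    b′Z≤ = ≤-trans (≤-reflexive (go xs xs≤)) (+-monoʳ-≤ T (≤-trans (≤-reflexive (cong sum (map-∘ xs))) (sq-sum≥ (map (λ a → b′ ∸ a) xs))))
      where
      eq : ∀ a z s t → z * (a + z) + (s + t) ≡ a * z + s + (z * z + t)
      eq = solve-∀
      go : ∀ xs → All (_≤ b′) xs → b′ * sum (map (λ a → b′ ∸ a) xs) ≡
        sum (map (λ a → a * (b′ ∸ a)) xs) + sum (map (λ a → sq (b′ ∸ a)) xs)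
      go [] [] = *-zeroʳ b′
      go (a ∷ xs) (a≤ ∷ xs≤) = trans (*-distribˡ-+ b′ (b′ ∸ a) _) (trans
        (cong₂ _+_ (trans (*-comm b′ (b′ ∸ a)) (cong ((b′ ∸ a) *_) (sym (m+[n∸m]≡n a≤)))) (go xs xs≤)) (eq a (b′ ∸ a) (sum (map (λ a → a * (b′ ∸ a)) xs)) _))

    kS≤ : k * S ≤ (b + x) * R
    kS≤ = begin
      k * S             ≤⟨ *-monoʳ-≤ k (m≤m+n S T) ⟩
      k * (S + T)       ≡⟨ cong (k *_) S+T ⟩
      k * (b′ * R)      ≡⟨ *-assoc k b′ R ⟨
      k * b′ * R        ≡⟨ cong (_* R) kb′ ⟩
      (b + x) * R       ∎
      where open ≤-Reasoning

    kT≥ : (b + x) * (x + δ) ≤ k * (T + sq (x + δ))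
    kT≥ = begin
      (b + x) * (x + δ)            ≡⟨ cong (_* (x + δ)) kb′ ⟨
      k * b′ * (x + δ)             ≡⟨ *-assoc k b′ (x + δ) ⟩
      k * (b′ * (x + δ))           ≤⟨ *-monoʳ-≤ k (subst (λ z → b′ * z ≤ T + sq z) Z≡ b′Z≤) ⟩
      k * (T + sq (x + δ))         ∎
      where open ≤-Reasoning

    -- Of `k b′ R = (b + x) R` the share `k T` does not belong to `k S`, and `kT≥` bounds it below
    -- by `(b + x) (x + δ) - k (x + δ)²`. Here `b x` cancels the surplus `x R`, because `R ≤ b`, and
    -- `b δ` is left as a gain.
    kS+bδ≤ : k * S + b * δ ≤ b * R + k * sq (x + δ)
    kS+bδ≤ = +-cancelʳ-≤ (b * x + x * x + 2 * (x * δ)) _ _ (begin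
      k * S + b * δ + (b * x + x * x + 2 * (x * δ))            ≡⟨ e₁ k S b δ x ⟩
      k * S + (b + x) * (x + δ) + x * δ                        ≤⟨ +-monoˡ-≤ (x * δ) (+-monoʳ-≤ (k * S) kT≥) ⟩
      k * S + k * (T + sq (x + δ)) + x * δ                     ≡⟨ e₂ k S T (sq (x + δ)) (x * δ) ⟩
      k * (S + T) + (k * sq (x + δ) + x * δ)                   ≡⟨ cong (λ s → k * s + (k * sq (x + δ) + x * δ)) S+T ⟩
      k * (b′ * R) + (k * sq (x + δ) + x * δ)                  ≡⟨ cong (_+ (k * sq (x + δ) + x * δ)) (trans (sym (*-assoc k b′ R)) (cong (_* R) kb′)) ⟩
      (b + x) * R + (k * sq (x + δ) + x * δ)                   ≡⟨ e₃ b x R (k * sq (x + δ)) δ ⟩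
      b * R + k * sq (x + δ) + x * (R + δ)                     ≡⟨ cong (λ c → b * R + k * sq (x + δ) + x * c) R+δ ⟩
      b * R + k * sq (x + δ) + x * b                           ≤⟨ +-monoʳ-≤ (b * R + k * sq (x + δ)) (≤-trans (≤-reflexive (*-comm x b)) (≤-trans (m≤m+n (b * x) (x * x)) (m≤m+n _ _))) ⟩
      b * R + k * sq (x + δ) + (b * x + x * x + 2 * (x * δ))   ∎)
      where
      open ≤-Reasoning
      e₁ : ∀ k S b δ x → k * S + b * δ + (b * x + x * x + 2 * (x * δ)) ≡ k * S + (b + x) * (x + δ) + x * δ
      e₁ = solve-∀
      e₂ : ∀ k S T q y → k * S + k * (T + q) + y ≡ k * (S + T) + (k * q + y)
      e₂ = solve-∀
      e₃ : ∀ b x R q δ → (b + x) * R + (q + x * δ) ≡ b * R + q + x * (R + δ)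
      e₃ = solve-∀

    R≤b : R ≤ b
    R≤b = subst (R ≤_) R+δ (m≤m+n R δ)

    -- A class with a large defect is allowed the crude surplus `x * R`, since `b < 4kδ` charges it
    -- to the weighted defect `R * δ`.
    sparse : b < 4 * k * δ → 2 * b * (k * S) ≤ 2 * b * b * R + 8 * k * x * (R * δ)
    sparse b<4kδ = begin
      2 * b * (k * S)                              ≤⟨ *-monoʳ-≤ (2 * b) kS≤ ⟩
      2 * b * ((b + x) * R)                        ≡⟨ e₁ b x R ⟩
      2 * b * b * R + 2 * (x * R) * b              ≤⟨ +-monoʳ-≤ (2 * b * b * R) (*-monoʳ-≤ (2 * (x * R)) (<⇒≤ b<4kδ)) ⟩
      2 * b * b * R + 2 * (x * R) * (4 * k * δ)    ≡⟨ e₂ (2 * b * b * R) x R k δ ⟩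
      2 * b * b * R + 8 * k * x * (R * δ)          ∎
      where
      open ≤-Reasoning
      e₁ : ∀ b x R → 2 * b * ((b + x) * R) ≡ 2 * b * b * R + 2 * (x * R) * b
      e₁ = solve-∀
      e₂ : ∀ B x R k δ → B + 2 * (x * R) * (4 * k * δ) ≡ B + 8 * k * x * (R * δ)
      e₂ = solve-∀

    -- For a nearly full class the surplus linear in `x` is gone by `kS+bδ≤` and only a square
    -- remains. Half of the gain `b * δ` absorbs the term in `δ²`, by `4kδ ≤ b`; the other half is
    -- kept.
    dense : 1 ≤ k → 4 * k * δ ≤ b → 2 * b * (k * S) + b * (R * δ) ≤ 2 * b * b * R + 8 * k * (x * x) * R
    dense 1≤k 4kδ≤b = begin
      2 * b * (k * S) + b * (R * δ)                      ≤⟨ +-monoʳ-≤ (2 * b * (k * S)) (*-monoʳ-≤ b (*-monoˡ-≤ δ R≤b)) ⟩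
      2 * b * (k * S) + b * (b * δ)                      ≡⟨ e₁ b (k * S) δ ⟩
      b * (2 * (k * S) + b * δ)                          ≤⟨ *-monoʳ-≤ b half ⟩
      b * (2 * (b * R) + 4 * k * (x * x))                ≡⟨ e₂ b R (4 * k * (x * x)) ⟩
      2 * b * b * R + 4 * k * (x * x) * b                ≤⟨ +-monoʳ-≤ (2 * b * b * R) (*-monoʳ-≤ (4 * k * (x * x)) b≤2R) ⟩
      2 * b * b * R + 4 * k * (x * x) * (2 * R)          ≡⟨ e₃ (2 * b * b * R) k (x * x) R ⟩
      2 * b * b * R + 8 * k * (x * x) * R                ∎
      where
      open ≤-Reasoning
      e₁ : ∀ b K δ → 2 * b * K + b * (b * δ) ≡ b * (2 * K + b * δ)
      e₁ = solve-∀
      e₂ : ∀ b R q → b * (2 * (b * R) + q) ≡ 2 * b * b * R + q * b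
      e₂ = solve-∀
      e₃ : ∀ B k q R → B + 4 * k * q * (2 * R) ≡ B + 8 * k * q * R
      e₃ = solve-∀
      2δ≤ : 2 * δ ≤ b
      2δ≤ = ≤-trans (≤-trans (*-monoˡ-≤ δ (≤-trans (s≤s (s≤s z≤n)) (*-monoʳ-≤ 4 1≤k))) ≤-refl) 4kδ≤b
      b≤2R : b ≤ 2 * R
      b≤2R = +-cancelʳ-≤ (2 * δ) b (2 * R) (begin
        b + 2 * δ          ≤⟨ +-monoʳ-≤ b 2δ≤ ⟩
        b + b              ≡⟨ cong₂ _+_ R+δ R+δ ⟨
        R + δ + (R + δ)    ≡⟨ f R δ ⟩
        2 * R + 2 * δ      ∎)
        where
        f : ∀ R δ → R + δ + (R + δ) ≡ 2 * R + 2 * δ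
        f = solve-∀
      square : ∀ x δ → sq (x + δ) ≤ 2 * (x * x) + 2 * (δ * δ)
      square x δ with ≤-total x δ
      ... | inj₁ p with m≤n⇒∃[o]m+o≡n p
      ...   | t , refl = ≤-trans (m≤m+n _ (t * t)) (≤-reflexive (f x t))
        where
        f : ∀ x t → (x + (x + t)) * (x + (x + t)) + t * t ≡ 2 * (x * x) + 2 * ((x + t) * (x + t))
        f = solve-∀
      square x δ | inj₂ p with m≤n⇒∃[o]m+o≡n p
      ...   | t , refl = ≤-trans (m≤m+n _ (t * t)) (≤-reflexive (f δ t))
        where
        f : ∀ x t → (x + t + x) * (x + t + x) + t * t ≡ 2 * ((x + t) * (x + t)) + 2 * (x * x)
        f = solve-∀
      half : 2 * (k * S) + b * δ ≤ 2 * (b * R) + 4 * k * (x * x)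
      half = +-cancelʳ-≤ (b * δ) _ _ (begin
        2 * (k * S) + b * δ + b * δ                                   ≡⟨ f₁ (k * S) (b * δ) ⟩
        2 * (k * S + b * δ)                                           ≤⟨ *-monoʳ-≤ 2 kS+bδ≤ ⟩
        2 * (b * R + k * sq (x + δ))                                  ≤⟨ *-monoʳ-≤ 2 (+-monoʳ-≤ (b * R) (*-monoʳ-≤ k (square x δ))) ⟩
        2 * (b * R + k * (2 * (x * x) + 2 * (δ * δ)))                 ≡⟨ f₂ b R k (x * x) δ ⟩
        2 * (b * R) + 4 * k * (x * x) + 4 * k * δ * δ                 ≤⟨ +-monoʳ-≤ (2 * (b * R) + 4 * k * (x * x)) (*-monoˡ-≤ δ 4kδ≤b) ⟩
        2 * (b * R) + 4 * k * (x * x) + b * δ                         ∎)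
        where
        f₁ : ∀ K y → 2 * K + y + y ≡ 2 * (K + y)
        f₁ = solve-∀
        f₂ : ∀ b R k q δ → 2 * (b * R + k * (2 * q + 2 * (δ * δ))) ≡ 2 * (b * R) + 4 * k * q + 4 * k * δ * δ
        f₂ = solve-∀

    module _ (1≤k : 1 ≤ k) (x≤ : 8 * (k * k) * x ≤ b) (δ≤ : 8 * (k * k) * δ ≤ b) where

      4kk≤ : 4 * (k * k) * (x + δ) ≤ b
      4kk≤ = *-cancelˡ-≤ 2 (begin
        2 * (4 * (k * k) * (x + δ))           ≡⟨ f (k * k) x δ ⟩
        8 * (k * k) * x + 8 * (k * k) * δ     ≤⟨ +-mono-≤ x≤ δ≤ ⟩
        b + b                                 ≡⟨ cong (b +_) (+-identityʳ b) ⟨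
        2 * b                                 ∎)
        where
        open ≤-Reasoning
        f : ∀ q x δ → 2 * (4 * q * (x + δ)) ≡ 8 * q * x + 8 * q * δ
        f = solve-∀

      parts-dense : ∀ {a} → a ∈ xs → 4 * k * (b′ ∸ a) ≤ b′
      parts-dense {a} a∈ = *-cancelˡ-≤ k {{>-nonZero 1≤k}} (begin
        k * (4 * k * (b′ ∸ a))       ≡⟨ f k (b′ ∸ a) ⟩
        4 * (k * k) * (b′ ∸ a)       ≤⟨ *-monoʳ-≤ (4 * (k * k)) (≤-trans (∈⇒≤sum (λ a → b′ ∸ a) a∈) (≤-reflexive Z≡)) ⟩
        4 * (k * k) * (x + δ)        ≤⟨ 4kk≤ ⟩
        b                            ≤⟨ m≤m+n b x ⟩
        b + x                        ≡⟨ kb′ ⟨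
        k * b′                       ∎)
        where
        open ≤-Reasoning
        f : ∀ k z → k * (4 * k * z) ≡ 4 * (k * k) * z
        f = solve-∀

      -- The parts lack `x + δ` elements in total. Weighting the missing elements by the part sizes
      -- gives `T` up to the square of `x + δ`, and the two smallness assumptions make that square
      -- at most half of the main term.
      defect : x * R ≤ 2 * k * T
      defect = +-cancelʳ-≤ (2 * k * sq (x + δ)) _ _ (begin
        x * R + 2 * k * sq (x + δ)              ≤⟨ +-mono-≤ (≤-trans (*-monoˡ-≤ R (m≤m+n x δ)) (*-monoʳ-≤ (x + δ) R≤b)) small ⟩
        (x + δ) * b + (x + δ) * b               ≤⟨ +-mono-≤ (*-monoʳ-≤ (x + δ) (m≤m+n b x)) (*-monoʳ-≤ (x + δ) (m≤m+n b x)) ⟩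
        (x + δ) * (b + x) + (x + δ) * (b + x)   ≡⟨ f₁ (x + δ) (b + x) ⟩
        2 * ((b + x) * (x + δ))                 ≤⟨ *-monoʳ-≤ 2 kT≥ ⟩
        2 * (k * (T + sq (x + δ)))              ≡⟨ f₂ k T (sq (x + δ)) ⟩
        2 * k * T + 2 * k * sq (x + δ)          ∎)
        where
        open ≤-Reasoning
        f₁ : ∀ y c → y * c + y * c ≡ 2 * (c * y)
        f₁ = solve-∀
        f₂ : ∀ k T q → 2 * (k * (T + q)) ≡ 2 * k * T + 2 * k * q
        f₂ = solve-∀
        f₃ : ∀ k y → 2 * k * (y * y) ≡ y * (2 * k * y)
        f₃ = solve-∀
        2k≤4kk : 2 * k ≤ 4 * (k * k)
        2k≤4kk = *-mono-≤ {2} {4} (s≤s (s≤s z≤n)) (≤-trans (≤-reflexive (sym (*-identityˡ k))) (*-monoˡ-≤ k 1≤k))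
        small : 2 * k * sq (x + δ) ≤ (x + δ) * b
        small = ≤-trans (≤-reflexive (f₃ k (x + δ))) (*-monoʳ-≤ (x + δ) (≤-trans (*-monoˡ-≤ (x + δ) 2k≤4kk) 4kk≤))

  -- blocks j lists the classes of level j, each as the list of the sizes of its parts, and b j is the size of the largest.
  record Partitions (k : ℕ) : Set where
    field
      blocks   : ℕ → List (List ℕ)
      len      : ∀ j → All (λ xs → length xs ≡ k) (blocks j)
      link     : ∀ j → map sum (blocks (suc j)) ≡ concat (blocks j)
      b        : ℕ → ℕ
      bound    : ∀ j {R} → R ∈ map sum (blocks j) → R ≤ b j
      attained : ∀ j → b j ∈ map sum (blocks j)
      b>0      : ∀ j → 1 ≤ b j

  module Levels (k : ℕ) (1≤k : 1 ≤ k) (partitions : Partitions k) where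

    open Partitions partitions

    s : ℕ → List ℕ
    s j = map sum (blocks j)

    n : ℕ
    n = sum (s 0)

    Q D : ℕ → ℕ
    Q j = sum (map sq (s j))
    D j = sum (map (λ R → R * (b j ∸ R)) (s j))

    sum-concat : ∀ (f : ℕ → ℕ) xss → sum (map f (concat xss)) ≡ sum (map (λ xs → sum (map f xs)) xss)
    sum-concat f xss = trans (cong (λ l → sum (map f (concat l))) (sym (map-id xss))) (sum-concatMap f (λ xs → xs) xss)

    sum-next : ∀ (f : ℕ → ℕ) j → sum (map f (s (suc j))) ≡ sum (map (λ xs → sum (map f xs)) (blocks j))
    sum-next f j = trans (cong (λ l → sum (map f l)) (link j)) (sum-concat f (blocks j))

    sum-this : ∀ (f : ℕ → ℕ) j → sum (map f (s j)) ≡ sum (map (λ xs → f (sum xs)) (blocks j))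
    sum-this f j = cong sum (sym (map-∘ (blocks j)))

    total : ∀ j → sum (s j) ≡ n
    total zero = refl
    total (suc j) = trans (cong sum (sym (map-id (s (suc j))))) (trans (sum-next (λ a → a) j)
      (trans (cong sum (map-cong (λ xs → cong sum (map-id xs)) (blocks j))) (total j)))

    part∈ : ∀ j {xs a} → xs ∈ blocks j → a ∈ xs → a ∈ s (suc j)
    part∈ j xs∈ a∈ = subst (_ ∈_) (sym (link j)) (∈-concat⁺′ a∈ xs∈)

    b≤kb : ∀ j → b j ≤ k * b (suc j)
    b≤kb j with ∈-map⁻ sum (attained j)
    ... | xs , xs∈ , eq = begin
      b j                     ≡⟨ eq ⟩
      sum xs                  ≤⟨ go xs (All.tabulate (λ a∈ → bound (suc j) (part∈ j xs∈ a∈))) ⟩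
      length xs * b (suc j)   ≡⟨ cong (_* b (suc j)) (All.lookup (len j) xs∈) ⟩
      k * b (suc j)           ∎
      where
      open ≤-Reasoning
      go : ∀ xs → All (_≤ b (suc j)) xs → sum xs ≤ length xs * b (suc j)
      go [] [] = z≤n
      go (x ∷ xs) (p ∷ ps) = +-mono-≤ p (go xs ps)

    x : ℕ → ℕ
    x j = k * b (suc j) ∸ b j

    kb≡ : ∀ j → k * b (suc j) ≡ b j + x j
    kb≡ j = sym (m+[n∸m]≡n (b≤kb j))

    Fail : ℕ → Set
    Fail j = b j * n < k * Q (suc j)

    module _ (j : ℕ) {xs : List ℕ} (xs∈ : xs ∈ blocks j) where
      splitting : Splitting k (b j) (b (suc j)) (x j)
      splitting = record
        { kb′ = kb≡ j
        ; xs  = xs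
        ; len = All.lookup (len j) xs∈
        ; xs≤ = All.tabulate (λ a∈ → bound (suc j) (part∈ j xs∈ a∈))
        ; δ   = b j ∸ sum xs
        ; R+δ = m+[n∸m]≡n (bound j (∈-map⁺ sum xs∈)) }

      open Block k (b j) (b (suc j)) (x j) splitting public

    Q+D : ∀ j → Q j + D j ≡ b j * n
    Q+D j = trans (go (s j) (λ p → bound j p)) (cong (b j *_) (total j))
      where
      eq : ∀ a z s t → a * a + s + (a * z + t) ≡ (a + z) * a + (s + t)
      eq = solve-∀
      go : ∀ Rs → (∀ {R} → R ∈ Rs → R ≤ b j) → sum (map sq Rs) + sum (map (λ R → R * (b j ∸ R)) Rs) ≡ b j * sum Rs
      go [] _ = sym (*-zeroʳ (b j))
      go (a ∷ Rs) le = trans (eq a (b j ∸ a) (sum (map sq Rs)) _) (trans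
        (cong₂ _+_ (cong (_* a) (m+[n∸m]≡n (le (here refl)))) (go Rs (λ p → le (there p)))) (sym (*-distribˡ-+ (b j) a (sum Rs))))

    -- `Q (suc j)` and `D (suc j)` share the total `b (suc j) * n`, so a large sum of squares leaves
    -- little room for defects: after a failure most of the set lies in classes of nearly maximal
    -- size.
    kD≤ : ∀ j → Fail j → k * D (suc j) ≤ x j * n
    kD≤ j fail = +-cancelˡ-≤ (b j * n) _ _ (begin
      b j * n + k * D (suc j)                ≤⟨ +-monoˡ-≤ (k * D (suc j)) (<⇒≤ fail) ⟩
      k * Q (suc j) + k * D (suc j)          ≡⟨ *-distribˡ-+ k (Q (suc j)) (D (suc j)) ⟨
      k * (Q (suc j) + D (suc j))            ≡⟨ cong (k *_) (Q+D (suc j)) ⟩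
      k * (b (suc j) * n)                    ≡⟨ *-assoc k (b (suc j)) n ⟨
      k * b (suc j) * n                      ≡⟨ cong (_* n) (kb≡ j) ⟩
      (b j + x j) * n                        ≡⟨ *-distribʳ-+ n (b j) (x j) ⟩
      b j * n + x j * n                      ∎)
      where open ≤-Reasoning

    Fail⇒x>0 : ∀ j → Fail j → 1 ≤ x j
    Fail⇒x>0 j fail = n≢0⇒n>0 λ x≡0 → <⇒≱ fail (begin
      k * Q (suc j)                 ≤⟨ *-monoʳ-≤ k (m≤m+n (Q (suc j)) (D (suc j))) ⟩
      k * (Q (suc j) + D (suc j))   ≡⟨ cong (k *_) (Q+D (suc j)) ⟩
      k * (b (suc j) * n)           ≡⟨ *-assoc k (b (suc j)) n ⟨
      k * b (suc j) * n             ≡⟨ cong (_* n) (trans (kb≡ j) (trans (cong (b j +_) x≡0) (+-identityʳ (b j)))) ⟩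
      b j * n                       ∎)
      where open ≤-Reasoning

    -- The weighted defect is restricted to nearly full classes, since only for them does `dense`
    -- provide the gain `b * (R * δ)`.
    w : ℕ → ℕ → ℕ
    w j R with 4 * k * (b j ∸ R) ≤? b j
    ... | yes _ = R * (b j ∸ R)
    ... | no _  = 0

    W : ℕ → ℕ
    W j = sum (map (w j) (s j))

    -- Sums `dense` over the nearly full classes and `sparse` over the others. When level `j` fails,
    -- the leading terms cancel and `W j` is controlled by the square of `x j`, up to defects.
    upper : ∀ j → 2 * b j * (k * Q (suc j)) + b j * W j ≤ 2 * b j * b j * n + (8 * k * (x j * x j) * n + 8 * k * x j * D j)
    upper j = begin
      2 * B * (k * Q (suc j)) + B * W j                       ≡⟨ cong₂ (λ p q → 2 * B * (k * p) + B * q) (sum-next sq j) (sum-this (w j) j) ⟩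
      2 * B * (k * sum (map ΣS bs)) + B * sum (map ΣW bs)     ≡⟨ cong₂ _+_ (trans (cong (2 * B *_) (sym (sum-* k ΣS bs))) (sym (sum-* (2 * B) (λ xs → k * ΣS xs) bs))) (sym (sum-* B ΣW bs)) ⟩
      sum (map (λ xs → 2 * B * (k * ΣS xs)) bs) + sum (map (λ xs → B * ΣW xs) bs)    ≡⟨ sum-+ (λ xs → 2 * B * (k * ΣS xs)) (λ xs → B * ΣW xs) bs ⟨
      sum (map (λ xs → 2 * B * (k * ΣS xs) + B * ΣW xs) bs)   ≤⟨ sum-mono _ (λ xs → 2 * B * B * sum xs + (c * sum xs + c′ * ΣD xs)) bs each ⟩
      sum (map (λ xs → 2 * B * B * sum xs + (c * sum xs + c′ * ΣD xs)) bs)   ≡⟨ sum-+ (λ xs → 2 * B * B * sum xs) (λ xs → c * sum xs + c′ * ΣD xs) bs ⟩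
      sum (map (λ xs → 2 * B * B * sum xs) bs) + sum (map (λ xs → c * sum xs + c′ * ΣD xs) bs)
        ≡⟨ cong₂ _+_ (sum-* (2 * B * B) sum bs) (trans (sum-+ (λ xs → c * sum xs) (λ xs → c′ * ΣD xs) bs) (cong₂ _+_ (sum-* c sum bs) (sum-* c′ ΣD bs))) ⟩
      2 * B * B * sum (s j) + (c * sum (s j) + c′ * sum (map ΣD bs))   ≡⟨ cong₂ (λ p q → 2 * B * B * p + (c * p + c′ * q)) (total j) (sym (sum-this (λ R → R * (B ∸ R)) j)) ⟩
      2 * B * B * n + (c * n + c′ * D j)                      ∎
      where
      open ≤-Reasoning
      B = b j
      bs = blocks j
      c = 8 * k * (x j * x j)
      c′ = 8 * k * x j
      ΣS ΣW ΣD : List ℕ → ℕ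
      ΣS xs = sum (map sq xs)
      ΣW xs = w j (sum xs)
      ΣD xs = sum xs * (B ∸ sum xs)
      each : ∀ {xs} → xs ∈ bs → 2 * B * (k * ΣS xs) + B * ΣW xs ≤ 2 * B * B * sum xs + (c * sum xs + c′ * ΣD xs)
      each {xs} xs∈ with 4 * k * (B ∸ sum xs) ≤? B
      ... | yes p = ≤-trans (dense j xs∈ 1≤k p) (+-monoʳ-≤ (2 * B * B * sum xs) (m≤m+n _ _))
      ... | no ¬p = ≤-trans (≤-reflexive (trans (cong (2 * B * (k * ΣS xs) +_) (*-zeroʳ B)) (+-identityʳ _)))
        (≤-trans (sparse j xs∈ (≰⇒> ¬p)) (+-monoʳ-≤ (2 * B * B * sum xs) (m≤n+m _ _)))

    Small : ℕ → Set
    Small j = 256 * (k * k) * x j ≤ b j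

    weaken : ∀ {c j} → c ≤ 256 * (k * k) → Small j → c * x j ≤ b j
    weaken {c} {j} c≤ small = ≤-trans (*-monoˡ-≤ (x j) c≤) small

    k≤kk : k ≤ k * k
    k≤kk = ≤-trans (≤-reflexive (sym (*-identityˡ k))) (*-monoˡ-≤ k 1≤k)

    16kx≤ : ∀ j → Small j → 16 * k * x j ≤ b (suc j)
    16kx≤ j small = *-cancelˡ-≤ k {{>-nonZero 1≤k}} (begin
      k * (16 * k * x j)             ≡⟨ f k (x j) ⟩
      16 * (k * k) * x j             ≤⟨ weaken (*-monoˡ-≤ (k * k) (m≤m+n 16 240)) small ⟩
      b j                            ≤⟨ b≤kb j ⟩
      k * b (suc j)                  ∎)
      where
      open ≤-Reasoning
      f : ∀ k x → k * (16 * k * x) ≡ 16 * (k * k) * x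
      f = solve-∀

    -- In a nearly full class the parts have a large weighted defect by `defect`, and `parts-dense`
    -- makes all of it count in `W (suc j)`. A class far from full is charged to `D j` instead.
    covering : ∀ j → Small j → b j * x j * n ≤ b j * (2 * k * W (suc j)) + 8 * (k * k) * x j * D j
    covering j small = begin
      B * X * n                                                  ≡⟨ cong (B * X *_) (total j) ⟨
      B * X * sum (s j)                                          ≡⟨ sum-* (B * X) sum bs ⟨
      sum (map (λ xs → B * X * sum xs) bs)                       ≤⟨ sum-mono _ (λ xs → c * ΣW xs + c′ * ΣD xs) bs each ⟩
      sum (map (λ xs → c * ΣW xs + c′ * ΣD xs) bs)               ≡⟨ trans (sum-+ (λ xs → c * ΣW xs) (λ xs → c′ * ΣD xs) bs) (cong₂ _+_ (sum-* c ΣW bs) (sum-* c′ ΣD bs)) ⟩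
      c * sum (map ΣW bs) + c′ * sum (map ΣD bs)                 ≡⟨ cong₂ (λ p q → c * p + c′ * q) (sum-next (w (suc j)) j) (sum-this (λ R → R * (B ∸ R)) j) ⟨
      c * W (suc j) + c′ * D j                                   ≡⟨ cong (_+ c′ * D j) (*-assoc B (2 * k) (W (suc j))) ⟩
      B * (2 * k * W (suc j)) + c′ * D j                         ∎
      where
      open ≤-Reasoning
      B = b j
      X = x j
      bs = blocks j
      c = B * (2 * k)
      c′ = 8 * (k * k) * X
      ΣW ΣD : List ℕ → ℕ
      ΣW xs = sum (map (w (suc j)) xs)
      ΣD xs = sum xs * (B ∸ sum xs)
      X≤ : 8 * (k * k) * X ≤ B
      X≤ = weaken (*-monoˡ-≤ (k * k) (m≤m+n 8 248)) small
      each : ∀ {xs} → xs ∈ bs → B * X * sum xs ≤ c * ΣW xs + c′ * ΣD xs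
      each {xs} xs∈ with 8 * (k * k) * (B ∸ sum xs) ≤? B
      ... | yes p = begin
          B * X * sum xs                         ≡⟨ *-assoc B X (sum xs) ⟩
          B * (X * sum xs)                       ≤⟨ *-monoʳ-≤ B (defect j xs∈ 1≤k X≤ p) ⟩
          B * (2 * k * T j xs∈)                  ≡⟨ *-assoc B (2 * k) (T j xs∈) ⟨
          c * T j xs∈                            ≤⟨ *-monoʳ-≤ c (sum-mono _ (w (suc j)) xs dense-part) ⟩
          c * ΣW xs                              ≤⟨ m≤m+n _ _ ⟩
          c * ΣW xs + c′ * ΣD xs                 ∎
        where
        dense-part : ∀ {a} → a ∈ xs → a * (b (suc j) ∸ a) ≤ w (suc j) a
        dense-part {a} a∈ with 4 * k * (b (suc j) ∸ a) ≤? b (suc j)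
        ... | yes _ = ≤-refl
        ... | no ¬q = contradiction (parts-dense j xs∈ 1≤k X≤ p a∈) ¬q
      ... | no ¬p = begin
          B * X * sum xs                                   ≡⟨ *-assoc B X (sum xs) ⟩
          B * (X * sum xs)                                 ≤⟨ *-monoˡ-≤ (X * sum xs) (<⇒≤ (≰⇒> ¬p)) ⟩
          8 * (k * k) * (B ∸ sum xs) * (X * sum xs)        ≡⟨ f (k * k) (B ∸ sum xs) X (sum xs) ⟩
          c′ * ΣD xs                                       ≤⟨ m≤n+m _ _ ⟩
          c * ΣW xs + c′ * ΣD xs                           ∎
        where
        f : ∀ q δ X R → 8 * q * δ * (X * R) ≡ 8 * q * X * (R * δ)
        f = solve-∀

    -- Failure at level `j` makes `D (suc j)` small by `kD≤`, so in twice the inequality `covering`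
    -- of level `suc j` the defect term is at most half of the left side and is absorbed there.
    lower : ∀ j → Fail j → Small j → Small (suc j) → x (suc j) * n ≤ 4 * k * W (suc (suc j))
    lower j fail small small′ = *-cancelˡ-≤ B {{>-nonZero (b>0 (suc j))}} (+-cancelʳ-≤ (B * X * n) _ _ (begin
      B * (X * n) + B * X * n                                       ≡⟨ f₁ B X n ⟩
      2 * (B * X * n)                                               ≤⟨ *-monoʳ-≤ 2 (covering (suc j) small′) ⟩
      2 * (B * (2 * k * V) + 8 * (k * k) * X * D (suc j))           ≡⟨ f₂ B k V X (D (suc j)) ⟩
      B * (4 * k * V) + 16 * k * X * (k * D (suc j))                ≤⟨ +-monoʳ-≤ (B * (4 * k * V)) (*-monoʳ-≤ (16 * k * X) (kD≤ j fail)) ⟩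
      B * (4 * k * V) + 16 * k * X * (x j * n)                      ≡⟨ cong (B * (4 * k * V) +_) (f₃ k X (x j) n) ⟩
      B * (4 * k * V) + 16 * k * x j * X * n                        ≤⟨ +-monoʳ-≤ (B * (4 * k * V)) (*-monoˡ-≤ n (*-monoˡ-≤ X (16kx≤ j small))) ⟩
      B * (4 * k * V) + B * X * n                                   ∎))
      where
      open ≤-Reasoning
      B = b (suc j)
      X = x (suc j)
      V = W (suc (suc j))
      f₁ : ∀ B X n → B * (X * n) + B * X * n ≡ 2 * (B * X * n)
      f₁ = solve-∀
      f₂ : ∀ B k V X D → 2 * (B * (2 * k * V) + 8 * (k * k) * X * D) ≡ B * (4 * k * V) + 16 * k * X * (k * D)
      f₂ = solve-∀
      f₃ : ∀ k X y n → 16 * k * X * (y * n) ≡ 16 * k * y * X * n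
      f₃ = solve-∀

    -- In terms of the relative growth ηⱼ = xⱼ / bⱼ, this says ηⱼ₊₁ ≤ 128 k ηⱼ₊₂².
    quadratic : ∀ j → Fail j → Fail (suc j) → Fail (suc (suc j)) → Small j → Small (suc j) → Small (suc (suc j)) →
      x (suc j) * sq (b (suc (suc j))) ≤ 128 * k * sq (x (suc (suc j))) * b (suc j)
    quadratic j fail fail′ fail″ small small′ small″ = begin
      X₁ * sq B                             ≡⟨ f₀ X₁ B ⟩
      B * X₁ * B                            ≤⟨ *-monoˡ-≤ B BX₁≤ ⟩
      64 * (k * k) * sq X * B               ≡⟨ f₁ k (sq X) B ⟩
      64 * k * sq X * (k * B)               ≡⟨ cong (64 * k * sq X *_) (kb≡ (suc j)) ⟩
      64 * k * sq X * (B₁ + X₁)             ≤⟨ *-monoʳ-≤ (64 * k * sq X) (+-monoʳ-≤ B₁ X₁≤B₁) ⟩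
      64 * k * sq X * (B₁ + B₁)             ≡⟨ f₂ k (sq X) B₁ ⟩
      128 * k * sq X * B₁                   ∎
      where
      open ≤-Reasoning
      B₁ = b (suc j)
      X₁ = x (suc j)
      B = b (suc (suc j))
      X = x (suc (suc j))
      V = W (suc (suc j))
      D₂ = D (suc (suc j))
      f₀ : ∀ X B → X * (B * B) ≡ B * X * B
      f₀ = solve-∀
      f₁ : ∀ k q B → 64 * (k * k) * q * B ≡ 64 * k * q * (k * B)
      f₁ = solve-∀
      f₂ : ∀ k q B → 64 * k * q * (B + B) ≡ 128 * k * q * B
      f₂ = solve-∀
      1≤kk : 1 ≤ k * k
      1≤kk = ≤-trans 1≤k k≤kk
      X₁≤B₁ : X₁ ≤ B₁
      X₁≤B₁ = ≤-trans (≤-reflexive (sym (*-identityˡ X₁))) (weaken {1} (≤-trans 1≤kk (m≤m+n (k * k) _)) small′)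
      0<n : 1 ≤ n
      0<n = ≤-trans (b>0 0) (≤-trans (∈⇒≤sum (λ a → a) (attained 0)) (≤-reflexive (cong sum (map-id (s 0)))))
      BV≤ : B * V ≤ 8 * k * (X * X) * n + 8 * k * X * D₂
      BV≤ = +-cancelˡ-≤ (2 * B * B * n) _ _ (≤-trans (+-monoˡ-≤ (B * V) (≤-trans (≤-reflexive (*-assoc (2 * B) B n)) (*-monoʳ-≤ (2 * B) (<⇒≤ fail″)))) (upper (suc (suc j))))
      -- The heart of the descent: the same `V` is at least linear in `X₁` by `lower`, and at most
      -- quadratic in `X` by `BV≤`, where failure at the third level was used. The remaining term in
      -- `X₁` is small and is absorbed below.
      main : B * (X₁ * n) ≤ 32 * (k * k) * sq X * n + 32 * k * X * (X₁ * n)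
      main = begin
        B * (X₁ * n)                                               ≤⟨ *-monoʳ-≤ B (lower j fail small small′) ⟩
        B * (4 * k * V)                                            ≡⟨ g₁ B k V ⟩
        4 * k * (B * V)                                            ≤⟨ *-monoʳ-≤ (4 * k) BV≤ ⟩
        4 * k * (8 * k * (X * X) * n + 8 * k * X * D₂)             ≡⟨ g₂ k X n D₂ ⟩
        32 * (k * k) * (X * X) * n + 32 * k * X * (k * D₂)         ≤⟨ +-monoʳ-≤ (32 * (k * k) * (X * X) * n) (*-monoʳ-≤ (32 * k * X) (kD≤ (suc j) fail′)) ⟩
        32 * (k * k) * sq X * n + 32 * k * X * (X₁ * n)            ∎
        where
        g₁ : ∀ B k V → B * (4 * k * V) ≡ 4 * k * (B * V)
        g₁ = solve-∀
        g₂ : ∀ k X n D → 4 * k * (8 * k * (X * X) * n + 8 * k * X * D) ≡ 32 * (k * k) * (X * X) * n + 32 * k * X * (k * D)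
        g₂ = solve-∀
      64kX≤B : 64 * k * X ≤ B
      64kX≤B = weaken (*-mono-≤ {64} (m≤m+n 64 192) k≤kk) small″
      BX₁≤ : B * X₁ ≤ 64 * (k * k) * sq X
      BX₁≤ = *-cancelʳ-≤ _ _ n {{>-nonZero 0<n}} (+-cancelʳ-≤ (64 * k * X * (X₁ * n)) _ _ (begin
        B * X₁ * n + 64 * k * X * (X₁ * n)                                         ≤⟨ +-monoʳ-≤ (B * X₁ * n) (*-monoˡ-≤ (X₁ * n) 64kX≤B) ⟩
        B * X₁ * n + B * (X₁ * n)                                                  ≡⟨ g₁ B X₁ n ⟩
        2 * (B * (X₁ * n))                                                         ≤⟨ *-monoʳ-≤ 2 main ⟩
        2 * (32 * (k * k) * sq X * n + 32 * k * X * (X₁ * n))                      ≡⟨ g₂ (k * k) (sq X) n (k * X) k X (X₁ * n) ⟩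
        64 * (k * k) * sq X * n + 64 * k * X * (X₁ * n)                            ∎))
        where
        g₁ : ∀ B X n → B * X * n + B * (X * n) ≡ 2 * (B * (X * n))
        g₁ = solve-∀
        g₂ : ∀ q X² n z k X y → 2 * (32 * q * X² * n + 32 * k * X * y) ≡ 64 * q * X² * n + 64 * k * X * y
        g₂ = solve-∀

    -- For `εⱼ = 128 k xⱼ / bⱼ` the first hypothesis says that `εⱼ` is at most the square of `εⱼ₊₁`,
    -- so a bound by a power of 1/2 passes to the preceding level with doubled exponent.
    descend : ∀ j e → x j * sq (b (suc j)) ≤ 128 * k * sq (x (suc j)) * b j →
      2 ^ e * (128 * k * x (suc j)) ≤ b (suc j) → 2 ^ (2 * e) * (128 * k * x j) ≤ b j
    descend j e quad le = *-cancelʳ-≤ _ _ (sq B′) {{>-nonZero (*-mono-≤ (b>0 (suc j)) (b>0 (suc j)))}} (begin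
      2 ^ (2 * e) * (128 * k * x j) * sq B′                          ≡⟨ cong (λ c → c * (128 * k * x j) * sq B′) (trans (cong (2 ^_) (cong (e +_) (+-identityʳ e))) (^-distribˡ-+-* 2 e e)) ⟩
      2 ^ e * 2 ^ e * (128 * k * x j) * sq B′                        ≡⟨ f₁ (2 ^ e) (128 * k) (x j) (sq B′) ⟩
      2 ^ e * 2 ^ e * (128 * k) * (x j * sq B′)                      ≤⟨ *-monoʳ-≤ (2 ^ e * 2 ^ e * (128 * k)) quad ⟩
      2 ^ e * 2 ^ e * (128 * k) * (128 * k * sq (x (suc j)) * b j)   ≡⟨ f₂ (2 ^ e) (128 * k) (x (suc j)) (b j) ⟩
      b j * sq (2 ^ e * (128 * k * x (suc j)))                       ≤⟨ *-monoʳ-≤ (b j) (*-mono-≤ le le) ⟩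
      b j * sq B′                                                    ∎)
      where
      open ≤-Reasoning
      B′ = b (suc j)
      f₁ : ∀ E c x q → E * E * (c * x) * q ≡ E * E * c * (x * q)
      f₁ = solve-∀
      f₂ : ∀ E c x b → E * E * c * (c * (x * x) * b) ≡ b * ((E * (c * x)) * (E * (c * x)))
      f₂ = solve-∀

    -- Smallness at the last level of the run gives exponent 1, and going back through the run
    -- doubles it `i` times. Failure forces `x (suc j) ≥ 1`, so `b (suc j)` would exceed `n`.
    no-long-small-run : ∀ i j → n < 2 ^ (2 ^ i) → (∀ l → j ≤ l → l ≤ j + suc i → Fail l × Small l) → ⊥
    no-long-small-run i j n< run = <⇒≱ n< (begin
      2 ^ (2 ^ i)                                  ≡⟨ *-identityʳ _ ⟨
      2 ^ (2 ^ i) * 1                              ≤⟨ *-monoʳ-≤ (2 ^ (2 ^ i)) (*-mono-≤ (≤-trans 1≤k (m≤m+n k _)) (Fail⇒x>0 (suc j) (proj₁ (run (suc j) (n≤1+n j) (≤-trans (≤-reflexive (+-comm 1 j)) (+-monoʳ-≤ j (s≤s z≤n))))))) ⟩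
      2 ^ (2 ^ i) * (128 * k * x (suc j))          ≤⟨ subst (λ m → 2 ^ (2 ^ i) * (128 * k * x (suc m)) ≤ b (suc m)) (+-identityʳ j) (go i 0 (+-identityʳ i)) ⟩
      b (suc j)                                    ≤⟨ ∈⇒≤sum (λ a → a) (attained (suc j)) ⟩
      sum (map (λ a → a) (s (suc j)))              ≡⟨ cong sum (map-id (s (suc j))) ⟩
      sum (s (suc j))                              ≡⟨ total (suc j) ⟩
      n                                            ∎)
      where
      open ≤-Reasoning
      go : ∀ m r → m + r ≡ i → 2 ^ (2 ^ m) * (128 * k * x (suc (j + r))) ≤ b (suc (j + r))
      go zero r refl = ≤-trans (≤-reflexive (f k (x (suc (j + r))))) (weaken (*-monoʳ-≤ 256 k≤kk)
          (proj₂ (run (suc (j + r)) (≤-trans (m≤m+n j r) (n≤1+n _)) (≤-reflexive (sym (+-suc j r))))))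
        where
        f : ∀ k x → 2 * (128 * k * x) ≡ 256 * k * x
        f = solve-∀
      go (suc m) r eq = descend (suc (j + r)) (2 ^ m)
        (quadratic (j + r) (proj₁ r₀) (proj₁ r₁) (proj₁ r₂) (proj₂ r₀) (proj₂ r₁) (proj₂ r₂))
        (subst (λ l → 2 ^ (2 ^ m) * (128 * k * x (suc l)) ≤ b (suc l)) (+-suc j r) (go m (suc r) (trans (+-suc m r) eq)))
        where
        r≤i : suc r ≤ i
        r≤i = subst (suc r ≤_) eq (s≤s (m≤n+m r m))
        r₀ = run (j + r) (m≤m+n j r) (+-monoʳ-≤ j (≤-trans (≤-trans (n≤1+n r) r≤i) (n≤1+n i)))
        r₁ = run (suc (j + r)) (≤-trans (m≤m+n j r) (n≤1+n _)) (≤-trans (≤-reflexive (sym (+-suc j r))) (+-monoʳ-≤ j (≤-trans r≤i (n≤1+n i))))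
        r₂ = run (suc (suc (j + r))) (≤-trans (m≤m+n j r) (≤-trans (n≤1+n _) (n≤1+n _)))
          (≤-trans (≤-reflexive (trans (cong suc (sym (+-suc j r))) (sym (+-suc j (suc r))))) (+-monoʳ-≤ j (s≤s r≤i)))

    M : ℕ
    M = 256 * (k * k)

    advance : ∀ t j → b j ≤ k ^ t * b (t + j)
    advance zero    j = ≤-reflexive (sym (+-identityʳ (b j)))
    advance (suc t) j = begin
      b j                                ≤⟨ advance t j ⟩
      k ^ t * b (t + j)                  ≤⟨ *-monoʳ-≤ (k ^ t) (b≤kb (t + j)) ⟩
      k ^ t * (k * b (suc (t + j)))      ≡⟨ f (k ^ t) k _ ⟩
      k * k ^ t * b (suc (t + j))        ∎
      where
      open ≤-Reasoning
      f : ∀ K k b → K * (k * b) ≡ k * K * b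
      f = solve-∀

    -- The normalised size `k ^ j * b j` never decreases, by `b≤kb`. A level that is not small
    -- raises it by a factor of at least `1 + 1/M`, since there `k * b (suc j) = b j + x j` with
    -- `M * x j > b j`.
    big-step : ∀ t j l → l < t → ¬ Small (l + j) → suc M * b j ≤ M * (k ^ t * b (t + j))
    big-step (suc t) j l (s≤s l≤t) ¬small with m≤n⇒m<n∨m≡n l≤t
    ... | inj₂ refl = begin
      b j + M * b j                                   ≤⟨ +-mono-≤ (advance t j) (*-monoʳ-≤ M (advance t j)) ⟩
      K * B + M * (K * B)                             ≤⟨ +-monoˡ-≤ (M * (K * B)) (*-monoʳ-≤ K (<⇒≤ (≰⇒> ¬small))) ⟩
      K * (M * x (t + j)) + M * (K * B)               ≡⟨ f M K B (x (t + j)) ⟩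
      M * (K * (B + x (t + j)))                       ≡⟨ cong (λ c → M * (K * c)) (kb≡ (t + j)) ⟨
      M * (K * (k * b (suc (t + j))))                 ≡⟨ cong (M *_) (g K k (b (suc (t + j)))) ⟩
      M * (k * K * b (suc (t + j)))                   ∎
      where
      open ≤-Reasoning
      K = k ^ t
      B = b (t + j)
      f : ∀ M K B X → K * (M * X) + M * (K * B) ≡ M * (K * (B + X))
      f = solve-∀
      g : ∀ K k b → K * (k * b) ≡ k * K * b
      g = solve-∀
    ... | inj₁ l<t = ≤-trans (big-step t j l l<t ¬small) (*-monoʳ-≤ M (begin
      k ^ t * b (t + j)                  ≤⟨ *-monoʳ-≤ (k ^ t) (b≤kb (t + j)) ⟩
      k ^ t * (k * b (suc (t + j)))      ≡⟨ f (k ^ t) k _ ⟩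
      k * k ^ t * b (suc (t + j))        ∎))
      where
      open ≤-Reasoning
      f : ∀ K k b → K * (k * b) ≡ k * K * b
      f = solve-∀

    large-in : ∀ t j → (∃[ l ] l < t × ¬ Small (l + j)) ⊎ (∀ l → l < t → Small (l + j))
    large-in zero j = inj₂ λ l ()
    large-in (suc t) j with 256 * (k * k) * x (t + j) ≤? b (t + j) | large-in t j
    ... | _     | inj₁ (l , l<t , big) = inj₁ (l , m≤n⇒m≤1+n l<t , big)
    ... | no ¬s | inj₂ _ = inj₁ (t , ≤-refl , ¬s)
    ... | yes s | inj₂ all = inj₂ λ l l<1+t → go l (m≤n⇒m<n∨m≡n (≤-pred l<1+t))
      where
      go : ∀ l → l < t ⊎ l ≡ t → Small (l + j)
      go l (inj₁ l<t)  = all l l<t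
      go l (inj₂ refl) = s

    -- Each run of i + 2 failing levels contains one at which b grows by a factor 1 + 1/M.
    growth : ∀ i N → n < 2 ^ (2 ^ i) → (∀ l → l < N * (2 + i) → Fail l) →
      suc M ^ N * b 0 ≤ M ^ N * (k ^ (N * (2 + i)) * b (N * (2 + i)))
    growth i zero    n< fails = ≤-reflexive (sym (+-identityʳ (b 0 + 0)))
    growth i (suc N) n< fails with large-in (2 + i) (N * (2 + i))
    ... | inj₂ small = ⊥-elim (no-long-small-run i J n< λ l J≤l l≤ → fails l (s≤s (≤-trans l≤ (≤-reflexive (+-comm J (suc i))))) ,
        subst Small (m∸n+n≡m J≤l) (small (l ∸ J) (s≤s (≤-trans (∸-monoˡ-≤ J l≤) (≤-reflexive (m+n∸m≡n J (suc i)))))))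
      where J = N * (2 + i)
    ... | inj₁ (l , l< , big) = begin
      suc M * suc M ^ N * b 0                                   ≡⟨ *-assoc (suc M) (suc M ^ N) (b 0) ⟩
      suc M * (suc M ^ N * b 0)                                 ≤⟨ *-monoʳ-≤ (suc M) (growth i N n< λ l l< → fails l (≤-trans l< (m≤n+m J (2 + i)))) ⟩
      suc M * (M ^ N * (k ^ J * b J))                           ≡⟨ f₁ (suc M) (M ^ N) (k ^ J) (b J) ⟩
      M ^ N * k ^ J * (suc M * b J)                             ≤⟨ *-monoʳ-≤ (M ^ N * k ^ J) (big-step (2 + i) J l l< big) ⟩
      M ^ N * k ^ J * (M * (k ^ (2 + i) * b (2 + i + J)))       ≡⟨ f₂ (M ^ N) (k ^ J) M (k ^ (2 + i)) _ ⟩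
      M * M ^ N * (k ^ (2 + i) * k ^ J * b (2 + i + J))         ≡⟨ cong (λ c → M * M ^ N * (c * b (2 + i + J))) (^-distribˡ-+-* k (2 + i) J) ⟨
      M * M ^ N * (k ^ (2 + i + J) * b (2 + i + J))             ∎
      where
      open ≤-Reasoning
      J = N * (2 + i)
      f₁ : ∀ m P K b → m * (P * (K * b)) ≡ P * K * (m * b)
      f₁ = solve-∀
      f₂ : ∀ P K m K′ b → P * K * (m * (K′ * b)) ≡ m * P * (K′ * K * b)
      f₂ = solve-∀

    1≤M : 1 ≤ M
    1≤M = *-mono-≤ {1} {256} (s≤s z≤n) (≤-trans 1≤k k≤kk)

    bernoulli : ∀ N → (N + M) * M ^ N ≤ M * suc M ^ N
    bernoulli zero    = ≤-reflexive (trans (*-identityʳ M) (sym (*-identityʳ M)))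
    bernoulli (suc N) = begin
      (suc N + M) * (M * M ^ N)                       ≤⟨ m≤m+n _ (N * M ^ N) ⟩
      (suc N + M) * (M * M ^ N) + N * M ^ N           ≡⟨ f N M (M ^ N) ⟩
      suc M * ((N + M) * M ^ N)                       ≤⟨ *-monoʳ-≤ (suc M) (bernoulli N) ⟩
      suc M * (M * suc M ^ N)                         ≡⟨ g (suc M) M (suc M ^ N) ⟩
      M * (suc M * suc M ^ N)                         ∎
      where
      open ≤-Reasoning
      f : ∀ N M P → (1 + N + M) * (M * P) + N * P ≡ (1 + M) * ((N + M) * P)
      f = solve-∀
      g : ∀ a b c → a * (b * c) ≡ b * (a * c)
      g = solve-∀

    doubling : ∀ z → 2 ^ z * M ^ (M * z) ≤ suc M ^ (M * z)
    doubling z = begin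
      2 ^ z * M ^ (M * z)             ≡⟨ cong (2 ^ z *_) (^-*-assoc M M z) ⟨
      2 ^ z * (M ^ M) ^ z             ≡⟨ ^-distribʳ-* z 2 (M ^ M) ⟨
      (2 * M ^ M) ^ z                 ≤⟨ ^-monoˡ-≤ z (*-cancelˡ-≤ M {{>-nonZero 1≤M}} base) ⟩
      (suc M ^ M) ^ z                 ≡⟨ ^-*-assoc (suc M) M z ⟩
      suc M ^ (M * z)                 ∎
      where
      open ≤-Reasoning
      ^-distribʳ-* : ∀ z a c → (a * c) ^ z ≡ a ^ z * c ^ z
      ^-distribʳ-* zero    a c = refl
      ^-distribʳ-* (suc z) a c = trans (cong (a * c *_) (^-distribʳ-* z a c)) (f a c (a ^ z) (c ^ z))
        where
        f : ∀ a c A C → a * c * (A * C) ≡ a * A * (c * C)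
        f = solve-∀
      base : M * (2 * M ^ M) ≤ M * suc M ^ M
      base = ≤-trans (≤-reflexive (f M (M ^ M))) (bernoulli M)
        where
        f : ∀ M P → M * (2 * P) ≡ (M + M) * P
        f = solve-∀

    -- The levels form `M * z` runs. By `growth` each run contributes a factor `1 + 1/M`, and by
    -- `doubling` any `M` of these factors make at least 2, so failure throughout would give
    -- `2 ^ z`.
    not-all-fail : ∀ i z → n < 2 ^ (2 ^ i) → k ^ (M * z * (2 + i)) * b (M * z * (2 + i)) < 2 ^ z * b 0 →
      ¬ (∀ l → l < M * z * (2 + i) → Fail l)
    not-all-fail i z n< slow fails = <⇒≱ slow (*-cancelˡ-≤ (M ^ (M * z)) {{m^n≢0 M (M * z) {{>-nonZero 1≤M}}}} (begin
      M ^ (M * z) * (2 ^ z * b 0)                      ≡⟨ f (M ^ (M * z)) (2 ^ z) (b 0) ⟩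
      2 ^ z * M ^ (M * z) * b 0                        ≤⟨ *-monoˡ-≤ (b 0) (doubling z) ⟩
      suc M ^ (M * z) * b 0                            ≤⟨ growth i (M * z) n< fails ⟩
      M ^ (M * z) * (k ^ (M * z * (2 + i)) * b (M * z * (2 + i)))  ∎))
      where
      open ≤-Reasoning
      f : ∀ P E b → P * (E * b) ≡ E * P * b
      f = solve-∀

-- Arithmetic of integer vectors, and a solver for their linear identities.

module Vectors where

  open import Defs using (module ℤLinear)
  open import Data.Fin.Base using (Fin; zero; suc)
  open import Data.Integer.Base using (0ℤ; 1ℤ)
  open import Data.Nat.Base using (ℕ; zero; suc)
  open import Data.Vec.Base as Vec using (Vec; []; _∷_; lookup)
  open import Data.Integer.Tactic.RingSolver using (solve-∀)
  open BoxVolumes using (0+ᵥ; +ᵥ0)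

  open ℤLinear public using (_+ᵥ_; 0ᵥ; _*ₛ_)

  -ᵥ_ : ∀ {d} → Vec ℤ d → Vec ℤ d
  -ᵥ_ = Vec.map (λ a → ℤ.- a)

  infixl 6 _-ᵥ_ _⊕_ _⊝_
  infix 8 -ᵥ_ ⊖_

  _-ᵥ_ : ∀ {d} → Vec ℤ d → Vec ℤ d → Vec ℤ d
  u -ᵥ v = u +ᵥ (-ᵥ v)

  +ᵥ-assoc : ∀ {d} (u v w : Vec ℤ d) → (u +ᵥ v) +ᵥ w ≡ u +ᵥ (v +ᵥ w)
  +ᵥ-assoc [] [] [] = refl
  +ᵥ-assoc (a ∷ u) (b ∷ v) (c ∷ w) = cong₂ _∷_ (ℤ.+-assoc a b c) (+ᵥ-assoc u v w)

  +ᵥ-comm : ∀ {d} (u v : Vec ℤ d) → u +ᵥ v ≡ v +ᵥ u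
  +ᵥ-comm [] [] = refl
  +ᵥ-comm (a ∷ u) (b ∷ v) = cong₂ _∷_ (ℤ.+-comm a b) (+ᵥ-comm u v)

  -ᵥ-inverseʳ : ∀ {d} (u : Vec ℤ d) → u -ᵥ u ≡ 0ᵥ
  -ᵥ-inverseʳ [] = refl
  -ᵥ-inverseʳ (a ∷ u) = cong₂ _∷_ (ℤ.+-inverseʳ a) (-ᵥ-inverseʳ u)

  *ₛ-zero : ∀ {d} (u : Vec ℤ d) → 0ℤ *ₛ u ≡ 0ᵥ
  *ₛ-zero [] = refl
  *ₛ-zero (a ∷ u) = cong (0ℤ ∷_) (*ₛ-zero u)

  *ₛ-one : ∀ {d} (u : Vec ℤ d) → 1ℤ *ₛ u ≡ u
  *ₛ-one [] = refl
  *ₛ-one (a ∷ u) = cong₂ _∷_ (ℤ.*-identityˡ a) (*ₛ-one u)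

  *ₛ-distribʳ : ∀ {d} b c (u : Vec ℤ d) → (b ℤ.+ c) *ₛ u ≡ (b *ₛ u) +ᵥ (c *ₛ u)
  *ₛ-distribʳ b c [] = refl
  *ₛ-distribʳ b c (a ∷ u) = cong₂ _∷_ (ℤ.*-distribʳ-+ a b c) (*ₛ-distribʳ b c u)

  *ₛ-distribˡ : ∀ {d} c (u v : Vec ℤ d) → c *ₛ (u +ᵥ v) ≡ (c *ₛ u) +ᵥ (c *ₛ v)
  *ₛ-distribˡ c [] [] = refl
  *ₛ-distribˡ c (a ∷ u) (b ∷ v) = cong₂ _∷_ (ℤ.*-distribˡ-+ c a b) (*ₛ-distribˡ c u v)

  *ₛ-neg : ∀ {d} c (u : Vec ℤ d) → (ℤ.- c) *ₛ u ≡ -ᵥ (c *ₛ u)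
  *ₛ-neg c [] = refl
  *ₛ-neg c (a ∷ u) = cong₂ _∷_ (sym (ℤ.neg-distribˡ-* c a)) (*ₛ-neg c u)

  *ₛ-assoc : ∀ {d} b c (u : Vec ℤ d) → (b ℤ.* c) *ₛ u ≡ b *ₛ (c *ₛ u)
  *ₛ-assoc b c [] = refl
  *ₛ-assoc b c (a ∷ u) = cong₂ _∷_ (ℤ.*-assoc b c a) (*ₛ-assoc b c u)

  *ₛ-0ᵥ : ∀ {d} c → c *ₛ 0ᵥ {d} ≡ 0ᵥ
  *ₛ-0ᵥ {zero}  c = refl
  *ₛ-0ᵥ {suc d} c = cong₂ _∷_ (ℤ.*-zeroʳ c) (*ₛ-0ᵥ c)

  data Expr (n : ℕ) : Set where
    var     : Fin n → Expr n
    _⊕_ _⊝_ : Expr n → Expr n → Expr n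
    ⊖_      : Expr n → Expr n
    𝟘       : Expr n

  coefs : ∀ {n} → Expr n → Vec ℤ n
  coefs (var zero)    = 1ℤ ∷ 0ᵥ
  coefs (var (suc i)) = 0ℤ ∷ coefs (var i)
  coefs (e ⊕ f)       = coefs e +ᵥ coefs f
  coefs (e ⊝ f)       = coefs e -ᵥ coefs f
  coefs (⊖ e)         = -ᵥ coefs e
  coefs 𝟘             = 0ᵥ

  module _ {d : ℕ} where

    ⟦_⟧ : ∀ {n} → Expr n → Vec (Vec ℤ d) n → Vec ℤ d
    ⟦ var i ⟧ ρ = lookup ρ i
    ⟦ e ⊕ f ⟧ ρ = ⟦ e ⟧ ρ +ᵥ ⟦ f ⟧ ρ
    ⟦ e ⊝ f ⟧ ρ = ⟦ e ⟧ ρ -ᵥ ⟦ f ⟧ ρ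
    ⟦ ⊖ e ⟧ ρ   = -ᵥ ⟦ e ⟧ ρ
    ⟦ 𝟘 ⟧ ρ     = 0ᵥ

    combination : ∀ {n} → Vec ℤ n → Vec (Vec ℤ d) n → Vec ℤ d
    combination []       []      = 0ᵥ
    combination (c ∷ cs) (x ∷ ρ) = (c *ₛ x) +ᵥ combination cs ρ

    interchange : ∀ {d} (a b c e : Vec ℤ d) → (a +ᵥ b) +ᵥ (c +ᵥ e) ≡ (a +ᵥ c) +ᵥ (b +ᵥ e)
    interchange [] [] [] [] = refl
    interchange (a ∷ u) (b ∷ v) (c ∷ w) (e ∷ z) = cong₂ _∷_ (eq a b c e) (interchange u v w z)
      where
      eq : ∀ a b c e → a ℤ.+ b ℤ.+ (c ℤ.+ e) ≡ a ℤ.+ c ℤ.+ (b ℤ.+ e)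
      eq = solve-∀

    combination-0 : ∀ {n} (ρ : Vec (Vec ℤ d) n) → combination 0ᵥ ρ ≡ 0ᵥ
    combination-0 []      = refl
    combination-0 (x ∷ ρ) = trans (cong₂ _+ᵥ_ (*ₛ-zero x) (combination-0 ρ)) (0+ᵥ 0ᵥ)

    combination-+ : ∀ {n} (cs es : Vec ℤ n) ρ → combination (cs +ᵥ es) ρ ≡ combination cs ρ +ᵥ combination es ρ
    combination-+ [] [] [] = sym (0+ᵥ 0ᵥ)
    combination-+ (c ∷ cs) (e ∷ es) (x ∷ ρ) =
      trans (cong₂ _+ᵥ_ (*ₛ-distribʳ c e x) (combination-+ cs es ρ)) (interchange _ _ _ _)

    neg-distrib : ∀ {d} (u v : Vec ℤ d) → -ᵥ (u +ᵥ v) ≡ (-ᵥ u) +ᵥ (-ᵥ v)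
    neg-distrib [] [] = refl
    neg-distrib (a ∷ u) (b ∷ v) = cong₂ _∷_ (ℤ.neg-distrib-+ a b) (neg-distrib u v)

    neg-0 : ∀ {d} → -ᵥ (0ᵥ {d}) ≡ 0ᵥ
    neg-0 {zero}  = refl
    neg-0 {suc d} = cong (0ℤ ∷_) neg-0

    combination-neg : ∀ {n} (cs : Vec ℤ n) ρ → combination (-ᵥ cs) ρ ≡ -ᵥ combination cs ρ
    combination-neg [] [] = sym neg-0
    combination-neg (c ∷ cs) (x ∷ ρ) = trans (cong₂ _+ᵥ_ (*ₛ-neg c x) (combination-neg cs ρ)) (sym (neg-distrib _ _))

    combination-coefs : ∀ {n} (e : Expr n) ρ → ⟦ e ⟧ ρ ≡ combination (coefs e) ρ
    combination-coefs (var zero) (x ∷ ρ) = sym (trans (cong₂ _+ᵥ_ (*ₛ-one x) (combination-0 ρ)) (+ᵥ0 x))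
    combination-coefs (var (suc i)) (x ∷ ρ) =
      sym (trans (cong₂ _+ᵥ_ (*ₛ-zero x) (sym (combination-coefs (var i) ρ))) (0+ᵥ _))
    combination-coefs (e ⊕ f) ρ = trans (cong₂ _+ᵥ_ (combination-coefs e ρ) (combination-coefs f ρ)) (sym (combination-+ (coefs e) (coefs f) ρ))
    combination-coefs (e ⊝ f) ρ = trans (cong₂ _-ᵥ_ (combination-coefs e ρ) (combination-coefs f ρ))
      (sym (trans (combination-+ (coefs e) (-ᵥ coefs f) ρ) (cong (combination (coefs e) ρ +ᵥ_) (combination-neg (coefs f) ρ))))
    combination-coefs (⊖ e) ρ = trans (cong -ᵥ_ (combination-coefs e ρ)) (sym (combination-neg (coefs e) ρ))
    combination-coefs 𝟘 ρ = sym (combination-0 ρ)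

    -- An expression is determined by its integer coefficients, a list of known length although the
    -- dimension `d` is a variable. An identity of vectors thereby reduces to `refl` on closed
    -- coefficients.
    vsolve : ∀ {n} (e f : Expr n) → coefs e ≡ coefs f → ∀ ρ → ⟦ e ⟧ ρ ≡ ⟦ f ⟧ ρ
    vsolve e f eq ρ = trans (combination-coefs e ρ) (trans (cong (λ c → combination c ρ) eq) (sym (combination-coefs f ρ)))

  pattern v₀ = var zero
  pattern v₁ = var (suc zero)
  pattern v₂ = var (suc (suc zero))
  pattern v₃ = var (suc (suc (suc zero)))
  pattern v₄ = var (suc (suc (suc (suc zero))))
  pattern v₅ = var (suc (suc (suc (suc (suc zero)))))
  pattern v₆ = var (suc (suc (suc (suc (suc (suc zero))))))

  module _ {d : ℕ} where

    +ᵥ-cancelˡ : ∀ (u : Vec ℤ d) {v w} → u +ᵥ v ≡ u +ᵥ w → v ≡ w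
    +ᵥ-cancelˡ u {v} {w} eq = trans (vsolve v₁ (⊖ v₀ ⊕ (v₀ ⊕ v₁)) refl (u ∷ v ∷ []))
      (trans (cong ((-ᵥ u) +ᵥ_) eq) (vsolve (⊖ v₀ ⊕ (v₀ ⊕ v₁)) v₁ refl (u ∷ w ∷ [])))

    +ᵥ-cancelʳ : ∀ (u : Vec ℤ d) {v w} → v +ᵥ u ≡ w +ᵥ u → v ≡ w
    +ᵥ-cancelʳ u {v} {w} eq = +ᵥ-cancelˡ u (trans (+ᵥ-comm u v) (trans eq (+ᵥ-comm w u)))

  record Additive {d e} (f : Vec ℤ d → Vec ℤ e) : Set where
    field
      +-homo : ∀ u v → f (u +ᵥ v) ≡ f u +ᵥ f v

    0-homo : f 0ᵥ ≡ 0ᵥ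
    0-homo = +ᵥ-cancelˡ (f 0ᵥ) (trans (sym (+-homo 0ᵥ 0ᵥ)) (trans (cong f (0+ᵥ 0ᵥ)) (sym (+ᵥ0 (f 0ᵥ)))))

    neg-homo : ∀ u → f (-ᵥ u) ≡ -ᵥ f u
    neg-homo u = +ᵥ-cancelˡ (f u) (trans (sym (+-homo u (-ᵥ u)))
      (trans (cong f (-ᵥ-inverseʳ u)) (trans 0-homo (sym (-ᵥ-inverseʳ (f u))))))

    sub-homo : ∀ u v → f (u -ᵥ v) ≡ f u -ᵥ f v
    sub-homo u v = trans (+-homo u (-ᵥ v)) (cong (f u +ᵥ_) (neg-homo v))

    ℕ-homo : ∀ n u → f ((ℤ.+ n) *ₛ u) ≡ (ℤ.+ n) *ₛ f u
    ℕ-homo zero    u = trans (cong f (*ₛ-zero u)) (trans 0-homo (sym (*ₛ-zero (f u))))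
    ℕ-homo (suc n) u = begin
      f ((ℤ.+ suc n) *ₛ u)                         ≡⟨ cong f (*ₛ-distribʳ 1ℤ (ℤ.+ n) u) ⟩
      f ((1ℤ *ₛ u) +ᵥ ((ℤ.+ n) *ₛ u))              ≡⟨ +-homo _ _ ⟩
      f (1ℤ *ₛ u) +ᵥ f ((ℤ.+ n) *ₛ u)              ≡⟨ cong₂ _+ᵥ_ (trans (cong f (*ₛ-one u)) (sym (*ₛ-one (f u)))) (ℕ-homo n u) ⟩
      (1ℤ *ₛ f u) +ᵥ ((ℤ.+ n) *ₛ f u)              ≡⟨ *ₛ-distribʳ 1ℤ (ℤ.+ n) (f u) ⟨
      (ℤ.+ suc n) *ₛ f u                           ∎
      where open ≡-Reasoning

    *-homo : ∀ c u → f (c *ₛ u) ≡ c *ₛ f u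
    *-homo (ℤ.+ n) u = ℕ-homo n u
    *-homo ℤ.-[1+ n ] u = begin
      f (ℤ.-[1+ n ] *ₛ u)           ≡⟨ cong f (*ₛ-neg (ℤ.+ suc n) u) ⟩
      f (-ᵥ ((ℤ.+ suc n) *ₛ u))       ≡⟨ neg-homo _ ⟩
      -ᵥ f ((ℤ.+ suc n) *ₛ u)         ≡⟨ cong -ᵥ_ (ℕ-homo (suc n) u) ⟩
      -ᵥ ((ℤ.+ suc n) *ₛ f u)         ≡⟨ *ₛ-neg (ℤ.+ suc n) (f u) ⟨
      ℤ.-[1+ n ] *ₛ f u             ∎
      where open ≡-Reasoning

-- The inequalities of Ruzsa, Petridis and Plünnecke, and Ruzsa's covering lemma.

module SumsetInequalities where

  open import Defs using (card; _⊞_)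
  open import Data.List.Base using (List; []; _∷_; map; filter; deduplicate; concatMap; length; cartesianProduct; cartesianProductWith; _++_)
  open import Data.List.Properties using (length-map; length-++)
  open import Data.List.Membership.Propositional.Properties
  open import Data.Nat.Base using (ℕ; zero; suc; _+_; _*_; _^_; _≤_; _<_; z≤n; s≤s; >-nonZero)
  open import Data.Nat.Properties
  open import Data.Nat.Tactic.RingSolver using (solve-∀)
  open import Data.Product.Properties using () renaming (≡-dec to ×-≡-dec)
  open import Data.Vec.Base using (Vec; []; _∷_)
  open Cardinality
  open BrunnMinkowski using (_≟ᵥ_; module VCard; ∈-⊞⁺; ∈-⊞⁻)
  open Vectors

  module _ {d : ℕ} where
    private
      V : Set
      V = Vec ℤ d

    open import Data.List.Membership.DecPropositional (_≟ᵥ_ {d}) using (_∈?_)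

    infixl 6 _⊟_

    _⊟_ : List V → List V → List V
    _⊟_ = cartesianProductWith _-ᵥ_

    ∈-⊟⁺ : ∀ {X Y : List V} {x y} → x ∈ X → y ∈ Y → (x -ᵥ y) ∈ (X ⊟ Y)
    ∈-⊟⁺ = ∈-cartesianProductWith⁺ _-ᵥ_

    ∈-⊟⁻ : ∀ (X Y : List V) {z} → z ∈ (X ⊟ Y) → ∃[ x ] ∃[ y ] x ∈ X × y ∈ Y × z ≡ x -ᵥ y
    ∈-⊟⁻ = ∈-cartesianProductWith⁻ _-ᵥ_

    card-⊞ : ∀ (X Y : List V) → card (X ⊞ Y) ≤ card X * card Y
    card-⊞ = card-productWith _≟ᵥ_ _≟ᵥ_ _≟ᵥ_ _+ᵥ_

    card-disjoint-union : ∀ {X Y S : List V} → X ⊆ S → Y ⊆ S → (∀ {z} → z ∈ X → z ∉ Y) → card X + card Y ≤ card S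
    card-disjoint-union {X} {Y} {S} X⊆ Y⊆ disj = subst (_≤ card S) (length-++ X′)
      (VCard.length≤card (Unique.++⁺ (VCard.dedup-! X) (VCard.dedup-! Y) λ (p , q) → disj (VCard.dedup⁻ X p) (VCard.dedup⁻ Y q)) sub)
      where
      X′ = deduplicate _≟ᵥ_ X
      sub : (X′ ++ deduplicate _≟ᵥ_ Y) ⊆ S
      sub p with ∈-++⁻ X′ p
      ... | inj₁ q = X⊆ (VCard.dedup⁻ X q)
      ... | inj₂ q = Y⊆ (VCard.dedup⁻ Y q)

    card-translate : ∀ (c : V) X → card (map (_+ᵥ c) X) ≡ card X
    card-translate c X = card-map _≟ᵥ_ _≟ᵥ_ (_+ᵥ c) {X} (λ _ _ → +ᵥ-cancelʳ c)

    -- Fix for every `w` in `Y ⊟ Z` one representation `w = y - z`. The pair `(x + y , x + z)`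
    -- determines `w` as the difference of its entries, hence `y`, and then `x`.
    ruzsa-triangle : ∀ (X Y Z : List V) → card X * card (Y ⊟ Z) ≤ card (X ⊞ Y) * card (X ⊞ Z)
    ruzsa-triangle X Y Z = ≤-trans
      (card-productWith-inj _≟ᵥ_ _≟ᵥ_ (×-≡-dec _≟ᵥ_ _≟ᵥ_) f into inj)
      (card-productWith _≟ᵥ_ _≟ᵥ_ (×-≡-dec _≟ᵥ_ _≟ᵥ_) _,_ (X ⊞ Y) (X ⊞ Z))
      where
      g : V × V → V
      g (y , z) = y -ᵥ z
      rep : V → V × V
      rep = pick _≟ᵥ_ g (cartesianProduct Y Z) (0ᵥ , 0ᵥ)
      f : V → V → V × V
      f x w = x +ᵥ proj₁ (rep w) , x +ᵥ proj₂ (rep w)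
      rep-∈ : ∀ {w} → w ∈ (Y ⊟ Z) → rep w ∈ cartesianProduct Y Z × g (rep w) ≡ w
      rep-∈ w∈ with ∈-⊟⁻ Y Z w∈
      ... | y , z , y∈ , z∈ , refl = pick-∈ _≟ᵥ_ g (∈-map⁺ g (∈-cartesianProduct⁺ y∈ z∈))
      into : ∀ {x w} → x ∈ X → w ∈ (Y ⊟ Z) → f x w ∈ cartesianProduct (X ⊞ Y) (X ⊞ Z)
      into x∈ w∈ = let p = ∈-cartesianProduct⁻ Y Z (proj₁ (rep-∈ w∈)) in
        ∈-cartesianProduct⁺ (∈-⊞⁺ x∈ (proj₁ p)) (∈-⊞⁺ x∈ (proj₂ p))
      diff : ∀ x w → (x +ᵥ proj₁ (rep w)) -ᵥ (x +ᵥ proj₂ (rep w)) ≡ g (rep w)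
      diff x w = vsolve ((v₀ ⊕ v₁) ⊝ (v₀ ⊕ v₂)) (v₁ ⊝ v₂) refl (x ∷ proj₁ (rep w) ∷ proj₂ (rep w) ∷ [])
      inj : ∀ {x w x′ w′} → x ∈ X → w ∈ (Y ⊟ Z) → x′ ∈ X → w′ ∈ (Y ⊟ Z) → f x w ≡ f x′ w′ → x ≡ x′ × w ≡ w′
      inj {x} {w} {x′} {w′} _ w∈ _ w∈′ eq with trans (sym (proj₂ (rep-∈ w∈))) (trans (sym (diff x w))
        (trans (cong g eq) (trans (diff x′ w′) (proj₂ (rep-∈ w∈′)))))
      ... | refl = +ᵥ-cancelʳ _ (cong proj₁ eq) , refl

    -- Petridis: if X minimises card (X ⊞ B) / card X among its subsets, then adding B to X ⊞ Z
    -- multiplies the cardinality by at most that ratio.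
    petridis : ∀ (B X : List V) → (∀ X′ → X′ ⊆ X → card (X ⊞ B) * card X′ ≤ card (X′ ⊞ B) * card X) →
      ∀ Z → card X * card ((X ⊞ B) ⊞ Z) ≤ card (X ⊞ B) * card (X ⊞ Z)
    petridis B X min [] = ≤-trans (≤-reflexive (trans (cong (card X *_) (n≤0⇒n≡0 (VCard.card≤length {xs = (X ⊞ B) ⊞ []} {[]} (λ p → ⊥-elim (none p))))) (*-zeroʳ (card X)))) z≤n
      where
      none : ∀ {z} → z ∈ ((X ⊞ B) ⊞ []) → ⊥
      none p with ∈-⊞⁻ (X ⊞ B) [] p
      ... | _ , _ , _ , () , _
    petridis B X min (c ∷ Z) = +-cancelʳ-≤ (p * card X′) _ _ (begin
      q * card ((X ⊞ B) ⊞ (c ∷ Z)) + p * card X′                   ≤⟨ +-monoʳ-≤ (q * card ((X ⊞ B) ⊞ (c ∷ Z))) (≤-trans (min X′ X′⊆) (≤-reflexive (*-comm (card (X′ ⊞ B)) q))) ⟩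
      q * card ((X ⊞ B) ⊞ (c ∷ Z)) + q * card (X′ ⊞ B)             ≡⟨ *-distribˡ-+ q _ _ ⟨
      q * (card ((X ⊞ B) ⊞ (c ∷ Z)) + card (X′ ⊞ B))               ≤⟨ *-monoʳ-≤ q upper ⟩
      q * (card ((X ⊞ B) ⊞ Z) + p)                                 ≡⟨ *-distribˡ-+ q _ p ⟩
      q * card ((X ⊞ B) ⊞ Z) + q * p                               ≤⟨ +-monoˡ-≤ (q * p) (petridis B X min Z) ⟩
      p * card (X ⊞ Z) + q * p                                     ≡⟨ eq p q _ ⟩
      p * (card (X ⊞ Z) + q)                                       ≤⟨ *-monoʳ-≤ p lower ⟩
      p * (card (X ⊞ (c ∷ Z)) + card X′)                           ≡⟨ *-distribˡ-+ p _ _ ⟩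
      p * card (X ⊞ (c ∷ Z)) + p * card X′                         ∎)
      where
      open ≤-Reasoning
      p = card (X ⊞ B)
      q = card X
      eq : ∀ p q z → p * z + q * p ≡ p * (z + q)
      eq = solve-∀
      -- Such `x` yield nothing new when `c` is adjoined. New elements of `(X ⊞ B) ⊞ (c ∷ Z)` come
      -- from outside `X′ ⊞ B`, while every `x` outside `X′` yields a new element `x + c` of
      -- `X ⊞ (c ∷ Z)`; minimality against `X′` balances the two counts.
      Old : V → Set
      Old x = All (λ b → ((x +ᵥ b) +ᵥ c) ∈ ((X ⊞ B) ⊞ Z)) B
      old? : ∀ x → Dec (Old x)
      old? x = All.all? (λ b → ((x +ᵥ b) +ᵥ c) ∈? ((X ⊞ B) ⊞ Z)) B
      X′ = filter old? X
      X′⊆ : X′ ⊆ X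
      X′⊆ z∈ = proj₁ (∈-filter⁻ old? z∈)
      mono-Z : ∀ (W : List V) → (W ⊞ Z) ⊆ (W ⊞ (c ∷ Z))
      mono-Z W z∈ with ∈-⊞⁻ W Z z∈
      ... | _ , _ , w∈ , z∈′ , refl = ∈-⊞⁺ w∈ (there z∈′)
      N = filter (λ w → ¬? (w ∈? (X′ ⊞ B))) (X ⊞ B)
      upper : card ((X ⊞ B) ⊞ (c ∷ Z)) + card (X′ ⊞ B) ≤ card ((X ⊞ B) ⊞ Z) + p
      upper = begin
        card ((X ⊞ B) ⊞ (c ∷ Z)) + card (X′ ⊞ B)                       ≤⟨ +-monoˡ-≤ (card (X′ ⊞ B)) (VCard.card-mono cover) ⟩
        card (((X ⊞ B) ⊞ Z) ++ map (_+ᵥ c) N) + card (X′ ⊞ B)          ≤⟨ +-monoˡ-≤ (card (X′ ⊞ B)) (VCard.card-++ ((X ⊞ B) ⊞ Z) (map (_+ᵥ c) N)) ⟩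
        card ((X ⊞ B) ⊞ Z) + card (map (_+ᵥ c) N) + card (X′ ⊞ B)      ≡⟨ cong (λ m → card ((X ⊞ B) ⊞ Z) + m + card (X′ ⊞ B)) (card-translate c N) ⟩
        card ((X ⊞ B) ⊞ Z) + card N + card (X′ ⊞ B)                    ≡⟨ +-assoc (card ((X ⊞ B) ⊞ Z)) (card N) _ ⟩
        card ((X ⊞ B) ⊞ Z) + (card N + card (X′ ⊞ B))                  ≤⟨ +-monoʳ-≤ (card ((X ⊞ B) ⊞ Z)) (card-disjoint-union (λ r → proj₁ (∈-filter⁻ _ {xs = X ⊞ B} r)) X′B⊆ (λ r → proj₂ (∈-filter⁻ _ {xs = X ⊞ B} r))) ⟩
        card ((X ⊞ B) ⊞ Z) + p                                         ∎
        where
        X′B⊆ : (X′ ⊞ B) ⊆ (X ⊞ B)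
        X′B⊆ r with ∈-⊞⁻ X′ B r
        ... | _ , _ , x∈ , b∈ , refl = ∈-⊞⁺ (X′⊆ x∈) b∈
        cover : ((X ⊞ B) ⊞ (c ∷ Z)) ⊆ (((X ⊞ B) ⊞ Z) ++ map (_+ᵥ c) N)
        cover r with ∈-⊞⁻ (X ⊞ B) (c ∷ Z) r
        ... | w , _ , w∈ , there z∈ , refl = ∈-++⁺ˡ (∈-⊞⁺ w∈ z∈)
        ... | w , _ , w∈ , here refl , refl with w ∈? (X′ ⊞ B)
        ...   | no w∉ = ∈-++⁺ʳ ((X ⊞ B) ⊞ Z) (∈-map⁺ (_+ᵥ c) (∈-filter⁺ _ w∈ w∉))
        ...   | yes w∈′ with ∈-⊞⁻ X′ B w∈′
        ...     | x , b , x∈ , b∈ , refl = ∈-++⁺ˡ (All.lookup (proj₂ (∈-filter⁻ old? {xs = X} x∈)) b∈)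
      N′ = filter (λ x → ¬? (old? x)) X
      lower : card (X ⊞ Z) + q ≤ card (X ⊞ (c ∷ Z)) + card X′
      lower = begin
        card (X ⊞ Z) + q                                           ≤⟨ +-monoʳ-≤ (card (X ⊞ Z)) (≤-trans (VCard.card-mono X⊆) (VCard.card-++ N′ X′)) ⟩
        card (X ⊞ Z) + (card N′ + card X′)                         ≡⟨ +-assoc (card (X ⊞ Z)) (card N′) (card X′) ⟨
        card (X ⊞ Z) + card N′ + card X′                           ≡⟨ cong (λ m → card (X ⊞ Z) + m + card X′) (card-translate c N′) ⟨
        card (X ⊞ Z) + card (map (_+ᵥ c) N′) + card X′             ≤⟨ +-monoˡ-≤ (card X′) (card-disjoint-union (mono-Z X) N′⊆ apart) ⟩
        card (X ⊞ (c ∷ Z)) + card X′                               ∎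
        where
        X⊆ : X ⊆ (N′ ++ X′)
        X⊆ {x} x∈ with old? x
        ... | yes o = ∈-++⁺ʳ N′ (∈-filter⁺ old? x∈ o)
        ... | no ¬o = ∈-++⁺ˡ (∈-filter⁺ _ x∈ ¬o)
        N′⊆ : map (_+ᵥ c) N′ ⊆ (X ⊞ (c ∷ Z))
        N′⊆ r with ∈-map⁻ (_+ᵥ c) r
        ... | x , x∈ , refl = ∈-⊞⁺ (proj₁ (∈-filter⁻ _ {xs = X} x∈)) (here refl)
        apart : ∀ {z} → z ∈ (X ⊞ Z) → z ∉ map (_+ᵥ c) N′
        apart r r′ with ∈-⊞⁻ X Z r | ∈-map⁻ (_+ᵥ c) r′
        ... | x₁ , z₁ , x₁∈ , z₁∈ , refl | x , x∈ , eq′ = proj₂ (∈-filter⁻ _ {xs = X} x∈) (All.tabulate λ {b} b∈ →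
            subst (_∈ ((X ⊞ B) ⊞ Z)) (shift b) (∈-⊞⁺ (∈-⊞⁺ x₁∈ b∈) z₁∈))
          where
          shift : ∀ b → (x₁ +ᵥ b) +ᵥ z₁ ≡ (x +ᵥ b) +ᵥ c
          shift b = trans (vsolve ((v₀ ⊕ v₁) ⊕ v₂) ((v₀ ⊕ v₂) ⊕ v₁) refl (x₁ ∷ b ∷ z₁ ∷ []))
            (trans (cong (_+ᵥ b) eq′) (vsolve ((v₀ ⊕ v₂) ⊕ v₁) ((v₀ ⊕ v₁) ⊕ v₂) refl (x ∷ b ∷ c ∷ [])))

    -- Descends along subsets instead of searching among them: a subset that violates minimality has
    -- a smaller ratio, and then also a strictly smaller sumset with `B`, so `card (A ⊞ B)` bounds
    -- the number of steps.
    minimiser : ∀ (A B : List V) → (∀ X → 1 ≤ card X → X ⊆ A → card (X ⊞ B) * card A ≤ card (A ⊞ B) * card X →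
      (∀ X′ → X′ ⊆ X → card (X ⊞ B) * card X′ ≤ card (X′ ⊞ B) * card X) → ⊥) → 1 ≤ card A → ⊥
    minimiser A B no-min 1≤A = go (suc (card (A ⊞ B))) A ≤-refl 1≤A (λ p → p) ≤-refl
      where
      go : ∀ m X → card (X ⊞ B) < m → 1 ≤ card X → X ⊆ A → card (X ⊞ B) * card A ≤ card (A ⊞ B) * card X → ⊥
      go (suc m) X (s≤s p≤m) 1≤X X⊆ ratio = no-min X 1≤X X⊆ ratio λ X′ X′⊆ →
        decidable-stable (card (X ⊞ B) * card X′ ≤? card (X′ ⊞ B) * card X) λ ¬le → smaller X′ X′⊆ (≰⇒> ¬le)
        where
        smaller : ∀ X′ → X′ ⊆ X → card (X′ ⊞ B) * card X < card (X ⊞ B) * card X′ → ⊥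
        smaller X′ X′⊆ lt = go m X′ (<-≤-trans p′<p p≤m) 1≤X′ (λ r → X⊆ (X′⊆ r)) ratio′
          where
          open ≤-Reasoning
          p = card (X ⊞ B)
          q = card X
          p′ = card (X′ ⊞ B)
          q′ = card X′
          q′≤q : q′ ≤ q
          q′≤q = VCard.card-mono X′⊆
          p′<p : p′ < p
          p′<p = *-cancelʳ-< q p′ p (<-≤-trans lt (*-monoʳ-≤ p q′≤q))
          1≤X′ : 1 ≤ q′
          1≤X′ = n≢0⇒n>0 λ q′≡0 → n≮0 (subst (p′ * q <_) (trans (cong (p *_) q′≡0) (*-zeroʳ p)) lt)
          ratio′ : p′ * card A ≤ card (A ⊞ B) * q′
          ratio′ = *-cancelʳ-≤ _ _ q {{>-nonZero 1≤X}} (begin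
            p′ * card A * q             ≡⟨ f p′ (card A) q ⟩
            p′ * q * card A             ≤⟨ *-monoˡ-≤ (card A) (<⇒≤ lt) ⟩
            p * q′ * card A             ≡⟨ f p q′ (card A) ⟩
            p * card A * q′             ≤⟨ *-monoˡ-≤ q′ ratio ⟩
            card (A ⊞ B) * q * q′       ≡⟨ f (card (A ⊞ B)) q q′ ⟩
            card (A ⊞ B) * q′ * q       ∎)
            where
            f : ∀ a b c → a * b * c ≡ a * c * b
            f = solve-∀

    _⊠_ : ℕ → List V → List V
    zero  ⊠ B = 0ᵥ ∷ []
    suc h ⊠ B = B ⊞ (h ⊠ B)

    -- For a minimising `X ⊆ A`, Petridis' inequality gives `card (X ⊞ (h ⊠ B)) ≤ C ^ h * card X` by
    -- adding one copy of `B` at a time. The triangle inequality through `X` then joins the two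
    -- multiples.
    plünnecke : ∀ (A B : List V) C → 1 ≤ card A → card (A ⊞ B) ≤ C * card A →
      ∀ h h′ → card ((h ⊠ B) ⊟ (h′ ⊠ B)) ≤ C ^ (h + h′) * card A
    plünnecke A B C 1≤A small h h′ = decidable-stable (card ((h ⊠ B) ⊟ (h′ ⊠ B)) ≤? C ^ (h + h′) * card A) λ ¬le → minimiser A B (λ X 1≤X X⊆ ratio min → ¬le (bound X 1≤X X⊆ ratio min)) 1≤A
      where
      open ≤-Reasoning
      bound : ∀ X → 1 ≤ card X → X ⊆ A → card (X ⊞ B) * card A ≤ card (A ⊞ B) * card X →
        (∀ X′ → X′ ⊆ X → card (X ⊞ B) * card X′ ≤ card (X′ ⊞ B) * card X) → card ((h ⊠ B) ⊟ (h′ ⊠ B)) ≤ C ^ (h + h′) * card A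
      bound X 1≤X X⊆ ratio min = *-cancelˡ-≤ (card X) {{>-nonZero 1≤X}} (begin
        card X * card ((h ⊠ B) ⊟ (h′ ⊠ B))               ≤⟨ ruzsa-triangle X (h ⊠ B) (h′ ⊠ B) ⟩
        card (X ⊞ (h ⊠ B)) * card (X ⊞ (h′ ⊠ B))         ≤⟨ *-mono-≤ (iterate h) (iterate h′) ⟩
        C ^ h * card X * (C ^ h′ * card X)               ≡⟨ f (C ^ h) (C ^ h′) (card X) ⟩
        card X * (C ^ h * C ^ h′ * card X)               ≡⟨ cong (λ c → card X * (c * card X)) (^-distribˡ-+-* C h h′) ⟨
        card X * (C ^ (h + h′) * card X)                 ≤⟨ *-monoʳ-≤ (card X) (*-monoʳ-≤ (C ^ (h + h′)) (VCard.card-mono X⊆)) ⟩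
        card X * (C ^ (h + h′) * card A)                 ∎)
        where
        f : ∀ a b x → a * x * (b * x) ≡ x * (a * b * x)
        f = solve-∀
        p≤ : card (X ⊞ B) ≤ C * card X
        p≤ = *-cancelʳ-≤ _ _ (card A) {{>-nonZero 1≤A}} (≤-trans ratio (≤-trans (*-monoˡ-≤ (card X) small) (≤-reflexive (g C (card A) (card X)))))
          where
          g : ∀ c a x → c * a * x ≡ c * x * a
          g = solve-∀
        step : ∀ Z → card ((X ⊞ B) ⊞ Z) ≤ C * card (X ⊞ Z)
        step Z = *-cancelˡ-≤ (card X) {{>-nonZero 1≤X}} (≤-trans (petridis B X min Z) (≤-trans (*-monoˡ-≤ (card (X ⊞ Z)) p≤) (≤-reflexive (g C (card X) (card (X ⊞ Z))))))
          where
          g : ∀ c a x → c * a * x ≡ a * (c * x)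
          g = solve-∀
        iterate : ∀ h → card (X ⊞ (h ⊠ B)) ≤ C ^ h * card X
        iterate zero = ≤-trans (card-⊞ X (0ᵥ ∷ [])) (≤-reflexive (*-comm (card X) 1))
        iterate (suc h) = begin
          card (X ⊞ (B ⊞ (h ⊠ B)))      ≤⟨ VCard.card-mono assoc ⟩
          card ((X ⊞ B) ⊞ (h ⊠ B))      ≤⟨ step (h ⊠ B) ⟩
          C * card (X ⊞ (h ⊠ B))        ≤⟨ *-monoʳ-≤ C (iterate h) ⟩
          C * (C ^ h * card X)          ≡⟨ *-assoc C (C ^ h) (card X) ⟨
          C * C ^ h * card X            ∎
          where
          assoc : (X ⊞ (B ⊞ (h ⊠ B))) ⊆ ((X ⊞ B) ⊞ (h ⊠ B))
          assoc r with ∈-⊞⁻ X (B ⊞ (h ⊠ B)) r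
          ... | x , _ , x∈ , r′ , refl with ∈-⊞⁻ B (h ⊠ B) r′
          ...   | b , c , b∈ , c∈ , refl = subst (_∈ _) (+ᵥ-assoc x b c) (∈-⊞⁺ (∈-⊞⁺ x∈ b∈) c∈)

    -- Take a maximal set of `x ∈ S` with pairwise disjoint translates `x + T`. Disjointness bounds
    -- its length, and maximality puts every `s` into some `x + (T - T)`.
    covering : ∀ S T C {t} → t ∈ T → card (S ⊞ T) ≤ C * card T →
      ∃[ X ] length X ≤ C × X ⊆ S × (∀ {s} → s ∈ S → s ∈ (X ⊞ (T ⊟ T)))
    covering S T C {t} t∈ small with greedy S
      where
      Apart : V → V → Set
      Apart x y = ∀ a a′ → a ∈ T → a′ ∈ T → x +ᵥ a ≢ y +ᵥ a′
      greedy : ∀ S → ∃[ X ] AllPairs Apart X × X ⊆ S × (∀ {s} → s ∈ S → s ∈ (X ⊞ (T ⊟ T)))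
      greedy [] = [] , [] , (λ ()) , λ ()
      greedy (s ∷ S) with greedy S
      ... | X , apart , X⊆ , cover with s ∈? (X ⊞ (T ⊟ T))
      ...   | yes s∈ = X , apart , (λ r → there (X⊆ r)) , λ { (here refl) → s∈ ; (there r) → cover r }
      ...   | no s∉ = s ∷ X , All.tabulate new ∷ apart , (λ { (here refl) → here refl ; (there r) → there (X⊆ r) }) , λ
          { (here refl) → subst (_∈ _) (vsolve (v₀ ⊕ (v₁ ⊝ v₁)) v₀ refl (s ∷ t ∷ [])) (∈-⊞⁺ {X = s ∷ X} (here refl) (∈-⊟⁺ t∈ t∈))
          ; (there r) → there′ (cover r) }
        where
        there′ : ∀ {z} → z ∈ (X ⊞ (T ⊟ T)) → z ∈ ((s ∷ X) ⊞ (T ⊟ T))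
        there′ r with ∈-⊞⁻ X (T ⊟ T) r
        ... | x , w , x∈ , w∈ , refl = ∈-⊞⁺ {X = s ∷ X} (there x∈) w∈
        new : ∀ {x} → x ∈ X → Apart s x
        new {x} x∈ a a′ a∈ a∈′ eq = s∉ (subst (_∈ (X ⊞ (T ⊟ T))) (begin
            x +ᵥ (a′ -ᵥ a)          ≡⟨ vsolve (v₀ ⊕ (v₁ ⊝ v₂)) ((v₀ ⊕ v₁) ⊝ v₂) refl (x ∷ a′ ∷ a ∷ []) ⟩
            (x +ᵥ a′) -ᵥ a          ≡⟨ cong (_-ᵥ a) eq ⟨
            (s +ᵥ a) -ᵥ a           ≡⟨ vsolve ((v₀ ⊕ v₁) ⊝ v₁) v₀ refl (s ∷ a ∷ []) ⟩
            s                       ∎) (∈-⊞⁺ x∈ (∈-⊟⁺ a∈′ a∈)))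
          where open ≡-Reasoning
    ... | X , apart , X⊆ , cover = X , *-cancelʳ-≤ _ _ (card T) {{>-nonZero (VCard.card>0 t∈)}} (≤-trans counted small) , X⊆ , cover
      where
      T′ = deduplicate _≟ᵥ_ T
      open ≤-Reasoning
      blocks : ∀ X → AllPairs (λ x y → ∀ a a′ → a ∈ T → a′ ∈ T → x +ᵥ a ≢ y +ᵥ a′) X → X ⊆ S → length X * card T ≤ card (S ⊞ T)
      blocks X apart X⊆ = ≤-trans (≤-reflexive (len X)) (VCard.length≤card (uniq X apart) (sub X X⊆))
        where
        D : List V → List V
        D = concatMap (λ x → map (x +ᵥ_) T′)
        len : ∀ X → length X * card T ≡ length (D X)
        len [] = refl
        len (x ∷ X) = trans (cong₂ _+_ (sym (length-map (x +ᵥ_) T′)) (len X)) (sym (length-++ (map (x +ᵥ_) T′)))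
        sub : ∀ X → X ⊆ S → D X ⊆ (S ⊞ T)
        sub (x ∷ X) X⊆ r with ∈-++⁻ (map (x +ᵥ_) T′) r
        ... | inj₂ r′ = sub X (λ q → X⊆ (there q)) r′
        ... | inj₁ r′ with ∈-map⁻ (x +ᵥ_) r′
        ...   | a , a∈ , refl = ∈-⊞⁺ (X⊆ (here refl)) (VCard.dedup⁻ T a∈)
        away : ∀ x X {z} → All (λ y → ∀ a a′ → a ∈ T → a′ ∈ T → x +ᵥ a ≢ y +ᵥ a′) X → z ∈ map (x +ᵥ_) T′ → z ∉ D X
        away x (y ∷ X) (p ∷ ps) r r′ with ∈-++⁻ (map (y +ᵥ_) T′) r′
        ... | inj₂ r″ = away x X ps r r″
        ... | inj₁ r″ with ∈-map⁻ (x +ᵥ_) r | ∈-map⁻ (y +ᵥ_) r″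
        ...   | a , a∈ , eq | a′ , a∈′ , eq′ = p a a′ (VCard.dedup⁻ T a∈) (VCard.dedup⁻ T a∈′) (trans (sym eq) eq′)
        uniq : ∀ X → AllPairs (λ x y → ∀ a a′ → a ∈ T → a′ ∈ T → x +ᵥ a ≢ y +ᵥ a′) X → Unique (D X)
        uniq [] [] = []
        uniq (x ∷ X) (p ∷ ps) = Unique.++⁺ (Unique.map⁺ (+ᵥ-cancelˡ x) (VCard.dedup-! T)) (uniq X ps) λ (r , r′) → away x X p r r′
      counted : length X * card T ≤ card (S ⊞ T)
      counted = blocks X apart X⊆

-- Consequences of small doubling: covers, balls and short vectors.

module DoublingConsequences where

  open import Defs using (card; _⊞_)
  open import Data.List.Base using (List; []; _∷_; map; filter; length; cartesianProduct; upTo; _++_)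
  open import Data.List.Properties using (length-map; length-upTo)
  open import Data.List.Membership.Propositional.Properties
  open import Data.Nat.Base using (ℕ; zero; suc; _+_; _*_; _^_; _≤_; _<_; z≤n; s≤s)
  open import Data.Nat.Properties
  open import Data.Nat.Tactic.RingSolver using (solve-∀)
  open import Data.Vec.Base using (Vec; []; _∷_)
  open Cardinality
  open BrunnMinkowski using (_≟ᵥ_; module VCard; ∈-⊞⁺; ∈-⊞⁻)
  open Vectors
  open SumsetInequalities
  open BoxVolumes using (0+ᵥ; +ᵥ0)

  iter : ∀ {A : Set} → (A → A) → ℕ → A → A
  iter g zero    v = v
  iter g (suc i) v = iter g i (g v)

  iter-suc : ∀ {A : Set} (g : A → A) i v → iter g (suc i) v ≡ g (iter g i v)
  iter-suc g zero    v = refl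
  iter-suc g (suc i) v = iter-suc g i (g v)

  iter-+ : ∀ {A : Set} (g : A → A) i j v → iter g (i + j) v ≡ iter g i (iter g j v)
  iter-+ g zero    j v = refl
  iter-+ g (suc i) j v = trans (iter-+ g i j (g v)) (cong (iter g i) (iter-suc g j v))

  iter-Additive : ∀ {d} {g : Vec ℤ d → Vec ℤ d} → Additive g → ∀ i → Additive (iter g i)
  iter-Additive add zero    = record { +-homo = λ _ _ → refl }
  iter-Additive {g = g} add (suc i) = record { +-homo = λ u v →
    trans (cong (iter g i) (Additive.+-homo add u v)) (Additive.+-homo (iter-Additive add i) (g u) (g v)) }

  iter-injective : ∀ {A : Set} {g : A → A} → (∀ {u v} → g u ≡ g v → u ≡ v) → ∀ i {u v} → iter g i u ≡ iter g i v → u ≡ v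
  iter-injective inj zero    eq = eq
  iter-injective inj (suc i) eq = inj (iter-injective inj i eq)

  double : ∀ {d} → Vec ℤ d → Vec ℤ d
  double v = v +ᵥ v

  double-Additive : ∀ {d} → Additive (double {d})
  double-Additive = record { +-homo = λ u v → vsolve ((v₀ ⊕ v₁) ⊕ (v₀ ⊕ v₁)) ((v₀ ⊕ v₀) ⊕ (v₁ ⊕ v₁)) refl (u ∷ v ∷ []) }

  module _ {d : ℕ} where
    private
      V : Set
      V = Vec ℤ d

    multiples : ℕ → V → List V
    multiples t x = map (λ c → (ℤ.+ c) *ₛ x) (upTo (suc t))

    -- A generalised arithmetic progression with generators `X` and coefficients from 0 to `t`. For
    -- fixed `X` its length is polynomial in `t`.
    box : ℕ → List V → List V
    box t []      = 0ᵥ ∷ []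
    box t (x ∷ X) = multiples t x ⊞ box t X

    ∈-multiples : ∀ {c t x} → c ≤ t → ((ℤ.+ c) *ₛ x) ∈ multiples t x
    ∈-multiples c≤t = ∈-map⁺ _ (∈-upTo⁺ (s≤s c≤t))

    ∈-multiples⁻ : ∀ {t x z} → z ∈ multiples t x → ∃[ c ] c ≤ t × z ≡ (ℤ.+ c) *ₛ x
    ∈-multiples⁻ z∈ with ∈-map⁻ _ z∈
    ... | c , c∈ , refl = c , ≤-pred (∈-upTo⁻ c∈) , refl

    length-box : ∀ t X → length (box t X) ≡ suc t ^ length X
    length-box t [] = refl
    length-box t (x ∷ X) = trans (length-cartesianProductWith _+ᵥ_ (multiples t x) (box t X))
      (cong₂ _*_ (trans (length-map _ (upTo (suc t))) (length-upTo (suc t))) (length-box t X))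

    0∈box : ∀ t X → 0ᵥ ∈ box t X
    0∈box t [] = here refl
    0∈box t (x ∷ X) = subst (_∈ box t (x ∷ X)) (trans (cong (_+ᵥ 0ᵥ) (*ₛ-zero x)) (0+ᵥ 0ᵥ))
      (∈-⊞⁺ {X = multiples t x} {box t X} (∈-multiples {0} z≤n) (0∈box t X))

    box-suc : ∀ {t} X → box t X ⊆ box (suc t) X
    box-suc [] u∈ = u∈
    box-suc {t} (x ∷ X) u∈ with ∈-⊞⁻ (multiples t x) (box t X) u∈
    ... | _ , b , a∈ , b∈ , refl with ∈-multiples⁻ a∈
    ...   | c , c≤ , refl = ∈-⊞⁺ {X = multiples (suc t) x} {box (suc t) X} (∈-multiples (m≤n⇒m≤1+n c≤)) (box-suc X b∈)

    box-mono : ∀ {t t′} X → t ≤ t′ → box t X ⊆ box t′ X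
    box-mono {t} X t≤ {u} u∈ with m≤n⇒∃[o]m+o≡n t≤
    ... | o , refl = subst (λ s → u ∈ box s X) (+-comm o t) (go o)
      where
      go : ∀ o → u ∈ box (o + t) X
      go zero    = u∈
      go (suc o) = box-suc X (go o)

    box-+ : ∀ {t u x} X → u ∈ box t X → x ∈ X → (u +ᵥ x) ∈ box (suc t) X
    box-+ {t} (y ∷ X) u∈ x∈ with ∈-⊞⁻ (multiples t y) (box t X) u∈
    ... | _ , b , a∈ , b∈ , refl with ∈-multiples⁻ a∈
    box-+ {t} (y ∷ X) u∈ (here refl) | _ , b , a∈ , b∈ , refl | c , c≤ , refl = subst (_∈ box (suc t) (y ∷ X))
      (trans (cong (_+ᵥ b) (trans (*ₛ-distribʳ ℤ.1ℤ (ℤ.+ c) y) (cong (_+ᵥ ((ℤ.+ c) *ₛ y)) (*ₛ-one y))))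
        (vsolve ((v₀ ⊕ v₁) ⊕ v₂) ((v₁ ⊕ v₂) ⊕ v₀) refl (y ∷ ((ℤ.+ c) *ₛ y) ∷ b ∷ [])))
      (∈-⊞⁺ {X = multiples (suc t) y} {box (suc t) X} (∈-multiples {suc c} (s≤s c≤)) (box-suc X b∈))
    box-+ {t} {x = x} (y ∷ X) u∈ (there x∈) | _ , b , a∈ , b∈ , refl | c , c≤ , refl =
      subst (_∈ box (suc t) (y ∷ X)) (sym (+ᵥ-assoc _ b x)) (∈-⊞⁺ {X = multiples (suc t) y} {box (suc t) X} (∈-multiples (m≤n⇒m≤1+n c≤)) (box-+ X b∈ x∈))

    pigeonhole : ∀ (code : V → V) X M U → (∀ {p} → p ∈ U → code p ∈ X) → length X * M < card U →
      ∃[ c ] M < card (filter (λ p → code p ≟ᵥ c) U)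
    pigeonhole code [] M (p ∷ U) in-X lt with in-X (here refl)
    ... | ()
    pigeonhole code (c ∷ X) M U in-X lt with M <? card (filter (λ p → code p ≟ᵥ c) U)
    ... | yes M< = c , M<
    ... | no ¬M< with pigeonhole code X M U′ in-X′ lt′
      where
      U₀ = filter (λ p → code p ≟ᵥ c) U
      U′ = filter (λ p → ¬? (code p ≟ᵥ c)) U
      in-X′ : ∀ {p} → p ∈ U′ → code p ∈ X
      in-X′ p∈ with ∈-filter⁻ (λ p → ¬? (code p ≟ᵥ c)) {xs = U} p∈
      ... | p∈U , ≢c with in-X p∈U
      ...   | here eq = contradiction eq ≢c
      ...   | there q = q
      split : U ⊆ (U₀ ++ U′)
      split {p} p∈ with code p ≟ᵥ c
      ... | yes eq = ∈-++⁺ˡ (∈-filter⁺ _ p∈ eq)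
      ... | no ≢c  = ∈-++⁺ʳ U₀ (∈-filter⁺ _ p∈ ≢c)
      lt′ : length X * M < card U′
      lt′ = +-cancelˡ-< M _ _ (<-≤-trans lt (≤-trans (VCard.card-mono split)
        (≤-trans (VCard.card-++ U₀ U′) (+-monoˡ-≤ (card U′) (≮⇒≥ ¬M<)))))
    ... | c′ , M< = c′ , <-≤-trans M< (VCard.card-mono {xs = filter (λ p → code p ≟ᵥ c′) (filter (λ p → ¬? (code p ≟ᵥ c)) U)} λ p∈ →
      let q = ∈-filter⁻ (λ p → code p ≟ᵥ c′) {xs = filter (λ p → ¬? (code p ≟ᵥ c)) U} p∈
      in ∈-filter⁺ _ (proj₁ (∈-filter⁻ (λ p → ¬? (code p ≟ᵥ c)) {xs = U} (proj₁ q))) (proj₂ q))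

    two-elements : ∀ (U : List V) → 1 < card U → ∃[ p ] ∃[ q ] p ∈ U × q ∈ U × p ≢ q
    two-elements (p ∷ U) 1< with All.all? (λ q → p ≟ᵥ q) U
    ... | yes same = contradiction (VCard.card≤length {xs = p ∷ U} {p ∷ []} λ
        { (here refl) → here refl ; (there q) → here (sym (All.lookup same q)) }) (<⇒≱ 1<)
    ... | no differ with Any.any? (λ q → ¬? (p ≟ᵥ q)) U
    ...   | yes other = let (q , q∈ , ≢) = find other in p , q , here refl , there q∈ , ≢
    ...   | no none = contradiction (All.tabulate λ {q} q∈ → decidable-stable (p ≟ᵥ q) λ ≢ → none (lose q∈ ≢)) differ

    decompose : List V → List V → V → V × V
    decompose X P = pick _≟ᵥ_ (λ z → proj₁ z +ᵥ proj₂ z) (cartesianProduct X P) (0ᵥ , 0ᵥ)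

    decompose-∈ : ∀ {X P w} → w ∈ (X ⊞ P) →
      proj₁ (decompose X P w) ∈ X × proj₂ (decompose X P w) ∈ P × proj₁ (decompose X P w) +ᵥ proj₂ (decompose X P w) ≡ w
    decompose-∈ {X} {P} w∈ with ∈-⊞⁻ X P w∈
    ... | x , r , x∈ , r∈ , refl with pick-∈ _≟ᵥ_ (λ z → proj₁ z +ᵥ proj₂ z) {cartesianProduct X P} {0ᵥ , 0ᵥ} (∈-map⁺ _ (∈-cartesianProduct⁺ x∈ r∈))
    ...   | p , eq = let q = ∈-cartesianProduct⁻ X P p in proj₁ q , proj₂ q , eq

    -- The orbits of h p and h q under g stay together if the translates of P that contain them agree.
    orbits : ∀ {g : V → V} → Additive g → ∀ X P K → length X ≤ K → (∀ {p} → p ∈ P → g p ∈ (X ⊞ P)) →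
      ∀ t M U (h : V → V) → (∀ {p} → p ∈ U → h p ∈ P) → K ^ t * M < card U →
      ∃[ U′ ] U′ ⊆ U × M < card U′ × (∀ {p q i} → p ∈ U′ → q ∈ U′ → i ≤ t → iter g i (h p -ᵥ h q) ∈ (P ⊟ P))
    orbits add X P K len cover zero M U h h∈ lt = U , (λ p → p) , subst (_< card U) (+-identityʳ M) lt ,
      λ { p∈ q∈ z≤n → ∈-⊟⁺ (h∈ p∈) (h∈ q∈) }
    orbits {g} add X P K len cover (suc t) M U h h∈ lt = step (pigeonhole code X (K ^ t * M) U
        (λ p∈ → proj₁ (spec p∈)) (≤-<-trans (*-monoˡ-≤ (K ^ t * M) len) (subst (_< card U) (*-assoc K (K ^ t) M) lt)))
      where
      -- The code of `p` is the covering translate that contains `g (h p)`, and `h′ p` is the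
      -- remainder inside `P`. For points with equal codes the translates cancel, so `g` maps the
      -- difference of the old values to that of the remainders.
      code h′ : V → V
      code p = proj₁ (decompose X P (g (h p)))
      h′ p = proj₂ (decompose X P (g (h p)))
      spec : ∀ {p} → p ∈ U → code p ∈ X × h′ p ∈ P × code p +ᵥ h′ p ≡ g (h p)
      spec p∈ = decompose-∈ (cover (h∈ p∈))
      step : ∃[ c ] K ^ t * M < card (filter (λ p → code p ≟ᵥ c) U) →
        ∃[ U′ ] U′ ⊆ U × M < card U′ × (∀ {p q i} → p ∈ U′ → q ∈ U′ → i ≤ suc t → iter g i (h p -ᵥ h q) ∈ (P ⊟ P))
      step (c , lt″) with orbits add X P K len cover t M (filter (λ p → code p ≟ᵥ c) U) h′
        (λ p∈ → proj₁ (proj₂ (spec (proj₁ (∈-filter⁻ (λ p → code p ≟ᵥ c) {xs = U} p∈))))) lt″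
      ... | U′ , U′⊆ , M< , stay = U′ , (λ p∈ → proj₁ (U₁⁻ p∈)) , M< , stay′
        where
        U₁⁻ : ∀ {p} → p ∈ U′ → p ∈ U × code p ≡ c
        U₁⁻ p∈ = ∈-filter⁻ (λ p → code p ≟ᵥ c) {xs = U} (U′⊆ p∈)
        g-diff : ∀ {p q} → p ∈ U′ → q ∈ U′ → g (h p -ᵥ h q) ≡ h′ p -ᵥ h′ q
        g-diff {p} {q} p∈ q∈ = begin
          g (h p -ᵥ h q)                                  ≡⟨ Additive.sub-homo add (h p) (h q) ⟩
          g (h p) -ᵥ g (h q)                              ≡⟨ cong₂ _-ᵥ_ (proj₂ (proj₂ (spec (proj₁ (U₁⁻ p∈))))) (proj₂ (proj₂ (spec (proj₁ (U₁⁻ q∈))))) ⟨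
          (code p +ᵥ h′ p) -ᵥ (code q +ᵥ h′ q)            ≡⟨ cong₂ (λ a b → (a +ᵥ h′ p) -ᵥ (b +ᵥ h′ q)) (proj₂ (U₁⁻ p∈)) (proj₂ (U₁⁻ q∈)) ⟩
          (c +ᵥ h′ p) -ᵥ (c +ᵥ h′ q)                      ≡⟨ vsolve ((v₀ ⊕ v₁) ⊝ (v₀ ⊕ v₂)) (v₁ ⊝ v₂) refl (c ∷ h′ p ∷ h′ q ∷ []) ⟩
          h′ p -ᵥ h′ q                                    ∎
          where open ≡-Reasoning
        stay′ : ∀ {p q i} → p ∈ U′ → q ∈ U′ → i ≤ suc t → iter g i (h p -ᵥ h q) ∈ (P ⊟ P)
        stay′ p∈ q∈ z≤n = ∈-⊟⁺ (h∈ (proj₁ (U₁⁻ p∈))) (h∈ (proj₁ (U₁⁻ q∈)))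
        stay′ {i = suc i} p∈ q∈ (s≤s i≤) = subst (λ w → iter g i w ∈ (P ⊟ P)) (sym (g-diff p∈ q∈)) (stay p∈ q∈ i≤)

    record SmallSumset (f : V → V) : Set where
      field
        add   : Additive f
        inj   : ∀ {u v} → f u ≡ f v → u ≡ v
        A     : List V
        a₀    : V
        a₀∈   : a₀ ∈ A
        C     : ℕ
        small : card (A ⊞ map f A) ≤ C * card A

    module SmallDoubling {f : V → V} (smallSumset : SmallSumset f) where

      open SmallSumset smallSumset
      open Additive add

      n : ℕ
      n = card A

      P : List V
      P = A ⊟ A

      f-⊠ : ∀ h {u} → u ∈ (h ⊠ A) → f u ∈ (h ⊠ map f A)
      f-⊠ zero (here refl) = here 0-homo
      f-⊠ (suc h) u∈ with ∈-⊞⁻ A (h ⊠ A) u∈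
      ... | a , b , a∈ , b∈ , refl = subst (_∈ (map f A ⊞ (h ⊠ map f A))) (sym (+-homo a b)) (∈-⊞⁺ (∈-map⁺ f a∈) (f-⊠ h b∈))

      -- Plünnecke's inequality applies to multiples of the second summand `map f A`; the additive
      -- injection `f` embeds the corresponding multiples of `A` into them.
      card-⊠ : ∀ h h′ → card ((h ⊠ A) ⊟ (h′ ⊠ A)) ≤ C ^ (h + h′) * n
      card-⊠ h h′ = ≤-trans (card-inj _≟ᵥ_ _≟ᵥ_ f into (λ _ _ → inj)) (plünnecke A (map f A) C (VCard.card>0 a₀∈) small h h′)
        where
        into : ∀ {u} → u ∈ ((h ⊠ A) ⊟ (h′ ⊠ A)) → f u ∈ ((h ⊠ map f A) ⊟ (h′ ⊠ map f A))
        into u∈ with ∈-⊟⁻ (h ⊠ A) (h′ ⊠ A) u∈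
        ... | a , b , a∈ , b∈ , refl = subst (_∈ ((h ⊠ map f A) ⊟ (h′ ⊠ map f A))) (sym (sub-homo a b)) (∈-⊟⁺ (f-⊠ h a∈) (f-⊠ h′ b∈))

      ⊠₁ : ∀ {a} → a ∈ A → (a +ᵥ 0ᵥ) ∈ (1 ⊠ A)
      ⊠₁ a∈ = ∈-⊞⁺ a∈ (here refl)

      ⊠₂ : ∀ {a b} → a ∈ A → b ∈ A → (a +ᵥ (b +ᵥ 0ᵥ)) ∈ (2 ⊠ A)
      ⊠₂ a∈ b∈ = ∈-⊞⁺ a∈ (⊠₁ b∈)

      ⊠₃ : ∀ {a b c} → a ∈ A → b ∈ A → c ∈ A → (a +ᵥ (b +ᵥ (c +ᵥ 0ᵥ))) ∈ (3 ⊠ A)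
      ⊠₃ a∈ b∈ c∈ = ∈-⊞⁺ a∈ (⊠₂ b∈ c∈)

      0∈P : 0ᵥ ∈ P
      0∈P = subst (_∈ P) (-ᵥ-inverseʳ a₀) (∈-⊟⁺ a₀∈ a₀∈)

      neg-P : ∀ {p} → p ∈ P → (-ᵥ p) ∈ P
      neg-P p∈ with ∈-⊟⁻ A A p∈
      ... | a , b , a∈ , b∈ , refl = subst (_∈ P) (vsolve (v₁ ⊝ v₀) (⊖ (v₀ ⊝ v₁)) refl (a ∷ b ∷ [])) (∈-⊟⁺ b∈ a∈)

      card-A⊞P : card (A ⊞ P) ≤ C ^ 3 * n
      card-A⊞P = ≤-trans (VCard.card-mono sub) (card-⊠ 2 1)
        where
        sub : (A ⊞ P) ⊆ ((2 ⊠ A) ⊟ (1 ⊠ A))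
        sub z∈ with ∈-⊞⁻ A P z∈
        ... | a , p , a∈ , p∈ , refl with ∈-⊟⁻ A A p∈
        ...   | b , c , b∈ , c∈ , refl = subst (_∈ ((2 ⊠ A) ⊟ (1 ⊠ A)))
          (vsolve ((v₀ ⊕ (v₁ ⊕ 𝟘)) ⊝ (v₂ ⊕ 𝟘)) (v₀ ⊕ (v₁ ⊝ v₂)) refl (a ∷ b ∷ c ∷ [])) (∈-⊟⁺ (⊠₂ a∈ b∈) (⊠₁ c∈))

      card-2A⊞P : card ((A ⊞ A) ⊞ P) ≤ C ^ 4 * n
      card-2A⊞P = ≤-trans (VCard.card-mono sub) (card-⊠ 3 1)
        where
        sub : ((A ⊞ A) ⊞ P) ⊆ ((3 ⊠ A) ⊟ (1 ⊠ A))
        sub z∈ with ∈-⊞⁻ (A ⊞ A) P z∈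
        ... | s , p , s∈ , p∈ , refl with ∈-⊞⁻ A A s∈ | ∈-⊟⁻ A A p∈
        ...   | a , e , a∈ , e∈ , refl | b , c , b∈ , c∈ , refl = subst (_∈ ((3 ⊠ A) ⊟ (1 ⊠ A)))
          (vsolve ((v₀ ⊕ (v₃ ⊕ (v₁ ⊕ 𝟘))) ⊝ (v₂ ⊕ 𝟘)) ((v₀ ⊕ v₃) ⊕ (v₁ ⊝ v₂)) refl (a ∷ b ∷ c ∷ e ∷ [])) (∈-⊟⁺ (⊠₃ a∈ e∈ b∈) (⊠₁ c∈))

      card-2P⊞A : card ((P ⊞ P) ⊞ A) ≤ C ^ 5 * n
      card-2P⊞A = ≤-trans (VCard.card-mono sub) (card-⊠ 3 2)
        where
        sub : ((P ⊞ P) ⊞ A) ⊆ ((3 ⊠ A) ⊟ (2 ⊠ A))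
        sub z∈ with ∈-⊞⁻ (P ⊞ P) A z∈
        ... | s , g , s∈ , g∈ , refl with ∈-⊞⁻ P P s∈
        ...   | p , q , p∈ , q∈ , refl with ∈-⊟⁻ A A p∈ | ∈-⊟⁻ A A q∈
        ...     | a , b , a∈ , b∈ , refl | c , e , c∈ , e∈ , refl = subst (_∈ ((3 ⊠ A) ⊟ (2 ⊠ A)))
          (vsolve ((v₀ ⊕ (v₂ ⊕ (v₄ ⊕ 𝟘))) ⊝ (v₁ ⊕ (v₃ ⊕ 𝟘))) (((v₀ ⊝ v₁) ⊕ (v₂ ⊝ v₃)) ⊕ v₄) refl (a ∷ b ∷ c ∷ e ∷ g ∷ []))
          (∈-⊟⁺ (⊠₃ a∈ c∈ g∈) (⊠₂ b∈ e∈))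

      abstract
        -- Covering by translates of `A`, whose difference set is `P` again. The exponent 5 counts
        -- the copies of `A` in `P + P + A`.
        cover-2P : ∃[ X ] length X ≤ C ^ 5 × X ⊆ (P ⊞ P) × (∀ {s} → s ∈ (P ⊞ P) → s ∈ (X ⊞ P))
        cover-2P = covering (P ⊞ P) A (C ^ 5) a₀∈ card-2P⊞A

        cover-fA : ∃[ X ] length X ≤ C × X ⊆ map f A × (∀ {s} → s ∈ map f A → s ∈ (X ⊞ P))
        cover-fA = covering (map f A) A C a₀∈ (≤-trans (VCard.card-mono sub) small)
          where
          sub : (map f A ⊞ A) ⊆ (A ⊞ map f A)
          sub z∈ with ∈-⊞⁻ (map f A) A z∈
          ... | u , v , u∈ , v∈ , refl = subst (_∈ (A ⊞ map f A)) (+ᵥ-comm v u) (∈-⊞⁺ v∈ u∈)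

      X Y F : List V
      X = proj₁ cover-2P
      Y = proj₁ cover-fA
      F = (Y ⊟ Y) ⊞ X

      P+P : ∀ {p q} → p ∈ P → q ∈ P → (p +ᵥ q) ∈ (X ⊞ P)
      P+P p∈ q∈ = proj₂ (proj₂ (proj₂ cover-2P)) (∈-⊞⁺ p∈ q∈)

      length-X : length X ≤ C ^ 5
      length-X = proj₁ (proj₂ cover-2P)

      length-F : length F ≤ C ^ 7
      length-F = begin
        length F                             ≡⟨ trans (length-cartesianProductWith _+ᵥ_ (Y ⊟ Y) X) (cong (_* length X) (length-cartesianProductWith _-ᵥ_ Y Y)) ⟩
        length Y * length Y * length X       ≤⟨ *-mono-≤ (*-mono-≤ (proj₁ (proj₂ cover-fA)) (proj₁ (proj₂ cover-fA))) length-X ⟩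
        C * C * C ^ 5                        ≡⟨ *-assoc C C (C ^ 5) ⟩
        C ^ 7                                ∎
        where open ≤-Reasoning

      -- As `f A` is covered by `Y ⊞ P`, the image of `P` lies in `(Y ⊟ Y) ⊞ (P ⊞ P)`, and `X`
      -- reduces the two copies of `P` to one. Two factors `Y` and one `X` explain the exponent 7 of
      -- `length-F`.
      fP : ∀ {p} → p ∈ P → f p ∈ (F ⊞ P)
      fP p∈ with ∈-⊟⁻ A A p∈
      ... | a , b , a∈ , b∈ , refl with ∈-⊞⁻ Y P (proj₂ (proj₂ (proj₂ cover-fA)) (∈-map⁺ f a∈)) | ∈-⊞⁻ Y P (proj₂ (proj₂ (proj₂ cover-fA)) (∈-map⁺ f b∈))
      ...   | y , p , y∈ , p∈ , eq | z , q , z∈ , q∈ , eq′ with ∈-⊞⁻ X P (P+P p∈ (neg-P q∈))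
      ...     | x , r , x∈ , r∈ , eq″ = subst (_∈ (F ⊞ P)) (sym (begin
        f (a -ᵥ b)                       ≡⟨ sub-homo a b ⟩
        f a -ᵥ f b                       ≡⟨ cong₂ _-ᵥ_ eq eq′ ⟩
        (y +ᵥ p) -ᵥ (z +ᵥ q)             ≡⟨ vsolve ((v₀ ⊕ v₁) ⊝ (v₂ ⊕ v₃)) ((v₀ ⊝ v₂) ⊕ (v₁ ⊝ v₃)) refl (y ∷ p ∷ z ∷ q ∷ []) ⟩
        (y -ᵥ z) +ᵥ (p -ᵥ q)             ≡⟨ cong ((y -ᵥ z) +ᵥ_) eq″ ⟩
        (y -ᵥ z) +ᵥ (x +ᵥ r)             ≡⟨ +ᵥ-assoc (y -ᵥ z) x r ⟨
        ((y -ᵥ z) +ᵥ x) +ᵥ r             ∎)) (∈-⊞⁺ (∈-⊞⁺ (∈-⊟⁺ y∈ z∈) x∈) r∈)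
        where open ≡-Reasoning

      -- Contains every sum of `t + 1` elements of `P`, as each further summand costs one step of
      -- the box by `Ball-suc`; yet it consists of only polynomially many translates of `P`.
      Ball : ℕ → List V
      Ball t = box t X ⊞ P

      Ball-0 : ∀ t → 0ᵥ ∈ Ball t
      Ball-0 t = subst (_∈ Ball t) (0+ᵥ 0ᵥ) (∈-⊞⁺ (0∈box t X) 0∈P)

      Ball-mono : ∀ {t t′} → t ≤ t′ → Ball t ⊆ Ball t′
      Ball-mono {t} t≤ z∈ with ∈-⊞⁻ (box t X) P z∈
      ... | u , p , u∈ , p∈ , refl = ∈-⊞⁺ (box-mono X t≤ u∈) p∈

      Ball-suc : ∀ {t z p} → z ∈ Ball t → p ∈ P → (z +ᵥ p) ∈ Ball (suc t)
      Ball-suc {t} {p = p} z∈ p∈ with ∈-⊞⁻ (box t X) P z∈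
      ... | u , q , u∈ , q∈ , refl with ∈-⊞⁻ X P (P+P q∈ p∈)
      ...   | x , r , x∈ , r∈ , eq = subst (_∈ Ball (suc t))
        (trans (+ᵥ-assoc u x r) (trans (cong (u +ᵥ_) (sym eq)) (sym (+ᵥ-assoc u q p)))) (∈-⊞⁺ (box-+ X u∈ x∈) r∈)

      Ball-2 : ∀ {t z w} → z ∈ Ball t → w ∈ (P ⊟ P) → (z +ᵥ w) ∈ Ball (2 + t)
      Ball-2 {t} {z} z∈ w∈ with ∈-⊟⁻ P P w∈
      ... | p , q , p∈ , q∈ , refl = subst (_∈ Ball (2 + t)) (+ᵥ-assoc z p (-ᵥ q)) (Ball-suc (Ball-suc z∈ p∈) (neg-P q∈))

      Ball-multiple : ∀ {t z w} c → z ∈ Ball t → w ∈ (P ⊟ P) → (z +ᵥ ((ℤ.+ c) *ₛ w)) ∈ Ball (c * 2 + t)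
      Ball-multiple {t} {z} {w} zero z∈ w∈ = subst (_∈ Ball t) (sym (trans (cong (z +ᵥ_) (*ₛ-zero w)) (+ᵥ0 z))) z∈
      Ball-multiple {t} {z} {w} (suc c) z∈ w∈ = subst (_∈ Ball (suc c * 2 + t))
        (trans (+ᵥ-assoc z _ w) (cong (z +ᵥ_) (trans (+ᵥ-comm _ w)
          (sym (trans (*ₛ-distribʳ ℤ.1ℤ (ℤ.+ c) w) (cong (_+ᵥ ((ℤ.+ c) *ₛ w)) (*ₛ-one w)))))))
        (Ball-2 (Ball-multiple c z∈ w∈) w∈)

      double-power : ∀ i (v : V) → iter double i v ≡ (ℤ.+ (2 ^ i)) *ₛ v
      double-power zero    v = sym (*ₛ-one v)
      double-power (suc i) v = trans (iter-suc double i v) (trans (cong double (double-power i v))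
        (trans (sym (*ₛ-distribʳ (ℤ.+ (2 ^ i)) (ℤ.+ (2 ^ i)) v)) (cong (λ m → (ℤ.+ m) *ₛ v) (cong (2 ^ i +_) (sym (+-identityʳ (2 ^ i)))))))

      -- binary expansion of l
      Ball-dyadic : ∀ t v → (∀ {i} → i ≤ t → iter double i v ∈ (P ⊟ P)) → ∀ s → s ≤ t → ∀ l → l < 2 ^ s → ((ℤ.+ l) *ₛ v) ∈ Ball (2 * s)
      Ball-dyadic t v stay zero    s≤ l (s≤s z≤n) = subst (_∈ Ball 0) (sym (*ₛ-zero v)) (Ball-0 0)
      Ball-dyadic t v stay (suc s) s≤ l l< with l <? 2 ^ s
      ... | yes l<s = Ball-mono {2 * s} (*-monoʳ-≤ 2 (n≤1+n s)) (Ball-dyadic t v stay s (≤-trans (n≤1+n s) s≤) l l<s)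
      ... | no l≮s with m≤n⇒∃[o]m+o≡n (≮⇒≥ l≮s)
      ...   | o , refl = subst₂ (λ z m → z ∈ Ball m) (trans (+ᵥ-comm _ _) (trans (cong (_+ᵥ ((ℤ.+ o) *ₛ v)) (double-power s v)) (sym (*ₛ-distribʳ (ℤ.+ (2 ^ s)) (ℤ.+ o) v)))) (eq s)
          (Ball-2 (Ball-dyadic t v stay s (≤-trans (n≤1+n s) s≤) o (+-cancelˡ-< (2 ^ s) o (2 ^ s) (subst (2 ^ s + o <_) (cong (2 ^ s +_) (+-identityʳ (2 ^ s))) l<))) (stay (≤-trans (n≤1+n s) s≤)))
        where
        eq : ∀ s → 2 + 2 * s ≡ 2 * suc s
        eq = solve-∀

      card-2A⊞Ball : ∀ t → card ((A ⊞ A) ⊞ Ball t) ≤ suc t ^ (C ^ 5) * (C ^ 4 * n)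
      card-2A⊞Ball t = begin
        card ((A ⊞ A) ⊞ Ball t)                      ≤⟨ VCard.card-mono sub ⟩
        card (box t X ⊞ ((A ⊞ A) ⊞ P))               ≤⟨ card-⊞ (box t X) ((A ⊞ A) ⊞ P) ⟩
        card (box t X) * card ((A ⊞ A) ⊞ P)          ≤⟨ *-mono-≤ (card-box t) card-2A⊞P ⟩
        suc t ^ (C ^ 5) * (C ^ 4 * n)                ∎
        where
        open ≤-Reasoning
        card-box : ∀ t → card (box t X) ≤ suc t ^ (C ^ 5)
        card-box t = ≤-trans (VCard.card≤length {xs = box t X} (λ p → p)) (≤-trans (≤-reflexive (length-box t X)) (^-monoʳ-≤ (suc t) length-X))
        sub : ((A ⊞ A) ⊞ Ball t) ⊆ (box t X ⊞ ((A ⊞ A) ⊞ P))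
        sub z∈ with ∈-⊞⁻ (A ⊞ A) (Ball t) z∈
        ... | s , w , s∈ , w∈ , refl with ∈-⊞⁻ (box t X) P w∈
        ...   | u , p , u∈ , p∈ , refl = subst (_∈ (box t X ⊞ ((A ⊞ A) ⊞ P)))
          (vsolve (v₀ ⊕ (v₁ ⊕ v₂)) (v₁ ⊕ (v₀ ⊕ v₂)) refl (u ∷ s ∷ p ∷ [])) (∈-⊞⁺ u∈ (∈-⊞⁺ s∈ p∈))

      -- Translation vectors by which copies of `P` cover the `q`-th image of `P`. Their number is
      -- bounded exponentially in `q`, which limits the number of levels that can be afforded.
      Z : ℕ → List V
      Z zero    = 0ᵥ ∷ []
      Z (suc q) = map f (Z q) ⊞ F

      length-Z : ∀ q → length (Z q) ≤ (C ^ 7) ^ q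
      length-Z zero    = ≤-refl
      length-Z (suc q) = begin
        length (map f (Z q) ⊞ F)             ≡⟨ length-cartesianProductWith _+ᵥ_ (map f (Z q)) F ⟩
        length (map f (Z q)) * length F      ≡⟨ cong (_* length F) (length-map f (Z q)) ⟩
        length (Z q) * length F              ≤⟨ *-mono-≤ (length-Z q) length-F ⟩
        (C ^ 7) ^ q * C ^ 7                  ≡⟨ *-comm ((C ^ 7) ^ q) (C ^ 7) ⟩
        C ^ 7 * (C ^ 7) ^ q                  ∎
        where open ≤-Reasoning

      iter-P : ∀ q {p} → p ∈ P → iter f q p ∈ (Z q ⊞ P)
      iter-P zero    {p} p∈ = subst (_∈ (Z 0 ⊞ P)) (0+ᵥ p) (∈-⊞⁺ {X = Z 0} (here refl) p∈)
      iter-P (suc q) {p} p∈ with ∈-⊞⁻ (Z q) P (iter-P q p∈)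
      ... | z , r , z∈ , r∈ , eq with ∈-⊞⁻ F P (fP r∈)
      ...   | w , s , w∈ , s∈ , eq′ = subst (_∈ (Z (suc q) ⊞ P)) (sym (begin
        iter f (suc q) p          ≡⟨ iter-suc f q p ⟩
        f (iter f q p)            ≡⟨ cong f eq ⟩
        f (z +ᵥ r)                ≡⟨ +-homo z r ⟩
        f z +ᵥ f r                ≡⟨ cong (f z +ᵥ_) eq′ ⟩
        f z +ᵥ (w +ᵥ s)           ≡⟨ +ᵥ-assoc (f z) w s ⟨
        (f z +ᵥ w) +ᵥ s           ∎)) (∈-⊞⁺ (∈-⊞⁺ (∈-map⁺ f z∈) w∈) s∈)
        where open ≡-Reasoning

      -- `map f A` goes into `Y ⊞ P`, the image of the box is no longer than the box, the image of
      -- `P` goes into `Z q ⊞ P`, and the two copies of `P` merge at the cost of `X`. The exponent 9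
      -- is 1 for `Y`, 5 for `X` and 3 for `A ⊞ P`.
      card-⊞iterBall : ∀ q t → card ((A ⊞ map f A) ⊞ map (iter f q) (Ball t)) ≤ suc t ^ (C ^ 5) * (C ^ 7) ^ q * (C ^ 9 * n)
      card-⊞iterBall q t = begin
        card ((A ⊞ map f A) ⊞ map (iter f q) (Ball t))      ≤⟨ VCard.card-mono sub ⟩
        card (W ⊞ (A ⊞ P))                                  ≤⟨ card-⊞ W (A ⊞ P) ⟩
        card W * card (A ⊞ P)                               ≤⟨ *-mono-≤ (≤-trans (VCard.card≤length {xs = W} (λ p → p)) len) card-A⊞P ⟩
        C * suc t ^ (C ^ 5) * ((C ^ 7) ^ q * C ^ 5) * (C ^ 3 * n)   ≡⟨ eq C (suc t ^ (C ^ 5)) ((C ^ 7) ^ q) (C ^ 5) (C ^ 3) n ⟩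
        suc t ^ (C ^ 5) * (C ^ 7) ^ q * (C * (C ^ 5 * C ^ 3) * n)   ≡⟨ cong (λ c → suc t ^ (C ^ 5) * (C ^ 7) ^ q * (C * c * n)) (^-distribˡ-+-* C 5 3) ⟨
        suc t ^ (C ^ 5) * (C ^ 7) ^ q * (C ^ 9 * n)         ∎
        where
        open ≤-Reasoning
        eq : ∀ c b z c₅ c₃ n → c * b * (z * c₅) * (c₃ * n) ≡ b * z * (c * (c₅ * c₃) * n)
        eq = solve-∀
        W = (Y ⊞ map (iter f q) (box t X)) ⊞ (Z q ⊞ X)
        len : length W ≤ C * suc t ^ (C ^ 5) * ((C ^ 7) ^ q * C ^ 5)
        len = begin
          length W                                                                   ≡⟨ length-cartesianProductWith _+ᵥ_ (Y ⊞ map (iter f q) (box t X)) (Z q ⊞ X) ⟩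
          length (Y ⊞ map (iter f q) (box t X)) * length (Z q ⊞ X)                   ≡⟨ cong₂ _*_ (trans (length-cartesianProductWith _+ᵥ_ Y (map (iter f q) (box t X))) (cong (length Y *_) (trans (length-map (iter f q) (box t X)) (length-box t X)))) (length-cartesianProductWith _+ᵥ_ (Z q) X) ⟩
          length Y * suc t ^ length X * (length (Z q) * length X)                    ≤⟨ *-mono-≤ (*-mono-≤ (proj₁ (proj₂ cover-fA)) (^-monoʳ-≤ (suc t) length-X)) (*-mono-≤ (length-Z q) length-X) ⟩
          C * suc t ^ (C ^ 5) * ((C ^ 7) ^ q * C ^ 5)                                ∎
        regroup : ∀ a y u p z r r′ x r″ → iter f q r ≡ z +ᵥ r′ → p +ᵥ r′ ≡ x +ᵥ r″ →
          ((y +ᵥ iter f q u) +ᵥ (z +ᵥ x)) +ᵥ (a +ᵥ r″) ≡ (a +ᵥ (y +ᵥ p)) +ᵥ iter f q (u +ᵥ r)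
        regroup a y u p z r r′ x r″ eq₁ eq₂ =
          trans (vsolve (((v₀ ⊕ v₁) ⊕ (v₂ ⊕ v₃)) ⊕ (v₄ ⊕ v₅)) (((v₄ ⊕ v₀) ⊕ (v₁ ⊕ v₂)) ⊕ (v₃ ⊕ v₅)) refl (y ∷ iter f q u ∷ z ∷ x ∷ a ∷ r″ ∷ []))
          (trans (cong (((a +ᵥ y) +ᵥ (iter f q u +ᵥ z)) +ᵥ_) (sym eq₂))
          (trans (vsolve (((v₄ ⊕ v₀) ⊕ (v₁ ⊕ v₂)) ⊕ (v₃ ⊕ v₅)) ((v₄ ⊕ (v₀ ⊕ v₃)) ⊕ (v₁ ⊕ (v₂ ⊕ v₅))) refl (y ∷ iter f q u ∷ z ∷ p ∷ a ∷ r′ ∷ []))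
          (trans (cong (λ w → (a +ᵥ (y +ᵥ p)) +ᵥ (iter f q u +ᵥ w)) (sym eq₁))
                 (cong ((a +ᵥ (y +ᵥ p)) +ᵥ_) (sym (Additive.+-homo (iter-Additive add q) u r))))))
        sub : ((A ⊞ map f A) ⊞ map (iter f q) (Ball t)) ⊆ (W ⊞ (A ⊞ P))
        sub m∈ with ∈-⊞⁻ (A ⊞ map f A) (map (iter f q) (Ball t)) m∈
        ... | s , m , s∈ , m∈′ , refl with ∈-⊞⁻ A (map f A) s∈ | ∈-map⁻ (iter f q) m∈′
        ...   | a , b , a∈ , b∈ , refl | c , c∈ , refl with ∈-⊞⁻ Y P (proj₂ (proj₂ (proj₂ cover-fA)) b∈) | ∈-⊞⁻ (box t X) P c∈
        ...     | y , p , y∈ , p∈ , refl | u , r , u∈ , r∈ , refl with ∈-⊞⁻ (Z q) P (iter-P q r∈)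
        ...       | z , r′ , z∈ , r′∈ , eq₁ with ∈-⊞⁻ X P (P+P p∈ r′∈)
        ...         | x , r″ , x∈ , r″∈ , eq₂ = subst (_∈ (W ⊞ (A ⊞ P))) (regroup a y u p z r r′ x r″ eq₁ eq₂)
          (∈-⊞⁺ (∈-⊞⁺ (∈-⊞⁺ y∈ (∈-map⁺ (iter f q) u∈)) (∈-⊞⁺ z∈ x∈)) (∈-⊞⁺ a∈ r″∈))

      n≤card-P : n ≤ card P
      n≤card-P = card-inj _≟ᵥ_ _≟ᵥ_ (λ a → a -ᵥ a₀) {A} {P} (λ a∈ → ∈-⊟⁺ a∈ a₀∈) (λ _ _ → +ᵥ-cancelʳ (-ᵥ a₀))

      -- Every point of `P` is coded by the covering translates met by its orbits under doubling and
      -- under `f`. With fewer codes than points, two points share all codes, and their difference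
      -- stays in `P ⊟ P` along both orbits.
      short-vector : ∀ t J → (C ^ 5) ^ t * (C ^ 7) ^ J < n →
        ∃[ v ] v ≢ 0ᵥ × (∀ {i} → i ≤ t → iter double i v ∈ (P ⊟ P)) × (∀ {i} → i ≤ J → iter f i v ∈ (P ⊟ P))
      short-vector t J lt with orbits double-Additive X P (C ^ 5) length-X (λ p∈ → P+P p∈ p∈) t ((C ^ 7) ^ J) P (λ p → p) (λ p∈ → p∈) (<-≤-trans lt n≤card-P)
      ... | U , U⊆ , lt′ , stay with orbits add F P (C ^ 7) length-F fP J 1 U (λ p → p) U⊆ (subst (_< card U) (sym (*-identityʳ _)) lt′)
      ...   | U′ , U′⊆ , 1< , stay′ with two-elements U′ 1<
      ...     | p , q , p∈ , q∈ , p≢q = p -ᵥ q , (λ eq → p≢q (+ᵥ-cancelʳ (-ᵥ q) (trans eq (sym (-ᵥ-inverseʳ q))))) ,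
        (λ i≤ → stay (U′⊆ p∈) (U′⊆ q∈) i≤) , (λ i≤ → stay′ p∈ q∈ i≤)

-- Independence of orbits under an irreducible matrix.

module Orbits where

  open import Defs using (Matrix; toℚ; NoNontrivialInvariantSubspace; module Linear; module ℤLinear; module ℚLinear)
  open import Algebra.Bundles.Raw using (RawRing)
  open import Algebra.Structures using (IsCommutativeRing)
  open import Data.Fin.Base using (zero; suc)
  open import Data.Integer.Base using (0ℤ; 1ℤ)
  open import Data.Integer.Tactic.RingSolver using (solve-∀)
  open import Data.List.Base using (List; []; _∷_; length; map; _∷ʳ_)
  open import Data.List.Properties using (length-map)
  open import Data.List.Membership.Propositional.Properties using (∈-map⁺)
  open import Data.Nat.Base as ℕ using (ℕ; zero; suc; _<_; _≤_; z≤n; s≤s)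
  import Data.Nat.Properties as ℕ
  open import Data.Rational.Base as ℚ using (ℚ; 0ℚ)
  import Data.Rational.Properties as ℚ
  open import Data.Rational.Unnormalised.Base as ℚᵘ using (mkℚᵘ; *≡*)
  import Data.Rational.Unnormalised.Properties as ℚᵘ
  open import Data.Vec.Base as Vec using (Vec; []; _∷_)
  open import Data.Vec.Properties using (∷-injectiveˡ; ∷-injectiveʳ)
  open import Level using (0ℓ)
  open Cardinality using (remove-∈)
  open BrunnMinkowski using (_≟ᵥ_)
  open BoxVolumes using (0+ᵥ)
  open Vectors
  open DoublingConsequences using (iter; iter-suc; iter-+; iter-Additive)

  module LinearLaws (R : RawRing 0ℓ 0ℓ) (laws : IsCommutativeRing _≡_ (RawRing._+_ R) (RawRing._*_ R) (RawRing.-_ R) (RawRing.0# R) (RawRing.1# R)) where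
    open RawRing R using (Carrier; 0#; _+_; _*_)
    open IsCommutativeRing laws using (+-assoc; +-comm; +-identityˡ; *-assoc; *-comm; distribˡ; zeroʳ)
    open Linear R renaming (0ᵥ to zeros; _+ᵥ_ to _⊞ᵥ_; _*ₛ_ to _⊠ₛ_)

    interchange-+ : ∀ a b c e → (a + b) + (c + e) ≡ (a + c) + (b + e)
    interchange-+ a b c e = trans (+-assoc a b (c + e)) (trans (cong (a +_) (trans (sym (+-assoc b c e))
      (trans (cong (_+ e) (+-comm b c)) (+-assoc c b e)))) (sym (+-assoc a c (b + e))))

    dot-+ʳ : ∀ {n} (u v w : Vec Carrier n) → dot u (v ⊞ᵥ w) ≡ dot u v + dot u w
    dot-+ʳ [] [] [] = sym (+-identityˡ 0#)
    dot-+ʳ (a ∷ u) (b ∷ v) (c ∷ w) = trans (cong₂ _+_ (distribˡ a b c) (dot-+ʳ u v w)) (interchange-+ _ _ _ _)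

    dot-*ʳ : ∀ {n} c (u v : Vec Carrier n) → dot u (c ⊠ₛ v) ≡ c * dot u v
    dot-*ʳ c [] [] = sym (zeroʳ c)
    dot-*ʳ c (a ∷ u) (b ∷ v) = trans (cong₂ _+_
      (trans (sym (*-assoc a c b)) (trans (cong (_* b) (*-comm a c)) (*-assoc c a b))) (dot-*ʳ c u v)) (sym (distribˡ c _ _))

    dot-0ʳ : ∀ {n} (u : Vec Carrier n) → dot u zeros ≡ 0#
    dot-0ʳ [] = refl
    dot-0ʳ (a ∷ u) = trans (cong₂ _+_ (zeroʳ a) (dot-0ʳ u)) (+-identityˡ 0#)

    *ᵥ-+ : ∀ {m n} (M : Vec (Vec Carrier n) m) v w → Vec.map (λ row → dot row (v ⊞ᵥ w)) M ≡
      Vec.map (λ row → dot row v) M ⊞ᵥ Vec.map (λ row → dot row w) M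
    *ᵥ-+ [] v w = refl
    *ᵥ-+ (r ∷ M) v w = cong₂ _∷_ (dot-+ʳ r v w) (*ᵥ-+ M v w)

    *ᵥ-* : ∀ {m n} (M : Vec (Vec Carrier n) m) c v → Vec.map (λ row → dot row (c ⊠ₛ v)) M ≡ c ⊠ₛ Vec.map (λ row → dot row v) M
    *ᵥ-* [] c v = refl
    *ᵥ-* (r ∷ M) c v = cong₂ _∷_ (dot-*ʳ c r v) (*ᵥ-* M c v)

    *ᵥ-0 : ∀ {m n} (M : Vec (Vec Carrier n) m) → Vec.map (λ row → dot row zeros) M ≡ zeros
    *ᵥ-0 [] = refl
    *ᵥ-0 (r ∷ M) = cong₂ _∷_ (dot-0ʳ r) (*ᵥ-0 M)

  open ℤLinear using (dot; _*ᵥ_)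
  module ℤLaws = LinearLaws ℤ.+-*-rawRing ℤ.+-*-isCommutativeRing
  module ℚLaws = LinearLaws ℚ.+-*-rawRing ℚ.+-*-isCommutativeRing

  *ᵥ-Additive : ∀ {d} (L : Matrix ℤ d) → Additive (L *ᵥ_)
  *ᵥ-Additive L = record { +-homo = ℤLaws.*ᵥ-+ L }

  fromℤ : ℤ → ℚ
  fromℤ a = a ℚ./ 1

  toℚᵘ-fromℤ : ∀ a → ℚ.toℚᵘ (fromℤ a) ℚᵘ.≃ mkℚᵘ a 0
  toℚᵘ-fromℤ a = ℚ.toℚᵘ-fromℚᵘ (mkℚᵘ a 0)

  fromℤ-+ : ∀ a b → fromℤ (a ℤ.+ b) ≡ fromℤ a ℚ.+ fromℤ b
  fromℤ-+ a b = ℚ.toℚᵘ-injective (begin-equality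
    ℚ.toℚᵘ (fromℤ (a ℤ.+ b))                        ≃⟨ toℚᵘ-fromℤ (a ℤ.+ b) ⟩
    mkℚᵘ (a ℤ.+ b) 0                                ≃⟨ *≡* (eq a b) ⟩
    mkℚᵘ a 0 ℚᵘ.+ mkℚᵘ b 0                          ≃⟨ ℚᵘ.+-cong (toℚᵘ-fromℤ a) (toℚᵘ-fromℤ b) ⟨
    ℚ.toℚᵘ (fromℤ a) ℚᵘ.+ ℚ.toℚᵘ (fromℤ b)          ≃⟨ ℚ.toℚᵘ-homo-+ (fromℤ a) (fromℤ b) ⟨
    ℚ.toℚᵘ (fromℤ a ℚ.+ fromℤ b)                    ∎)
    where
    open ℚᵘ.≤-Reasoning
    eq : ∀ a b → (a ℤ.+ b) ℤ.* 1ℤ ≡ (a ℤ.* 1ℤ ℤ.+ b ℤ.* 1ℤ) ℤ.* 1ℤ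
    eq = solve-∀

  fromℤ-* : ∀ a b → fromℤ (a ℤ.* b) ≡ fromℤ a ℚ.* fromℤ b
  fromℤ-* a b = ℚ.toℚᵘ-injective (begin-equality
    ℚ.toℚᵘ (fromℤ (a ℤ.* b))                        ≃⟨ toℚᵘ-fromℤ (a ℤ.* b) ⟩
    mkℚᵘ a 0 ℚᵘ.* mkℚᵘ b 0                          ≃⟨ ℚᵘ.*-cong (toℚᵘ-fromℤ a) (toℚᵘ-fromℤ b) ⟨
    ℚ.toℚᵘ (fromℤ a) ℚᵘ.* ℚ.toℚᵘ (fromℤ b)          ≃⟨ ℚ.toℚᵘ-homo-* (fromℤ a) (fromℤ b) ⟨
    ℚ.toℚᵘ (fromℤ a ℚ.* fromℤ b)                    ∎)
    where open ℚᵘ.≤-Reasoning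

  fromℤ-injective : ∀ {a b} → fromℤ a ≡ fromℤ b → a ≡ b
  fromℤ-injective {a} {b} eq with ℚᵘ.≃-trans (ℚᵘ.≃-sym (toℚᵘ-fromℤ a)) (ℚᵘ.≃-trans (ℚᵘ.≃-reflexive (cong ℚ.toℚᵘ eq)) (toℚᵘ-fromℤ b))
  ... | *≡* p = trans (sym (ℤ.*-identityʳ a)) (trans p (ℤ.*-identityʳ b))

  embed : ∀ {d} → Vec ℤ d → Vec ℚ d
  embed = Vec.map fromℤ

  dot-embed : ∀ {d} (u v : Vec ℤ d) → ℚLinear.dot (embed u) (embed v) ≡ fromℤ (dot u v)
  dot-embed [] [] = refl
  dot-embed (a ∷ u) (b ∷ v) = trans (cong₂ ℚ._+_ (sym (fromℤ-* a b)) (dot-embed u v)) (sym (fromℤ-+ (a ℤ.* b) (dot u v)))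

  *ᵥ-embed : ∀ {d} (L : Matrix ℤ d) v → toℚ L ℚLinear.*ᵥ embed v ≡ embed (L *ᵥ v)
  *ᵥ-embed L v = rows L
    where
    rows : ∀ {m} (M : Vec (Vec ℤ _) m) → Vec.map (λ row → ℚLinear.dot row (embed v)) (Vec.map embed M) ≡ embed (Vec.map (λ row → dot row v) M)
    rows [] = refl
    rows (r ∷ M) = cong₂ _∷_ (dot-embed r v) (rows M)

  embed-injective : ∀ {d} {u v : Vec ℤ d} → embed u ≡ embed v → u ≡ v
  embed-injective {u = []} {[]} _ = refl
  embed-injective {u = a ∷ u} {b ∷ v} eq = cong₂ _∷_ (fromℤ-injective (∷-injectiveˡ eq)) (embed-injective (∷-injectiveʳ eq))

  embed-0 : ∀ {d} → embed (0ᵥ {d}) ≡ ℚLinear.0ᵥ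
  embed-0 {zero}  = refl
  embed-0 {suc d} = cong (0ℚ ∷_) embed-0

  dot-separates : ∀ {d} (ψ : Vec ℤ d) → (∀ w → dot ψ w ≡ 0ℤ) → ψ ≡ 0ᵥ
  dot-separates [] _ = refl
  dot-separates (a ∷ ψ) orth = cong₂ _∷_
    (trans (sym (trans (cong₂ ℤ._+_ (ℤ.*-identityʳ a) (ℤLaws.dot-0ʳ ψ)) (ℤ.+-identityʳ a))) (orth (1ℤ ∷ 0ᵥ)))
    (dot-separates ψ λ w → trans (sym (trans (cong (ℤ._+ dot ψ w) (ℤ.*-zeroʳ a)) (ℤ.+-identityˡ (dot ψ w)))) (orth (0ℤ ∷ w)))

  module _ {d : ℕ} (L : Matrix ℤ d) (irreducible : NoNontrivialInvariantSubspace L) where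
    private
      f : Vec ℤ d → Vec ℤ d
      f = L *ᵥ_

    -- The rational vectors whose whole orbit is orthogonal to `ψ` form an invariant subspace that
    -- contains `v`, and a proper one if `ψ` is not zero. Defined by equations rather than as the
    -- span of the orbit, it has its closure properties at once.
    no-annihilator : ∀ {v} → v ≢ 0ᵥ → ∀ ψ → (∀ i → dot ψ (iter f i v) ≡ 0ℤ) → ψ ≡ 0ᵥ
    no-annihilator {v} v≢0 ψ orth = decidable-stable (ψ ≟ᵥ 0ᵥ) λ ψ≢0 → irreducible W record
      { isSubspace = record { 0-closed = W-0 ; +-closed = W-+ ; *-closed = W-* }
      ; nonzero = λ W≐0 → v≢0 (embed-injective (trans (sym (proj₁ W≐0 v∈W)) (sym embed-0)))
      ; proper = λ W≐U → ψ≢0 (dot-separates ψ λ w → fromℤ-injective (trans (sym (dot-embed ψ w)) (proj₂ W≐U {embed w} _ 0)))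
      ; invariant = λ w∈ i → w∈ (suc i) }
      where
      g : Vec ℚ d → Vec ℚ d
      g = toℚ L ℚLinear.*ᵥ_
      W : Vec ℚ d → Set
      W w = ∀ i → ℚLinear.dot (embed ψ) (iter g i w) ≡ 0ℚ
      iter-0 : ∀ i → iter g i ℚLinear.0ᵥ ≡ ℚLinear.0ᵥ
      iter-0 zero    = refl
      iter-0 (suc i) = trans (cong (iter g i) (ℚLaws.*ᵥ-0 (toℚ L))) (iter-0 i)
      iter-+ᵥ : ∀ i u w → iter g i (u ℚLinear.+ᵥ w) ≡ iter g i u ℚLinear.+ᵥ iter g i w
      iter-+ᵥ zero    u w = refl
      iter-+ᵥ (suc i) u w = trans (cong (iter g i) (ℚLaws.*ᵥ-+ (toℚ L) u w)) (iter-+ᵥ i (g u) (g w))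
      iter-* : ∀ i c w → iter g i (c ℚLinear.*ₛ w) ≡ c ℚLinear.*ₛ iter g i w
      iter-* zero    c w = refl
      iter-* (suc i) c w = trans (cong (iter g i) (ℚLaws.*ᵥ-* (toℚ L) c w)) (iter-* i c (g w))
      W-0 : W ℚLinear.0ᵥ
      W-0 i = trans (cong (ℚLinear.dot (embed ψ)) (iter-0 i)) (ℚLaws.dot-0ʳ (embed ψ))
      W-+ : ∀ {u w} → W u → W w → W (u ℚLinear.+ᵥ w)
      W-+ {u} {w} p q i = trans (cong (ℚLinear.dot (embed ψ)) (iter-+ᵥ i u w))
        (trans (ℚLaws.dot-+ʳ (embed ψ) (iter g i u) (iter g i w)) (trans (cong₂ ℚ._+_ (p i) (q i)) (ℚ.+-identityˡ 0ℚ)))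
      W-* : ∀ c {w} → W w → W (c ℚLinear.*ₛ w)
      W-* c {w} p i = trans (cong (ℚLinear.dot (embed ψ)) (iter-* i c w))
        (trans (ℚLaws.dot-*ʳ c (embed ψ) (iter g i w)) (trans (cong (c ℚ.*_) (p i)) (ℚ.*-zeroʳ c)))
      iter-embed : ∀ i w → iter g i (embed w) ≡ embed (iter f i w)
      iter-embed zero    w = refl
      iter-embed (suc i) w = trans (cong (iter g i) (*ᵥ-embed L w)) (iter-embed i (f w))
      v∈W : W (embed v)
      v∈W i = trans (cong (ℚLinear.dot (embed ψ)) (iter-embed i v)) (trans (dot-embed ψ (iter f i v)) (cong fromℤ (orth i)))

  eliminate : ∀ {d} → ℤ → Vec ℤ d → Vec ℤ (suc d) → Vec ℤ d
  eliminate a p (b ∷ r) = (a *ₛ r) +ᵥ ((ℤ.- b) *ₛ p)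

  -- by Gaussian elimination
  orthogonal : ∀ {d} (rows : List (Vec ℤ d)) → length rows < d → ∃[ ψ ] ψ ≢ 0ᵥ × (∀ {r} → r ∈ rows → dot ψ r ≡ 0ℤ)
  orthogonal {suc d} rows len with Any.any? (λ r → ¬? (Vec.head r ℤ.≟ 0ℤ)) rows
  ... | no none = 1ℤ ∷ 0ᵥ , (λ ()) , first
    where
    zero-dot : ∀ {d} (r : Vec ℤ d) → dot 0ᵥ r ≡ 0ℤ
    zero-dot [] = refl
    zero-dot (a ∷ r) = trans (cong (ℤ._+ dot 0ᵥ r) (ℤ.*-zeroˡ a)) (trans (ℤ.+-identityˡ _) (zero-dot r))
    first : ∀ {r} → r ∈ rows → dot (1ℤ ∷ 0ᵥ) r ≡ 0ℤ
    first {a ∷ r} r∈ with decidable-stable (a ℤ.≟ 0ℤ) (λ a≢0 → none (lose r∈ a≢0))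
    ... | refl = trans (ℤ.+-identityˡ _) (zero-dot r)
  ... | yes some with find some
  ...   | a ∷ p , p∈ , a≢0 with remove-∈ p∈
  ...     | rest , len′ , others with orthogonal (map (eliminate a p) rest)
              (subst (_< d) (sym (length-map (eliminate a p) rest)) (ℕ.≤-pred (subst (λ l → suc l ≤ suc d) len′ len)))
  ...       | ψ , ψ≢0 , orth = (ℤ.- dot ψ p) ∷ (a *ₛ ψ) , nonzero , zero-on
    where
    dot-*ˡ : ∀ {d} c (u v : Vec ℤ d) → dot (c *ₛ u) v ≡ c ℤ.* dot u v
    dot-*ˡ c [] [] = sym (ℤ.*-zeroʳ c)
    dot-*ˡ c (x ∷ u) (y ∷ v) = trans (cong₂ ℤ._+_ (ℤ.*-assoc c x y) (dot-*ˡ c u v)) (sym (ℤ.*-distribˡ-+ c _ _))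
    nonzero : (ℤ.- dot ψ p) ∷ (a *ₛ ψ) ≢ 0ᵥ
    nonzero eq = ψ≢0 (cancel ψ (∷-injectiveʳ eq))
      where
      cancel : ∀ {d} (ψ : Vec ℤ d) → a *ₛ ψ ≡ 0ᵥ → ψ ≡ 0ᵥ
      cancel [] _ = refl
      cancel (x ∷ ψ) eq with ℤ.i*j≡0⇒i≡0∨j≡0 a (∷-injectiveˡ eq)
      ... | inj₁ a≡0 = contradiction a≡0 a≢0
      ... | inj₂ x≡0 = cong₂ _∷_ x≡0 (cancel ψ (∷-injectiveʳ eq))
    zero-on : ∀ {r} → r ∈ rows → dot ((ℤ.- dot ψ p) ∷ (a *ₛ ψ)) r ≡ 0ℤ
    zero-on {b ∷ r} r∈ with (b ∷ r) ≟ᵥ (a ∷ p)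
    ... | yes refl = trans (cong (λ z → (ℤ.- dot ψ p) ℤ.* a ℤ.+ z) (dot-*ˡ a ψ p)) (eq (dot ψ p) a)
      where
      eq : ∀ s a → (ℤ.- s) ℤ.* a ℤ.+ a ℤ.* s ≡ 0ℤ
      eq = solve-∀
    ... | no r≢ = begin
      (ℤ.- dot ψ p) ℤ.* b ℤ.+ dot (a *ₛ ψ) r           ≡⟨ cong (λ z → (ℤ.- dot ψ p) ℤ.* b ℤ.+ z) (dot-*ˡ a ψ r) ⟩
      (ℤ.- dot ψ p) ℤ.* b ℤ.+ a ℤ.* dot ψ r            ≡⟨ eq (dot ψ p) b a (dot ψ r) ⟩
      a ℤ.* dot ψ r ℤ.+ (ℤ.- b) ℤ.* dot ψ p            ≡⟨ cong₂ ℤ._+_ (ℤLaws.dot-*ʳ a ψ r) (ℤLaws.dot-*ʳ (ℤ.- b) ψ p) ⟨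
      dot ψ (a *ₛ r) ℤ.+ dot ψ ((ℤ.- b) *ₛ p)          ≡⟨ ℤLaws.dot-+ʳ ψ (a *ₛ r) ((ℤ.- b) *ₛ p) ⟨
      dot ψ (eliminate a p (b ∷ r))                        ≡⟨ orth (∈-map⁺ (eliminate a p) (others r∈ r≢)) ⟩
      0ℤ                                               ∎
      where
      open ≡-Reasoning
      eq : ∀ s b a t → (ℤ.- s) ℤ.* b ℤ.+ a ℤ.* t ≡ a ℤ.* t ℤ.+ (ℤ.- b) ℤ.* s
      eq = solve-∀

  module Horner {d : ℕ} (f : Vec ℤ d → Vec ℤ d) (add : Additive f) where
    open Additive add

    horner : List ℤ → Vec ℤ d → Vec ℤ d
    horner []       v = 0ᵥ
    horner (c ∷ cs) v = (c *ₛ v) +ᵥ f (horner cs v)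

    horner-∷ʳ : ∀ cs c v → horner (cs ∷ʳ c) v ≡ horner cs v +ᵥ (c *ₛ iter f (length cs) v)
    horner-∷ʳ [] c v = trans (cong ((c *ₛ v) +ᵥ_) 0-homo) (+ᵥ-comm (c *ₛ v) 0ᵥ)
    horner-∷ʳ (b ∷ cs) c v = begin
      (b *ₛ v) +ᵥ f (horner (cs ∷ʳ c) v)                                      ≡⟨ cong (λ w → (b *ₛ v) +ᵥ f w) (horner-∷ʳ cs c v) ⟩
      (b *ₛ v) +ᵥ f (horner cs v +ᵥ (c *ₛ iter f (length cs) v))              ≡⟨ cong ((b *ₛ v) +ᵥ_) (+-homo _ _) ⟩
      (b *ₛ v) +ᵥ (f (horner cs v) +ᵥ f (c *ₛ iter f (length cs) v))          ≡⟨ +ᵥ-assoc (b *ₛ v) _ _ ⟨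
      ((b *ₛ v) +ᵥ f (horner cs v)) +ᵥ f (c *ₛ iter f (length cs) v)          ≡⟨ cong (((b *ₛ v) +ᵥ f (horner cs v)) +ᵥ_) (*-homo c _) ⟩
      ((b *ₛ v) +ᵥ f (horner cs v)) +ᵥ (c *ₛ f (iter f (length cs) v))        ≡⟨ cong (λ w → ((b *ₛ v) +ᵥ f (horner cs v)) +ᵥ (c *ₛ w)) (iter-suc f (length cs) v) ⟨
      ((b *ₛ v) +ᵥ f (horner cs v)) +ᵥ (c *ₛ iter f (suc (length cs)) v)      ∎
      where open ≡-Reasoning

    horner-f : ∀ cs v → horner cs (f v) ≡ f (horner cs v)
    horner-f [] v = sym 0-homo
    horner-f (c ∷ cs) v = trans (cong₂ _+ᵥ_ (sym (*-homo c v)) (cong f (horner-f cs v))) (sym (+-homo _ _))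

    horner-iter : ∀ cs i v → horner cs (iter f i v) ≡ iter f i (horner cs v)
    horner-iter cs zero    v = refl
    horner-iter cs (suc i) v = trans (horner-iter cs i (f v)) (cong (iter f i) (horner-f cs v))

    dot-horner : ∀ ψ cs v → (∀ i → i < length cs → dot ψ (iter f i v) ≡ 0ℤ) → dot ψ (horner cs v) ≡ 0ℤ
    dot-horner ψ [] v orth = ℤLaws.dot-0ʳ ψ
    dot-horner ψ (c ∷ cs) v orth = trans (ℤLaws.dot-+ʳ ψ (c *ₛ v) (f (horner cs v))) (cong₂ ℤ._+_
      (trans (ℤLaws.dot-*ʳ c ψ v) (trans (cong (c ℤ.*_) (orth 0 (s≤s z≤n))) (ℤ.*-zeroʳ c)))
      (trans (cong (dot ψ) (sym (horner-f cs v))) (dot-horner ψ cs (f v) (λ i i< → orth (suc i) (s≤s i<)))))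

    leading : ∀ cs → All (_≡ 0ℤ) cs ⊎ ∃[ cs′ ] ∃[ c ] c ≢ 0ℤ × length cs′ < length cs × (∀ v → horner cs v ≡ horner (cs′ ∷ʳ c) v)
    leading [] = inj₁ []
    leading (c ∷ cs) with leading cs
    ... | inj₂ (cs′ , c′ , c′≢0 , len , eq) = inj₂ (c ∷ cs′ , c′ , c′≢0 , s≤s len , λ v → cong (λ w → (c *ₛ v) +ᵥ f w) (eq v))
    ... | inj₁ zeros with c ℤ.≟ 0ℤ
    ...   | yes c≡0 = inj₁ (c≡0 ∷ zeros)
    ...   | no c≢0 = inj₂ ([] , c , c≢0 , s≤s z≤n , λ v → cong (λ w → (c *ₛ v) +ᵥ f w) (vanish cs zeros v))
      where
      vanish : ∀ cs → All (_≡ 0ℤ) cs → ∀ v → horner cs v ≡ 0ᵥ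
      vanish [] [] v = refl
      vanish (_ ∷ cs) (refl ∷ zs) v = trans (cong₂ _+ᵥ_ (*ₛ-zero v) (trans (cong f (vanish cs zs v)) 0-homo)) (0+ᵥ 0ᵥ)

    upTo-iter : ℕ → Vec ℤ d → List (Vec ℤ d)
    upTo-iter zero    v = []
    upTo-iter (suc m) v = v ∷ upTo-iter m (f v)

    length-upTo-iter : ∀ m v → length (upTo-iter m v) ≡ m
    length-upTo-iter zero    v = refl
    length-upTo-iter (suc m) v = cong suc (length-upTo-iter m (f v))

    ∈-upTo-iter : ∀ {m i} v → i < m → iter f i v ∈ upTo-iter m v
    ∈-upTo-iter {i = zero}  v (s≤s _) = here refl
    ∈-upTo-iter {i = suc i} v (s≤s i<) = there (∈-upTo-iter (f v) i<)

    -- Cut a nontrivial relation at its last nonzero coefficient `c`, of index `m < d`. Some `ψ ≠ 0`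
    -- is orthogonal to the first `m` iterates of `v`; the relation, shifted along the orbit,
    -- extends this to all iterates, because `c` is not a zero divisor. This contradicts the
    -- assumption on annihilators.
    independent : (∀ {v} → v ≢ 0ᵥ → ∀ ψ → (∀ i → dot ψ (iter f i v) ≡ 0ℤ) → ψ ≡ 0ᵥ) →
      ∀ {v} → v ≢ 0ᵥ → ∀ cs → length cs ≤ d → horner cs v ≡ 0ᵥ → All (_≡ 0ℤ) cs
    independent no-annihilator {v} v≢0 cs len rel with leading cs
    ... | inj₁ zeros = zeros
    ... | inj₂ (cs′ , c , c≢0 , len′ , eq) with orthogonal (upTo-iter (length cs′) v)
          (subst (_< d) (sym (length-upTo-iter (length cs′) v)) (ℕ.<-≤-trans len′ len))
    ...   | ψ , ψ≢0 , orth = contradiction (no-annihilator v≢0 ψ all) ψ≢0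
      where
      m = length cs′
      next : ∀ j → (∀ i → i < m → dot ψ (iter f i (iter f j v)) ≡ 0ℤ) → dot ψ (iter f m (iter f j v)) ≡ 0ℤ
      next j low with ℤ.i*j≡0⇒i≡0∨j≡0 c (begin
          c ℤ.* dot ψ (iter f m w)                                       ≡⟨ ℤLaws.dot-*ʳ c ψ (iter f m w) ⟨
          dot ψ (c *ₛ iter f m w)                                        ≡⟨ ℤ.+-identityˡ _ ⟨
          0ℤ ℤ.+ dot ψ (c *ₛ iter f m w)                                 ≡⟨ cong (ℤ._+ dot ψ (c *ₛ iter f m w)) (dot-horner ψ cs′ w low) ⟨
          dot ψ (horner cs′ w) ℤ.+ dot ψ (c *ₛ iter f m w)               ≡⟨ ℤLaws.dot-+ʳ ψ (horner cs′ w) (c *ₛ iter f m w) ⟨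
          dot ψ (horner cs′ w +ᵥ (c *ₛ iter f m w))                      ≡⟨ cong (dot ψ) (horner-∷ʳ cs′ c w) ⟨
          dot ψ (horner (cs′ ∷ʳ c) w)                                    ≡⟨ cong (dot ψ) (trans (horner-iter (cs′ ∷ʳ c) j v) (cong (iter f j) (trans (sym (eq v)) rel))) ⟩
          dot ψ (iter f j 0ᵥ)                                            ≡⟨ cong (dot ψ) (Additive.0-homo (iter-Additive add j)) ⟩
          dot ψ 0ᵥ                                                       ≡⟨ ℤLaws.dot-0ʳ ψ ⟩
          0ℤ                                                             ∎)
        where
        open ≡-Reasoning
        w = iter f j v
      ... | inj₁ c≡0 = contradiction c≡0 c≢0
      ... | inj₂ p = p
      -- The invariant of the extension: `ψ` vanishes on the `m` consecutive iterates from the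
      -- `j`-th on, and `next` supplies the one that enters when the window moves.
      window : ∀ j i → i < m → dot ψ (iter f i (iter f j v)) ≡ 0ℤ
      window zero    i i<m = orth (∈-upTo-iter v i<m)
      window (suc j) i i<m with ℕ.m≤n⇒m<n∨m≡n i<m
      ... | inj₁ 1+i<m = trans (cong (λ w → dot ψ (iter f i w)) (iter-suc f j v)) (window j (suc i) 1+i<m)
      ... | inj₂ 1+i≡m = trans (cong (λ w → dot ψ (iter f i w)) (iter-suc f j v))
        (trans (cong (λ l → dot ψ (iter f l (iter f j v))) 1+i≡m) (next j (window j)))
      all : ∀ i → dot ψ (iter f i v) ≡ 0ℤ
      all i with ℕ.≤-total (suc i) m
      ... | inj₁ i<m = window 0 i i<m
      ... | inj₂ m≤1+i with ℕ.m≤n⇒m<n∨m≡n m≤1+i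
      ...   | inj₂ eq′ = window 0 i (ℕ.≤-reflexive (sym eq′))
      ...   | inj₁ m<1+i with ℕ.m≤n⇒∃[o]m+o≡n (ℕ.≤-pred m<1+i)
      ...     | o , refl = trans (cong (dot ψ) (iter-+ f m o v)) (next o (window o))

-- Determinants of matrices of operators, and the characteristic polynomial.

module CharacteristicPolynomial where

  open import Defs using (det; module ℤLinear)
  open import Data.Fin.Base using (Fin; zero; suc)
  open import Data.Integer.Base using (0ℤ; 1ℤ)
  open import Data.Integer.Tactic.RingSolver using (solve-∀)
  open import Data.Nat.Base as ℕ using (ℕ; zero; suc)
  import Data.Nat.Properties as ℕ
  open import Data.Unit.Base using (⊤; tt)
  open import Data.Vec.Base as Vec using (Vec; []; _∷_; lookup; removeAt; head; tail; map; zipWith; tabulate; _∷ʳ_)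
  open import Data.Vec.Properties using (map-∘; map-cong; lookup-map; ∷-injectiveˡ; ∷-injectiveʳ)
  open BoxVolumes using (0+ᵥ; +ᵥ0)
  open Vectors
  open DoublingConsequences using (iter; iter-suc)
  open Orbits

  open ℤLinear using (alternatingSum)

  altsum : ∀ {e} n → (Fin n → Vec ℤ e) → Vec ℤ e
  altsum zero    g = 0ᵥ
  altsum (suc n) g = g zero -ᵥ altsum n (λ i → g (suc i))

  module _ {e : ℕ} where

    altsum-cong : ∀ n {g h : Fin n → Vec ℤ e} → (∀ i → g i ≡ h i) → altsum n g ≡ altsum n h
    altsum-cong zero    eq = refl
    altsum-cong (suc n) eq = cong₂ _-ᵥ_ (eq zero) (altsum-cong n (λ i → eq (suc i)))

    altsum-0 : ∀ n {g : Fin n → Vec ℤ e} → (∀ i → g i ≡ 0ᵥ) → altsum n g ≡ 0ᵥ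
    altsum-0 zero    eq = refl
    altsum-0 (suc n) eq = trans (cong₂ _-ᵥ_ (eq zero) (altsum-0 n (λ i → eq (suc i)))) (-ᵥ-inverseʳ 0ᵥ)

    altsum-+ : ∀ n (g h : Fin n → Vec ℤ e) → altsum n (λ i → g i +ᵥ h i) ≡ altsum n g +ᵥ altsum n h
    altsum-+ zero    g h = sym (0+ᵥ 0ᵥ)
    altsum-+ (suc n) g h = trans (cong (λ z → (g zero +ᵥ h zero) -ᵥ z) (altsum-+ n _ _))
      (vsolve ((v₀ ⊕ v₁) ⊝ (v₂ ⊕ v₃)) ((v₀ ⊝ v₂) ⊕ (v₁ ⊝ v₃)) refl (g zero ∷ h zero ∷ altsum n (λ i → g (suc i)) ∷ altsum n (λ i → h (suc i)) ∷ []))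

    altsum-neg : ∀ n (g : Fin n → Vec ℤ e) → altsum n (λ i → -ᵥ g i) ≡ -ᵥ altsum n g
    altsum-neg zero    g = sym (neg-0 {0})
    altsum-neg (suc n) g = trans (cong (λ z → (-ᵥ g zero) -ᵥ z) (altsum-neg n _))
      (vsolve ((⊖ v₀) ⊝ (⊖ v₁)) (⊖ (v₀ ⊝ v₁)) refl (g zero ∷ altsum n (λ i → g (suc i)) ∷ []))

  altsum-homo : ∀ {d e} {φ : Vec ℤ d → Vec ℤ e} → Additive φ → ∀ n (g : Fin n → Vec ℤ d) → φ (altsum n g) ≡ altsum n (λ i → φ (g i))
  altsum-homo add zero    g = Additive.0-homo add
  altsum-homo {φ = φ} add (suc n) g = trans (Additive.sub-homo add (g zero) _) (cong (λ z → φ (g zero) -ᵥ z) (altsum-homo add n (λ i → g (suc i))))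

  -- double alternating sums over ordered pairs of distinct indices, the second index being
  -- taken in the list from which the first has been removed
  module _ {e : ℕ} where

    Grid : ℕ → Set
    Grid n = Fin (suc n) → Fin n → Vec ℤ e

    altsum² : ∀ n → Grid n → Vec ℤ e
    altsum² n g = altsum (suc n) (λ j → altsum n (g j))

    inner : ∀ {n} → Grid (suc n) → Grid n
    inner g j l = g (suc j) (suc l)

    -- In terms of the original indices, `g′` is `g` with the two indices exchanged. A pair that
    -- contains the index 0 appears as `(suc j , zero)` in one order and as `(zero , j)` in the
    -- other; pairs without 0 are left to the recursion.
    Transposed : ∀ n → Grid n → Grid n → Set
    Transposed zero    g g′ = ⊤
    Transposed (suc n) g g′ = (∀ j → g (suc j) zero ≡ g′ zero j) × (∀ j → g′ (suc j) zero ≡ g zero j) × Transposed n (inner g) (inner g′)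

    Symmetric : ∀ n → Grid n → Set
    Symmetric zero    g = ⊤
    Symmetric (suc n) g = (∀ j → g (suc j) zero ≡ g zero j) × Symmetric n (inner g)

    Symmetric-cong : ∀ n {g h : Grid n} → (∀ j l → g j l ≡ h j l) → Symmetric n g → Symmetric n h
    Symmetric-cong zero    eq s = tt
    Symmetric-cong (suc n) eq (s , t) = (λ j → trans (sym (eq (suc j) zero)) (trans (s j) (eq zero j))) ,
      Symmetric-cong n (λ j l → eq (suc j) (suc l)) t

    -- The pairs with index 0 contribute a first row minus a first column. Row and column change
    -- places under transposition, so these contributions cancel, and the inner grids cancel by
    -- induction.
    transposed-cancel : ∀ n g g′ → Transposed n g g′ → altsum² n g +ᵥ altsum² n g′ ≡ 0ᵥ
    transposed-cancel zero    g g′ _ = vsolve ((𝟘 ⊝ 𝟘) ⊕ (𝟘 ⊝ 𝟘)) 𝟘 refl []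
    transposed-cancel (suc n) g g′ (p , q , r) = begin
      altsum² (suc n) g +ᵥ altsum² (suc n) g′                     ≡⟨ cong₂ _+ᵥ_ (expand g) (expand g′) ⟩
      ((G -ᵥ altsum (suc n) (λ j → g (suc j) zero)) +ᵥ I) +ᵥ ((G′ -ᵥ altsum (suc n) (λ j → g′ (suc j) zero)) +ᵥ I′)
        ≡⟨ cong₂ (λ x y → ((G -ᵥ x) +ᵥ I) +ᵥ ((G′ -ᵥ y) +ᵥ I′)) (altsum-cong (suc n) p) (altsum-cong (suc n) q) ⟩
      ((G -ᵥ G′) +ᵥ I) +ᵥ ((G′ -ᵥ G) +ᵥ I′)                       ≡⟨ vsolve (((v₀ ⊝ v₁) ⊕ v₂) ⊕ ((v₁ ⊝ v₀) ⊕ v₃)) (v₂ ⊕ v₃) refl (G ∷ G′ ∷ I ∷ I′ ∷ []) ⟩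
      I +ᵥ I′                                                     ≡⟨ transposed-cancel n (inner g) (inner g′) r ⟩
      0ᵥ                                                          ∎
      where
      open ≡-Reasoning
      G = altsum (suc n) (g zero)
      G′ = altsum (suc n) (g′ zero)
      I = altsum² n (inner g)
      I′ = altsum² n (inner g′)
      expand : ∀ (g : Grid (suc n)) → altsum² (suc n) g ≡ (altsum (suc n) (g zero) -ᵥ altsum (suc n) (λ j → g (suc j) zero)) +ᵥ altsum² n (inner g)
      expand g = trans (cong (λ z → altsum (suc n) (g zero) -ᵥ z) (trans (altsum-+ (suc n) (λ j → g (suc j) zero) (λ j → -ᵥ altsum n (inner g j)))
          (cong (altsum (suc n) (λ j → g (suc j) zero) +ᵥ_) (altsum-neg (suc n) (λ j → altsum n (inner g j))))))
        (vsolve (v₀ ⊝ (v₁ ⊝ v₂)) ((v₀ ⊝ v₁) ⊕ v₂) refl (altsum (suc n) (g zero) ∷ altsum (suc n) (λ j → g (suc j) zero) ∷ altsum² n (inner g) ∷ []))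

  minor : ∀ {X : Set} {m k} → Vec (Vec X (suc m)) k → Fin (suc m) → Vec (Vec X m) k
  minor rows j = map (λ r → removeAt r j) rows

  -- Deleting two columns gives the same result in either order. The arbitrary `K` lets the
  -- induction set aside the first column when both deletions keep it.
  minor²-symmetric : ∀ {X : Set} {e k} n (K : Vec (Vec X n) k → Vec ℤ e) (rest : Vec (Vec X (suc (suc n))) k) →
    Symmetric (suc n) (λ j l → K (map (λ row → removeAt (removeAt row j) l) rest))
  minor²-symmetric {X} n K rest = (λ j → cong K (map-cong (first j) rest)) , deeper n K rest
    where
    first : ∀ {n} (j : Fin (suc n)) (row : Vec X (suc (suc n))) → removeAt (removeAt row (suc j)) zero ≡ removeAt (removeAt row zero) j
    first j (x ∷ y ∷ xs) = refl
    deeper : ∀ {e k} n (K : Vec (Vec X n) k → Vec ℤ e) rest → Symmetric n (inner (λ j l → K (map (λ row → removeAt (removeAt row j) l) rest)))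
    deeper zero    K rest = tt
    deeper (suc n) K rest = Symmetric-cong (suc n) (λ j l → cong K (rows j l rest))
      (minor²-symmetric n (λ M → K (zipWith _∷_ (map head rest) M)) (map tail rest))
      where
      rows : ∀ {k} (j : Fin (suc (suc n))) (l : Fin (suc n)) (rest : Vec (Vec X (suc (suc (suc n)))) k) →
        zipWith _∷_ (map head rest) (map (λ row → removeAt (removeAt row j) l) (map tail rest)) ≡
        map (λ row → removeAt (removeAt row (suc j)) (suc l)) rest
      rows j l [] = refl
      rows j l ((x ∷ y ∷ z ∷ xs) ∷ rest) = cong₂ _∷_ (one j) (rows j l rest)
        where
        one : ∀ j → x ∷ removeAt (removeAt (y ∷ z ∷ xs) j) l ≡ removeAt (removeAt (x ∷ y ∷ z ∷ xs) (suc j)) (suc l)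
        one zero    = refl
        one (suc j) = refl

  module OperatorDeterminant {d : ℕ} (f : Vec ℤ d → Vec ℤ d) (add : Additive f) where
    open Additive add
    open Horner f add

    private
      V : Set
      V = Vec ℤ d

    -- (a , b) stands for the operator a + b f
    op : ℤ × ℤ → V → V
    op (a , b) w = (a *ₛ w) +ᵥ (b *ₛ f w)

    op-Additive : ∀ x → Additive (op x)
    op-Additive (a , b) = record { +-homo = λ u v → trans
      (cong₂ _+ᵥ_ (*ₛ-distribˡ a u v) (trans (cong (b *ₛ_) (+-homo u v)) (*ₛ-distribˡ b (f u) (f v)))) (interchange {d} _ _ _ _) }

    op-comm : ∀ x y w → op x (op y w) ≡ op y (op x w)
    op-comm x@(a , b) y@(c , e) w = trans (expand a b c e) (trans (swap a b c e) (sym (expand c e a b)))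
      where
      expand : ∀ a b c e → op (a , b) (op (c , e) w) ≡ (((a ℤ.* c) *ₛ w) +ᵥ ((a ℤ.* e) *ₛ f w)) +ᵥ (((b ℤ.* c) *ₛ f w) +ᵥ ((b ℤ.* e) *ₛ f (f w)))
      expand a b c e = cong₂ _+ᵥ_
        (trans (*ₛ-distribˡ a _ _) (cong₂ _+ᵥ_ (sym (*ₛ-assoc a c w)) (sym (*ₛ-assoc a e (f w)))))
        (trans (cong (b *ₛ_) (trans (+-homo _ _) (cong₂ _+ᵥ_ (*-homo c w) (*-homo e (f w)))))
          (trans (*ₛ-distribˡ b _ _) (cong₂ _+ᵥ_ (sym (*ₛ-assoc b c (f w))) (sym (*ₛ-assoc b e (f (f w)))))))
      swap : ∀ a b c e → (((a ℤ.* c) *ₛ w) +ᵥ ((a ℤ.* e) *ₛ f w)) +ᵥ (((b ℤ.* c) *ₛ f w) +ᵥ ((b ℤ.* e) *ₛ f (f w))) ≡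
        (((c ℤ.* a) *ₛ w) +ᵥ ((c ℤ.* b) *ₛ f w)) +ᵥ (((e ℤ.* a) *ₛ f w) +ᵥ ((e ℤ.* b) *ₛ f (f w)))
      swap a b c e = trans (interchange {d} _ _ _ _) (trans
        (cong₂ _+ᵥ_ (cong₂ (λ x y → (x *ₛ w) +ᵥ (y *ₛ f w)) (ℤ.*-comm a c) (ℤ.*-comm b c)) (cong₂ (λ x y → (x *ₛ f w) +ᵥ (y *ₛ f (f w))) (ℤ.*-comm a e) (ℤ.*-comm b e))) refl)

    -- The determinant of a matrix whose entries are operators `a + b f`, given only by its action
    -- on vectors. It behaves like a determinant over a commutative ring because of `op-comm`.
    D : ∀ m → Vec (Vec (ℤ × ℤ) m) m → V → V
    D zero    []           w = w
    D (suc m) (row ∷ rows) w = altsum (suc m) (λ j → op (lookup row j) (D m (minor rows j) w))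

    D-Additive : ∀ m rows → Additive (D m rows)
    D-Additive zero    []           = record { +-homo = λ _ _ → refl }
    D-Additive (suc m) (row ∷ rows) = record { +-homo = λ u v → trans
      (altsum-cong (suc m) λ j → trans (cong (op (lookup row j)) (Additive.+-homo (D-Additive m (minor rows j)) u v))
        (Additive.+-homo (op-Additive (lookup row j)) _ _))
      (altsum-+ (suc m) (λ j → op (lookup row j) (D m (minor rows j) u)) (λ j → op (lookup row j) (D m (minor rows j) v))) }

    D-op : ∀ m rows x w → D m rows (op x w) ≡ op x (D m rows w)
    D-op zero    []           x w = refl
    D-op (suc m) (row ∷ rows) x w = trans
      (altsum-cong (suc m) λ j → trans (cong (op (lookup row j)) (D-op m (minor rows j) x w)) (op-comm (lookup row j) x _))
      (sym (altsum-homo (op-Additive x) (suc m) (λ j → op (lookup row j) (D m (minor rows j) w))))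

    D-swap : ∀ n r s rest w → D (suc (suc n)) (r ∷ s ∷ rest) w +ᵥ D (suc (suc n)) (s ∷ r ∷ rest) w ≡ 0ᵥ
    D-swap n r s rest w = trans (cong₂ _+ᵥ_ (expand r s) (expand s r))
      (transposed-cancel (suc n) (grid r s E) (grid s r E) (transposed n r s E (minor²-symmetric n (λ M → D n M w) rest)))
      where
      E : Grid (suc n)
      E j l = D n (map (λ row → removeAt (removeAt row j) l) rest) w
      grid : ∀ {n} → Vec (ℤ × ℤ) (suc (suc n)) → Vec (ℤ × ℤ) (suc (suc n)) → Grid {d} (suc n) → Grid (suc n)
      grid r s E j l = op (lookup r j) (op (lookup (removeAt s j) l) (E j l))
      expand : ∀ r s → D (suc (suc n)) (r ∷ s ∷ rest) w ≡ altsum² (suc n) (grid r s E)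
      expand r s = altsum-cong (suc (suc n)) λ j → trans
        (altsum-homo (op-Additive (lookup r j)) (suc n) (λ l → op (lookup (removeAt s j) l) (D n (minor (minor rest j) l) w)))
        (altsum-cong (suc n) λ l → cong (λ M → op (lookup r j) (op (lookup (removeAt s j) l) (D n M w))) (sym (map-∘ (λ r → removeAt r l) (λ r → removeAt r j) rest)))
      transposed : ∀ n r s (E : Grid (suc n)) → Symmetric (suc n) E → Transposed (suc n) (grid r s E) (grid s r E)
      transposed n (r₀ ∷ r₁ ∷ r) (s₀ ∷ s₁ ∷ s) E (sym₀ , sym₁) =
        (λ j → trans (op-comm (lookup (r₁ ∷ r) j) s₀ _) (cong (λ z → op s₀ (op (lookup (r₁ ∷ r) j) z)) (sym₀ j))) ,
        (λ j → trans (op-comm (lookup (s₁ ∷ s) j) r₀ _) (cong (λ z → op r₀ (op (lookup (s₁ ∷ s) j) z)) (sym₀ j))) ,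
        rest′ n r s E sym₁
        where
        rest′ : ∀ n r s (E : Grid (suc n)) → Symmetric n (inner E) →
          Transposed n (inner (grid (r₀ ∷ r₁ ∷ r) (s₀ ∷ s₁ ∷ s) E)) (inner (grid (s₀ ∷ s₁ ∷ s) (r₀ ∷ r₁ ∷ r) E))
        rest′ zero    r s E _ = tt
        rest′ (suc n) (r₂ ∷ r) (s₂ ∷ s) E sym₁ = transposed n (r₁ ∷ r₂ ∷ r) (s₁ ∷ s₂ ∷ s) (inner E) sym₁

    torsion-free : ∀ {e} (u : Vec ℤ e) → u +ᵥ u ≡ 0ᵥ → u ≡ 0ᵥ
    torsion-free [] _ = refl
    torsion-free (a ∷ u) eq = cong₂ _∷_ (zero-of a (∷-injectiveˡ eq)) (torsion-free u (∷-injectiveʳ eq))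
      where
      zero-of : ∀ a → a ℤ.+ a ≡ 0ℤ → a ≡ 0ℤ
      zero-of (ℤ.+ zero)  _ = refl

    -- If the first two rows agree, their exchange shows that twice the value is 0, and integer
    -- vectors are torsion-free. A copy further down is reached by exchanging the first two rows and
    -- expanding along the new first row, whose minors have a repeated row.
    D-repeated : ∀ m (rows : Vec (Vec (ℤ × ℤ) (suc m)) m) i w → D (suc m) (lookup rows i ∷ rows) w ≡ 0ᵥ
    D-repeated (suc m) (s ∷ rest) zero    w = torsion-free _ (D-swap m s s rest w)
    D-repeated (suc m) (s ∷ rest) (suc i) w = trans
      (+ᵥ-cancelʳ (D (suc (suc m)) (s ∷ lookup rest i ∷ rest) w) (trans (D-swap m (lookup rest i) s rest w)
        (sym (trans (cong (0ᵥ +ᵥ_) vanish) (0+ᵥ 0ᵥ)))))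
      refl
      where
      vanish : D (suc (suc m)) (s ∷ lookup rest i ∷ rest) w ≡ 0ᵥ
      vanish = altsum-0 (suc (suc m)) λ j → trans (cong (op (lookup s j)) (trans
          (cong (λ r → D (suc m) (r ∷ minor rest j) w) (sym (lookup-map i (λ r → removeAt r j) rest)))
          (D-repeated m (minor rest j) i w)))
        (Additive.0-homo (op-Additive (lookup s j)))

    columns : ∀ {k n} → Vec (Vec (ℤ × ℤ) n) k → Vec V k → Fin n → V
    columns []         []       j = 0ᵥ
    columns (r ∷ rows) (x ∷ xs) j = op (lookup r j) x +ᵥ columns rows xs j

    -- The adjugate argument: apply to the relation of each column its cofactor along the first row
    -- and add up with signs. The first row contributes `D` at `x`, every other row a determinant
    -- with a repeated row.
    D-columns : ∀ m r (R : Vec (Vec (ℤ × ℤ) (suc m)) m) x xs → (∀ j → columns (r ∷ R) (x ∷ xs) j ≡ 0ᵥ) → D (suc m) (r ∷ R) x ≡ 0ᵥ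
    D-columns m r R x xs zeros = begin
      D (suc m) (r ∷ R) x                                                        ≡⟨ altsum-cong (suc m) (λ j → sym (D-op m (minor R j) (lookup r j) x)) ⟩
      F (λ j → op (lookup r j) x)                                                ≡⟨ +ᵥ0 _ ⟨
      F (λ j → op (lookup r j) x) +ᵥ 0ᵥ                                          ≡⟨ cong (F (λ j → op (lookup r j) x) +ᵥ_) (others R xs (λ i → i , refl)) ⟨
      F (λ j → op (lookup r j) x) +ᵥ F (columns R xs)                            ≡⟨ F-+ (λ j → op (lookup r j) x) (columns R xs) ⟨
      F (columns (r ∷ R) (x ∷ xs))                                               ≡⟨ F-0 zeros ⟩
      0ᵥ                                                                         ∎
      where
      open ≡-Reasoning
      F : (Fin (suc m) → V) → V
      F u = altsum (suc m) (λ j → D m (minor R j) (u j))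
      F-+ : ∀ u v → F (λ j → u j +ᵥ v j) ≡ F u +ᵥ F v
      F-+ u v = trans (altsum-cong (suc m) (λ j → Additive.+-homo (D-Additive m (minor R j)) (u j) (v j))) (altsum-+ (suc m) (λ j → D m (minor R j) (u j)) (λ j → D m (minor R j) (v j)))
      F-0 : ∀ {u} → (∀ j → u j ≡ 0ᵥ) → F u ≡ 0ᵥ
      F-0 eq = altsum-0 (suc m) (λ j → trans (cong (D m (minor R j)) (eq j)) (Additive.0-homo (D-Additive m (minor R j))))
      others : ∀ {k} (rows : Vec (Vec (ℤ × ℤ) (suc m)) k) xs → (∀ i → ∃[ i′ ] lookup rows i ≡ lookup R i′) → F (columns rows xs) ≡ 0ᵥ
      others [] [] _ = F-0 (λ _ → refl)
      others (s ∷ rows) (y ∷ xs) from with from zero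
      ... | i′ , refl = begin
        F (columns (lookup R i′ ∷ rows) (y ∷ xs))                        ≡⟨ F-+ (λ j → op (lookup (lookup R i′) j) y) (columns rows xs) ⟩
        F (λ j → op (lookup (lookup R i′) j) y) +ᵥ F (columns rows xs)   ≡⟨ cong₂ _+ᵥ_
          (trans (altsum-cong (suc m) (λ j → D-op m (minor R j) (lookup (lookup R i′) j) y)) (D-repeated m R i′ y)) (others rows xs (λ i → from (suc i))) ⟩
        0ᵥ +ᵥ 0ᵥ                                                         ≡⟨ 0+ᵥ 0ᵥ ⟩
        0ᵥ                                                               ∎

    hornerᵥ : ∀ {n} → Vec ℤ n → V → V
    hornerᵥ []       v = 0ᵥ
    hornerᵥ (c ∷ cs) v = (c *ₛ v) +ᵥ f (hornerᵥ cs v)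

    hornerᵥ-Additive : ∀ {n} v → Additive {n} (λ cs → hornerᵥ cs v)
    hornerᵥ-Additive v = record { +-homo = go }
      where
      go : ∀ {n} (cs es : Vec ℤ n) → hornerᵥ (cs +ᵥ es) v ≡ hornerᵥ cs v +ᵥ hornerᵥ es v
      go [] [] = sym (0+ᵥ 0ᵥ)
      go (c ∷ cs) (e ∷ es) = trans (cong₂ _+ᵥ_ (*ₛ-distribʳ c e v) (trans (cong f (go cs es)) (+-homo _ _))) (interchange {d} _ _ _ _)

    hornerᵥ-∷ʳ : ∀ {n} (cs : Vec ℤ n) c v → hornerᵥ (cs ∷ʳ c) v ≡ hornerᵥ cs v +ᵥ (c *ₛ iter f n v)
    hornerᵥ-∷ʳ [] c v = trans (cong ((c *ₛ v) +ᵥ_) 0-homo) (+ᵥ-comm (c *ₛ v) 0ᵥ)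
    hornerᵥ-∷ʳ {suc n} (b ∷ cs) c v = trans (cong (λ w → (b *ₛ v) +ᵥ f w) (hornerᵥ-∷ʳ cs c v))
      (trans (cong ((b *ₛ v) +ᵥ_) (trans (+-homo _ _) (cong (f (hornerᵥ cs v) +ᵥ_) (trans (*-homo c _) (cong (c *ₛ_) (sym (iter-suc f n v)))))))
        (sym (+ᵥ-assoc (b *ₛ v) _ _)))

    times : ∀ {n} → ℤ × ℤ → Vec ℤ n → Vec ℤ (suc n)
    times (a , b) cs = (a *ₛ (cs ∷ʳ 0ℤ)) +ᵥ (b *ₛ (0ℤ ∷ cs))

    hornerᵥ-times : ∀ {n} x (cs : Vec ℤ n) v → hornerᵥ (times x cs) v ≡ op x (hornerᵥ cs v)
    hornerᵥ-times {n} (a , b) cs v = trans (Additive.+-homo (hornerᵥ-Additive v) (a *ₛ (cs ∷ʳ 0ℤ)) (b *ₛ (0ℤ ∷ cs))) (cong₂ _+ᵥ_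
      (trans (Additive.*-homo (hornerᵥ-Additive v) a (cs ∷ʳ 0ℤ)) (cong (a *ₛ_) (trans (hornerᵥ-∷ʳ cs 0ℤ v)
        (trans (cong (hornerᵥ cs v +ᵥ_) (*ₛ-zero (iter f n v))) (+ᵥ0 _)))))
      (trans (Additive.*-homo (hornerᵥ-Additive v) b (0ℤ ∷ cs)) (cong (b *ₛ_) (trans (cong (_+ᵥ f (hornerᵥ cs v)) (*ₛ-zero v)) (0+ᵥ _)))))

    -- Follows the recursion of `D` with `times` in place of `op`, so that `hornerᵥ` carries one to
    -- the other. Coefficients are listed from the constant term up, and the length is fixed even if
    -- leading ones vanish.
    charpoly : ∀ m → Vec (Vec (ℤ × ℤ) m) m → Vec ℤ (suc m)
    charpoly zero    []           = 1ℤ ∷ []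
    charpoly (suc m) (row ∷ rows) = altsum (suc m) (λ j → times (lookup row j) (charpoly m (minor rows j)))

    hornerᵥ-charpoly : ∀ m rows v → hornerᵥ (charpoly m rows) v ≡ D m rows v
    hornerᵥ-charpoly zero    []           v = trans (cong₂ _+ᵥ_ (*ₛ-one v) 0-homo) (+ᵥ0 v)
    hornerᵥ-charpoly (suc m) (row ∷ rows) v = trans
      (altsum-homo (hornerᵥ-Additive v) (suc m) (λ j → times (lookup row j) (charpoly m (minor rows j))))
      (altsum-cong (suc m) λ j → trans (hornerᵥ-times (lookup row j) (charpoly m (minor rows j)) v)
        (cong (op (lookup row j)) (hornerᵥ-charpoly m (minor rows j) v)))

    lst : ∀ {n} → Vec ℤ (suc n) → ℤ
    lst (x ∷ [])     = x
    lst (x ∷ y ∷ ys) = lst (y ∷ ys)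

    -- π picks the constant or the leading coefficient, and σ the corresponding part of an entry.
    module Coefficient (σ : ℤ × ℤ → ℤ) (π : ∀ {n} → Vec ℤ (suc n) → ℤ) (π-one : π (1ℤ ∷ []) ≡ 1ℤ) (π-0 : ∀ {n} → π (0ᵥ {suc n}) ≡ 0ℤ)
      (π-sub : ∀ {n} (u v : Vec ℤ (suc n)) → π (u -ᵥ v) ≡ π u ℤ.- π v) (π-times : ∀ {n} x (cs : Vec ℤ (suc n)) → π (times x cs) ≡ σ x ℤ.* π cs) where

      removeAt-map : ∀ {n} (r : Vec (ℤ × ℤ) (suc n)) j → removeAt (map σ r) j ≡ map σ (removeAt r j)
      removeAt-map (x ∷ r) zero = refl
      removeAt-map (x ∷ y ∷ r) (suc j) = cong (σ x ∷_) (removeAt-map (y ∷ r) j)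

      minor-map : ∀ {n k} (rows : Vec (Vec (ℤ × ℤ) (suc n)) k) j → map (λ r → removeAt r j) (map (map σ) rows) ≡ map (map σ) (minor rows j)
      minor-map rows j = trans (sym (map-∘ (λ r → removeAt r j) (map σ) rows)) (trans (map-cong (λ r → removeAt-map r j) rows) (map-∘ (map σ) (λ r → removeAt r j) rows))

      π-altsum : ∀ {m n} (row : Vec (ℤ × ℤ) n) (C : Fin n → Vec ℤ (suc m)) (h : Fin n → ℤ) → (∀ j → π (C j) ≡ h j) →
        π (altsum n (λ j → times (lookup row j) (C j))) ≡ alternatingSum (zipWith ℤ._*_ (map σ row) (tabulate h))
      π-altsum [] C h eq = π-0
      π-altsum (x ∷ row) C h eq = trans (π-sub (times x (C zero)) _) (cong₂ ℤ._-_
        (trans (π-times x (C zero)) (cong (σ x ℤ.*_) (eq zero))) (π-altsum row (λ j → C (suc j)) (λ j → h (suc j)) (λ j → eq (suc j))))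

      coefficient : ∀ m rows → π (charpoly m rows) ≡ det (map (map σ) rows)
      coefficient zero    []           = π-one
      coefficient (suc m) (row ∷ rows) = π-altsum row (λ j → charpoly m (minor rows j)) _
        (λ j → trans (coefficient m (minor rows j)) (cong det (sym (minor-map rows j))))

    head-coefficient : ∀ m rows → head (charpoly m rows) ≡ det (map (map proj₁) rows)
    head-coefficient = Coefficient.coefficient proj₁ head refl refl (λ { (a ∷ u) (b ∷ v) → refl }) λ { (a , b) (c ∷ cs) → eq a b c }
      where
      eq : ∀ a b c → a ℤ.* c ℤ.+ b ℤ.* 0ℤ ≡ a ℤ.* c
      eq = solve-∀

    lst-+ : ∀ {n} (u v : Vec ℤ (suc n)) → lst (u +ᵥ v) ≡ lst u ℤ.+ lst v
    lst-+ (a ∷ []) (b ∷ []) = refl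
    lst-+ (a ∷ a′ ∷ u) (b ∷ b′ ∷ v) = lst-+ (a′ ∷ u) (b′ ∷ v)

    lst-map : ∀ {n} (φ : ℤ → ℤ) (u : Vec ℤ (suc n)) → lst (map φ u) ≡ φ (lst u)
    lst-map φ (a ∷ []) = refl
    lst-map φ (a ∷ a′ ∷ u) = lst-map φ (a′ ∷ u)

    lst-∷ʳ : ∀ {n} (u : Vec ℤ n) c → lst (u ∷ʳ c) ≡ c
    lst-∷ʳ [] c = refl
    lst-∷ʳ (a ∷ []) c = refl
    lst-∷ʳ (a ∷ b ∷ u) c = lst-∷ʳ (b ∷ u) c

    last-coefficient : ∀ m rows → lst (charpoly m rows) ≡ det (map (map proj₂) rows)
    last-coefficient = Coefficient.coefficient proj₂ lst refl (λ {n} → zero-last {n})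
        (λ u v → trans (lst-+ u (-ᵥ v)) (cong (λ z → lst u ℤ.+ z) (lst-map (λ a → ℤ.- a) v))) times-last
      where
      zero-last : ∀ {n} → lst (0ᵥ {suc n}) ≡ 0ℤ
      zero-last {zero}  = refl
      zero-last {suc n} = zero-last {n}
      shift : ∀ {n} (cs : Vec ℤ (suc n)) → lst (0ℤ ∷ cs) ≡ lst cs
      shift (c ∷ cs) = refl
      times-last : ∀ {n} x (cs : Vec ℤ (suc n)) → lst (times x cs) ≡ proj₂ x ℤ.* lst cs
      times-last (a , b) cs = trans (lst-+ (a *ₛ (cs ∷ʳ 0ℤ)) (b *ₛ (0ℤ ∷ cs))) (trans (cong₂ ℤ._+_
        (trans (lst-map (a ℤ.*_) (cs ∷ʳ 0ℤ)) (trans (cong (a ℤ.*_) (lst-∷ʳ cs 0ℤ)) (ℤ.*-zeroʳ a)))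
        (trans (lst-map (b ℤ.*_) (0ℤ ∷ cs)) (cong (b ℤ.*_) (shift cs)))) (ℤ.+-identityˡ _))

-- The lattice spanned by an orbit, and division with digits in it.

module KrylovLattice where

  open import Defs using (Matrix; NoNontrivialInvariantSubspace; det; module ℤLinear)
  open import Data.Fin.Base using (Fin; zero; suc; toℕ)
  open import Data.Integer.Base using (0ℤ; 1ℤ; -1ℤ; ∣_∣)
  import Data.Integer.DivMod as ℤ
  open import Data.Integer.Tactic.RingSolver using (solve-∀)
  open import Data.Nat.Base as ℕ using (ℕ; zero; suc; _<_; _≤_)
  open import Data.Nat.Divisibility using (_∣_; divides; >⇒∤)
  import Data.Nat.Properties as ℕ
  open import Data.Product.Base using (Σ)
  open import Data.Vec.Base as Vec using (Vec; []; _∷_; lookup; head; tail; map; zipWith; tabulate; _∷ʳ_; toList; initLast)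
  open import Data.Vec.Properties using (map-∘; map-cong; lookup-map; lookup-zipWith; ∷-injectiveˡ; ∷-injectiveʳ; length-toList; lookup-replicate)
  open BoxVolumes using (0+ᵥ; +ᵥ0; axis)
  open Vectors
  open DoublingConsequences using (iter; iter-suc; iter-Additive)
  open Orbits
  open CharacteristicPolynomial

  open ℤLinear using (dot; _*ᵥ_; alternatingSum)

  identity : ∀ n → Vec (Vec ℤ n) n
  identity zero    = []
  identity (suc n) = (1ℤ ∷ 0ᵥ) ∷ map (0ℤ ∷_) (identity n)

  -identity : ∀ n → Vec (Vec ℤ n) n
  -identity zero    = []
  -identity (suc n) = (-1ℤ ∷ 0ᵥ) ∷ map (0ℤ ∷_) (-identity n)

  unit : ∀ {n} → Fin n → Vec ℤ n
  unit zero    = 1ℤ ∷ 0ᵥ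
  unit (suc i) = 0ℤ ∷ unit i

  column : ∀ {n k} → Fin n → Vec (Vec ℤ n) k → Vec ℤ k
  column j = map (λ r → lookup r j)

  combination-0∷ : ∀ {n k} (cs : Vec ℤ k) (xs : Vec (Vec ℤ n) k) → combination cs (map (0ℤ ∷_) xs) ≡ 0ℤ ∷ combination cs xs
  combination-0∷ [] [] = refl
  combination-0∷ (c ∷ cs) (x ∷ xs) = trans (cong ((c *ₛ (0ℤ ∷ x)) +ᵥ_) (combination-0∷ cs xs))
    (cong (_∷ ((c *ₛ x) +ᵥ combination cs xs)) (trans (ℤ.+-identityʳ _) (ℤ.*-zeroʳ c)))

  combination-identity : ∀ {n} (c : Vec ℤ n) → combination c (identity n) ≡ c
  combination-identity [] = refl
  combination-identity (c ∷ cs) = trans (cong ((c *ₛ (1ℤ ∷ 0ᵥ)) +ᵥ_) (trans (combination-0∷ cs (identity _)) (cong (0ℤ ∷_) (combination-identity cs))))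
    (cong₂ _∷_ (trans (ℤ.+-identityʳ _) (ℤ.*-identityʳ c)) (trans (cong (_+ᵥ cs) (*ₛ-0ᵥ c)) (0+ᵥ cs)))

  column-0∷ : ∀ {n k} j (M : Vec (Vec ℤ n) k) → column (suc j) (map (0ℤ ∷_) M) ≡ column j M
  column-0∷ j M = sym (map-∘ (λ r → lookup r (suc j)) (0ℤ ∷_) M)

  column-0 : ∀ {n k} (M : Vec (Vec ℤ n) k) → column zero (map (0ℤ ∷_) M) ≡ 0ᵥ
  column-0 []      = refl
  column-0 (r ∷ M) = cong (0ℤ ∷_) (column-0 M)

  column-‿identity : ∀ {n} (j : Fin n) → column j (-identity n) ≡ -ᵥ unit j
  column-‿identity {suc n} zero    = cong (-1ℤ ∷_) (trans (column-0 (-identity n)) (sym neg-0′))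
    where
    neg-0′ : ∀ {m} → -ᵥ (0ᵥ {m}) ≡ 0ᵥ
    neg-0′ {zero}  = refl
    neg-0′ {suc m} = cong (0ℤ ∷_) neg-0′
  column-‿identity {suc n} (suc j) = cong₂ _∷_ (lookup-replicate j 0ℤ) (trans (column-0∷ j (-identity n)) (column-‿identity j))

  dot-unit : ∀ {n} (r : Vec ℤ n) j → dot r (unit j) ≡ lookup r j
  dot-unit (a ∷ r) zero    = trans (cong₂ ℤ._+_ (ℤ.*-identityʳ a) (ℤLaws.dot-0ʳ r)) (ℤ.+-identityʳ a)
  dot-unit (a ∷ r) (suc j) = trans (cong (ℤ._+ dot r (unit j)) (ℤ.*-zeroʳ a)) (trans (ℤ.+-identityˡ _) (dot-unit r j))

  dot-0ˡ : ∀ {n} (u : Vec ℤ n) → dot 0ᵥ u ≡ 0ℤ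
  dot-0ˡ [] = refl
  dot-0ˡ (a ∷ u) = trans (cong (ℤ._+ dot 0ᵥ u) (ℤ.*-zeroˡ a)) (trans (ℤ.+-identityˡ _) (dot-0ˡ u))

  det-identity² : ∀ n → det (-identity n) ℤ.* det (-identity n) ≡ 1ℤ
  det-identity² zero = refl
  det-identity² (suc n) = begin
    det (-identity (suc n)) ℤ.* det (-identity (suc n))                 ≡⟨ cong₂ ℤ._*_ step step ⟩
    (ℤ.- det (-identity n)) ℤ.* (ℤ.- det (-identity n))                 ≡⟨ eq (det (-identity n)) ⟩
    det (-identity n) ℤ.* det (-identity n)                             ≡⟨ det-identity² n ⟩
    1ℤ                                                                  ∎
    where
    open ≡-Reasoning
    eq : ∀ x → (ℤ.- x) ℤ.* (ℤ.- x) ≡ x ℤ.* x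
    eq = solve-∀
    zeros : ∀ {m} (xs : Vec ℤ m) → alternatingSum (zipWith ℤ._*_ 0ᵥ xs) ≡ 0ℤ
    zeros [] = refl
    zeros (x ∷ xs) = trans (cong₂ (λ a b → a ℤ.+ ℤ.- b) (ℤ.*-zeroˡ x) (zeros xs)) refl
    removed : ∀ {m k} (M : Vec (Vec ℤ m) k) → map (λ r → Vec.removeAt r zero) (map (0ℤ ∷_) M) ≡ M
    removed [] = refl
    removed (r ∷ M) = cong (r ∷_) (removed M)
    step : det (-identity (suc n)) ≡ ℤ.- det (-identity n)
    step = trans (cong₂ (λ a b → -1ℤ ℤ.* a ℤ.+ ℤ.- b) (cong det (removed (-identity n))) (zeros {n} (tabulate λ j → det (map (λ r → Vec.removeAt r (suc j)) (map (0ℤ ∷_) (-identity n)))))) (eq′ (det (-identity n)))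
      where
      eq′ : ∀ x → -1ℤ ℤ.* x ℤ.+ ℤ.- 0ℤ ≡ ℤ.- x
      eq′ = solve-∀

  zip² : ∀ {n k} → Vec (Vec ℤ n) k → Vec (Vec ℤ n) k → Vec (Vec (ℤ × ℤ) n) k
  zip² = zipWith (zipWith _,_)

  map-proj₁-zip² : ∀ {n k} (M B : Vec (Vec ℤ n) k) → map (map proj₁) (zip² M B) ≡ M
  map-proj₁-zip² [] [] = refl
  map-proj₁-zip² (m ∷ M) (b ∷ B) = cong₂ _∷_ (row m b) (map-proj₁-zip² M B)
    where
    row : ∀ {n} (m b : Vec ℤ n) → map proj₁ (zipWith _,_ m b) ≡ m
    row [] [] = refl
    row (x ∷ m) (y ∷ b) = cong (x ∷_) (row m b)

  map-proj₂-zip² : ∀ {n k} (M B : Vec (Vec ℤ n) k) → map (map proj₂) (zip² M B) ≡ B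
  map-proj₂-zip² [] [] = refl
  map-proj₂-zip² (m ∷ M) (b ∷ B) = cong₂ _∷_ (row m b) (map-proj₂-zip² M B)
    where
    row : ∀ {n} (m b : Vec ℤ n) → map proj₂ (zipWith _,_ m b) ≡ b
    row [] [] = refl
    row (x ∷ m) (y ∷ b) = cong (y ∷_) (row m b)

  combination-homo : ∀ {d e n} {g : Vec ℤ d → Vec ℤ e} → Additive g → ∀ (cs : Vec ℤ n) xs → g (combination cs xs) ≡ combination cs (map g xs)
  combination-homo add [] [] = Additive.0-homo add
  combination-homo add (c ∷ cs) (x ∷ xs) = trans (Additive.+-homo add _ _) (cong₂ _+ᵥ_ (Additive.*-homo add c x) (combination-homo add cs xs))

  lookup-combination : ∀ {e n} (cs : Vec ℤ n) (xs : Vec (Vec ℤ e) n) j → lookup (combination cs xs) j ≡ dot (column j xs) cs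
  lookup-combination [] [] j = lookup-replicate j 0ℤ
  lookup-combination (c ∷ cs) (x ∷ xs) j = trans (lookup-zipWith ℤ._+_ j (c *ₛ x) (combination cs xs))
    (cong₂ ℤ._+_ (trans (lookup-map j (c ℤ.*_) x) (ℤ.*-comm c (lookup x j))) (lookup-combination cs xs j))

  lookup-0 : ∀ {n} (u : Vec ℤ n) → (∀ j → lookup u j ≡ 0ℤ) → u ≡ 0ᵥ
  lookup-0 [] _ = refl
  lookup-0 (a ∷ u) eq = cong₂ _∷_ (eq zero) (lookup-0 u (λ j → eq (suc j)))

  module Krylov {d₀ : ℕ} (L : Matrix ℤ (suc d₀)) (irreducible : NoNontrivialInvariantSubspace L) where
    private
      d : ℕ
      d = suc d₀
      V : Set
      V = Vec ℤ d

    f : V → V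
    f = L *ᵥ_

    f-Additive : Additive f
    f-Additive = *ᵥ-Additive L

    open Additive f-Additive
    open Horner f f-Additive using (horner; independent)
    open OperatorDeterminant f f-Additive

    private
      N : Vec (Vec (ℤ × ℤ) d) d
      N = zip² L (-identity d)

      cs : Vec ℤ (suc d)
      cs = charpoly d N

      g : V → V
      g = hornerᵥ cs

    columns-zip² : ∀ {n k} (M B : Vec (Vec ℤ n) k) (xs : Vec V k) j →
      columns (zip² M B) xs j ≡ combination (column j M) xs +ᵥ f (combination (column j B) xs)
    columns-zip² [] [] [] j = sym (trans (0+ᵥ _) 0-homo)
    columns-zip² (m ∷ M) (b ∷ B) (x ∷ xs) j = begin
      op (lookup (zipWith _,_ m b) j) x +ᵥ columns (zip² M B) xs j
        ≡⟨ cong₂ (λ p r → op p x +ᵥ r) (lookup-zipWith _,_ j m b) (columns-zip² M B xs j) ⟩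
      (p +ᵥ (lookup b j *ₛ f x)) +ᵥ (q +ᵥ f r)                          ≡⟨ interchange {d} p _ q (f r) ⟩
      (p +ᵥ q) +ᵥ ((lookup b j *ₛ f x) +ᵥ f r)                          ≡⟨ cong (λ y → (p +ᵥ q) +ᵥ (y +ᵥ f r)) (*-homo (lookup b j) x) ⟨
      (p +ᵥ q) +ᵥ (f (lookup b j *ₛ x) +ᵥ f r)                          ≡⟨ cong ((p +ᵥ q) +ᵥ_) (+-homo (lookup b j *ₛ x) r) ⟨
      (p +ᵥ q) +ᵥ f ((lookup b j *ₛ x) +ᵥ r)                            ∎
      where
      open ≡-Reasoning
      p = lookup m j *ₛ x
      q = combination (column j M) xs
      r = combination (column j B) xs

    -- `N` is the matrix `L - f I`. Its `j`-th column, applied to the standard basis, is the `j`-th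
    -- column of `L` minus `f (unit j)`, which is the same vector; this is the input of the adjugate
    -- argument.
    columns-zero : ∀ j → columns N (identity d) j ≡ 0ᵥ
    columns-zero j = begin
      columns N (identity d) j                                                       ≡⟨ columns-zip² L (-identity d) (identity d) j ⟩
      combination (column j L) (identity d) +ᵥ f (combination (column j (-identity d)) (identity d))
        ≡⟨ cong₂ (λ x y → x +ᵥ f y) (combination-identity (column j L)) (trans (combination-identity (column j (-identity d))) (column-‿identity j)) ⟩
      column j L +ᵥ f (-ᵥ unit j)                                                    ≡⟨ cong (column j L +ᵥ_) (neg-homo (unit j)) ⟩
      column j L -ᵥ f (unit j)                                                       ≡⟨ cong (λ x → column j L -ᵥ x) (map-cong (λ r → dot-unit r j) L) ⟩
      column j L -ᵥ column j L                                                       ≡⟨ -ᵥ-inverseʳ (column j L) ⟩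
      0ᵥ                                                                             ∎
      where open ≡-Reasoning

    private
      e₀ : V
      e₀ = 1ℤ ∷ 0ᵥ

      g-e₀ : ∀ rows → (∀ j → columns rows (identity d) j ≡ 0ᵥ) → hornerᵥ (charpoly d rows) e₀ ≡ 0ᵥ
      g-e₀ (r ∷ R) zeros = trans (hornerᵥ-charpoly d (r ∷ R) e₀) (D-columns d₀ r R e₀ _ zeros)

      g-f : ∀ {n} (cs : Vec ℤ n) w → hornerᵥ cs (f w) ≡ f (hornerᵥ cs w)
      g-f [] w = sym 0-homo
      g-f (c ∷ cs) w = trans (cong₂ _+ᵥ_ (sym (*-homo c w)) (cong f (g-f cs w))) (sym (+-homo _ _))

      g-iter : ∀ i w → g (iter f i w) ≡ iter f i (g w)
      g-iter zero    w = refl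
      g-iter (suc i) w = trans (g-iter i (f w)) (cong (iter f i) (g-f cs w))

      g-Additive : ∀ {n} (cs : Vec ℤ n) → Additive (hornerᵥ cs)
      g-Additive [] = record { +-homo = λ u v → sym (0+ᵥ 0ᵥ) }
      g-Additive (c ∷ cs) = record { +-homo = λ u v → trans
        (cong₂ _+ᵥ_ (*ₛ-distribˡ c u v) (trans (cong f (Additive.+-homo (g-Additive cs) u v)) (+-homo _ _))) (interchange {d} _ _ _ _) }

    -- The characteristic polynomial annihilates e₀, hence everything, by irreducibility.
    charpoly-annihilates : ∀ w → g w ≡ 0ᵥ
    charpoly-annihilates w = lookup-0 (g w) λ j → trans (coordinate j w) (trans (cong (λ ψ → dot ψ w) (vanish j)) (dot-0ˡ w))
      where
      ψ : Fin d → V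
      ψ j = column j (map g (identity d))
      coordinate : ∀ j w → lookup (g w) j ≡ dot (ψ j) w
      coordinate j w = trans (cong (λ u → lookup (g u) j) (sym (combination-identity w)))
        (trans (cong (λ u → lookup u j) (combination-homo (g-Additive cs) w (identity d))) (lookup-combination w (map g (identity d)) j))
      -- `D-columns` shows only that `g` kills the first basis vector `e₀`. As `g` commutes with
      -- `f`, each coordinate of `g` is then a functional that vanishes on the whole orbit of `e₀`.
      vanish : ∀ j → ψ j ≡ 0ᵥ
      vanish j = no-annihilator L irreducible {e₀} (λ ()) (ψ j) λ i → trans (sym (coordinate j (iter f i e₀)))
        (trans (cong (λ u → lookup u j) (trans (g-iter i e₀) (trans (cong (iter f i) (g-e₀ N columns-zero)) (Additive.0-homo (iter-Additive f-Additive i))))) (lookup-replicate j 0ℤ))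

    abstract
      -- The leading coefficient `c` is `det (-identity d)`, whose square is 1. Multiplication by
      -- `c` therefore solves for the `d`-th iterate over the integers, and it keeps the absolute
      -- value of the constant term, which is `det L`.
      cayley-hamilton : Σ V λ e → (∀ w → iter f d w ≡ hornerᵥ e w) × ∣ head e ∣ ≡ ∣ det L ∣
      cayley-hamilton with initLast cs
      ... | ini , c , eqn = (ℤ.- c) *ₛ ini , power , norm ini eqn
        where
        leading : c ≡ det (-identity d)
        leading = trans (sym (lst-∷ʳ ini c)) (trans (cong lst (sym eqn)) (trans (last-coefficient d N) (cong det (map-proj₂-zip² L (-identity d)))))
        c²≡1 : c ℤ.* c ≡ 1ℤ
        c²≡1 = trans (cong₂ ℤ._*_ leading leading) (det-identity² d)
        power : ∀ w → iter f d w ≡ hornerᵥ ((ℤ.- c) *ₛ ini) w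
        power w = begin
          iter f d w                                   ≡⟨ *ₛ-one _ ⟨
          1ℤ *ₛ iter f d w                             ≡⟨ cong (_*ₛ iter f d w) c²≡1 ⟨
          (c ℤ.* c) *ₛ iter f d w                      ≡⟨ *ₛ-assoc c c (iter f d w) ⟩
          c *ₛ (c *ₛ iter f d w)                       ≡⟨ cong (c *ₛ_) (+ᵥ-cancelˡ (hornerᵥ ini w) (trans (trans (sym (hornerᵥ-∷ʳ ini c w)) (trans (cong (λ u → hornerᵥ u w) (sym eqn)) (charpoly-annihilates w))) (sym (-ᵥ-inverseʳ _)))) ⟩
          c *ₛ (-ᵥ hornerᵥ ini w)                      ≡⟨ flip c (hornerᵥ ini w) ⟩
          (ℤ.- c) *ₛ hornerᵥ ini w                     ≡⟨ Additive.*-homo (hornerᵥ-Additive w) (ℤ.- c) ini ⟨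
          hornerᵥ ((ℤ.- c) *ₛ ini) w                   ∎
          where
          open ≡-Reasoning
          flip : ∀ {n} c (u : Vec ℤ n) → c *ₛ (-ᵥ u) ≡ (ℤ.- c) *ₛ u
          flip c [] = refl
          flip c (a ∷ u) = cong₂ _∷_ (eq c a) (flip c u)
            where
            eq : ∀ c a → c ℤ.* (ℤ.- a) ≡ (ℤ.- c) ℤ.* a
            eq = solve-∀
        norm : ∀ ini → cs ≡ ini ∷ʳ c → ∣ head ((ℤ.- c) *ₛ ini) ∣ ≡ ∣ det L ∣
        norm (a ∷ as) eq = begin
          ∣ (ℤ.- c) ℤ.* a ∣                ≡⟨ ℤ.abs-* (ℤ.- c) a ⟩
          ∣ ℤ.- c ∣ ℕ.* ∣ a ∣              ≡⟨ cong (ℕ._* ∣ a ∣) (trans (ℤ.∣-i∣≡∣i∣ c) (ℕ.m*n≡1⇒m≡1 ∣ c ∣ ∣ c ∣ (trans (sym (ℤ.abs-* c c)) (cong ∣_∣ c²≡1)))) ⟩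
          1 ℕ.* ∣ a ∣                      ≡⟨ ℕ.*-identityˡ ∣ a ∣ ⟩
          ∣ a ∣                            ≡⟨ cong (λ u → ∣ head u ∣) eq ⟨
          ∣ head cs ∣                      ≡⟨ cong ∣_∣ (trans (head-coefficient d N) (cong det (map-proj₁-zip² L (-identity d)))) ⟩
          ∣ det L ∣                        ∎
          where open ≡-Reasoning

    module Lattice (det≢0 : ∣ det L ∣ ≢ 0) where
      private
        e : V
        e = proj₁ cayley-hamilton
        ch : ∀ w → iter f d w ≡ hornerᵥ e w
        ch = proj₁ (proj₂ cayley-hamilton)
        q₀ : ℤ
        q₀ = head e
        es : Vec ℤ d₀
        es = tail e
        e≡ : e ≡ q₀ ∷ es
        e≡ with e
        ... | _ ∷ _ = refl
        k : ℕ
        k = ∣ det L ∣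
        q₀-norm : ∣ q₀ ∣ ≡ k
        q₀-norm = proj₂ (proj₂ cayley-hamilton)
        q₀≢0 : q₀ ≢ 0ℤ
        q₀≢0 q₀≡0 = det≢0 (trans (sym q₀-norm) (cong ∣_∣ q₀≡0))
        instance
          q₀-nonZero : ℤ.NonZero q₀
          q₀-nonZero = ℤ.≢-nonZero q₀≢0

      -- If `f w = 0`, Cayley-Hamilton leaves only its constant term, `q₀ w = 0`, and `q₀` is not
      -- zero because its absolute value is that of the determinant.
      f-injective : ∀ {u v} → f u ≡ f v → u ≡ v
      f-injective {u} {v} eq = trans (vsolve v₀ ((v₀ ⊝ v₁) ⊕ v₁) refl (u ∷ v ∷ [])) (trans (cong (_+ᵥ v) (kernel (u -ᵥ v)
          (trans (sub-homo u v) (trans (cong (λ x → x -ᵥ f v) eq) (-ᵥ-inverseʳ (f v)))))) (0+ᵥ v))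
        where
        kernel : ∀ w → f w ≡ 0ᵥ → w ≡ 0ᵥ
        kernel w fw≡0 = cancel w (begin
          q₀ *ₛ w                             ≡⟨ +ᵥ0 _ ⟨
          (q₀ *ₛ w) +ᵥ 0ᵥ                     ≡⟨ cong ((q₀ *ₛ w) +ᵥ_) (trans (cong (hornerᵥ es) fw≡0) (Additive.0-homo (g-Additive es))) ⟨
          (q₀ *ₛ w) +ᵥ hornerᵥ es (f w)       ≡⟨ cong ((q₀ *ₛ w) +ᵥ_) (g-f es w) ⟩
          hornerᵥ (q₀ ∷ es) w                 ≡⟨ cong (λ x → hornerᵥ x w) e≡ ⟨
          hornerᵥ e w                         ≡⟨ ch w ⟨
          iter f d₀ (f w)                     ≡⟨ cong (iter f d₀) fw≡0 ⟩
          iter f d₀ 0ᵥ                        ≡⟨ Additive.0-homo (iter-Additive f-Additive d₀) ⟩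
          0ᵥ                                  ∎)
          where
          open ≡-Reasoning
          cancel : ∀ {n} (u : Vec ℤ n) → q₀ *ₛ u ≡ 0ᵥ → u ≡ 0ᵥ
          cancel [] _ = refl
          cancel (a ∷ u) eq with ℤ.i*j≡0⇒i≡0∨j≡0 q₀ (∷-injectiveˡ eq)
          ... | inj₁ q≡0 = contradiction q≡0 q₀≢0
          ... | inj₂ a≡0 = cong₂ _∷_ a≡0 (cancel u (∷-injectiveʳ eq))

      remainder-unique : ∀ r r′ x x′ → (ℤ.+ r) ℤ.+ (0ℤ ℤ.+ x ℤ.* q₀) ≡ (ℤ.+ r′) ℤ.+ (0ℤ ℤ.+ x′ ℤ.* q₀) → r ≤ r′ → r′ < k → r ≡ r′
      remainder-unique r r′ x x′ eq r≤r′ r′<k with ℕ.m≤n⇒∃[o]m+o≡n r≤r′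
      ... | zero , refl = sym (ℕ.+-identityʳ r)
      ... | suc t , refl = contradiction (divides ∣ x ℤ.- x′ ∣ (trans (cong ∣_∣ gap) (trans (ℤ.abs-* (x ℤ.- x′) q₀) (cong (∣ x ℤ.- x′ ∣ ℕ.*_) q₀-norm))))
          (>⇒∤ (ℕ.≤-<-trans (ℕ.m≤n+m (suc t) r) r′<k))
        where
        eq₁ : ∀ t r → t ≡ (r ℤ.+ t) ℤ.- r
        eq₁ = solve-∀
        eq₃ : ∀ r r′ b → r′ ℤ.- r ≡ (r′ ℤ.+ (0ℤ ℤ.+ b)) ℤ.- r ℤ.- b
        eq₃ = solve-∀
        eq₄ : ∀ r x x′ q → (r ℤ.+ (0ℤ ℤ.+ x ℤ.* q)) ℤ.- r ℤ.- x′ ℤ.* q ≡ (x ℤ.- x′) ℤ.* q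
        eq₄ = solve-∀
        gap : ℤ.+ suc t ≡ (x ℤ.- x′) ℤ.* q₀
        gap = trans (eq₁ (ℤ.+ suc t) (ℤ.+ r)) (trans (cong (ℤ._- (ℤ.+ r)) (sym (ℤ.pos-+ r (suc t))))
          (trans (eq₃ (ℤ.+ r) (ℤ.+ (r ℕ.+ suc t)) (x′ ℤ.* q₀))
            (trans (cong (λ s → s ℤ.- (ℤ.+ r) ℤ.- x′ ℤ.* q₀) (sym eq)) (eq₄ (ℤ.+ r) x x′ q₀))))

      module _ {v : V} (v≢0 : v ≢ 0ᵥ) where

        kry : V → V
        kry y = hornerᵥ y v

        kry-Additive : Additive kry
        kry-Additive = hornerᵥ-Additive v

        kry-injective : ∀ {y z} → kry y ≡ kry z → y ≡ z
        kry-injective {y} {z} eq = trans (vsolve v₀ ((v₀ ⊝ v₁) ⊕ v₁) refl (y ∷ z ∷ [])) (trans (cong (_+ᵥ z) (vanish (y -ᵥ z)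
            (independent (no-annihilator L irreducible) v≢0 (toList (y -ᵥ z)) (ℕ.≤-reflexive (length-toList (y -ᵥ z)))
              (trans (list (y -ᵥ z)) (trans (Additive.sub-homo kry-Additive y z) (trans (cong (λ x → x -ᵥ kry z) eq) (-ᵥ-inverseʳ (kry z)))))))) (0+ᵥ z))
          where
          list : ∀ {n} (u : Vec ℤ n) → horner (toList u) v ≡ hornerᵥ u v
          list [] = refl
          list (a ∷ u) = cong (λ w → (a *ₛ v) +ᵥ f w) (list u)
          vanish : ∀ {n} (u : Vec ℤ n) → All (_≡ 0ℤ) (toList u) → u ≡ 0ᵥ
          vanish [] [] = refl
          vanish (a ∷ u) (refl ∷ zs) = cong (0ℤ ∷_) (vanish u zs)

        kry-axis : ∀ i l → kry (axis i l) ≡ (ℤ.+ l) *ₛ iter f (toℕ i) v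
        kry-axis i l = go i
          where
          zeros : ∀ n → hornerᵥ (0ᵥ {n}) v ≡ 0ᵥ
          zeros n = Additive.0-homo (hornerᵥ-Additive {n} v)
          go : ∀ {n} (i : Fin n) → hornerᵥ (axis i l) v ≡ (ℤ.+ l) *ₛ iter f (toℕ i) v
          go {suc n} zero = trans (cong (((ℤ.+ l) *ₛ v) +ᵥ_) (trans (cong f (zeros n)) 0-homo)) (+ᵥ0 _)
          go (suc i) = trans (cong₂ _+ᵥ_ (*ₛ-zero v) (trans (cong f (go i)) (*-homo (ℤ.+ l) _)))
            (trans (0+ᵥ _) (cong ((ℤ.+ l) *ₛ_) (sym (iter-suc f (toℕ i) v))))

        -- In orbit coordinates `f` acts as the companion matrix: a shift, with the overflow at the
        -- `d`-th iterate rewritten by Cayley-Hamilton.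
        companion : ∀ (ys : Vec ℤ d₀) x → f (kry (ys ∷ʳ x)) ≡ kry ((0ℤ ∷ ys) +ᵥ (x *ₛ e))
        companion ys x = begin
          f (hornerᵥ (ys ∷ʳ x) v)                                     ≡⟨ trans (cong (_+ᵥ f (hornerᵥ (ys ∷ʳ x) v)) (*ₛ-zero v)) (0+ᵥ _) ⟨
          hornerᵥ ((0ℤ ∷ ys) ∷ʳ x) v                                  ≡⟨ hornerᵥ-∷ʳ (0ℤ ∷ ys) x v ⟩
          hornerᵥ (0ℤ ∷ ys) v +ᵥ (x *ₛ iter f d v)                    ≡⟨ cong (λ w → hornerᵥ (0ℤ ∷ ys) v +ᵥ (x *ₛ w)) (ch v) ⟩
          hornerᵥ (0ℤ ∷ ys) v +ᵥ (x *ₛ hornerᵥ e v)                   ≡⟨ cong (hornerᵥ (0ℤ ∷ ys) v +ᵥ_) (Additive.*-homo kry-Additive x e) ⟨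
          hornerᵥ (0ℤ ∷ ys) v +ᵥ hornerᵥ (x *ₛ e) v                   ≡⟨ Additive.+-homo kry-Additive (0ℤ ∷ ys) (x *ₛ e) ⟨
          kry ((0ℤ ∷ ys) +ᵥ (x *ₛ e))                                 ∎
          where open ≡-Reasoning

        kry-digit : ∀ r → kry ((ℤ.+ r) ∷ 0ᵥ) ≡ (ℤ.+ r) *ₛ v
        kry-digit = kry-axis zero

        digit : V → ℕ
        digit z = head z ℤ.% q₀

        digit<k : ∀ z → digit z < k
        digit<k z = subst (digit z <_) q₀-norm (ℤ.n%d<d (head z) q₀)

        quotient : V → V
        quotient z = (tail z -ᵥ ((head z ℤ./ q₀) *ₛ es)) ∷ʳ (head z ℤ./ q₀)

        -- By `companion`, the image of `f` consists of the vectors whose constant coordinate is a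
        -- multiple of `q₀`. The remainder of that coordinate modulo `q₀` thus selects the coset;
        -- its quotient becomes the last coordinate of the preimage, and `es` corrects the others.
        division : ∀ z → kry z ≡ ((ℤ.+ digit z) *ₛ v) +ᵥ f (kry (quotient z))
        division z@(z₀ ∷ zs) = begin
          kry (z₀ ∷ zs)                                                                      ≡⟨ cong kry (cong₂ _∷_ first rest) ⟩
          kry (((ℤ.+ r) ∷ 0ᵥ) +ᵥ ((0ℤ ∷ (zs -ᵥ (q *ₛ es))) +ᵥ (q *ₛ (q₀ ∷ es))))             ≡⟨ Additive.+-homo kry-Additive ((ℤ.+ r) ∷ 0ᵥ) ((0ℤ ∷ (zs -ᵥ (q *ₛ es))) +ᵥ (q *ₛ (q₀ ∷ es))) ⟩
          kry ((ℤ.+ r) ∷ 0ᵥ) +ᵥ kry ((0ℤ ∷ (zs -ᵥ (q *ₛ es))) +ᵥ (q *ₛ (q₀ ∷ es)))           ≡⟨ cong₂ _+ᵥ_ (kry-digit r) (trans (cong (λ x → kry ((0ℤ ∷ (zs -ᵥ (q *ₛ es))) +ᵥ (q *ₛ x))) (sym e≡)) (sym (companion (zs -ᵥ (q *ₛ es)) q))) ⟩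
          ((ℤ.+ r) *ₛ v) +ᵥ f (kry (quotient z))                                             ∎
          where
          open ≡-Reasoning
          q = z₀ ℤ./ q₀
          r = z₀ ℤ.% q₀
          first : z₀ ≡ (ℤ.+ r) ℤ.+ (0ℤ ℤ.+ q ℤ.* q₀)
          first = trans (ℤ.a≡a%n+[a/n]*n z₀ q₀) (cong (λ x → (ℤ.+ r) ℤ.+ x) (sym (ℤ.+-identityˡ (q ℤ.* q₀))))
          rest : zs ≡ 0ᵥ +ᵥ ((zs -ᵥ (q *ₛ es)) +ᵥ (q *ₛ es))
          rest = vsolve v₀ (𝟘 ⊕ ((v₀ ⊝ v₁) ⊕ v₁)) refl (zs ∷ (q *ₛ es) ∷ [])

        expand : ∀ r ys x → ((ℤ.+ r) *ₛ v) +ᵥ f (kry (ys ∷ʳ x)) ≡ kry (((ℤ.+ r) ∷ 0ᵥ) +ᵥ ((0ℤ ∷ ys) +ᵥ (x *ₛ (q₀ ∷ es))))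
        expand r ys x = sym (trans (Additive.+-homo kry-Additive ((ℤ.+ r) ∷ 0ᵥ) ((0ℤ ∷ ys) +ᵥ (x *ₛ (q₀ ∷ es))))
          (cong₂ _+ᵥ_ (kry-digit r) (trans (cong (λ z → kry ((0ℤ ∷ ys) +ᵥ (x *ₛ z))) (sym e≡)) (sym (companion ys x)))))

        compose : ∀ r y → ∃[ z ] ((ℤ.+ r) *ₛ v) +ᵥ f (kry y) ≡ kry z
        compose r y with initLast y
        ... | ys , x , refl = ((ℤ.+ r) ∷ 0ᵥ) +ᵥ ((0ℤ ∷ ys) +ᵥ (x *ₛ (q₀ ∷ es))) , expand r ys x

        digit-unique : ∀ {r r′ y y′} → r < k → r′ < k → ((ℤ.+ r) *ₛ v) +ᵥ f (kry y) ≡ ((ℤ.+ r′) *ₛ v) +ᵥ f (kry y′) → r ≡ r′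
        digit-unique {r} {r′} {y} {y′} r< r′< eq = from (initLast y) (initLast y′) eq
          where
          compare : ∀ x x′ → (ℤ.+ r) ℤ.+ (0ℤ ℤ.+ x ℤ.* q₀) ≡ (ℤ.+ r′) ℤ.+ (0ℤ ℤ.+ x′ ℤ.* q₀) → r ≤ r′ ⊎ r′ ≤ r → r ≡ r′
          compare x x′ heads (inj₁ r≤r′) = remainder-unique r r′ x x′ heads r≤r′ r′<
          compare x x′ heads (inj₂ r′≤r) = sym (remainder-unique r′ r x′ x (sym heads) r′≤r r<)
          from : ∀ {y y′} → (∃[ ys ] ∃[ x ] y ≡ ys ∷ʳ x) → (∃[ ys ] ∃[ x ] y′ ≡ ys ∷ʳ x) →
            ((ℤ.+ r) *ₛ v) +ᵥ f (kry y) ≡ ((ℤ.+ r′) *ₛ v) +ᵥ f (kry y′) → r ≡ r′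
          from (ys , x , refl) (ys′ , x′ , refl) eq = compare x x′ (∷-injectiveˡ (kry-injective
            {((ℤ.+ r) ∷ 0ᵥ) +ᵥ ((0ℤ ∷ ys) +ᵥ (x *ₛ (q₀ ∷ es)))} {((ℤ.+ r′) ∷ 0ᵥ) +ᵥ ((0ℤ ∷ ys′) +ᵥ (x′ *ₛ (q₀ ∷ es)))}
            (trans (sym (expand r ys x)) (trans eq (expand r′ ys′ x′))))) (ℕ.≤-total r r′)

-- Cosets of the lattice chain, and the sumset at one level.

module CosetTower where

  open import Defs using (card; _⊞_)
  open import Data.Fin.Base using (Fin; toℕ)
  open import Data.List.Base using (List; []; _∷_; map; filter; length; concat; concatMap; upTo)
  open import Data.List.Properties using (length-map; length-upTo; length-++; map-∘; map-cong; map-concatMap)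
  open import Data.List.Membership.Propositional.Properties
  open import Data.Nat.Base using (ℕ; zero; suc; _+_; _*_; _^_; _∸_; _≤_; _<_; z≤n; s≤s; NonZero; >-nonZero; >-nonZero⁻¹)
  open import Data.Nat.Properties
  open import Data.Nat.Tactic.RingSolver using (solve-∀)
  open import Data.Vec.Base using (Vec; []; _∷_)
  open import Relation.Nullary using (¬¬-excluded-middle)
  open Cardinality
  open BrunnMinkowski using (_≟ᵥ_; module VCard; ∈-⊞⁺; ∈-⊞⁻; lines; brunn-minkowski; BoxBound)
  open BoxVolumes
  open Vectors
  open SumsetInequalities
  open DoublingConsequences

  -- All that the coset argument needs to know of `f` and the orbit of `v`; irreducibility and
  -- determinants do not occur below this interface.
  record Frame (d k : ℕ) : Set where
    field
      f             : Vec ℤ d → Vec ℤ d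
      add           : Additive f
      f-injective   : ∀ {u v} → f u ≡ f v → u ≡ v
      v             : Vec ℤ d
      kry           : Vec ℤ d → Vec ℤ d
      kry-Additive  : Additive kry
      kry-injective : ∀ {y z} → kry y ≡ kry z → y ≡ z
      kry-axis      : ∀ i l → kry (axis i l) ≡ (ℤ.+ l) *ₛ iter f (toℕ i) v
      digit         : Vec ℤ d → ℕ
      digit<k       : ∀ z → digit z < k
      quotient      : Vec ℤ d → Vec ℤ d
      division      : ∀ z → kry z ≡ ((ℤ.+ digit z) *ₛ v) +ᵥ f (kry (quotient z))
      compose       : ∀ r y → ∃[ z ] ((ℤ.+ r) *ₛ v) +ᵥ f (kry y) ≡ kry z
      digit-unique  : ∀ {r r′ y y′} → r < k → r′ < k → ((ℤ.+ r) *ₛ v) +ᵥ f (kry y) ≡ ((ℤ.+ r′) *ₛ v) +ᵥ f (kry y′) → r ≡ r′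

  module Cosets {d k : ℕ} (frame : Frame d k) where

    open Frame frame

    private
      V : Set
      V = Vec ℤ d

    -- A pair `(g , Y)` stands at level `j` for the points `g + Λ j y` with `y ∈ Y`. Storing
    -- coordinates instead of points lets the Brunn-Minkowski inequality be applied to `Y` at every
    -- level.
    Class : Set
    Class = V × List V

    size : Class → ℕ
    size cl = length (proj₂ cl)

    -- the elements of the lattice Λ j = fʲ ⟨v , f v , … , fᵈ⁻¹ v⟩
    Λ : ℕ → V → V
    Λ j y = iter f j (kry y)

    Λ-Additive : ∀ j → Additive (Λ j)
    Λ-Additive j = record { +-homo = λ u w → trans (cong (iter f j) (Additive.+-homo kry-Additive u w))
      (Additive.+-homo (iter-Additive add j) (kry u) (kry w)) }

    Λ-injective : ∀ j {y z} → Λ j y ≡ Λ j z → y ≡ z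
    Λ-injective j eq = kry-injective (iter-injective f-injective j eq)

    base : ℕ → V → ℕ → V
    base j g c = g +ᵥ ((ℤ.+ c) *ₛ iter f j v)

    iter-digit : ∀ j c w → iter f j (((ℤ.+ c) *ₛ v) +ᵥ w) ≡ ((ℤ.+ c) *ₛ iter f j v) +ᵥ iter f j w
    iter-digit j c w = trans (Additive.+-homo (iter-Additive add j) _ w) (cong (_+ᵥ iter f j w) (Additive.*-homo (iter-Additive add j) (ℤ.+ c) v))

    Λ-division : ∀ j g y → g +ᵥ Λ j y ≡ base j g (digit y) +ᵥ Λ (suc j) (quotient y)
    Λ-division j g y = trans (cong (λ w → g +ᵥ iter f j w) (division y))
      (trans (cong (g +ᵥ_) (iter-digit j (digit y) (f (kry (quotient y))))) (sym (+ᵥ-assoc g _ _)))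

    Incongruent : ℕ → V → V → Set
    Incongruent j g g′ = ∀ y y′ → g +ᵥ Λ j y ≢ g′ +ᵥ Λ j y′

    base-compose : ∀ j g c y → ∃[ z ] base j g c +ᵥ Λ (suc j) y ≡ g +ᵥ Λ j z
    base-compose j g c y with compose c y
    ... | z , eq = z , trans (+ᵥ-assoc g _ _) (cong (g +ᵥ_) (trans (sym (iter-digit j c (f (kry y)))) (cong (iter f j) eq)))

    incongruent-bases : ∀ {j g g′} c c′ → Incongruent j g g′ → Incongruent (suc j) (base j g c) (base j g′ c′)
    incongruent-bases {j} {g} {g′} c c′ apart y y′ eq with base-compose j g c y | base-compose j g′ c′ y′
    ... | z , eq₁ | z′ , eq₂ = apart z z′ (trans (sym eq₁) (trans eq eq₂))

    incongruent-digits : ∀ {j g c c′} → c < k → c′ < k → c ≢ c′ → Incongruent (suc j) (base j g c) (base j g c′)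
    incongruent-digits {j} {g} {c} {c′} c< c′< c≢ y y′ eq = c≢ (digit-unique c< c′< (iter-injective f-injective j
      (trans (iter-digit j c (f (kry y))) (trans (+ᵥ-cancelˡ g (trans (sym (+ᵥ-assoc g _ _)) (trans eq (+ᵥ-assoc g _ _)))) (sym (iter-digit j c′ (f (kry y′))))))))

    part : Class → ℕ → List V
    part cl c = map quotient (filter (λ y → digit y ≟ c) (proj₂ cl))

    -- Empty parts are kept, so every class has exactly `k` children, as `Splitting` requires, and
    -- the number of classes grows by exactly `k` per level, as `density` requires.
    children : ℕ → Class → List Class
    children j cl = map (λ c → base j (proj₁ cl) c , part cl c) (upTo k)

    length-children : ∀ j cl → length (children j cl) ≡ k
    length-children j cl = trans (length-map (λ c → base j (proj₁ cl) c , part cl c) (upTo k)) (length-upTo k)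

    one-digit : ∀ {m cs} → Unique cs → m ∈ cs → sum (map (λ c → indicator (m ≟ c)) cs) ≡ 1
    one-digit {m} {c ∷ cs} (c∉ ∷ u) m∈ with m ≟ c
    ... | yes refl = cong suc (none cs c∉)
      where
      none : ∀ cs → All (λ c′ → c ≢ c′) cs → sum (map (λ c′ → indicator (c ≟ c′)) cs) ≡ 0
      none [] [] = refl
      none (c′ ∷ cs) (p ∷ ps) with c ≟ c′
      ... | yes eq = contradiction eq p
      ... | no _  = none cs ps
    one-digit (c∉ ∷ u) (here eq)  | no ≢ = contradiction eq ≢
    one-digit (c∉ ∷ u) (there m∈) | no _ = one-digit u m∈

    sum-parts : ∀ Y → sum (map (λ c → length (filter (λ y → digit y ≟ c) Y)) (upTo k)) ≡ length Y
    sum-parts [] = zeros (upTo k)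
      where
      zeros : ∀ (cs : List ℕ) → sum (map (λ _ → 0) cs) ≡ 0
      zeros [] = refl
      zeros (_ ∷ cs) = zeros cs
    sum-parts (y ∷ Y) = trans (cong sum (map-cong step (upTo k)))
      (trans (sum-+ (λ c → indicator (digit y ≟ c)) (λ c → length (filter (λ y → digit y ≟ c) Y)) (upTo k))
        (cong₂ _+_ (one-digit (Unique.upTo⁺ k) (∈-upTo⁺ (digit<k y))) (sum-parts Y)))
      where
      step : ∀ c → length (filter (λ y → digit y ≟ c) (y ∷ Y)) ≡ indicator (digit y ≟ c) + length (filter (λ y → digit y ≟ c) Y)
      step c = trans (length-filter-sum (λ y → digit y ≟ c) (y ∷ Y)) (cong (indicator (digit y ≟ c) +_) (sym (length-filter-sum (λ y → digit y ≟ c) Y)))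

    sum-children : ∀ j cl → sum (map size (children j cl)) ≡ size cl
    sum-children j cl = trans (cong sum (trans (sym (map-∘ (upTo k))) (map-cong (λ c → length-map quotient (filter (λ y → digit y ≟ c) (proj₂ cl))) (upTo k)))) (sum-parts (proj₂ cl))

    ∈-part⁻ : ∀ {y c} cl → y ∈ part cl c → ∃[ z ] z ∈ proj₂ cl × y ≡ quotient z × digit z ≡ c
    ∈-part⁻ {c = c} cl y∈ with ∈-map⁻ quotient y∈
    ... | z , z∈ , refl with ∈-filter⁻ (λ y → digit y ≟ c) {xs = proj₂ cl} z∈
    ...   | z∈Y , eq = z , z∈Y , refl , eq

    unique-part : ∀ {c} cl → Unique (proj₂ cl) → Unique (part cl c)
    unique-part {c} cl u = Unique-map quotient inj (Unique.filter⁺ (λ y → digit y ≟ c) u)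
      where
      inj : ∀ {y z} → y ∈ filter (λ y → digit y ≟ c) (proj₂ cl) → z ∈ filter (λ y → digit y ≟ c) (proj₂ cl) → quotient y ≡ quotient z → y ≡ z
      inj {y} {z} y∈ z∈ eq = kry-injective (trans (division y) (trans
        (cong₂ (λ a q → ((ℤ.+ a) *ₛ v) +ᵥ f (kry q)) (trans (dig y∈) (sym (dig z∈))) eq) (sym (division z))))
        where
        dig : ∀ {y} → y ∈ filter (λ y → digit y ≟ c) (proj₂ cl) → digit y ≡ c
        dig y∈ = proj₂ (∈-filter⁻ (λ y → digit y ≟ c) {xs = proj₂ cl} y∈)

    -- The classes of A modulo Λ 0; congruence is decided classically.
    Partition : List V → List Class → Set
    Partition A C₀ = AllPairs (λ cl cl′ → Incongruent 0 (proj₁ cl) (proj₁ cl′)) C₀ × All (λ cl → proj₁ cl ∈ A) C₀ ×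
      (∀ {cl y} → cl ∈ C₀ → y ∈ proj₂ cl → (proj₁ cl +ᵥ Λ 0 y) ∈ A) × All (λ cl → Unique (proj₂ cl)) C₀ × sum (map size C₀) ≡ length A

    partition : ∀ A → Unique A → (∀ C₀ → Partition A C₀ → ⊥) → ⊥
    partition [] [] none = none [] ([] , [] , (λ ()) , [] , refl)
    partition (a ∷ A) (a∉ ∷ u) none = partition A u λ C₀ P → ¬¬-excluded-middle {A = ∃[ cl ] ∃[ y ] cl ∈ C₀ × a ≡ proj₁ cl +ᵥ kry y} λ
        { (yes (cl , y , cl∈ , eq)) → let (C₁ , P₁) = insert C₀ P cl∈ y eq in none C₁ P₁
        ; (no new) → none _ (fresh C₀ P new) }
      where
      fresh : ∀ C₀ → Partition A C₀ → ¬ (∃[ cl ] ∃[ y ] cl ∈ C₀ × a ≡ proj₁ cl +ᵥ kry y) → Partition (a ∷ A) ((a , 0ᵥ ∷ []) ∷ C₀)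
      fresh C₀ (apart , bases , members , uniq , total) new =
        All.tabulate (λ {cl} cl∈ y y′ eq → new (cl , y′ -ᵥ y , cl∈ , (begin
          a                                          ≡⟨ vsolve v₀ ((v₀ ⊕ v₁) ⊝ v₁) refl (a ∷ kry y ∷ []) ⟩
          (a +ᵥ kry y) -ᵥ kry y                      ≡⟨ cong (λ w → w -ᵥ kry y) eq ⟩
          (proj₁ cl +ᵥ kry y′) -ᵥ kry y              ≡⟨ +ᵥ-assoc (proj₁ cl) (kry y′) _ ⟩
          proj₁ cl +ᵥ (kry y′ -ᵥ kry y)              ≡⟨ cong (proj₁ cl +ᵥ_) (Additive.sub-homo kry-Additive y′ y) ⟨
          proj₁ cl +ᵥ kry (y′ -ᵥ y)                  ∎))) ∷ apart ,
        here refl ∷ All.map there bases ,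
        (λ { (here refl) (here refl) → here (trans (cong (a +ᵥ_) (Additive.0-homo kry-Additive)) (+ᵥ0 a))
           ; (there cl∈) y∈ → there (members cl∈ y∈) }) ,
        ([] ∷ []) ∷ uniq ,
        cong suc total
        where open ≡-Reasoning
      insert : ∀ C₀ → Partition A C₀ → ∀ {cl} → cl ∈ C₀ → ∀ y → a ≡ proj₁ cl +ᵥ kry y → ∃[ C₁ ] Partition (a ∷ A) C₁
      insert C₀ (apart , bases , members , uniq , total) cl∈ y a≡ = adjoin cl∈ ,
        AllPairs.map⁻ (subst (AllPairs (Incongruent 0)) (sym (same-bases cl∈)) (AllPairs.map⁺ apart)) ,
        All.map there (All.map⁻ (subst (All (_∈ A)) (sym (same-bases cl∈)) (All.map⁺ bases))) ,
        adjoin-members cl∈ a≡ members , adjoin-unique cl∈ a≡ members uniq , trans (adjoin-total cl∈) (cong suc total)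
        where
        adjoin : ∀ {cl C} → cl ∈ C → List Class
        adjoin {C = (g , Y) ∷ C} (here _)  = (g , y ∷ Y) ∷ C
        adjoin {C = c ∷ C}       (there p) = c ∷ adjoin p
        same-bases : ∀ {cl C} (p : cl ∈ C) → map proj₁ (adjoin p) ≡ map proj₁ C
        same-bases (here _)  = refl
        same-bases {C = c ∷ C} (there p) = cong (proj₁ c ∷_) (same-bases p)
        adjoin-total : ∀ {cl C} (p : cl ∈ C) → sum (map size (adjoin p)) ≡ suc (sum (map size C))
        adjoin-total (here _)  = refl
        adjoin-total {C = c ∷ C} (there p) = trans (cong (size c +_) (adjoin-total p)) (+-suc (size c) _)
        Members : List Class → List V → Set
        Members C A = ∀ {cl y} → cl ∈ C → y ∈ proj₂ cl → (proj₁ cl +ᵥ Λ 0 y) ∈ A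
        adjoin-members : ∀ {cl C} (p : cl ∈ C) → a ≡ proj₁ cl +ᵥ kry y → Members C A → Members (adjoin p) (a ∷ A)
        adjoin-members (here refl) a≡ m (here refl) (here refl) = here (sym a≡)
        adjoin-members (here refl) a≡ m (here refl) (there y∈) = there (m (here refl) y∈)
        adjoin-members (here refl) a≡ m (there cl∈) y∈ = there (m (there cl∈) y∈)
        adjoin-members (there p) a≡ m (here refl) y∈ = there (m (here refl) y∈)
        adjoin-members (there p) a≡ m (there cl∈) y∈ = adjoin-members p a≡ (λ q → m (there q)) cl∈ y∈
        adjoin-unique : ∀ {cl C} (p : cl ∈ C) → a ≡ proj₁ cl +ᵥ kry y → Members C A → All (λ cl → Unique (proj₂ cl)) C → All (λ cl → Unique (proj₂ cl)) (adjoin p)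
        adjoin-unique (here refl) a≡ m (u ∷ us) = (All.tabulate (λ { z∈ refl → All.lookup a∉ (m (here refl) z∈) a≡ }) ∷ u) ∷ us
        adjoin-unique (there p) a≡ m (u ∷ us) = u ∷ adjoin-unique p a≡ (λ q → m (there q)) us

    record Partitioned : Set where
      field
        A   : List V
        A-! : Unique A
        a₀  : V
        a₀∈ : a₀ ∈ A
        C₀  : List Class
        P   : Partition A C₀

    module Levels (1≤k : 1 ≤ k) (partitioned : Partitioned) where

      open Partitioned partitioned

      C : ℕ → List Class
      C zero    = C₀
      C (suc j) = concatMap (children j) (C j)

      apart : ∀ j → AllPairs (λ cl cl′ → Incongruent j (proj₁ cl) (proj₁ cl′)) (C j)
      apart zero    = proj₁ P
      apart (suc j) = AllPairs.concat⁺ (All.map⁺ (All.tabulate λ {cl} _ → within cl)) (AllPairs.map⁺ (AllPairs.map (λ {cl} {cl′} → across {cl} {cl′}) (apart j)))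
        where
        within : ∀ cl → AllPairs (λ cl cl′ → Incongruent (suc j) (proj₁ cl) (proj₁ cl′)) (children j cl)
        within cl = AllPairs.map⁺ (digits (upTo k) (All.tabulate ∈-upTo⁻) (Unique.upTo⁺ k))
          where
          digits : ∀ cs → All (_< k) cs → Unique cs → AllPairs (λ c c′ → Incongruent (suc j) (base j (proj₁ cl) c) (base j (proj₁ cl) c′)) cs
          digits [] [] [] = []
          digits (c ∷ cs) (c< ∷ cs<) (c∉ ∷ u) = All.tabulate (λ c′∈ → incongruent-digits {j} {proj₁ cl} c< (All.lookup cs< c′∈) (All.lookup c∉ c′∈)) ∷ digits cs cs< u
        across : ∀ {cl cl′} → Incongruent j (proj₁ cl) (proj₁ cl′) →
          All (λ x → All (λ y → Incongruent (suc j) (proj₁ x) (proj₁ y)) (children j cl′)) (children j cl)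
        across {cl} {cl′} p = All.map⁺ (All.tabulate λ {c} _ → All.map⁺ (All.tabulate λ {c′} _ → incongruent-bases {j} {proj₁ cl} {proj₁ cl′} c c′ p))

      ∈-C-suc : ∀ {j cl} → cl ∈ C (suc j) → ∃[ parent ] ∃[ c ] parent ∈ C j × c < k × cl ≡ (base j (proj₁ parent) c , part parent c)
      ∈-C-suc {j} cl∈ with find (∈-concatMap⁻ (children j) {xs = C j} cl∈)
      ... | parent , parent∈ , cl∈′ with ∈-map⁻ _ cl∈′
      ...   | c , c∈ , refl = parent , c , parent∈ , ∈-upTo⁻ c∈ , refl

      members : ∀ j {cl y} → cl ∈ C j → y ∈ proj₂ cl → (proj₁ cl +ᵥ Λ j y) ∈ A
      members zero    = proj₁ (proj₂ (proj₂ P))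
      members (suc j) cl∈ y∈ with ∈-C-suc {j} cl∈
      ... | parent , c , parent∈ , _ , refl with ∈-part⁻ parent y∈
      ...   | z , z∈ , refl , refl = subst (_∈ A) (Λ-division j (proj₁ parent) z) (members j parent∈ z∈)

      unique : ∀ j {cl} → cl ∈ C j → Unique (proj₂ cl)
      unique zero    cl∈ = All.lookup (proj₁ (proj₂ (proj₂ (proj₂ P)))) cl∈
      unique (suc j) cl∈ with ∈-C-suc {j} cl∈
      ... | parent , c , parent∈ , _ , refl = unique-part parent (unique j parent∈)

      blocks : ℕ → List (List ℕ)
      blocks j = map (λ cl → map size (children j cl)) (C j)

      sums : ∀ j → map sum (blocks j) ≡ map size (C j)
      sums j = trans (sym (map-∘ (C j))) (map-cong (sum-children j) (C j))

      link : ∀ j → map sum (blocks (suc j)) ≡ concat (blocks j)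
      link j = trans (sums (suc j)) (map-concatMap size (children j) (C j))

      length-C : ∀ j → length (C j) ≡ length C₀ * k ^ j
      length-C zero    = sym (*-identityʳ (length C₀))
      length-C (suc j) = trans (go (C j)) (trans (cong (_* k) (length-C j)) (trans (*-assoc (length C₀) (k ^ j) k) (cong (length C₀ *_) (*-comm (k ^ j) k))))
        where
        go : ∀ cls → length (concatMap (children j) cls) ≡ length cls * k
        go [] = refl
        go (cl ∷ cls) = trans (length-++ (children j cl)) (cong₂ _+_ (length-children j cl) (go cls))

      ∈⇒nonempty : ∀ {a : V} {as} → a ∈ as → 1 ≤ length as
      ∈⇒nonempty {as = _ ∷ _} _ = s≤s z≤n

      inhabited : ∀ j → ∃[ cl ] cl ∈ C j × 1 ≤ size cl
      inhabited zero = go C₀ (subst (1 ≤_) (sym (proj₂ (proj₂ (proj₂ (proj₂ P))))) (∈⇒nonempty a₀∈))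
        where
        go : ∀ cls → 1 ≤ sum (map size cls) → ∃[ cl ] cl ∈ cls × 1 ≤ size cl
        go ((g , []) ∷ cls) le = let (cl , cl∈ , p) = go cls le in cl , there cl∈ , p
        go ((g , y ∷ Y) ∷ cls) le = (g , y ∷ Y) , here refl , s≤s z≤n
      inhabited (suc j) with inhabited j
      ... | cl@(g , y ∷ Y) , cl∈ , _ = (base j g (digit y) , part cl (digit y)) ,
        ∈-concatMap⁺ (children j) (lose cl∈ (∈-map⁺ _ (∈-upTo⁺ (digit<k y)))) ,
        ∈⇒nonempty (∈-map⁺ quotient (∈-filter⁺ (λ z → digit z ≟ digit y) {xs = y ∷ Y} (here refl) refl))

      largest : ∀ j → ∃[ cl ] cl ∈ C j × (∀ {cl′} → cl′ ∈ C j → size cl′ ≤ size cl)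
      largest j = extremum {_≼_ = λ a b → size b ≤ size a} (λ a b → ≤-total (size b) (size a)) (λ p q → ≤-trans q p) (proj₁ (proj₂ (inhabited j)))

      B : ℕ → Class
      B j = proj₁ (largest j)

      b : ℕ → ℕ
      b j = size (B j)

      b>0 : ∀ j → 1 ≤ b j
      b>0 j = ≤-trans (proj₂ (proj₂ (inhabited j))) (proj₂ (proj₂ (largest j)) (proj₁ (proj₂ (inhabited j))))

      bounded : ∀ j {R} → R ∈ map size (C j) → R ≤ b j
      bounded j R∈ with ∈-map⁻ size R∈
      ... | cl , cl∈ , refl = proj₂ (proj₂ (largest j)) cl∈

      partitions : ClassSizes.Partitions k
      partitions = record
        { blocks   = blocks
        ; len      = λ j → All.map⁺ (All.tabulate λ {cl} _ → trans (length-map size (children j cl)) (length-children j cl))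
        ; link     = link
        ; b        = b
        ; bound    = λ j R∈ → bounded j (subst (_ ∈_) (sums j) R∈)
        ; attained = λ j → subst (b j ∈_) (sym (sums j)) (∈-map⁺ size (proj₁ (proj₂ (largest j))))
        ; b>0      = b>0 }

      module N = ClassSizes.Levels k 1≤k partitions

      n≡ : N.n ≡ length A
      n≡ = trans (cong sum (sums 0)) (proj₂ (proj₂ (proj₂ (proj₂ P))))

      card-class : ∀ j {cl} → cl ∈ C j → card (proj₂ cl) ≡ size cl
      card-class j cl∈ = VCard.card-Unique (unique j cl∈)

      n≤ : length A ≤ length C₀ * b 0
      n≤ = subst (_≤ length C₀ * b 0) (proj₂ (proj₂ (proj₂ (proj₂ P)))) (go C₀ (λ cl∈ → proj₂ (proj₂ (largest 0)) cl∈))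
        where
        go : ∀ cls → (∀ {cl} → cl ∈ cls → size cl ≤ b 0) → sum (map size cls) ≤ length cls * b 0
        go [] _ = z≤n
        go (cl ∷ cls) le = +-mono-≤ (le (here refl)) (go cls (λ p → le (there p)))

      -- If Ball t contains the sums of digits, then the index kʲ of Λ j in Λ 0 limits the size of a class.
      density : ∀ {Ball : ℕ → List V} s → 0ᵥ ∈ Ball 0 → (∀ {t t′} → t ≤ t′ → Ball t ⊆ Ball t′) →
        (∀ j → (∀ {i t z} c → i ≤ j → z ∈ Ball t → (z +ᵥ ((ℤ.+ c) *ₛ iter f i v)) ∈ Ball (c * s + t)) →
          length C₀ * (k ^ j * b j) ≤ card ((A ⊞ A) ⊞ Ball (j * (k * s))))
      density {Ball} s 0∈ mono j grow = ≤-trans (≤-reflexive count) (sum-card-disjoint _≟ᵥ_ _≟ᵥ_ (λ _ → proj₂ (B j)) (λ cl y → proj₁ cl +ᵥ (proj₁ (B j) +ᵥ Λ j y))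
          into (λ {cl} _ eq → Λ-injective j (+ᵥ-cancelˡ (proj₁ (B j)) (+ᵥ-cancelˡ (proj₁ cl) eq)))
          (AllPairs.map (λ {cl} {cl′} p y y′ eq → p y y′ (+ᵥ-cancelʳ (proj₁ (B j)) (trans (shift (proj₁ cl) y) (trans eq (sym (shift (proj₁ cl′) y′)))))) (apart j)))
        where
        shift : ∀ g y → (g +ᵥ Λ j y) +ᵥ proj₁ (B j) ≡ g +ᵥ (proj₁ (B j) +ᵥ Λ j y)
        shift g y = vsolve ((v₀ ⊕ v₁) ⊕ v₂) (v₀ ⊕ (v₂ ⊕ v₁)) refl (g ∷ Λ j y ∷ proj₁ (B j) ∷ [])
        count : length C₀ * (k ^ j * b j) ≡ sum (map (λ _ → card (proj₂ (B j))) (C j))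
        count = trans (sym (*-assoc (length C₀) (k ^ j) (b j))) (trans (cong₂ _*_ (sym (length-C j)) (sym (card-class j (proj₁ (proj₂ (largest j)))))) (go (C j)))
          where
          go : ∀ (cls : List Class) → length cls * card (proj₂ (B j)) ≡ sum (map (λ _ → card (proj₂ (B j))) cls)
          go [] = refl
          go (_ ∷ cls) = cong (card (proj₂ (B j)) +_) (go cls)
        -- A base is an element of `A` plus one scaled digit per level. A digit is less than `k` and
        -- each unit of it costs `s`, so the radius grows by at most `k * s` per level.
        bases : ∀ i → i ≤ j → ∀ {cl} → cl ∈ C i → ∃[ a ] ∃[ u ] a ∈ A × u ∈ Ball (i * (k * s)) × proj₁ cl ≡ a +ᵥ u
        bases zero    i≤ cl∈ = _ , 0ᵥ , All.lookup (proj₁ (proj₂ P)) cl∈ , 0∈ , sym (+ᵥ0 _)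
        bases (suc i) i≤ cl∈ with ∈-C-suc {i} cl∈
        ... | parent , c , parent∈ , c<k , refl with bases i (≤-trans (n≤1+n i) i≤) parent∈
        ...   | a , u , a∈ , u∈ , eq = a , u +ᵥ ((ℤ.+ c) *ₛ iter f i v) , a∈ ,
          mono (+-monoˡ-≤ (i * (k * s)) (*-monoˡ-≤ s (<⇒≤ c<k))) (grow c (≤-trans (n≤1+n i) i≤) u∈) ,
          trans (cong (_+ᵥ ((ℤ.+ c) *ₛ iter f i v)) eq) (+ᵥ-assoc a u _)
        into : ∀ {cl y} → cl ∈ C j → y ∈ proj₂ (B j) → (proj₁ cl +ᵥ (proj₁ (B j) +ᵥ Λ j y)) ∈ ((A ⊞ A) ⊞ Ball (j * (k * s)))
        into {cl} {y} cl∈ y∈ with bases j ≤-refl cl∈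
        ... | a , u , a∈ , u∈ , eq = subst (_∈ ((A ⊞ A) ⊞ Ball (j * (k * s))))
          (trans (vsolve ((v₀ ⊕ v₂) ⊕ v₁) ((v₀ ⊕ v₁) ⊕ v₂) refl (a ∷ u ∷ (proj₁ (B j) +ᵥ Λ j y) ∷ [])) (cong (_+ᵥ (proj₁ (B j) +ᵥ Λ j y)) (sym eq)))
          (∈-⊞⁺ (∈-⊞⁺ a∈ (members j (proj₁ (proj₂ (largest j))) y∈)) u∈)

      module Sum (j : ℕ) where

        T : Class → List V
        T cl = proj₂ cl ⊞ proj₂ (B j)

        f-Λ : ∀ t → f (Λ j t) ≡ Λ (suc j) t
        f-Λ t = sym (iter-suc f j (kry t))

        -- Since `f (Λ j t) = Λ (suc j) t`, the image of the largest class of level `j` lives in the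
        -- coordinates of level `suc j`. Its sum with a class there is the sumset `T cl` in
        -- coordinates, moved by both bases.
        place : Class → V → V
        place cl t = f (proj₁ (B j)) +ᵥ (proj₁ cl +ᵥ Λ (suc j) t)

        place-injective : ∀ cl {t t′} → place cl t ≡ place cl t′ → t ≡ t′
        place-injective cl eq = Λ-injective (suc j) (+ᵥ-cancelˡ (proj₁ cl) (+ᵥ-cancelˡ (f (proj₁ (B j))) eq))

        place-apart : AllPairs (λ cl cl′ → ∀ t t′ → place cl t ≢ place cl′ t′) (C (suc j))
        place-apart = AllPairs.map (λ p t t′ eq → p t t′ (+ᵥ-cancelˡ (f (proj₁ (B j))) eq)) (apart (suc j))

        place-∈ : ∀ {cl t} → cl ∈ C (suc j) → t ∈ T cl → place cl t ∈ (A ⊞ map f A)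
        place-∈ {cl} {t} cl∈ t∈ with ∈-⊞⁻ (proj₂ cl) (proj₂ (B j)) t∈
        ... | y , y′ , y∈ , y′∈ , refl = subst (_∈ (A ⊞ map f A)) (begin
            (g +ᵥ Λ (suc j) y) +ᵥ f (g′ +ᵥ Λ j y′)                       ≡⟨ cong ((g +ᵥ Λ (suc j) y) +ᵥ_) (trans (Additive.+-homo add g′ (Λ j y′)) (cong (f g′ +ᵥ_) (f-Λ y′))) ⟩
            (g +ᵥ Λ (suc j) y) +ᵥ (f g′ +ᵥ Λ (suc j) y′)                 ≡⟨ vsolve ((v₀ ⊕ v₁) ⊕ (v₂ ⊕ v₃)) (v₂ ⊕ (v₀ ⊕ (v₁ ⊕ v₃))) refl (g ∷ Λ (suc j) y ∷ f g′ ∷ Λ (suc j) y′ ∷ []) ⟩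
            f g′ +ᵥ (g +ᵥ (Λ (suc j) y +ᵥ Λ (suc j) y′))                 ≡⟨ cong (λ w → f g′ +ᵥ (g +ᵥ w)) (Additive.+-homo (Λ-Additive (suc j)) y y′) ⟨
            place cl (y +ᵥ y′)                                           ∎)
            (∈-⊞⁺ (members (suc j) cl∈ y∈) (∈-map⁺ f (members j (proj₁ (proj₂ (largest j))) y′∈)))
          where
          open ≡-Reasoning
          g = proj₁ cl
          g′ = proj₁ (B j)

        sum-card-T : sum (map (λ cl → card (T cl)) (C (suc j))) ≤ card (A ⊞ map f A)
        sum-card-T = sum-card-disjoint _≟ᵥ_ _≟ᵥ_ T place place-∈ (λ {cl} _ → place-injective cl) place-apart

        -- A ray along axis `i` of the coordinates is, in the original space, the progression of
        -- multiples of `v` moved by the iterate `suc j + toℕ i` of `f`. Adding it keeps different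
        -- classes apart, so all pieces fit into one sumset with the image of `Q`.
        sum-card-rays : ∀ {m Q} → (∀ {l} → l < m → ((ℤ.+ l) *ₛ v) ∈ Q) → ∀ i →
          sum (map (λ cl → card (T cl ⊞ ray m i)) (C (suc j))) ≤ card ((A ⊞ map f A) ⊞ map (iter f (suc j + toℕ i)) Q)
        sum-card-rays {m} {Q} Q∋ i = sum-card-disjoint _≟ᵥ_ _≟ᵥ_ (λ cl → T cl ⊞ ray m i) place into (λ {cl} _ → place-injective cl) place-apart
          where
          into : ∀ {cl t} → cl ∈ C (suc j) → t ∈ (T cl ⊞ ray m i) → place cl t ∈ ((A ⊞ map f A) ⊞ map (iter f (suc j + toℕ i)) Q)
          into {cl} cl∈ t∈ with ∈-⊞⁻ (T cl) (ray m i) t∈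
          ... | s , r , s∈ , r∈ , refl with ∈-map⁻ (axis i) r∈
          ...   | l , l∈ , refl = subst (_∈ ((A ⊞ map f A) ⊞ map (iter f (suc j + toℕ i)) Q)) (begin
            place cl s +ᵥ iter f (suc j + toℕ i) ((ℤ.+ l) *ₛ v)              ≡⟨ cong (place cl s +ᵥ_) (iter-+ f (suc j) (toℕ i) _) ⟩
            place cl s +ᵥ iter f (suc j) (iter f (toℕ i) ((ℤ.+ l) *ₛ v))     ≡⟨ cong (λ w → place cl s +ᵥ iter f (suc j) w) (trans (Additive.*-homo (iter-Additive add (toℕ i)) (ℤ.+ l) v) (sym (kry-axis i l))) ⟩
            place cl s +ᵥ Λ (suc j) (axis i l)                               ≡⟨ vsolve ((v₀ ⊕ (v₁ ⊕ v₂)) ⊕ v₃) (v₀ ⊕ (v₁ ⊕ (v₂ ⊕ v₃))) refl (f (proj₁ (B j)) ∷ proj₁ cl ∷ Λ (suc j) s ∷ Λ (suc j) (axis i l) ∷ []) ⟩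
            f (proj₁ (B j)) +ᵥ (proj₁ cl +ᵥ (Λ (suc j) s +ᵥ Λ (suc j) (axis i l)))  ≡⟨ cong (λ w → f (proj₁ (B j)) +ᵥ (proj₁ cl +ᵥ w)) (Additive.+-homo (Λ-Additive (suc j)) s (axis i l)) ⟨
            place cl (s +ᵥ axis i l)                                         ∎)
            (∈-⊞⁺ (place-∈ cl∈ s∈) (∈-map⁺ (iter f (suc j + toℕ i)) (Q∋ (∈-upTo⁻ l∈))))
            where open ≡-Reasoning

        module _ (p q : ℕ) .{{_ : NonZero p}} .{{_ : NonZero q}} (p≤ : p ^ d ≤ k * q ^ d) where

          w₁ : ℕ → ℕ
          w₁ a = (p + q) ^ d * (a * ((p + (p + q)) * b j ∸ p * (k * a)))

          w₂ : ℕ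
          w₂ = q ^ d * ((p + q) * b j)

          class-bound : ∀ {cl} → cl ∈ C (suc j) → w₁ (size cl) ≤ w₂ * (card (T cl) + lines (T cl))
          class-bound {g , []} cl∈ = ≤-trans (≤-reflexive (*-zeroʳ ((p + q) ^ d))) z≤n
          class-bound {g , y ∷ Y} cl∈ = go (y ∷ Y) (here refl) (card-class (suc j) cl∈)
            where
            go : ∀ Y → y ∈ Y → card Y ≡ length Y → w₁ (length Y) ≤ w₂ * (card (Y ⊞ proj₂ (B j)) + lines (Y ⊞ proj₂ (B j)))
            go Y y∈ eq = brunn-minkowski d Y (proj₂ (B j)) y∈ (proj₂ (nonempty (proj₂ (B j)) (b>0 j))) (w₁ (length Y)) w₂
              (subst₂ (λ a c → BoxBound d a c (w₁ (length Y)) w₂) (sym eq) (sym (card-class j (proj₁ (proj₂ (largest j)))))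
                (boxBound p q d k (length Y) (b j) (∈⇒nonempty y∈) (b>0 j) p≤))
              where
              nonempty : ∀ (Y : List V) → 1 ≤ length Y → ∃[ y ] y ∈ Y
              nonempty (y ∷ Y) _ = y , here refl

          mass : ∀ cls → (p + (p + q)) * b j * sum (map size cls) ≤
            sum (map (λ cl → size cl * ((p + (p + q)) * b j ∸ p * (k * size cl))) cls) + p * (k * sum (map (λ cl → ClassSizes.sq (size cl)) cls))
          mass [] = ≤-trans (≤-reflexive (*-zeroʳ ((p + (p + q)) * b j))) z≤n
          mass (cl ∷ cls) = begin
            X * (a + sum (map size cls))                 ≡⟨ *-distribˡ-+ X a _ ⟩
            X * a + X * sum (map size cls)               ≤⟨ +-mono-≤ one (mass cls) ⟩
            (a * (X ∸ p * (k * a)) + p * (k * (a * a))) + (S + p * (k * Q))   ≡⟨ eq (a * (X ∸ p * (k * a))) p k (a * a) S Q ⟩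
            (a * (X ∸ p * (k * a)) + S) + p * (k * (a * a + Q))               ∎
            where
            open ≤-Reasoning
            X = (p + (p + q)) * b j
            a = size cl
            S = sum (map (λ cl → size cl * ((p + (p + q)) * b j ∸ p * (k * size cl))) cls)
            Q = sum (map (λ cl → ClassSizes.sq (size cl)) cls)
            eq : ∀ y p k a² S Q → (y + p * (k * a²)) + (S + p * (k * Q)) ≡ (y + S) + p * (k * (a² + Q))
            eq = solve-∀
            eq′ : ∀ p k a → a * (p * (k * a)) ≡ p * (k * (a * a))
            eq′ = solve-∀
            one : X * a ≤ a * (X ∸ p * (k * a)) + p * (k * (a * a))
            one = begin
              X * a                                              ≡⟨ *-comm X a ⟩
              a * X                                              ≤⟨ *-monoʳ-≤ a (≤-trans (m≤n+m∸n X (p * (k * a))) (≤-reflexive (+-comm (p * (k * a)) _))) ⟩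
              a * ((X ∸ p * (k * a)) + p * (k * a))              ≡⟨ *-distribˡ-+ a _ _ ⟩
              a * (X ∸ p * (k * a)) + a * (p * (k * a))          ≡⟨ cong (a * (X ∸ p * (k * a)) +_) (eq′ p k a) ⟩
              a * (X ∸ p * (k * a)) + p * (k * (a * a))          ∎

          -- Over all parts the tangent-line bounds add up to at least `(2p + q) b n - p k Q`, with
          -- `Q` the sum of the squares of the part sizes. As the level does not fail, `k Q ≤ b n`,
          -- and `(p + q) b n` remains.
          level-sum : ¬ N.Fail j → (p + q) ^ d * length A ≤
            q ^ d * (sum (map (λ cl → card (T cl)) (C (suc j))) + sum (map (λ cl → lines (T cl)) (C (suc j))))
          level-sum ok = *-cancelʳ-≤ _ _ ((p + q) * b j) {{>-nonZero (*-mono-≤ {1} {p + q} (≤-trans (>-nonZero⁻¹ p) (m≤m+n p q)) (b>0 j))}} (begin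
            (p + q) ^ d * n * ((p + q) * b j)                    ≡⟨ e₁ ((p + q) ^ d) n (p + q) (b j) ⟩
            (p + q) ^ d * ((p + q) * b j * n)                    ≤⟨ *-monoʳ-≤ ((p + q) ^ d) enough ⟩
            (p + q) ^ d * sum (map u cls)                        ≡⟨ sum-* ((p + q) ^ d) u cls ⟨
            sum (map (λ cl → w₁ (size cl)) cls)                  ≤⟨ sum-mono (λ cl → w₁ (size cl)) (λ cl → w₂ * (card (T cl) + lines (T cl))) cls class-bound ⟩
            sum (map (λ cl → w₂ * (card (T cl) + lines (T cl))) cls)    ≡⟨ trans (sum-* w₂ (λ cl → card (T cl) + lines (T cl)) cls) (cong (w₂ *_) (sum-+ (λ cl → card (T cl)) (λ cl → lines (T cl)) cls)) ⟩
            w₂ * (sum (map (λ cl → card (T cl)) cls) + sum (map (λ cl → lines (T cl)) cls))   ≡⟨ e₂ (q ^ d) ((p + q) * b j) _ ⟩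
            q ^ d * (sum (map (λ cl → card (T cl)) cls) + sum (map (λ cl → lines (T cl)) cls)) * ((p + q) * b j)   ∎)
            where
            open ≤-Reasoning
            n = length A
            cls = C (suc j)
            u : Class → ℕ
            u cl = size cl * ((p + (p + q)) * b j ∸ p * (k * size cl))
            e₁ : ∀ P n r b → P * n * (r * b) ≡ P * (r * b * n)
            e₁ = solve-∀
            e₂ : ∀ Q r s → Q * r * s ≡ Q * s * r
            e₂ = solve-∀
            total : sum (map size cls) ≡ n
            total = trans (cong sum (sym (sums (suc j)))) (trans (N.total (suc j)) n≡)
            Q≡ : N.Q (suc j) ≡ sum (map (λ cl → ClassSizes.sq (size cl)) cls)
            Q≡ = trans (cong (λ s → sum (map ClassSizes.sq s)) (sums (suc j))) (cong sum (sym (map-∘ cls)))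
            enough : (p + q) * b j * n ≤ sum (map u cls)
            enough = +-cancelʳ-≤ (p * (b j * n)) _ _ (begin
              (p + q) * b j * n + p * (b j * n)                  ≡⟨ e₃ p q (b j) n ⟩
              (p + (p + q)) * b j * n                            ≡⟨ cong ((p + (p + q)) * b j *_) total ⟨
              (p + (p + q)) * b j * sum (map size cls)           ≤⟨ mass cls ⟩
              sum (map u cls) + p * (k * sum (map (λ cl → ClassSizes.sq (size cl)) cls))   ≡⟨ cong (λ z → sum (map u cls) + p * (k * z)) Q≡ ⟨
              sum (map u cls) + p * (k * N.Q (suc j))            ≤⟨ +-monoʳ-≤ (sum (map u cls)) (*-monoʳ-≤ p (≤-trans (≮⇒≥ ok) (≤-reflexive (cong (b j *_) n≡)))) ⟩
              sum (map u cls) + p * (b j * n)                    ∎)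
              where
              e₃ : ∀ p q b n → (p + q) * b * n + p * (b * n) ≡ (p + (p + q)) * b * n
              e₃ = solve-∀

          -- `lines-rays` bounds `m` times the line counts, so the whole estimate is multiplied by
          -- `m`; a long progression in `Q` makes the error `M / m` small.
          conclusion : ¬ N.Fail j → ∀ {m Q} M → (∀ {l} → l < m → ((ℤ.+ l) *ₛ v) ∈ Q) →
            (∀ (i : Fin d) → card ((A ⊞ map f A) ⊞ map (iter f (suc j + toℕ i)) Q) ≤ M) →
            m * ((p + q) ^ d * length A) ≤ q ^ d * (m * card (A ⊞ map f A) + 2 ^ d * M)
          conclusion ok {m} {Q} M Q∋ bounds = begin
            m * ((p + q) ^ d * length A)                     ≤⟨ *-monoʳ-≤ m (level-sum ok) ⟩
            m * (q ^ d * (ΣT + Σℓ))                          ≡⟨ e m (q ^ d) ΣT Σℓ ⟩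
            q ^ d * (m * ΣT + m * Σℓ)                        ≤⟨ *-monoʳ-≤ (q ^ d) (+-mono-≤ (*-monoʳ-≤ m sum-card-T) lines≤) ⟩
            q ^ d * (m * card (A ⊞ map f A) + 2 ^ d * M)     ∎
            where
            open ≤-Reasoning
            ΣT = sum (map (λ cl → card (T cl)) (C (suc j)))
            Σℓ = sum (map (λ cl → lines (T cl)) (C (suc j)))
            e : ∀ m Q T ℓ → m * (Q * (T + ℓ)) ≡ Q * (m * T + m * ℓ)
            e = solve-∀
            lines≤ : m * Σℓ ≤ 2 ^ d * M
            lines≤ = ≤-trans (m≤m+n (m * Σℓ) M) (subst (λ s → m * s + M ≤ 2 ^ d * M) (cong sum (sym (map-∘ (C (suc j)))))
              (lines-rays d (map T (C (suc j))) m M λ i → ≤-trans (≤-reflexive (cong sum (sym (map-∘ (C (suc j)))))) (≤-trans (sum-card-rays Q∋ i) (bounds i))))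

-- Choice of the parameters.

module ParameterChoice where

  open import Data.Nat.Base using (ℕ; zero; suc; _+_; _*_; _^_; _/_; _%_; _≤_; _<_; z≤n; s≤s; NonZero; >-nonZero)
  open import Data.Nat.DivMod using (m≡m%n+[m/n]*n; m%n<n; m/n*n≤m; m*n/n≡m; /-monoˡ-≤; m≥n⇒m/n>0)
  open import Data.Nat.Properties
  open import Data.Nat.Tactic.RingSolver using (solve-∀)

  ^-distribʳ-* : ∀ z a c → (a * c) ^ z ≡ a ^ z * c ^ z
  ^-distribʳ-* zero    a c = refl
  ^-distribʳ-* (suc z) a c = trans (cong (a * c *_) (^-distribʳ-* z a c)) (f a c (a ^ z) (c ^ z))
    where
    f : ∀ a c A C → a * c * (A * C) ≡ a * A * (c * C)
    f = solve-∀

  n<2^n : ∀ n → n < 2 ^ n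
  n<2^n zero    = s≤s z≤n
  n<2^n (suc n) = ≤-trans (s≤s (n<2^n n)) (≤-trans (+-monoˡ-≤ (2 ^ n) (m^n>0 2 n)) (≤-reflexive (cong (2 ^ n +_) (sym (+-identityʳ (2 ^ n))))))
  -- With `h = x / E` one has `x + 1 ≤ E (h + 1) ≤ E 2 ^ h`, and the `E`-th power of `2 ^ h` is at
  -- most `2 ^ x`.
  power≤exponential : ∀ E .{{_ : NonZero E}} x → suc x ^ E ≤ E ^ E * 2 ^ x
  power≤exponential E x = begin
    suc x ^ E                        ≤⟨ ^-monoˡ-≤ E base ⟩
    (E * 2 ^ h) ^ E                  ≡⟨ ^-distribʳ-* E E (2 ^ h) ⟩
    E ^ E * (2 ^ h) ^ E              ≡⟨ cong (E ^ E *_) (^-*-assoc 2 h E) ⟩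
    E ^ E * 2 ^ (h * E)              ≤⟨ *-monoʳ-≤ (E ^ E) (^-monoʳ-≤ 2 (m/n*n≤m x E)) ⟩
    E ^ E * 2 ^ x                    ∎
    where
    open ≤-Reasoning
    h = x / E
    base : suc x ≤ E * 2 ^ h
    base = begin
      suc x                     ≡⟨ cong suc (m≡m%n+[m/n]*n x E) ⟩
      suc (x % E) + h * E       ≤⟨ +-monoˡ-≤ (h * E) (m%n<n x E) ⟩
      E + h * E                 ≡⟨ *-comm (suc h) E ⟩
      E * suc h                 ≤⟨ *-monoʳ-≤ E (n<2^n h) ⟩
      E * 2 ^ h                 ∎

  -- The exponent `E = 2K + 1` has one factor `x + 1` to spare, which beyond the threshold
  -- `a ^ K * E ^ E` swallows both constants.
  exponential-dominates : ∀ a K → ∃[ x₀ ] (∀ x → x₀ ≤ x → (a * (suc x * suc x)) ^ K ≤ 2 ^ x)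
  exponential-dominates a K = a ^ K * E ^ E , λ x x₀≤x → *-cancelˡ-≤ (E ^ E) {{m^n≢0 E E}} (begin
    E ^ E * (a * (suc x * suc x)) ^ K           ≡⟨ cong (E ^ E *_) (trans (^-distribʳ-* K a (suc x * suc x)) (cong (a ^ K *_) (^-distribʳ-* K (suc x) (suc x)))) ⟩
    E ^ E * (a ^ K * (suc x ^ K * suc x ^ K))   ≡⟨ f (E ^ E) (a ^ K) _ ⟩
    a ^ K * E ^ E * (suc x ^ K * suc x ^ K)     ≤⟨ *-monoˡ-≤ (suc x ^ K * suc x ^ K) (m≤n⇒m≤1+n x₀≤x) ⟩
    suc x * (suc x ^ K * suc x ^ K)             ≡⟨ cong (suc x *_) (^-distribˡ-+-* (suc x) K K) ⟨
    suc x ^ E                                   ≤⟨ power≤exponential E x ⟩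
    E ^ E * 2 ^ x                               ∎)
    where
    open ≤-Reasoning
    E = suc (K + K)
    f : ∀ e a s → e * (a * s) ≡ a * e * s
    f = solve-∀

  log₂ : ∀ n → 1 ≤ n → ∃[ l ] 2 ^ l ≤ n × n < 2 ^ suc l
  log₂ (suc zero)      _ = 0 , s≤s z≤n , s≤s (s≤s z≤n)
  log₂ (suc (suc n)) _ with log₂ (suc n) (s≤s z≤n)
  ... | l , lo , hi with m≤n⇒m<n∨m≡n hi
  ...   | inj₁ lt = l , m≤n⇒m≤1+n lo , lt
  ...   | inj₂ eq = suc l , ≤-reflexive (sym eq) , subst (_< 2 ^ suc (suc l)) (sym eq) (^-monoʳ-< 2 (s≤s (s≤s z≤n)) (n<1+n (suc l)))

  2^-cancel-≤ : ∀ {a b n} → 2 ^ a ≤ n → n < 2 ^ suc b → a ≤ b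
  2^-cancel-≤ {a} {b} lo hi = ≮⇒≥ λ b<a → <⇒≱ hi (≤-trans (^-monoʳ-≤ 2 b<a) lo)

  module Constants (d k c : ℕ) (1≤c : 1 ≤ c) where

    -- Below, w ≈ log₂ n / (q₁ + 1), t = t₁ w, levels z i ≤ w and r ≈ n / 2ʷ⁺¹; q₁ is such that (C⁵)ᵗ (C⁷)ʷ = 2^(q₁ w),
    -- and t₁ is such that 2ᵗ = (C⁷)ʷ 4ʷ, which leaves a factor 2ʷ for the polynomial in t and another for n / r.
    C M q₁ t₁ Mq : ℕ
    C  = 2 ^ c
    M  = 256 * (k * k)
    t₁ = c * 7 + 2
    q₁ = c * 5 * t₁ + c * 7
    Mq = M * (q₁ + 4)

    -- `2 ^ d` comes from `lines-rays`, `C ^ 9` from `card-⊞iterBall`, `(C ^ 7) ^ d` from the up to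
    -- `d` further iterates along the axes, and 4 from `n ≤ 4 * 2 ^ w * r`.
    D₁ : ℕ
    D₁ = 4 * (2 ^ d * (C ^ 7) ^ d * C ^ 9)

    private
      -- The thresholds serve, in this order, `J ≤ w`, the polynomial bound in `slow-growth`, and
      -- the polynomial factor of `few-lines`.
      first  = exponential-dominates Mq 1
      second = exponential-dominates (suc (Mq * (k * 2)) * 2 ^ suc (c * 4)) (C ^ 5)
      third  = exponential-dominates (suc (2 * t₁)) (C ^ 5)

    u₀ N₀ : ℕ
    u₀ = proj₁ first + proj₁ second + proj₁ third
    N₀ = 2 ^ (suc q₁ * 2 ^ u₀)

    levels : ℕ → ℕ → ℕ
    levels z i = M * z * (2 + i)

    -- The inequalities feed, in turn, the pigeonhole for the short vector, the exclusion of long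
    -- small runs, the contradiction with exponential growth, the bound for the lines, and the
    -- saving `r ≤ n ^ (1 - 1 / (q₁ + 1))`.
    record Parameters (n : ℕ) : Set where
      field
        t i z r : ℕ
        enough-codes : (C ^ 5) ^ t * (C ^ 7) ^ levels z i < n
        double-log   : n < 2 ^ (2 ^ i)
        slow-growth  : suc (levels z i * (k * 2)) ^ (C ^ 5) * C ^ 4 < 2 ^ z
        few-lines    : 2 ^ d * (suc (2 * t) ^ (C ^ 5) * (C ^ 7) ^ (levels z i + d) * (C ^ 9 * n)) ≤ 2 ^ t * (D₁ * r)
        r-power      : r ^ suc q₁ ≤ n ^ q₁
        r-positive   : 1 ≤ r

    parameters : ∀ n → N₀ ≤ n → Parameters n
    parameters n N₀≤n with log₂ n (≤-trans (m^n>0 2 (suc q₁ * 2 ^ u₀)) N₀≤n)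
    ... | ℓ , lo , hi with log₂ (ℓ / suc q₁) (≤-trans (m^n>0 2 u₀) w≥)
      where
      w≥ : 2 ^ u₀ ≤ ℓ / suc q₁
      w≥ = ≤-trans (≤-reflexive (sym (trans (cong (_/ suc q₁) (*-comm (suc q₁) (2 ^ u₀))) (m*n/n≡m (2 ^ u₀) (suc q₁))))) (/-monoˡ-≤ (suc q₁) (2^-cancel-≤ {suc q₁ * 2 ^ u₀} {ℓ} {n} N₀≤n hi))
    ...   | u , lo′ , hi′ = record
      { t = t ; i = i ; z = u ; r = r
      ; enough-codes = codes ; double-log = dlog ; slow-growth = slow ; few-lines = few ; r-power = rpow ; r-positive = 1≤r }
      where
      open ≤-Reasoning
      w = ℓ / suc q₁
      t = t₁ * w
      -- Chosen so that `suc ℓ ≤ suc w * suc q₁ ≤ 2 ^ suc u * 2 ^ suc q₁ = 2 ^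
      -- i`, which is `double-log`.
      i = u + q₁ + 2
      J = levels u i
      instance
        2^w≢0 : NonZero (2 ^ suc w)
        2^w≢0 = m^n≢0 2 (suc w)
      -- The exponent `suc w` instead of `w` compensates the rounding in `ℓ / suc q₁`: it gives
      -- `n < 2 ^ (suc w * suc q₁)`, from which `r-power` follows.
      r = n / 2 ^ suc w
      w≥ : 2 ^ u₀ ≤ w
      w≥ = ≤-trans (≤-reflexive (sym (trans (cong (_/ suc q₁) (*-comm (suc q₁) (2 ^ u₀))) (m*n/n≡m (2 ^ u₀) (suc q₁))))) (/-monoˡ-≤ (suc q₁) (2^-cancel-≤ {suc q₁ * 2 ^ u₀} {ℓ} {n} N₀≤n hi))
      1≤w : 1 ≤ w
      1≤w = ≤-trans (m^n>0 2 u₀) w≥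
      u≥ : u₀ ≤ u
      u≥ = 2^-cancel-≤ {u₀} {u} {w} w≥ hi′
      u≤w : u ≤ w
      u≤w = ≤-trans (<⇒≤ (n<2^n u)) lo′
      qw≤ℓ : w * suc q₁ ≤ ℓ
      qw≤ℓ = m/n*n≤m ℓ (suc q₁)
      ℓ< : ℓ < suc w * suc q₁
      ℓ< = begin-strict
        ℓ                              ≡⟨ m≡m%n+[m/n]*n ℓ (suc q₁) ⟩
        ℓ % suc q₁ + w * suc q₁        <⟨ +-monoˡ-< (w * suc q₁) (m%n<n ℓ (suc q₁)) ⟩
        suc w * suc q₁                 ∎
      J≤′ : J ≤ Mq * (suc u * suc u)
      J≤′ = begin
        M * u * (2 + (u + q₁ + 2))                ≤⟨ *-mono-≤ (*-monoʳ-≤ M (n≤1+n u)) (≤-reflexive (e₁ u q₁)) ⟩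
        M * suc u * (u + (q₁ + 4))                ≤⟨ *-monoʳ-≤ (M * suc u) (+-monoˡ-≤ (q₁ + 4) (≤-trans (≤-reflexive (sym (*-identityʳ u))) (*-monoʳ-≤ u (≤-trans (s≤s z≤n) (m≤n+m 4 q₁))))) ⟩
        M * suc u * (u * (q₁ + 4) + (q₁ + 4))     ≡⟨ e₂ M u (q₁ + 4) ⟩
        M * (q₁ + 4) * (suc u * suc u)            ∎
        where
        e₁ : ∀ u q → 2 + (u + q + 2) ≡ u + (q + 4)
        e₁ = solve-∀
        e₂ : ∀ M u p → M * (1 + u) * (u * p + p) ≡ M * p * ((1 + u) * (1 + u))
        e₂ = solve-∀
      J≤w : J ≤ w
      J≤w = ≤-trans J≤′ (≤-trans (≤-reflexive (sym (*-identityʳ _))) (≤-trans (proj₂ first u (≤-trans (≤-trans (m≤m+n _ _) (m≤m+n _ _)) u≥)) lo′))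
      C^ : ∀ a b → (C ^ a) ^ b ≡ 2 ^ (c * a * b)
      C^ a b = trans (cong (_^ b) (^-*-assoc 2 c a)) (^-*-assoc 2 (c * a) b)
      C7J : (C ^ 7) ^ J ≤ 2 ^ (c * 7 * w)
      C7J = ≤-trans (≤-reflexive (C^ 7 J)) (^-monoʳ-≤ 2 (*-monoʳ-≤ (c * 7) J≤w))
      codes : (C ^ 5) ^ t * (C ^ 7) ^ J < n
      codes = begin-strict
        (C ^ 5) ^ t * (C ^ 7) ^ J                  ≤⟨ *-mono-≤ (≤-reflexive (C^ 5 t)) C7J ⟩
        2 ^ (c * 5 * t) * 2 ^ (c * 7 * w)          ≡⟨ ^-distribˡ-+-* 2 (c * 5 * t) (c * 7 * w) ⟨
        2 ^ (c * 5 * (t₁ * w) + c * 7 * w)         ≡⟨ cong (2 ^_) (e c t₁ w) ⟩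
        2 ^ (w * q₁)                               <⟨ ^-monoʳ-< 2 (s≤s (s≤s z≤n)) (≤-trans (≤-trans (+-monoˡ-≤ (w * q₁) 1≤w) (≤-reflexive (sym (*-suc w q₁)))) qw≤ℓ) ⟩
        2 ^ ℓ                                      ≤⟨ lo ⟩
        n                                          ∎
        where
        e : ∀ c t₁ w → c * 5 * (t₁ * w) + c * 7 * w ≡ w * (c * 5 * t₁ + c * 7)
        e = solve-∀
      dlog : n < 2 ^ (2 ^ i)
      dlog = <-≤-trans hi (^-monoʳ-≤ 2 (begin
        suc ℓ                          ≤⟨ ℓ< ⟩
        suc w * suc q₁                 ≤⟨ *-mono-≤ hi′ (<⇒≤ (n<2^n (suc q₁))) ⟩
        2 ^ suc u * 2 ^ suc q₁         ≡⟨ ^-distribˡ-+-* 2 (suc u) (suc q₁) ⟨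
        2 ^ (suc u + suc q₁)           ≡⟨ cong (2 ^_) (e u q₁) ⟩
        2 ^ i                          ∎))
        where
        e : ∀ u q → 1 + u + (1 + q) ≡ u + q + 2
        e = solve-∀
      slow : suc (J * (k * 2)) ^ (C ^ 5) * C ^ 4 < 2 ^ u
      slow = begin-strict
        suc (J * (k * 2)) ^ K * C ^ 4                    ≤⟨ *-mono-≤ (^-monoˡ-≤ K base) (≤-reflexive (^-*-assoc 2 c 4)) ⟩
        X ^ K * 2 ^ (c * 4)                              <⟨ *-monoʳ-< (X ^ K) {{m^n≢0 X K}} (^-monoʳ-< 2 (s≤s (s≤s z≤n)) (n<1+n (c * 4))) ⟩
        X ^ K * 2 ^ suc (c * 4)                          ≤⟨ *-monoʳ-≤ (X ^ K) (≤-trans (≤-reflexive (sym (^-identityʳ Y))) (^-monoʳ-≤ Y {{m^n≢0 2 (suc (c * 4))}} (m^n>0 C {{m^n≢0 2 c}} 5))) ⟩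
        X ^ K * Y ^ K                                    ≡⟨ ^-distribʳ-* K X Y ⟨
        (X * Y) ^ K                                      ≡⟨ cong (_^ K) (e (suc (Mq * (k * 2))) (suc u * suc u) Y) ⟩
        (suc (Mq * (k * 2)) * Y * (suc u * suc u)) ^ K   ≤⟨ proj₂ second u (≤-trans (≤-trans (m≤n+m _ (proj₁ first)) (m≤m+n _ _)) u≥) ⟩
        2 ^ u                                            ∎
        where
        K = C ^ 5
        X = suc (Mq * (k * 2)) * (suc u * suc u)
        Y = 2 ^ suc (c * 4)
        e : ∀ a s y → a * s * y ≡ a * y * s
        e = solve-∀
        e′ : ∀ q s k → 1 * s + q * s * k ≡ (1 + q * k) * s
        e′ = solve-∀
        base : suc (J * (k * 2)) ≤ X
        base = ≤-trans (+-mono-≤ {1} {1 * (suc u * suc u)} (s≤s z≤n) (*-monoˡ-≤ (k * 2) J≤′)) (≤-reflexive (e′ Mq (suc u * suc u) (k * 2)))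
      n<r : n < suc r * 2 ^ suc w
      n<r = begin-strict
        n                                         ≡⟨ m≡m%n+[m/n]*n n (2 ^ suc w) ⟩
        n % 2 ^ suc w + r * 2 ^ suc w             <⟨ +-monoˡ-< (r * 2 ^ suc w) (m%n<n n (2 ^ suc w)) ⟩
        suc r * 2 ^ suc w                         ∎
      suc-w≤ℓ : suc w ≤ ℓ
      suc-w≤ℓ = ≤-trans (≤-trans (+-mono-≤ 1≤w (≤-trans (≤-reflexive (sym (*-identityʳ w))) ≤-refl)) (≤-trans (+-monoʳ-≤ w (*-monoʳ-≤ w (≤-trans (≤-trans 1≤c (m≤m*n c 7)) (m≤n+m (c * 7) (c * 5 * t₁))))) (≤-reflexive (sym (*-suc w q₁))))) qw≤ℓ
      1≤r : 1 ≤ r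
      1≤r = m≥n⇒m/n>0 (≤-trans (^-monoʳ-≤ 2 suc-w≤ℓ) lo)
      n≤4 : n ≤ 4 * 2 ^ w * r
      n≤4 = begin
        n                          ≤⟨ <⇒≤ n<r ⟩
        suc r * (2 * 2 ^ w)        ≤⟨ *-monoˡ-≤ (2 * 2 ^ w) (+-monoˡ-≤ r 1≤r) ⟩
        (r + r) * (2 * 2 ^ w)      ≡⟨ e r (2 ^ w) ⟩
        4 * 2 ^ w * r              ∎
        where
        e : ∀ r W → (r + r) * (2 * W) ≡ 4 * W * r
        e = solve-∀
      few : 2 ^ d * (suc (2 * t) ^ (C ^ 5) * (C ^ 7) ^ (J + d) * (C ^ 9 * n)) ≤ 2 ^ t * (D₁ * r)
      few = begin
        2 ^ d * (suc (2 * t) ^ K * (C ^ 7) ^ (J + d) * (C ^ 9 * n))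
          ≤⟨ *-monoʳ-≤ (2 ^ d) (*-mono-≤ (*-mono-≤ poly (≤-trans (≤-reflexive (^-distribˡ-+-* (C ^ 7) J d)) (*-monoˡ-≤ ((C ^ 7) ^ d) C7J))) (*-monoʳ-≤ (C ^ 9) n≤4)) ⟩
        2 ^ d * (2 ^ w * (2 ^ (c * 7 * w) * (C ^ 7) ^ d) * (C ^ 9 * (4 * 2 ^ w * r)))
          ≡⟨ e (2 ^ d) (2 ^ w) (2 ^ (c * 7 * w)) ((C ^ 7) ^ d) (C ^ 9) r ⟩
        2 ^ (c * 7 * w) * (2 ^ w * 2 ^ w) * (D₁ * r)
          ≡⟨ cong (_* (D₁ * r)) (trans (cong (2 ^ (c * 7 * w) *_) (sym (^-distribˡ-+-* 2 w w))) (trans (sym (^-distribˡ-+-* 2 (c * 7 * w) (w + w))) (cong (2 ^_) (e′ c w)))) ⟩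
        2 ^ t * (D₁ * r)   ∎
        where
        K = C ^ 5
        e : ∀ a W B E F r → a * (W * (B * E) * (F * (4 * W * r))) ≡ B * (W * W) * (4 * (a * E * F) * r)
        e = solve-∀
        e′ : ∀ c w → c * 7 * w + (w + w) ≡ (c * 7 + 2) * w
        e′ = solve-∀
        e″ : ∀ t w → 2 * (t * w) ≡ 2 * t * w
        e″ = solve-∀
        poly : suc (2 * t) ^ K ≤ 2 ^ w
        poly = ≤-trans (^-monoˡ-≤ K (begin
            suc (2 * t)                          ≡⟨ cong suc (e″ t₁ w) ⟩
            1 + 2 * t₁ * w                       ≤⟨ +-mono-≤ {1} {suc w * suc w} (s≤s z≤n) (*-monoʳ-≤ (2 * t₁) (≤-trans (n≤1+n w) (m≤m*n (suc w) (suc w)))) ⟩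
            suc (2 * t₁) * (suc w * suc w)       ∎))
          (proj₂ third w (≤-trans (≤-trans (m≤n+m _ (proj₁ first + proj₁ second)) u≥) u≤w))
      rpow : r ^ suc q₁ ≤ n ^ q₁
      rpow = *-cancelʳ-≤ _ _ n {{>-nonZero (≤-trans (m^n>0 2 ℓ) lo)}} (begin
        r ^ suc q₁ * n                              ≤⟨ *-monoʳ-≤ (r ^ suc q₁) (≤-trans (<⇒≤ hi) (≤-trans (^-monoʳ-≤ 2 ℓ<) (≤-reflexive (sym (^-*-assoc 2 (suc w) (suc q₁)))))) ⟩
        r ^ suc q₁ * (2 ^ suc w) ^ suc q₁           ≡⟨ ^-distribʳ-* (suc q₁) r (2 ^ suc w) ⟨
        (r * 2 ^ suc w) ^ suc q₁                    ≤⟨ ^-monoˡ-≤ (suc q₁) (m/n*n≤m n (2 ^ suc w)) ⟩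
        n * n ^ q₁                                  ≡⟨ *-comm n (n ^ q₁) ⟩
        n ^ q₁ * n                                  ∎)

-- The estimate in natural numbers.

module IntegerBound where

  open import Defs using (card; _⊞_; _·_; Matrix; NoNontrivialInvariantSubspace; det; module ℤLinear; module CauchySequence)
  open import Data.Fin.Base using (Fin; toℕ)
  open import Data.Fin.Properties using (toℕ<n)
  open import Data.Integer.Base using (∣_∣)
  open import Data.List.Base using (List; []; _∷_; map; length; deduplicate)
  open import Data.List.Membership.Propositional.Properties using (∈-map⁺; ∈-map⁻)
  open import Data.Nat.Base using (ℕ; suc; _+_; _*_; _^_; _≤_; _<_; NonZero; >-nonZero; ≢-nonZero)
  open import Data.Nat.Properties
  open import Data.Nat.Tactic.RingSolver using (solve-∀)
  open import Data.Vec.Base using (Vec; []; _∷_)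
  open BrunnMinkowski using (_≟ᵥ_; module VCard; ∈-⊞⁺; ∈-⊞⁻)
  open Vectors
  open SumsetInequalities
  open DoublingConsequences
  open KrylovLattice
  open CosetTower
  open ParameterChoice

  module _ {d₀ : ℕ} (L : Matrix ℤ (suc d₀)) (irreducible : NoNontrivialInvariantSubspace L) (1≤k : 1 ≤ ∣ det L ∣) (c : ℕ) (1≤c : 1 ≤ c) where

    private
      d k : ℕ
      d = suc d₀
      k = ∣ det L ∣

      det≢0 : ∣ det L ∣ ≢ 0
      det≢0 eq = contradiction (subst (1 ≤_) eq 1≤k) λ ()

    open Krylov L irreducible
    open Lattice det≢0
    open Constants d k c 1≤c

    module _ (A : List (Vec ℤ d)) (A-! : Unique A) {a₀ : Vec ℤ d} (a₀∈ : a₀ ∈ A)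
      (small : card (A ⊞ map f A) ≤ C * card A) (params : Parameters (card A)) where

      open Parameters params

      private
        smallSumset : SmallSumset f
        smallSumset = record { add = f-Additive ; inj = f-injective ; A = A ; a₀ = a₀ ; a₀∈ = a₀∈ ; C = C ; small = small }

      open SmallDoubling smallSumset
        using (Ball; Ball-0; Ball-mono; Ball-multiple; Ball-dyadic; card-2A⊞Ball; card-⊞iterBall; short-vector)

      private
        J n : ℕ
        J = levels z i
        n = card A

        V : Set
        V = Vec ℤ d

        1≤n : 1 ≤ n
        1≤n = VCard.card>0 a₀∈

        n≡length : n ≡ length A
        n≡length = VCard.card-Unique A-!

      module _ {v : V} (v≢0 : v ≢ 0ᵥ) (doubles : ∀ {i} → i ≤ t → iter double i v ∈ (A ⊟ A) ⊟ (A ⊟ A))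
        (images : ∀ {i} → i ≤ J → iter f i v ∈ (A ⊟ A) ⊟ (A ⊟ A)) where

        private
          frame : Frame d k
          frame = record
            { f = f ; add = f-Additive ; f-injective = f-injective ; v = v
            ; kry = kry v≢0 ; kry-Additive = kry-Additive v≢0 ; kry-injective = kry-injective v≢0 ; kry-axis = kry-axis v≢0
            ; digit = digit v≢0 ; digit<k = digit<k v≢0 ; quotient = quotient v≢0 ; division = division v≢0 ; compose = compose v≢0
            ; digit-unique = λ {r} {r′} {y} {y′} → digit-unique v≢0 {r} {r′} {y} {y′} }

          module K = Cosets frame

        module _ (C₀ : List K.Class) (P : K.Partition A C₀) where

          private
            partitioned : K.Partitioned
            partitioned = record { A = A ; A-! = A-! ; a₀ = a₀ ; a₀∈ = a₀∈ ; C₀ = C₀ ; P = P }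

            module T = K.Levels 1≤k partitioned

          -- Both `density` and `n ≤ length C₀ * b 0` contain the number of classes of level 0,
          -- about which nothing is known; it cancels.
          slow : k ^ J * T.b J < 2 ^ z * T.b 0
          slow = ≤-<-trans (*-cancelˡ-≤ (length C₀) {{nonempty}} (begin
            length C₀ * (k ^ J * T.b J)                              ≤⟨ T.density {Ball} 2 (Ball-0 0) Ball-mono J (λ c i≤J u∈ → Ball-multiple c u∈ (images i≤J)) ⟩
            card ((A ⊞ A) ⊞ Ball (J * (k * 2)))                      ≤⟨ card-2A⊞Ball (J * (k * 2)) ⟩
            suc (J * (k * 2)) ^ (C ^ 5) * (C ^ 4 * n)                ≡⟨ *-assoc (suc (J * (k * 2)) ^ (C ^ 5)) (C ^ 4) n ⟨
            suc (J * (k * 2)) ^ (C ^ 5) * C ^ 4 * n                  ≤⟨ *-monoʳ-≤ (suc (J * (k * 2)) ^ (C ^ 5) * C ^ 4) (≤-trans (≤-reflexive n≡length) T.n≤) ⟩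
            suc (J * (k * 2)) ^ (C ^ 5) * C ^ 4 * (length C₀ * T.b 0) ≡⟨ e (suc (J * (k * 2)) ^ (C ^ 5) * C ^ 4) (length C₀) (T.b 0) ⟩
            length C₀ * (suc (J * (k * 2)) ^ (C ^ 5) * C ^ 4 * T.b 0) ∎))
            (*-monoˡ-< (T.b 0) {{>-nonZero (T.b>0 0)}} slow-growth)
            where
            open ≤-Reasoning
            e : ∀ r l b → r * (l * b) ≡ l * (r * b)
            e = solve-∀
            nonempty : NonZero (length C₀)
            nonempty = ≢-nonZero λ eq → contradiction (subst (λ l → n ≤ l * T.b 0) eq (≤-trans (≤-reflexive n≡length) T.n≤)) (<⇒≱ 1≤n)

          module _ (p q : ℕ) .{{_ : NonZero p}} .{{_ : NonZero q}} (p≤ : p ^ d ≤ k * q ^ d) where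

            level-bound : ∀ {j} → j < J → ¬ T.N.Fail j → (p + q) ^ d * n ≤ q ^ d * (card (A ⊞ map f A) + D₁ * r)
            level-bound {j} j<J ok = *-cancelˡ-≤ (2 ^ t) {{m^n≢0 2 t}} (begin
              2 ^ t * ((p + q) ^ d * n)                                        ≡⟨ cong (λ m → 2 ^ t * ((p + q) ^ d * m)) n≡length ⟩
              2 ^ t * ((p + q) ^ d * length A)                                 ≤⟨ T.Sum.conclusion j p q p≤ ok {2 ^ t} {Ball (2 * t)} M′ (λ {l} → Ball-dyadic t v doubles t ≤-refl l) bounds ⟩
              q ^ d * (2 ^ t * card (A ⊞ map f A) + 2 ^ d * M′)                ≤⟨ *-monoʳ-≤ (q ^ d) (+-monoʳ-≤ (2 ^ t * card (A ⊞ map f A)) few-lines) ⟩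
              q ^ d * (2 ^ t * card (A ⊞ map f A) + 2 ^ t * (D₁ * r))          ≡⟨ e (q ^ d) (2 ^ t) (card (A ⊞ map f A)) (D₁ * r) ⟩
              2 ^ t * (q ^ d * (card (A ⊞ map f A) + D₁ * r))                  ∎)
              where
              open ≤-Reasoning
              e : ∀ Q T a b → Q * (T * a + T * b) ≡ T * (Q * (a + b))
              e = solve-∀
              M′ : ℕ
              M′ = suc (2 * t) ^ (C ^ 5) * (C ^ 7) ^ (J + d) * (C ^ 9 * n)
              bounds : ∀ (i : Fin d) → card ((A ⊞ map f A) ⊞ map (iter f (suc j + toℕ i)) (Ball (2 * t))) ≤ M′
              bounds i = ≤-trans (card-⊞iterBall (suc j + toℕ i) (2 * t)) (*-monoˡ-≤ (C ^ 9 * n) (*-monoʳ-≤ (suc (2 * t) ^ (C ^ 5))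
                (^-monoʳ-≤ (C ^ 7) {{m^n≢0 C 7 {{m^n≢0 2 c}}}} (+-mono-≤ j<J (<⇒≤ (toℕ<n i))))))

            some-level-holds : ¬ ((p + q) ^ d * n ≤ q ^ d * (card (A ⊞ map f A) + D₁ * r)) → ⊥
            some-level-holds fails = T.N.not-all-fail i z (subst (_< 2 ^ (2 ^ i)) (trans n≡length (sym T.n≡)) double-log) slow
              λ l l<J → decidable-stable (T.b l * T.N.n <? k * T.N.Q (suc l)) λ ok → fails (level-bound l<J ok)

        bound : ∀ p q .{{_ : NonZero p}} .{{_ : NonZero q}} → p ^ d ≤ k * q ^ d →
          (p + q) ^ d * n ≤ q ^ d * (card (A ⊞ map f A) + D₁ * r)
        bound p q p≤ = decidable-stable ((p + q) ^ d * n ≤? q ^ d * (card (A ⊞ map f A) + D₁ * r)) λ fails →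
          K.partition A A-! λ C₀ P → some-level-holds C₀ P p q p≤ fails

      small-doubling-bound : ∀ p q .{{_ : NonZero p}} .{{_ : NonZero q}} → p ^ d ≤ k * q ^ d →
        (p + q) ^ d * n ≤ q ^ d * (card (A ⊞ map f A) + D₁ * r)
      small-doubling-bound p q p≤ = from (short-vector t J enough-codes)
        where
        from : ∃[ v ] v ≢ 0ᵥ × (∀ {i} → i ≤ t → iter double i v ∈ (A ⊟ A) ⊟ (A ⊟ A)) × (∀ {i} → i ≤ J → iter f i v ∈ (A ⊟ A) ⊟ (A ⊟ A)) →
          (p + q) ^ d * n ≤ q ^ d * (card (A ⊞ map f A) + D₁ * r)
        from (v , v≢0 , doubles , images) = bound v≢0 doubles images p q p≤

  ^-cancel-≤-* : ∀ d .{{_ : NonZero d}} k p q → 1 ≤ k → p ^ d ≤ k * q ^ d → p ≤ k * q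
  ^-cancel-≤-* d@(suc d₀) k p q 1≤k p≤ = CauchySequence.^-cancelʳ-≤ d (begin
    p ^ d              ≤⟨ p≤ ⟩
    k * q ^ d          ≤⟨ *-monoˡ-≤ (q ^ d) (m≤m*n k (k ^ d₀) {{m^n≢0 k d₀ {{>-nonZero 1≤k}}}}) ⟩
    k ^ d * q ^ d      ≡⟨ ^-distribʳ-* d k q ⟨
    (k * q) ^ d        ∎)
    where open ≤-Reasoning

  private
    -- The second summand takes care of the sets with fewer than `N₀` elements, for which `r = 1`.
    D : ∀ d k → ℕ
    D d k = Constants.D₁ d k (suc k ^ d) (m^n>0 (suc k) d) + suc k ^ d * Constants.N₀ d k (suc k ^ d) (m^n>0 (suc k) d)

    s : ∀ d k → ℕ
    s d k = Constants.q₁ d k (suc k ^ d) (m^n>0 (suc k) d)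

  module _ {d₀ : ℕ} (L : Matrix ℤ (suc d₀)) (irreducible : NoNontrivialInvariantSubspace L) (1≤k : 1 ≤ ∣ det L ∣)
    (A : List (Vec ℤ (suc d₀))) {a₀ : Vec ℤ (suc d₀)} (a₀∈ : a₀ ∈ A) where

    private
      d k c n Σ : ℕ
      d = suc d₀
      k = ∣ det L ∣
      c = suc k ^ d
      n = card A
      Σ = card (A ⊞ L · A)
      A′ : List (Vec ℤ d)
      A′ = deduplicate _≟ᵥ_ A

      1≤c : 1 ≤ c
      1≤c = m^n>0 (suc k) d

    open Constants d k c 1≤c

    Bounded : Set
    Bounded = ∃[ r ] r ^ suc q₁ ≤ n ^ q₁ × 1 ≤ r ×
      (∀ p q .{{_ : NonZero p}} .{{_ : NonZero q}} → p ^ d ≤ k * q ^ d → (p + q) ^ d * n ≤ q ^ d * (Σ + (D₁ + c * N₀) * r))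

    private
      1≤n : 1 ≤ n
      1≤n = VCard.card>0 a₀∈

      n≡ : card A′ ≡ n
      n≡ = VCard.card-Unique (VCard.dedup-! A)

      Σ′≤Σ : card (A′ ⊞ L · A′) ≤ Σ
      Σ′≤Σ = VCard.card-mono sub
        where
        sub : (A′ ⊞ L · A′) ⊆ (A ⊞ L · A)
        sub u∈ with ∈-⊞⁻ A′ (L · A′) u∈
        ... | a , b , a∈ , b∈ , refl with ∈-map⁻ (L ℤLinear.*ᵥ_) b∈
        ...   | a′ , a′∈ , refl = ∈-⊞⁺ (VCard.dedup⁻ A a∈) (∈-map⁺ (L ℤLinear.*ᵥ_) (VCard.dedup⁻ A a′∈))

      -- From `p ^ d ≤ k * q ^ d` follows `p ≤ k * q`, so `(p + q) ^ d ≤ c * q ^ d`. A bound for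
      -- `c * n` therefore settles both the small sets and, as `c ≤ C`, the sets with a large
      -- sumset.
      trivial-bound : ∀ r → c * n ≤ Σ + (D₁ + c * N₀) * r → ∀ p q .{{_ : NonZero p}} .{{_ : NonZero q}} → p ^ d ≤ k * q ^ d →
        (p + q) ^ d * n ≤ q ^ d * (Σ + (D₁ + c * N₀) * r)
      trivial-bound r h p q p≤ = begin
        (p + q) ^ d * n            ≤⟨ *-monoˡ-≤ n (^-monoˡ-≤ d (≤-trans (+-monoˡ-≤ q (^-cancel-≤-* d k p q 1≤k p≤)) (≤-reflexive (+-comm (k * q) q)))) ⟩
        (suc k * q) ^ d * n        ≡⟨ cong (_* n) (^-distribʳ-* d (suc k) q) ⟩
        c * q ^ d * n              ≡⟨ e c (q ^ d) n ⟩
        q ^ d * (c * n)            ≤⟨ *-monoʳ-≤ (q ^ d) h ⟩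
        q ^ d * (Σ + (D₁ + c * N₀) * r)   ∎
        where
        open ≤-Reasoning
        e : ∀ c q n → c * q * n ≡ q * (c * n)
        e = solve-∀

    bounded : Bounded
    bounded = few (n <? N₀)
      where
      open ≤-Reasoning
      few : Dec (n < N₀) → Bounded
      few (yes n<N₀) = 1 , (≤-trans (≤-reflexive (^-zeroˡ (suc q₁))) (m^n>0 n {{>-nonZero 1≤n}} q₁)) , ≤-refl , trivial-bound 1 (begin
        c * n                           ≤⟨ *-monoʳ-≤ c (<⇒≤ n<N₀) ⟩
        c * N₀                          ≤⟨ m≤n+m (c * N₀) D₁ ⟩
        D₁ + c * N₀                     ≡⟨ *-identityʳ _ ⟨
        (D₁ + c * N₀) * 1               ≤⟨ m≤n+m _ Σ ⟩
        Σ + (D₁ + c * N₀) * 1           ∎)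
      few (no n≮N₀) = r , subst (λ m → r ^ suc q₁ ≤ m ^ q₁) n≡ r-power , r-positive , dense (card (A′ ⊞ L · A′) ≤? C * card A′)
        where
        params : Parameters (card A′)
        params = parameters (card A′) (subst (N₀ ≤_) (sym n≡) (≮⇒≥ n≮N₀))
        open Parameters params
        dense : Dec (card (A′ ⊞ L · A′) ≤ C * card A′) → ∀ p q .{{_ : NonZero p}} .{{_ : NonZero q}} → p ^ d ≤ k * q ^ d →
          (p + q) ^ d * n ≤ q ^ d * (Σ + (D₁ + c * N₀) * r)
        dense (yes small) p q p≤ = begin
          (p + q) ^ d * n                                    ≡⟨ cong ((p + q) ^ d *_) n≡ ⟨
          (p + q) ^ d * card A′                              ≤⟨ small-doubling-bound L irreducible 1≤k c 1≤c A′ (VCard.dedup-! A) (VCard.dedup⁺ a₀∈) small params p q p≤ ⟩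
          q ^ d * (card (A′ ⊞ L · A′) + D₁ * r)              ≤⟨ *-monoʳ-≤ (q ^ d) (+-mono-≤ Σ′≤Σ (*-monoˡ-≤ r (m≤m+n D₁ (c * N₀)))) ⟩
          q ^ d * (Σ + (D₁ + c * N₀) * r)                    ∎
        dense (no large) = trivial-bound r (begin
          c * n                           ≤⟨ *-mono-≤ (<⇒≤ (n<2^n c)) (≤-reflexive (sym n≡)) ⟩
          C * card A′                     ≤⟨ <⇒≤ (≰⇒> large) ⟩
          card (A′ ⊞ L · A′)              ≤⟨ Σ′≤Σ ⟩
          Σ                               ≤⟨ m≤m+n Σ _ ⟩
          Σ + (D₁ + c * N₀) * r           ∎)

  abstract
    sumset-bound : ∀ d .{{_ : NonZero d}} k → 1 ≤ k → ∃[ D ] ∃[ s ] ∀ (L : Matrix ℤ d) → NoNontrivialInvariantSubspace L → ∣ det L ∣ ≡ k →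
      ∀ A {a₀ : Vec ℤ d} → a₀ ∈ A → ∃[ r ] r ^ suc s ≤ card A ^ s × 1 ≤ r ×
        (∀ p q .{{_ : NonZero p}} .{{_ : NonZero q}} → p ^ d ≤ k * q ^ d → (p + q) ^ d * card A ≤ q ^ d * (card (A ⊞ L · A) + D * r))
    sumset-bound d@(suc _) k 1≤k = D d k , s d k , λ { L irreducible refl A a₀∈ → bounded L irreducible 1≤k A a₀∈ }

-- Transfer to real numbers.

module RealBound where

  open import Defs as R using (ℝ; seq; fromℚ; fromℕ; 0ℝ; 1ℝ; _^ᴿ_; card; _⊞_; _·_; Matrix; det; module CauchySequence)
  open import Data.Integer.Base using (∣_∣)
  open import Data.List.Base using (List; []; _∷_)
  open import Data.Nat.Base using (ℕ; zero; suc; _+_; _*_; _^_; _∸_; _≤_; _<_; z≤n; s≤s; NonZero; >-nonZero)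
  open import Data.Nat.Coprimality using (Coprime; 1-coprimeTo; coprime-+)
  import Data.Nat.Coprimality as Coprime
  open import Data.Nat.Properties
  open import Data.Rational.Base as ℚ using (ℚ; mkℚ; 0ℚ; 1ℚ)
  import Data.Rational.Properties as ℚ
  import Data.Rational.Solver
  open import Data.Vec.Base using (Vec)
  open Cardinality using (card-inj)
  open BrunnMinkowski using (_≟ᵥ_; module VCard; ∈-⊞⁺)
  open Vectors
  open Orbits using (fromℤ; fromℤ-+; fromℤ-*)
  open IntegerBound
  open ParameterChoice using (^-distribʳ-*)

  module ℚSolver = Data.Rational.Solver.+-*-Solver
  open CauchySequence using (frac; frac-*; frac-+; frac-one; 0≤frac; floorPow; floorPow-lower; below?; largest-max; Below)

  abstract
    -- Opaque outside this block, so that later terms are compared by the lemmas about it and not by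
    -- computing normalised fractions.
    ι : ℕ → ℚ
    ι n = fromℤ (ℤ.+ n)

    ι-+ : ∀ a b → ι (a + b) ≡ ι a ℚ.+ ι b
    ι-+ a b = trans (cong fromℤ (ℤ.pos-+ a b)) (fromℤ-+ (ℤ.+ a) (ℤ.+ b))

    ι-* : ∀ a b → ι (a * b) ≡ ι a ℚ.* ι b
    ι-* a b = trans (cong fromℤ (ℤ.pos-* a b)) (fromℤ-* (ℤ.+ a) (ℤ.+ b))

    ι≥0 : ∀ n → ℚ.NonNegative (ι n)
    ι≥0 n = ℚ.normalize-nonNeg n 1

    ι>0 : ∀ n .{{_ : NonZero n}} → ℚ.Positive (ι n)
    ι>0 n = ℚ.normalize-pos n 1

    ι-mono : ∀ {a b} → a ≤ b → ι a ℚ.≤ ι b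
    ι-mono {a} {b} a≤b = begin
      ι a                       ≡⟨ ℚ.+-identityʳ (ι a) ⟨
      ι a ℚ.+ 0ℚ                ≤⟨ ℚ.+-monoʳ-≤ (ι a) (ℚ.nonNegative⁻¹ (ι (b ∸ a)) {{ι≥0 (b ∸ a)}}) ⟩
      ι a ℚ.+ ι (b ∸ a)         ≡⟨ ι-+ a (b ∸ a) ⟨
      ι (a + (b ∸ a))           ≡⟨ cong ι (m+[n∸m]≡n a≤b) ⟩
      ι b                       ∎
      where open ℚ.≤-Reasoning

    frac-ι : ∀ a i → frac a i ℚ.* ι (suc i) ≡ ι a
    frac-ι a i = begin
      frac a i ℚ.* ι (suc i)                       ≡⟨ cong (ℚ._* ι (suc i)) (frac-* a i) ⟩
      (ι a ℚ.* frac 1 i) ℚ.* ι (suc i)             ≡⟨ ℚ.*-assoc (ι a) (frac 1 i) (ι (suc i)) ⟩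
      ι a ℚ.* (frac 1 i ℚ.* ι (suc i))             ≡⟨ cong (ι a ℚ.*_) (ℚ.*-comm (frac 1 i) (ι (suc i))) ⟩
      ι a ℚ.* (ι (suc i) ℚ.* frac 1 i)             ≡⟨ cong (ι a ℚ.*_) (trans (sym (frac-* (suc i) i)) (frac-one i)) ⟩
      ι a ℚ.* 1ℚ                                   ≡⟨ ℚ.*-identityʳ (ι a) ⟩
      ι a                                          ∎
      where open ≡-Reasoning

    seq-fromℕ : ∀ n i → seq (fromℕ n) i ≡ ι n
    seq-fromℕ n i = refl

    ι0≡0 : ι 0 ≡ 0ℚ
    ι0≡0 = refl

  -- The floor is found by a search below a fixed bound; an admissible `r` is within it because `r`
  -- is at most its power with exponent the denominator of `e`.
  floorPow-max : ∀ n e N .{{_ : NonZero (n ^ CauchySequence.neg (ℚ.↥ e))}} r → 1 ≤ r → Below n e N r → r ≤ floorPow n e N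
  floorPow-max n e@record{} N r 1≤r r-below = largest-max (below? n e N) _ (begin
    r                                                    ≤⟨ m≤m*n r (r ^ ℚ.ℚ.denominator-1 e) {{m^n≢0 r (ℚ.ℚ.denominator-1 e) {{>-nonZero 1≤r}}}} ⟩
    r ^ ℚ.↧ₙ e                                           ≤⟨ m≤m*n (r ^ ℚ.↧ₙ e) (n ^ CauchySequence.neg (ℚ.↥ e)) ⟩
    r ^ ℚ.↧ₙ e * n ^ CauchySequence.neg (ℚ.↥ e)          ≤⟨ r-below ⟩
    _                                                    ∎) r-below
    where open ≤-Reasoning

  module _ (s a : ℕ) .(cop : Coprime a (suc s)) where

    private
      e : ℚ
      e = ℤ.+ a ℚ./ suc s

      e≡ : e ≡ mkℚ (ℤ.+ a) s cop
      e≡ = ℚ.normalize-coprime cop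

    floorPow-power : ∀ n N → floorPow n e N ^ suc s ≤ n ^ a * N ^ suc s
    floorPow-power n N = subst (λ e → floorPow n e N ^ suc s ≤ n ^ a * N ^ suc s) (sym e≡)
      (≤-trans (≤-reflexive (sym (*-identityʳ _))) (floorPow-lower n (mkℚ (ℤ.+ a) s cop) N))

    ≤floorPow : ∀ n N r → 1 ≤ r → r ^ suc s ≤ n ^ a * N ^ suc s → r ≤ floorPow n e N
    ≤floorPow n N r 1≤r h = subst (λ e → r ≤ floorPow n e N) (sym e≡)
      (floorPow-max n (mkℚ (ℤ.+ a) s cop) N r 1≤r (≤-trans (≤-reflexive (*-identityʳ _)) h))

  1-frac : ∀ s → 1ℚ ℚ.- frac 1 s ≡ frac s s
  1-frac s = begin
    1ℚ ℚ.- frac 1 s                              ≡⟨ cong (ℚ._- frac 1 s) (trans (sym (frac-one s)) (frac-+ 1 s s)) ⟩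
    frac 1 s ℚ.+ frac s s ℚ.- frac 1 s           ≡⟨ ident (frac 1 s) (frac s s) ⟩
    frac s s                                     ∎
    where
    open ≡-Reasoning
    open ℚSolver
    ident : ∀ x y → x ℚ.+ y ℚ.- x ≡ y
    ident = solve 2 (λ x y → x :+ y :- x := y) refl

  coprime-suc : ∀ s → Coprime s (suc s)
  coprime-suc s = Coprime.sym (subst (λ m → Coprime m s) (+-comm s 1) (coprime-+ (1-coprimeTo s)))

  0≤^ᴿ : ∀ n x i → ι 0 ℚ.≤ seq (n ^ᴿ x) i
  0≤^ᴿ zero    x i = ℚ.≤-reflexive ι0≡0
  0≤^ᴿ (suc n) x i = ℚ.≤-trans (ℚ.≤-reflexive ι0≡0) (0≤frac (floorPow (suc n) (seq x i) (suc i)) i)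

  -- The integer `r * N` satisfies the inequality that defines the floor of `N` times
  -- `n ^ (s / (s + 1))`, so it is at most that floor: rounding costs nothing at any index.
  ≤^ᴿ : ∀ n s r → 1 ≤ n → 1 ≤ r → r ^ suc s ≤ n ^ s → ∀ i → ι r ℚ.≤ seq (n ^ᴿ (1ℝ R.- fromℚ (frac 1 s))) i
  ≤^ᴿ n@(suc _) s r _ 1≤r h i = ℚ.*-cancelʳ-≤-pos (ι N) {{ι>0 N}} (begin
    ι r ℚ.* ι N                                                          ≡⟨ ι-* r N ⟨
    ι (r * N)                                                            ≤⟨ ι-mono le ⟩
    ι (floorPow n (1ℚ ℚ.- frac 1 s) N)                                   ≡⟨ frac-ι (floorPow n (1ℚ ℚ.- frac 1 s) N) i ⟨
    frac (floorPow n (1ℚ ℚ.- frac 1 s) N) i ℚ.* ι N                      ∎)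
    where
    open ℚ.≤-Reasoning
    N = suc i
    le : r * N ≤ floorPow n (1ℚ ℚ.- frac 1 s) N
    le = subst (λ e → r * N ≤ floorPow n e N) (sym (1-frac s)) (≤floorPow s s (coprime-suc s) n N (r * N) (*-mono-≤ {1} {r} {1} {N} 1≤r (s≤s z≤n))
      (≤-trans (≤-reflexive (^-distribʳ-* (suc s) r N)) (*-monoˡ-≤ (N ^ suc s) h)))

  pow : ℚ → ℕ → ℚ
  pow y zero    = 1ℚ
  pow y (suc d) = y ℚ.* pow y d

  seq-^ : ∀ x d i → seq (x R.^ d) i ≡ pow (seq x i) d
  seq-^ x zero    i = refl
  seq-^ x (suc d) i = cong (seq x i ℚ.*_) (seq-^ x d i)

  pow-* : ∀ y q p → y ℚ.* ι q ≡ ι p → ∀ d → pow y d ℚ.* ι (q ^ d) ≡ ι (p ^ d)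
  pow-* y q p eq zero    = ℚ.*-identityˡ (ι 1)
  pow-* y q p eq (suc d) = begin
    (y ℚ.* pow y d) ℚ.* ι (q * q ^ d)               ≡⟨ cong ((y ℚ.* pow y d) ℚ.*_) (ι-* q (q ^ d)) ⟩
    (y ℚ.* pow y d) ℚ.* (ι q ℚ.* ι (q ^ d))         ≡⟨ ident y (pow y d) (ι q) (ι (q ^ d)) ⟩
    (y ℚ.* ι q) ℚ.* (pow y d ℚ.* ι (q ^ d))         ≡⟨ cong₂ ℚ._*_ eq (pow-* y q p eq d) ⟩
    ι p ℚ.* ι (p ^ d)                               ≡⟨ ι-* p (p ^ d) ⟨
    ι (p ^ suc d)                                   ∎
    where
    open ≡-Reasoning
    open ℚSolver
    ident : ∀ a b c d → a ℚ.* b ℚ.* (c ℚ.* d) ≡ a ℚ.* c ℚ.* (b ℚ.* d)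
    ident = solve 4 (λ a b c d → a :* b :* (c :* d) := a :* c :* (b :* d)) refl

  combine : ∀ {P X D r m q y n : ℚ} → .{{ℚ.Positive q}} → .{{ℚ.NonNegative D}} → r ℚ.≤ y →
    P ℚ.* q ≡ X → X ℚ.* n ℚ.≤ (m ℚ.+ D ℚ.* r) ℚ.* q → P ℚ.* n ℚ.- D ℚ.* y ℚ.≤ m
  combine {P} {X} {D} {r} {m} {q} {y} {n} r≤ Pq≡X nat = begin
    P ℚ.* n ℚ.- D ℚ.* y                        ≤⟨ ℚ.+-mono-≤ main (ℚ.neg-antimono-≤ (ℚ.*-monoˡ-≤-nonNeg D r≤)) ⟩
    m ℚ.+ D ℚ.* r ℚ.- D ℚ.* r                  ≡⟨ solve 2 (λ a b → a :+ b :- b := a) refl m (D ℚ.* r) ⟩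
    m                                          ∎
    where
    open ℚ.≤-Reasoning
    open ℚSolver
    main : P ℚ.* n ℚ.≤ m ℚ.+ D ℚ.* r
    main = ℚ.*-cancelʳ-≤-pos q (begin
      P ℚ.* n ℚ.* q                            ≡⟨ solve 3 (λ P n q → P :* n :* q := P :* q :* n) refl P n q ⟩
      P ℚ.* q ℚ.* n                            ≡⟨ cong (ℚ._* n) Pq≡X ⟩
      X ℚ.* n                                  ≤⟨ nat ⟩
      (m ℚ.+ D ℚ.* r) ℚ.* q                    ∎)

  private
    seq-difference : ∀ (a b c y : ℝ) i → seq (a R.* b R.- c R.* y) i ≡ seq a i ℚ.* seq b i ℚ.- seq c i ℚ.* seq y i
    seq-difference a b c y i = refl

  -- The inequality holds at every index without error, so `N = 0` serves for every `ε`. The `i`-th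
  -- term of `x` is itself a fraction `p / (i + 1)`, to which the estimate in natural numbers
  -- applies.
  termwise : ∀ d (x y : ℝ) D n m → (∀ i → ∃[ p ] ∃[ r ] (1ℚ ℚ.+ seq x i) ℚ.* ι (suc i) ≡ ι (p + suc i) × ι r ℚ.≤ seq y i ×
    (p + suc i) ^ d * n ≤ suc i ^ d * (m + D * r)) → fromℕ m R.≥ ((1ℝ R.+ x) R.^ d R.* fromℕ n R.- fromℕ D R.* y)
  termwise d x y D n m bounds {ε} 0<ε = 0 , λ {i} _ → weaken (subst₂ ℚ._≤_ (sym (expand i)) (sym (seq-fromℕ m i)) (term i (bounds i)))
    where
    weaken : ∀ {a b} → a ℚ.≤ b → a ℚ.≤ b ℚ.+ ε
    weaken {a} {b} a≤b = ℚ.≤-trans a≤b (ℚ.≤-trans (ℚ.≤-reflexive (sym (ℚ.+-identityʳ b))) (ℚ.+-monoʳ-≤ b (ℚ.<⇒≤ 0<ε)))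
    expand : ∀ i → seq ((1ℝ R.+ x) R.^ d R.* fromℕ n R.- fromℕ D R.* y) i ≡ pow (1ℚ ℚ.+ seq x i) d ℚ.* ι n ℚ.- ι D ℚ.* seq y i
    expand i = trans (seq-difference ((1ℝ R.+ x) R.^ d) (fromℕ n) (fromℕ D) y i)
      (cong₂ ℚ._-_ (cong₂ ℚ._*_ (seq-^ (1ℝ R.+ x) d i) (seq-fromℕ n i)) (cong (ℚ._* seq y i) (seq-fromℕ D i)))
    term : ∀ i → (∃[ p ] ∃[ r ] (1ℚ ℚ.+ seq x i) ℚ.* ι (suc i) ≡ ι (p + suc i) × ι r ℚ.≤ seq y i × (p + suc i) ^ d * n ≤ suc i ^ d * (m + D * r)) →
      pow (1ℚ ℚ.+ seq x i) d ℚ.* ι n ℚ.- ι D ℚ.* seq y i ℚ.≤ ι m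
    term i (p , r , eq , r≤ , nat) = combine {P = pow (1ℚ ℚ.+ seq x i) d} {D = ι D} {q = ι Q} {{ι>0 Q {{m^n≢0 (suc i) d}}}} {{ι≥0 D}} r≤ (pow-* (1ℚ ℚ.+ seq x i) (suc i) (p + suc i) eq d) (begin
      ι ((p + suc i) ^ d) ℚ.* ι n              ≡⟨ ι-* ((p + suc i) ^ d) n ⟨
      ι ((p + suc i) ^ d * n)                  ≤⟨ ι-mono nat ⟩
      ι (Q * (m + D * r))                      ≡⟨ trans (ι-* Q (m + D * r)) (ℚ.*-comm (ι Q) (ι (m + D * r))) ⟩
      ι (m + D * r) ℚ.* ι Q                    ≡⟨ cong (ℚ._* ι Q) (trans (ι-+ m (D * r)) (cong (ι m ℚ.+_) (ι-* D r))) ⟩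
      (ι m ℚ.+ ι D ℚ.* ι r) ℚ.* ι Q            ∎)
      where
      open ℚ.≤-Reasoning
      Q = suc i ^ d

  term-eq : ∀ p i → (1ℚ ℚ.+ frac p i) ℚ.* ι (suc i) ≡ ι (p + suc i)
  term-eq p i = begin
    (1ℚ ℚ.+ frac p i) ℚ.* ι (suc i)                      ≡⟨ ℚ.*-distribʳ-+ (ι (suc i)) 1ℚ (frac p i) ⟩
    1ℚ ℚ.* ι (suc i) ℚ.+ frac p i ℚ.* ι (suc i)          ≡⟨ cong₂ ℚ._+_ (ℚ.*-identityˡ (ι (suc i))) (frac-ι p i) ⟩
    ι (suc i) ℚ.+ ι p                                    ≡⟨ ι-+ (suc i) p ⟨
    ι (suc i + p)                                        ≡⟨ cong ι (+-comm (suc i) p) ⟩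
    ι (p + suc i)                                        ∎
    where open ≡-Reasoning

  0<fromℕ : ∀ n → 0ℝ R.< fromℕ (suc n)
  0<fromℕ n = ι (suc n) , ℚ.positive⁻¹ (ι (suc n)) {{ι>0 (suc n)}} , 0 , λ {i} _ → ℚ.≤-reflexive (trans (ℚ.+-identityˡ (ι (suc n))) (sym (seq-fromℕ (suc n) i)))

  0<fromℚ-frac : ∀ s → 0ℝ R.< fromℚ (frac 1 s)
  0<fromℚ-frac s = frac 1 s , ℚ.positive⁻¹ (frac 1 s) {{ℚ.normalize-pos 1 (suc s)}} , 0 , λ _ → ℚ.≤-reflexive (ℚ.+-identityˡ (frac 1 s))

  card≤card-⊞ : ∀ {d} (A : List (Vec ℤ d)) {B b} → b ∈ B → card A ≤ card (A ⊞ B)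
  card≤card-⊞ A {B} {b} b∈ = card-inj _≟ᵥ_ _≟ᵥ_ (λ a → a +ᵥ b) {A} {A ⊞ B} (λ a∈ → ∈-⊞⁺ a∈ b∈) (λ _ _ → +ᵥ-cancelʳ b)

  private
    Claim : ℕ → ℝ → ℕ → ℕ → ℕ → ℕ → Set
    Claim d x D s n m = fromℕ m R.≥ ((1ℝ R.+ x) R.^ d R.* fromℕ n R.- fromℕ D R.* n ^ᴿ (1ℝ R.- fromℚ (frac 1 s)))

    -- With `x = 0` both `p` and `r` may be taken to be 0, and what is left is `n ≤ m`.
    singular-case : ∀ d x n m → (∀ i → seq x i ≡ 0ℚ) → n ≤ m → Claim d x 1 0 n m
    singular-case d x n m x≡0 n≤m = termwise d x (n ^ᴿ (1ℝ R.- fromℚ (frac 1 0))) 1 n m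
      λ i → 0 , 0 , trans (cong (λ z → (1ℚ ℚ.+ z) ℚ.* ι (suc i)) (x≡0 i)) (ℚ.*-identityˡ (ι (suc i))) , 0≤^ᴿ n (1ℝ R.- fromℚ (frac 1 0)) i ,
        *-monoʳ-≤ (suc i ^ d) (≤-trans n≤m (m≤m+n m _))

    module _ (d k : ℕ) (x : ℝ) (root : ℕ → ℕ) (x≡ : ∀ i → seq x i ≡ frac (root i) i)
      (root≥1 : ∀ i → 1 ≤ root i) (root-power : ∀ i → root i ^ d ≤ k * suc i ^ d) where

      x-term : ∀ i → (1ℚ ℚ.+ seq x i) ℚ.* ι (suc i) ≡ ι (root i + suc i)
      x-term i = trans (cong (λ z → (1ℚ ℚ.+ z) ℚ.* ι (suc i)) (x≡ i)) (term-eq (root i) i)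

      empty-case : ∀ D s n m → n ≡ 0 → Claim d x D s n m
      empty-case D s n m n≡0 = termwise d x (n ^ᴿ (1ℝ R.- fromℚ (frac 1 s))) D n m
        λ i → root i , 0 , x-term i , 0≤^ᴿ n (1ℝ R.- fromℚ (frac 1 s)) i ,
          ≤-trans (≤-reflexive (trans (cong ((root i + suc i) ^ d *_) n≡0) (*-zeroʳ ((root i + suc i) ^ d)))) z≤n

      -- `suc D` in place of `D` only serves to make the final constant positive.
      nonempty-case : ∀ D s n m → 1 ≤ n → (∃[ r ] r ^ suc s ≤ n ^ s × 1 ≤ r ×
        (∀ p q .{{_ : NonZero p}} .{{_ : NonZero q}} → p ^ d ≤ k * q ^ d → (p + q) ^ d * n ≤ q ^ d * (m + D * r))) →
        Claim d x (suc D) s n m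
      nonempty-case D s n m 1≤n (r , r-power , 1≤r , bound) = termwise d x (n ^ᴿ (1ℝ R.- fromℚ (frac 1 s))) (suc D) n m
        λ i → root i , r , x-term i , ≤^ᴿ n s r 1≤n 1≤r r-power i ,
          ≤-trans (bound (root i) (suc i) {{>-nonZero (root≥1 i)}} (root-power i)) (*-monoʳ-≤ (suc i ^ d) (+-monoʳ-≤ m (*-monoˡ-≤ r (n≤1+n D))))

  Result : (d k : ℕ) .{{nz : NonZero d}} → ℝ → ℝ → Set₁
  Result d k {{nz}} D σ = ∀ (L : Matrix ℤ d) → R.NoNontrivialInvariantSubspace L → ∣ det L ∣ ≡ k → ∀ (A : R.FiniteSet d) →
    fromℕ (card (A ⊞ L · A)) R.≥ ((1ℝ R.+ k ^ᴿ fromℚ ((ℤ.+ 1 ℚ./ d) {{nz}})) R.^ d R.* fromℕ (card A) R.- D R.* card A ^ᴿ (1ℝ R.- σ))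

  private
    zero-^ᴿ : ∀ {k} z i → k ≡ 0 → seq (k ^ᴿ z) i ≡ 0ℚ
    zero-^ᴿ z i refl = refl

    nonzero-^ᴿ : ∀ {k} z i → 1 ≤ k → seq (k ^ᴿ z) i ≡ frac (floorPow k (seq z i) (suc i)) i
    nonzero-^ᴿ {suc _} z i _ = refl

    singular-result : ∀ d k .{{nz : NonZero d}} → k ≡ 0 → Result d k {{nz}} (fromℕ 1) (fromℚ (frac 1 0))
    singular-result d k {{nz}} k≡0 L _ _ A = singular-case d (k ^ᴿ fromℚ ((ℤ.+ 1 ℚ./ d) {{nz}})) (card A) (card (A ⊞ L · A)) (λ i → zero-^ᴿ (fromℚ ((ℤ.+ 1 ℚ./ d) {{nz}})) i k≡0) (at-least A)
      where
      at-least : ∀ A → card A ≤ card (A ⊞ L · A)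
      at-least []      = z≤n
      at-least (a ∷ A) = card≤card-⊞ (a ∷ A) {L · (a ∷ A)} (here refl)

    inhabited : ∀ {d} (A : List (Vec ℤ d)) → card A ≡ 0 ⊎ (∃[ a ] a ∈ A)
    inhabited []      = inj₁ refl
    inhabited (a ∷ A) = inj₂ (a , here refl)

    module _ (d₀ k : ℕ) .{{nz : NonZero (suc d₀)}} (1≤k : 1 ≤ k) where

      root : ℕ → ℕ
      root i = floorPow k ((ℤ.+ 1 ℚ./ suc d₀) {{nz}}) (suc i)

      -- The integer estimate needs a positive numerator; as `k ≥ 1`, the number 1 is already
      -- admissible for the floor.
      root≥1 : ∀ i → 1 ≤ root i
      root≥1 i = ≤floorPow d₀ 1 (1-coprimeTo (suc d₀)) k (suc i) 1 ≤-refl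
        (≤-trans (≤-reflexive (^-zeroˡ (suc d₀))) (*-mono-≤ {1} {k ^ 1} {1} {suc i ^ suc d₀} (m^n>0 k {{>-nonZero 1≤k}} 1) (m^n>0 (suc i) (suc d₀))))

      root-power : ∀ i → root i ^ suc d₀ ≤ k * suc i ^ suc d₀
      root-power i = ≤-trans (floorPow-power d₀ 1 (1-coprimeTo (suc d₀)) k (suc i)) (≤-reflexive (cong (_* suc i ^ suc d₀) (*-identityʳ k)))

      seq-root : ∀ i → seq (k ^ᴿ fromℚ ((ℤ.+ 1 ℚ./ suc d₀) {{nz}})) i ≡ frac (root i) i
      seq-root i = nonzero-^ᴿ (fromℚ ((ℤ.+ 1 ℚ./ suc d₀) {{nz}})) i 1≤k

      regular-result : ∀ D s → (∀ (L : Matrix ℤ (suc d₀)) → R.NoNontrivialInvariantSubspace L → ∣ det L ∣ ≡ k →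
        ∀ A {a₀ : Vec ℤ (suc d₀)} → a₀ ∈ A → ∃[ r ] r ^ suc s ≤ card A ^ s × 1 ≤ r ×
          (∀ p q .{{_ : NonZero p}} .{{_ : NonZero q}} → p ^ suc d₀ ≤ k * q ^ suc d₀ → (p + q) ^ suc d₀ * card A ≤ q ^ suc d₀ * (card (A ⊞ L · A) + D * r))) →
        Result (suc d₀) k {{nz}} (fromℕ (suc D)) (fromℚ (frac 1 s))
      regular-result D s bound L irreducible eq A = cases (inhabited A)
        where
        cases : card A ≡ 0 ⊎ (∃[ a ] a ∈ A) → Claim (suc d₀) (k ^ᴿ fromℚ ((ℤ.+ 1 ℚ./ suc d₀) {{nz}})) (suc D) s (card A) (card (A ⊞ L · A))
        cases (inj₁ n≡0)      = empty-case (suc d₀) k (k ^ᴿ fromℚ ((ℤ.+ 1 ℚ./ suc d₀) {{nz}})) root seq-root root≥1 root-power (suc D) s (card A) (card (A ⊞ L · A)) n≡0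
        cases (inj₂ (a , a∈)) = nonempty-case (suc d₀) k (k ^ᴿ fromℚ ((ℤ.+ 1 ℚ./ suc d₀) {{nz}})) root seq-root root≥1 root-power D s (card A) (card (A ⊞ L · A)) (VCard.card>0 a∈)
          (bound L irreducible eq A a∈)

  sumset-estimate : ∀ d k .{{nz : NonZero d}} → ∃[ D ] ∃[ σ ] 0ℝ R.< D × 0ℝ R.< σ × Result d k {{nz}} D σ
  sumset-estimate d k {{nz}} = split (k ≟ 0)
    where
    regular : ∀ d k .{{nz : NonZero d}} → 1 ≤ k → ∃[ D ] ∃[ σ ] 0ℝ R.< D × 0ℝ R.< σ × Result d k {{nz}} D σ
    regular d@(suc d₀) k {{nz}} 1≤k =
      let (D , s , bound) = sumset-bound d {{nz}} k 1≤k
      in fromℕ (suc D) , fromℚ (frac 1 s) , 0<fromℕ D , 0<fromℚ-frac s , regular-result d₀ k {{nz}} 1≤k D s bound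
    split : Dec (k ≡ 0) → ∃[ D ] ∃[ σ ] 0ℝ R.< D × 0ℝ R.< σ × Result d k {{nz}} D σ
    split (yes k≡0) = fromℕ 1 , fromℚ (frac 1 0) , 0<fromℕ 0 , 0<fromℚ-frac 0 , singular-result d k {{nz}} k≡0
    split (no k≢0)  = regular d k {{nz}} (n≢0⇒n>0 k≢0)

open import Defs
open import Data.Integer.Base using (ℤ; +_; ∣_∣)
open import Data.Nat.Base using (ℕ; NonZero)
open import Data.Product.Base using (∃-syntax; _×_)
open import Data.Rational.Base using (_/_)
open import Relation.Binary.PropositionalEquality using (_≡_)

theorem3p4 : (d k : ℕ) .{{_ : NonZero d}} →
    ∃[ D ] ∃[ σ ] 0ℝ < D × 0ℝ < σ ×
    (∀ (L : Matrix ℤ d) → NoNontrivialInvariantSubspace L → ∣ det L ∣ ≡ k →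
    ∀ (A : FiniteSet d) →
    fromℕ (card (A ⊞ L · A)) ≥ (1ℝ + k ^ᴿ fromℚ (+ 1 / d)) ^ d * fromℕ (card A) - D * card A ^ᴿ (1ℝ - σ))
theorem3p4 d k {{nz}} = RealBound.sumset-estimate d k {{nz}}
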